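{- Let $G$ be a finite planar graph with at least $7$ vertices. Then there is a vertex $v$ of $G$ such that, after deleting $v$ from $G$, one can collect at least $6$ vertices, i.e. there exist distinct vertices $u_1,\dots,u_6$ of $G-v$ such that for each $i\in\{1,\dots,6\}$ the vertex $u_i$ has degree at most $4$ in the graph $G-\{v,u_1,\dots,u_{i-1}\}$.
   Context: To delete a vertex means to remove it together with its incident edges. To collect a vertex means to delete it when its degree in the current graph is at most $4$; collecting a set of vertices means collecting them one after another in some order, each having degree at most $4$ in the current graph at the moment it is collected. -}

module Defs where

open import Data.Nat using (ℕ; zero; suc; _+_; _*_; _≤_; _<ᵇ_; _≤ᵇ_)
open import Data.Bool using (Bool; true; false; not; _∧_; if_then_else_)
open import Data.Fin using (Fin; toℕ; _≟_)
import Data.Fin as F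
open import Data.Product using (Σ; ∃; _×_; _,_; proj₁; proj₂)
open import Relation.Nullary using (does)
open import Relation.Binary.PropositionalEquality using (_≡_; _≢_)

_==_ : ∀ {n} → Fin n → Fin n → Bool
x == y = does (x ≟ y)

count : ∀ {n} → (Fin n → Bool) → ℕ
count {zero}  f = 0
count {suc n} f = (if f F.zero then 1 else 0) + count (λ i → f (F.suc i))

sumF : ∀ {n} → (Fin n → ℕ) → ℕ
sumF {zero}  f = 0
sumF {suc n} f = f F.zero + sumF (λ i → f (F.suc i))

anyB : ∀ {n} → (Fin n → Bool) → Bool
anyB {zero}  f = false
anyB {suc n} f = f F.zero Data.Bool.∨ anyB (λ i → f (F.suc i))
  where import Data.Bool

allB : ∀ {n} → (Fin n → Bool) → Bool
allB f = not (anyB (λ i → not (f i)))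

iter : ∀ {A : Set} → (A → A) → ℕ → A → A
iter f zero    x = x
iter f (suc k) x = f (iter f k x)

record Graph (n : ℕ) : Set where
  field
    adj   : Fin n → Fin n → Bool
    sym   : ∀ u v → adj u v ≡ adj v u
    irrefl : ∀ u → adj u u ≡ false
open Graph public

degIn : ∀ {n} → Graph n → (Fin n → Bool) → Fin n → ℕ
degIn G alive u = count (λ w → alive w ∧ adj G u w)

-- Planarity, via combinatorial embeddings (rotation systems) of genus 0
-- (Heffter–Edmonds–Ringel): a rotation system assigns to every vertex u
-- a cyclic permutation σ u of its neighbourhood.  Darts are ordered pairs
-- (u , v) with u ~ v; the face permutation is φ (u , v) = (v , σ v u).
-- The embedding is planar (genus 0 on every component) iff
--   V − E + F = 2·(#components with an edge) + (#isolated vertices),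
-- i.e. 2V + 2F + 2I = D + 4C, with D = #darts = 2E, C = #components,
-- I = #isolated vertices, F = #orbits of φ on darts.

record Rotation {n : ℕ} (G : Graph n) : Set where
  field
    σ      : Fin n → Fin n → Fin n
    σ-nbr  : ∀ u v → adj G u v ≡ true → adj G u (σ u v) ≡ true
    σ-inj  : ∀ u v w → adj G u v ≡ true → adj G u w ≡ true →
             σ u v ≡ σ u w → v ≡ w
    σ-cyc  : ∀ u v w → adj G u v ≡ true → adj G u w ≡ true →
             ∃ λ k → iter (σ u) k v ≡ w
open Rotation public

Dart : ℕ → Set
Dart n = Fin n × Fin n

isDart : ∀ {n} → Graph n → Dart n → Bool
isDart G (u , v) = adj G u v

faceStep : ∀ {n} {G : Graph n} → Rotation G → Dart n → Dart n
faceStep ρ (u , v) = (v , σ ρ v u)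

key : ∀ {n} → Dart n → ℕ
key {n} (u , v) = toℕ u * n + toℕ v

numDarts : ∀ {n} → Graph n → ℕ
numDarts G = sumF (λ u → count (λ v → adj G u v))

-- d is the key-minimal dart of its φ-orbit (orbits have length ≤ n*n)
orbitMin : ∀ {n} {G : Graph n} → Rotation G → Dart n → Bool
orbitMin {n} ρ d = allB {suc (n * n)} (λ k → key d ≤ᵇ key (iter (faceStep ρ) (toℕ k) d))

numFaces : ∀ {n} {G : Graph n} → Rotation G → ℕ
numFaces {G = G} ρ =
  sumF (λ u → count (λ v → adj G u v ∧ orbitMin ρ (u , v)))

reach : ∀ {n} → Graph n → ℕ → Fin n → Fin n → Bool
reach G zero    u w = u == w
reach G (suc k) u w = reach G k u w Data.Bool.∨ anyB (λ x → reach G k u x ∧ adj G x w)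
  where import Data.Bool

numComponents : ∀ {n} → Graph n → ℕ
numComponents {n} G = count (λ u → allB (λ w → not (reach G n u w) Data.Bool.∨ (toℕ u ≤ᵇ toℕ w)))
  where import Data.Bool

numIsolated : ∀ {n} → Graph n → ℕ
numIsolated G = count (λ u → not (anyB (adj G u)))

Planar : ∀ {n} → Graph n → Set
Planar {n} G = Σ (Rotation G) λ ρ →
  2 * n + 2 * numFaces ρ + 2 * numIsolated G ≡ numDarts G + 4 * numComponents G

aliveAt : ∀ {n k} → Fin n → (Fin k → Fin n) → Fin k → Fin n → Bool
aliveAt v u i w = not (w == v) ∧ not (anyB (λ j → (toℕ j <ᵇ toℕ i) ∧ (u j == w)))

{-# OPTIONS --safe #-}

-- Collect vertices from G until none of degree at most 4 is left. If fewer than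
-- six could be collected, the remaining core has minimum degree 5; triangulate
-- it, which only makes collecting harder. Let S v consist of v and everything
-- that can be collected once v is deleted, and suppose every S v has at most six
-- elements. By Euler's formula the charges deg v − 6 have a negative sum, so it
-- suffices to move charge from the vertices of degree at least 7 to those of
-- degree 5 until none is negative. Deleting v collects all its neighbours of
-- degree 5, so there are at most five of them, and at most three of them if v
-- has degree 7 and S v has six elements; how much v can afford per neighbour is
-- read off their number. A vertex u of degree 5 with too few big neighbours to
-- be paid by them is a hub: its small neighbours are collected together, so the
-- vertices seen from u across the edges of its link must be big, since otherwise
-- they would be collected as well, and each of them contributes a fifth.
--
-- Planarity enters through a lower bound on V − E + F that is stable under
-- deleting an edge and under adding a chord inside a face.
module Submission where

open import Defs
open import Data.Nat using (ℕ; zero; suc; _+_; _*_; _∸_; _⊓_; _≤_; _<_; _≤ᵇ_; _<ᵇ_; z≤n; s≤s; _≤?_)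
open import Data.Nat.Properties
open import Data.Nat.Solver using (module +-*-Solver)
open import Data.Nat.ListAction using (sum)
open import Data.Bool using (Bool; true; false; not; _∧_; _∨_; if_then_else_; T)
open import Data.Bool.Properties using (∧-comm; ∧-zeroʳ; ∨-zeroʳ; ∧-identityʳ; ∨-identityʳ)
open import Data.Fin using (Fin; toℕ; fromℕ<; combine)
import Data.Fin as F
import Data.Fin.Properties as FP
open import Data.List using (List; []; _∷_; length; map; filter; upTo; lookup; _++_)
import Data.List.Properties as LP
open import Data.List.Membership.Propositional using (_∈_; _∉_)
open import Data.List.Membership.Propositional.Properties using (∈-map⁺; ∈-map⁻; ∈-upTo⁺; ∈-upTo⁻; ∈-filter⁻; ∈-lookup)
open import Data.List.Relation.Unary.Any using (here; there)
open import Data.List.Relation.Unary.All using (All; []; _∷_)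
import Data.List.Relation.Unary.All as All
open import Data.List.Relation.Unary.All.Properties using (¬Any⇒All¬; All¬⇒¬Any)
open import Data.List.Relation.Unary.AllPairs using ([]; _∷_)
open import Data.List.Relation.Unary.Unique.Propositional using (Unique)
open import Data.Product using (Σ; ∃; _×_; _,_; proj₁; proj₂)
open import Data.Product.Properties using (≡-dec)
open import Data.Sum using (_⊎_; inj₁; inj₂)
open import Data.Empty using (⊥; ⊥-elim)
open import Data.Unit using (tt)
open import Relation.Nullary using (¬_; Dec; yes; no; does)
open import Relation.Nullary.Decidable using (¬?; toSum)
open import Relation.Binary using (DecidableEquality)
open import Relation.Binary.PropositionalEquality using (_≡_; _≢_; refl; cong; cong₂; trans; subst; subst₂) renaming (sym to symm)
open import Data.Fin.Patterns using (0F; 1F; 2F; 3F; 4F; 5F)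

-- Everything about `S` rests on monotonicity: if `t ∋ v`, then `S v` lies inside `S t`. A set `S v`
-- with six members therefore cannot be collected from outside. A vertex of degree `d` falls once
-- `d − 4` of its neighbours are gone, so in a bad configuration a short chain of forced collections
-- yields a seventh member.
--
-- The difficulty is that degree 7 owns a single unit of charge and may have four neighbours of
-- degree 5. A vertex reduced to paying quarters has an `S v` made of itself and these four; a big
-- vertex that collects it is thereby limited in turn and can pay more. The shares 1/5, 1/4, 1/3,
-- 2/5, 1/2, 3/5, 2/3, 3/4 have common denominator 60.
--
-- On the planar side faces and components are not recomputed after a change: a list of label values
-- bounds the faces from below, a list of representatives bounds the components from above, and both
-- are patched when one edge changes. Chords must join non-adjacent corners, which is where a plane
-- K₄ has to be excluded.

bool-cases : (b : Bool) → (b ≡ true) ⊎ (b ≡ false)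
bool-cases true  = inj₁ refl
bool-cases false = inj₂ refl

≢true : ∀ {b} → b ≢ true → b ≡ false
≢true {true}  q = ⊥-elim (q refl)
≢true {false} q = refl

≢false : ∀ {b} → b ≢ false → b ≡ true
≢false {true}  q = refl
≢false {false} q = ⊥-elim (q refl)

contra : ∀ {A : Set} {b} → b ≡ true → b ≡ false → A
contra refl ()

∧-elim : ∀ {a b} → a ∧ b ≡ true → (a ≡ true) × (b ≡ true)
∧-elim {true} {true} refl = refl , refl

∧-intro : ∀ {a b} → a ≡ true → b ≡ true → a ∧ b ≡ true
∧-intro refl refl = refl

∨-elim : ∀ {a b} → a ∨ b ≡ true → (a ≡ true) ⊎ (b ≡ true)
∨-elim {true}  q = inj₁ refl
∨-elim {false} q = inj₂ q

∨-introˡ : ∀ {a b} → a ≡ true → a ∨ b ≡ true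
∨-introˡ refl = refl

∨-introʳ : ∀ {a b} → b ≡ true → a ∨ b ≡ true
∨-introʳ {a} refl = ∨-zeroʳ a

not-elim : ∀ {a} → not a ≡ true → a ≡ false
not-elim {false} q = refl

not-intro : ∀ {a} → a ≡ false → not a ≡ true
not-intro refl = refl

does⇒ : ∀ {A : Set} (d : Dec A) → does d ≡ true → A
does⇒ (yes p) q = p

does⇐ : ∀ {A : Set} (d : Dec A) → A → does d ≡ true
does⇐ (yes p) a = refl
does⇐ (no ¬p) a = ⊥-elim (¬p a)

does⇐¬ : ∀ {A : Set} (d : Dec A) → ¬ A → does d ≡ false
does⇐¬ (yes p) ¬a = ⊥-elim (¬a p)
does⇐¬ (no ¬p) ¬a = refl

==-refl : ∀ {n} (x : Fin n) → (x == x) ≡ true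
==-refl x = does⇐ (x F.≟ x) refl

≤ᵇ⇒ : ∀ {m n} → (m ≤ᵇ n) ≡ true → m ≤ n
≤ᵇ⇒ {m} {n} q = ≤ᵇ⇒≤ m n (subst T (symm q) tt)

⇒≤ᵇ : ∀ {m n} → m ≤ n → (m ≤ᵇ n) ≡ true
⇒≤ᵇ {m} {n} q with m ≤ᵇ n in eq
... | true  = refl
... | false = ⊥-elim (subst T eq (≤⇒≤ᵇ q))

-- Boolean search over finite types

anyB⇒ : ∀ {n} (f : Fin n → Bool) → anyB f ≡ true → ∃ λ i → f i ≡ true
anyB⇒ {suc n} f q with f F.zero in eq
... | true  = F.zero , eq
... | false with anyB⇒ (λ i → f (F.suc i)) q
...   | i , p = F.suc i , p

anyB⇐ : ∀ {n} (f : Fin n → Bool) i → f i ≡ true → anyB f ≡ true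
anyB⇐ {suc n} f F.zero    p rewrite p = refl
anyB⇐ {suc n} f (F.suc i) p = ∨-introʳ {f F.zero} (anyB⇐ (λ i → f (F.suc i)) i p)

anyB-false : ∀ {n} (f : Fin n → Bool) → anyB f ≡ false → ∀ i → f i ≡ false
anyB-false f q i = ≢true λ p → contra (anyB⇐ f i p) q

allB⇒ : ∀ {n} (f : Fin n → Bool) → allB f ≡ true → ∀ i → f i ≡ true
allB⇒ f q i = ≢false λ p → contra (anyB⇐ _ i (not-intro p)) (not-elim q)

allB-false : ∀ {n} (f : Fin n → Bool) → allB f ≡ false → ∃ λ i → f i ≡ false
allB-false f q with anyB (λ i → not (f i)) in eq
... | true with anyB⇒ _ eq
...   | i , p = i , not-elim p

search : ∀ {n} (p : Fin n → Bool) → (∃ λ x → p x ≡ true) ⊎ (∀ x → p x ≡ false)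
search p with anyB p in eq
... | true  = inj₁ (anyB⇒ p eq)
... | false = inj₂ (anyB-false p eq)

-- Counting

if-suc : (b : Bool) → b ≡ true → (if b then 1 else 0) ≡ 1
if-suc true q = refl

count-cong : ∀ {n} {p q : Fin n → Bool} → (∀ x → p x ≡ q x) → count p ≡ count q
count-cong {zero}  e = refl
count-cong {suc n} e rewrite e F.zero = cong (_ +_) (count-cong (λ i → e (F.suc i)))

count-none : ∀ {n} (p : Fin n → Bool) → (∀ x → p x ≡ false) → count p ≡ 0
count-none {zero}  p e = refl
count-none {suc n} p e rewrite e F.zero = count-none _ (λ i → e (F.suc i))

count-remove : ∀ {n} (p : Fin n → Bool) x → p x ≡ true →
  count p ≡ suc (count (λ y → p y ∧ not (does (y F.≟ x))))
count-remove {suc n} p F.zero px rewrite px =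
  cong suc (count-cong (λ i → symm (∧-identityʳ (p (F.suc i)))))
count-remove {suc n} p (F.suc x) px rewrite ∧-identityʳ (p F.zero) =
  trans (cong ((if p F.zero then 1 else 0) +_)
          (trans (count-remove (λ i → p (F.suc i)) x px)
                 (cong suc (count-cong λ i → cong (λ z → p (F.suc i) ∧ not z) (≟suc i)))))
        (+-suc _ _)
  where
  ≟suc : ∀ i → does (i F.≟ x) ≡ does (F.suc i F.≟ F.suc x)
  ≟suc i with i F.≟ x
  ... | yes _ = refl
  ... | no  _ = refl

sumF-cong : ∀ {n} {f g : Fin n → ℕ} → (∀ i → f i ≡ g i) → sumF f ≡ sumF g
sumF-cong {zero}  e = refl
sumF-cong {suc n} e = cong₂ _+_ (e F.zero) (sumF-cong (λ i → e (F.suc i)))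

sumF-mono : ∀ {n} {f g : Fin n → ℕ} → (∀ i → f i ≤ g i) → sumF f ≤ sumF g
sumF-mono {zero}  e = z≤n
sumF-mono {suc n} e = +-mono-≤ (e F.zero) (sumF-mono (λ i → e (F.suc i)))

sumF-+ : ∀ {n} (f g : Fin n → ℕ) → sumF (λ i → f i + g i) ≡ sumF f + sumF g
sumF-+ {zero}  f g = refl
sumF-+ {suc n} f g rewrite sumF-+ (λ i → f (F.suc i)) (λ i → g (F.suc i)) =
  solve 4 (λ a b c d → (a :+ b) :+ (c :+ d) := (a :+ c) :+ (b :+ d)) refl
    (f F.zero) (g F.zero) (sumF (λ i → f (F.suc i))) (sumF (λ i → g (F.suc i)))
  where
  open +-*-Solver

sumF-0 : ∀ n → sumF {n} (λ _ → 0) ≡ 0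
sumF-0 zero    = refl
sumF-0 (suc n) = sumF-0 n

sumF-* : ∀ {n} c (f : Fin n → ℕ) → sumF (λ i → c * f i) ≡ c * sumF f
sumF-* {zero}  c f = symm (*-zeroʳ c)
sumF-* {suc n} c f = trans (cong (c * f F.zero +_) (sumF-* c (λ i → f (F.suc i))))
                           (symm (*-distribˡ-+ c (f F.zero) _))

sumF-swap : ∀ {m n} (f : Fin m → Fin n → ℕ) →
  sumF (λ i → sumF (λ j → f i j)) ≡ sumF (λ j → sumF (λ i → f i j))
sumF-swap {zero} {n} f = symm (sumF-0 n)
sumF-swap {suc m}   f = trans (cong (sumF (f F.zero) +_) (sumF-swap (λ i → f (F.suc i))))
                              (symm (sumF-+ (f F.zero) _))

count-sum : ∀ {n} (p : Fin n → Bool) → count p ≡ sumF (λ i → if p i then 1 else 0)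
count-sum {zero}  p = refl
count-sum {suc n} p = cong ((if p F.zero then 1 else 0) +_) (count-sum (λ i → p (F.suc i)))

sumF-remove : ∀ {n} (f : Fin n → ℕ) x →
  sumF f ≡ f x + sumF (λ y → if does (y F.≟ x) then 0 else f y)
sumF-remove {suc n} f F.zero = refl
sumF-remove {suc n} f (F.suc x) =
  trans (cong (f F.zero +_) (trans (sumF-remove (λ i → f (F.suc i)) x)
          (cong (f (F.suc x) +_) (sumF-cong λ i → cong (λ z → if z then 0 else f (F.suc i)) (≟suc i)))))
    (solve 3 (λ a b c → a :+ (b :+ c) := b :+ (a :+ c)) refl (f F.zero) (f (F.suc x)) _)
  where
  open +-*-Solver
  ≟suc : ∀ i → does (i F.≟ x) ≡ does (F.suc i F.≟ F.suc x)
  ≟suc i with i F.≟ x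
  ... | yes _ = refl
  ... | no  _ = refl

sum-list-≤ : ∀ {n} (f : Fin n → ℕ) {xs} → Unique xs → sum (map f xs) ≤ sumF f
sum-list-≤ f [] = z≤n
sum-list-≤ f {x ∷ xs} (x∉ ∷ u) = subst (f x + sum (map f xs) ≤_) (symm (sumF-remove f x))
    (+-monoʳ-≤ (f x) (subst (_≤ sumF f′) (cong sum (same x∉)) (sum-list-≤ f′ u)))
  where
  f′ = λ y → if does (y F.≟ x) then 0 else f y
  same : ∀ {ys} → All (x ≢_) ys → map f′ ys ≡ map f ys
  same [] = refl
  same {y ∷ ys} (x≢y ∷ a) = cong₂ _∷_
    (cong (λ z → if z then 0 else f y) (does⇐¬ (y F.≟ x) (λ q → x≢y (symm q)))) (same a)

-- Serves vertices and darts alike: `#` is accessed only through its value on the empty predicate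
-- and through the removal of one element.
module Counting {A : Set} (_≟A_ : DecidableEquality A) (# : (A → Bool) → ℕ)
  (#-none : ∀ p → (∀ x → p x ≡ false) → # p ≡ 0)
  (#-remove : ∀ p x → p x ≡ true → # p ≡ suc (# (λ y → p y ∧ not (does (y ≟A x)))))
  (#-search : ∀ (p : A → Bool) → (∃ λ x → p x ≡ true) ⊎ (∀ x → p x ≡ false))
  where

  private
    _−_ : (A → Bool) → A → A → Bool
    (p − x) y = p y ∧ not (does (y ≟A x))

    −-elim : ∀ p {x y} → (p − x) y ≡ true → (p y ≡ true) × (y ≢ x)
    −-elim p {x} {y} q with ∧-elim {p y} q
    ... | py , ny = py , λ e → contra (does⇐ (y ≟A x) e) (not-elim ny)

    −-intro : ∀ p {x y} → p y ≡ true → y ≢ x → (p − x) y ≡ true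
    −-intro p {x} {y} py ne = ∧-intro py (not-intro (does⇐¬ (y ≟A x) ne))

  open import Data.List.Membership.DecPropositional _≟A_ using (_∈?_)

  abstract
    unique-≤-# : ∀ p {xs} → Unique xs → All (λ x → p x ≡ true) xs → length xs ≤ # p
    unique-≤-# p [] [] = z≤n
    unique-≤-# p {x ∷ xs} (x∉ ∷ u) (px ∷ ps) rewrite #-remove p x px =
      s≤s (unique-≤-# (p − x) u (go x∉ ps))
      where
      go : ∀ {ys} → All (x ≢_) ys → All (λ y → p y ≡ true) ys → All (λ y → (p − x) y ≡ true) ys
      go [] [] = []
      go (n ∷ ns) (q ∷ qs) = −-intro p q (λ e → n (symm e)) ∷ go ns qs

    #-≤-cover : ∀ p xs → (∀ x → p x ≡ true → x ∈ xs) → # p ≤ length xs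
    #-≤-cover p [] c = ≤-reflexive (#-none p (λ x → ≢true λ q → case (c x q)))
      where
      case : ∀ {x : A} → x ∈ [] → ⊥
      case ()
    #-≤-cover p (x ∷ xs) c with bool-cases (p x)
    ... | inj₂ f = m≤n⇒m≤1+n (#-≤-cover p xs λ y py → drop y py (c y py))
      where
      drop : ∀ y → p y ≡ true → y ∈ x ∷ xs → y ∈ xs
      drop y py (here refl) = contra py f
      drop y py (there q)   = q
    ... | inj₁ t rewrite #-remove p x t = s≤s (#-≤-cover (p − x) xs λ y q → drop y q (c y (proj₁ (−-elim p q))))
      where
      drop : ∀ y → (p − x) y ≡ true → y ∈ x ∷ xs → y ∈ xs
      drop y q (here refl) = ⊥-elim (proj₂ (−-elim p q) refl)
      drop y q (there r)   = r

    #-elems : ∀ m p → m ≤ # p → ∃ λ xs → Unique xs × All (λ x → p x ≡ true) xs × (length xs ≡ m)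
    #-elems zero p _ = [] , [] , [] , refl
    #-elems (suc m) p le with #-search p
    ... | inj₂ none = ⊥-elim (1+n≰n {m} (≤-trans le (≤-trans (≤-reflexive (#-none p none)) z≤n)))
    ... | inj₁ (x , px) with #-elems m (p − x) (≤-pred (subst (suc m ≤_) (#-remove p x px) le))
    ...   | xs , u , a , l = x ∷ xs , (All.map (λ q e → proj₂ (−-elim p q) (symm e)) a ∷ u)
                            , (px ∷ All.map (λ q → proj₁ (−-elim p q)) a) , cong suc l

    -- A missing element could be prepended and would exceed the count. Applied to a full `S v`,
    -- this converts a bound on size into an explicit list of members.
    unique-full : ∀ p {xs} → Unique xs → All (λ x → p x ≡ true) xs → # p ≤ length xs →
      ∀ x → p x ≡ true → x ∈ xs
    unique-full p {xs} u a le x px with x ∈? xs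
    ... | yes q = q
    ... | no  q = ⊥-elim (1+n≰n (≤-trans (unique-≤-# p (¬Any⇒All¬ xs q ∷ u) (px ∷ a)) le))

    #-mono : ∀ p q → (∀ x → p x ≡ true → q x ≡ true) → # p ≤ # q
    #-mono p q h with #-elems (# p) p ≤-refl
    ... | xs , u , a , l = subst (_≤ # q) l (unique-≤-# q u (All.map (h _) a))

    #-mono+ : ∀ p q → (∀ x → p x ≡ true → q x ≡ true) →
      ∀ {ys} → Unique ys → All (λ y → (q y ≡ true) × (p y ≡ false)) ys → # p + length ys ≤ # q
    #-mono+ p q h [] [] = subst (_≤ # q) (symm (+-identityʳ _)) (#-mono p q h)
    #-mono+ p q h {y ∷ ys} (y∉ ∷ u) ((qy , py) ∷ a) rewrite #-remove q y qy | +-suc (# p) (length ys) =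
      s≤s (#-mono+ p (q − y) (λ x px → −-intro q (h x px) (λ e → contra px (subst (λ z → p z ≡ false) (symm e) py)))
            u (go y∉ a))
      where
      go : ∀ {zs} → All (y ≢_) zs → All (λ z → (q z ≡ true) × (p z ≡ false)) zs →
           All (λ z → ((q − y) z ≡ true) × (p z ≡ false)) zs
      go [] [] = []
      go (n ∷ ns) ((b , c) ∷ rs) = (−-intro q b (λ e → n (symm e)) , c) ∷ go ns rs

module CountFin {n : ℕ} = Counting {Fin n} F._≟_ count count-none count-remove search
open CountFin

_≟D_ : ∀ {n} → DecidableEquality (Dart n)
_≟D_ = ≡-dec F._≟_ F._≟_

count₂ : ∀ {n} → (Dart n → Bool) → ℕ
count₂ p = sumF (λ u → count (λ v → p (u , v)))

count₂-none : ∀ {n} (p : Dart n → Bool) → (∀ x → p x ≡ false) → count₂ p ≡ 0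
count₂-none {n} p e = trans (sumF-cong (λ u → count-none _ (λ v → e (u , v)))) (sumF-0 n)

count₂-cong : ∀ {n} {p q : Dart n → Bool} → (∀ x → p x ≡ q x) → count₂ p ≡ count₂ q
count₂-cong e = sumF-cong (λ u → count-cong (λ v → e (u , v)))

count₂-remove : ∀ {n} (p : Dart n → Bool) x → p x ≡ true →
  count₂ p ≡ suc (count₂ (λ y → p y ∧ not (does (y ≟D x))))
count₂-remove {n} p (a , b) pab =
  trans (sumF-remove f a)
   (trans (cong (_+ sumF f⁻) (trans (count-remove (λ v → p (a , v)) b pab)
                                    (cong suc (count-cong atA))))
    (cong suc (symm (trans (sumF-remove g a) (cong (g a +_) (sumF-cong off))))))
  where
  f g f⁻ : Fin n → ℕ
  f u = count (λ v → p (u , v))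
  g u = count (λ v → p (u , v) ∧ not (does ((u , v) ≟D (a , b))))
  f⁻ u = if does (u F.≟ a) then 0 else f u
  atA : ∀ v → p (a , v) ∧ not (does (v F.≟ b)) ≡ p (a , v) ∧ not (does ((a , v) ≟D (a , b)))
  atA v with v F.≟ b
  ... | yes refl rewrite does⇐ ((a , b) ≟D (a , b)) refl = refl
  ... | no  q    rewrite does⇐¬ ((a , v) ≟D (a , b)) (λ e → q (cong proj₂ e)) = refl
  off : ∀ u → (if does (u F.≟ a) then 0 else g u) ≡ f⁻ u
  off u = go (u F.≟ a)
    where
    go : (d : Dec (u ≡ a)) → (if does d then 0 else g u) ≡ (if does d then 0 else f u)
    go (yes _) = refl
    go (no  q) = count-cong λ v → trans (cong (λ z → p (u , v) ∧ not z)
                  (does⇐¬ ((u , v) ≟D (a , b)) (λ e → q (cong proj₁ e)))) (∧-identityʳ _)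

search₂ : ∀ {n} (p : Dart n → Bool) → (∃ λ x → p x ≡ true) ⊎ (∀ x → p x ≡ false)
search₂ p with search (λ u → anyB (λ v → p (u , v)))
... | inj₁ (u , q) with anyB⇒ _ q
...   | v , r = inj₁ ((u , v) , r)
search₂ p | inj₂ none = inj₂ λ { (u , v) → anyB-false _ (none u) v }

module CountDart {n : ℕ} = Counting {Dart n} _≟D_ count₂ count₂-none count₂-remove search₂

-- Rotation systems

iter-+ : ∀ {A : Set} (f : A → A) i j x → iter f (i + j) x ≡ iter f i (iter f j x)
iter-+ f zero    j x = refl
iter-+ f (suc i) j x = cong f (iter-+ f i j x)

least : ∀ {P : ℕ → Set} → (∀ k → Dec (P k)) → ∀ N → P N → ∃ λ k → P k × (∀ j → j < k → ¬ P j)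
least P? zero p = zero , p , λ j ()
least {P} P? (suc N) p with P? 0
... | yes p₀ = 0 , p₀ , λ j ()
... | no ¬p₀ with least (λ k → P? (suc k)) N p
...   | k , pk , below = suc k , pk , below′
  where
  below′ : ∀ j → j < suc k → ¬ P j
  below′ zero    _        = ¬p₀
  below′ (suc j) (s≤s lt) = below j lt

data Conn {n} (G : Graph n) (x : Fin n) : Fin n → Set where
  stop : Conn G x x
  step : ∀ {y z} → Conn G x y → adj G y z ≡ true → Conn G x z

module _ {n} {G : Graph n} where
  adj-flip : ∀ {u v} → adj G u v ≡ true → adj G v u ≡ true
  adj-flip {u} {v} p = trans (sym G v u) p

  adj⇒≢ : ∀ {u v} → adj G u v ≡ true → u ≢ v
  adj⇒≢ {u} p refl = contra p (irrefl G u)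

  conn-trans : ∀ {x y z} → Conn G x y → Conn G y z → Conn G x z
  conn-trans p stop       = p
  conn-trans p (step q e) = step (conn-trans p q) e

  conn-sym : ∀ {x y} → Conn G x y → Conn G y x
  conn-sym stop       = stop
  conn-sym (step q e) = conn-trans (step stop (adj-flip e)) (conn-sym q)

module Face {n} {G : Graph n} (ρ : Rotation G) where
  φ : Dart n → Dart n
  φ = faceStep ρ

  φ-dart : ∀ d → isDart G d ≡ true → isDart G (φ d) ≡ true
  φ-dart (u , v) p = σ-nbr ρ v u (adj-flip {G = G} p)

  φ-inj : ∀ d e → isDart G d ≡ true → isDart G e ≡ true → φ d ≡ φ e → d ≡ e
  φ-inj (u , v) (u′ , v′) p p′ q with cong proj₁ q
  ... | refl = cong (_, v) (σ-inj ρ v u u′ (adj-flip {G = G} p) (adj-flip {G = G} p′) (cong proj₂ q))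

  iter-dart : ∀ k d → isDart G d ≡ true → isDart G (iter φ k d) ≡ true
  iter-dart zero    d p = p
  iter-dart (suc k) d p = φ-dart _ (iter-dart k d p)

  iter-cancel : ∀ i k d → isDart G d ≡ true → iter φ i d ≡ iter φ (i + k) d → d ≡ iter φ k d
  iter-cancel zero    k d p q = q
  iter-cancel (suc i) k d p q =
    iter-cancel i k d p (φ-inj _ _ (iter-dart i d p) (iter-dart (i + k) d p) q)

  -- Two of the first `n * n + 1` iterates coincide, and injectivity of `φ` on darts cancels their
  -- common prefix.
  return : ∀ d → isDart G d ≡ true → ∃ λ k → (suc k ≤ n * n) × (iter φ (suc k) d ≡ d)
  return d p with FP.pigeonhole ≤-refl enc
    where
    enc : Fin (suc (n * n)) → Fin (n * n)
    enc i = combine (proj₁ (iter φ (toℕ i) d)) (proj₂ (iter φ (toℕ i) d))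
  ... | i , j , i<j , eq = toℕ j ∸ suc (toℕ i)
      , ≤-trans (≤-reflexive (symm (+-∸-assoc 1 i<j))) (≤-trans (m∸n≤m (toℕ j) (toℕ i)) (≤-pred (FP.toℕ<n j)))
      , symm (iter-cancel (toℕ i) _ d p (trans pairs (cong (λ z → iter φ z d) (symm sums))))
    where
    pairs : iter φ (toℕ i) d ≡ iter φ (toℕ j) d
    pairs = let e = FP.combine-injective _ _ _ _ eq in cong₂ _,_ (proj₁ e) (proj₂ e)
    sums : toℕ i + suc (toℕ j ∸ suc (toℕ i)) ≡ toℕ j
    sums = trans (+-suc (toℕ i) _) (m+[n∸m]≡n i<j)

flip : ∀ {n} → Dart n → Dart n
flip (u , v) = (v , u)

Isolated : ∀ {n} → Graph n → Fin n → Set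
Isolated G x = ∀ y → adj G x y ≡ false

-- The diagonal pair (x , x) of an isolated vertex x stands for the face of the
-- component {x}.
Realised : ∀ {n} → Graph n → Dart n → Set
Realised G (u , v) = (adj G u v ≡ true) ⊎ ((u ≡ v) × Isolated G u)

-- A witness of V − E + F ≥ 2C: a face invariant taking many values, and few
-- vertices meeting every component.
record Euler {n} {G : Graph n} (ρ : Rotation G) : Set where
  field
    lab     : Dart n → ℕ
    lab-inv : ∀ d → isDart G d ≡ true → lab (faceStep ρ d) ≡ lab d
    L       : List ℕ
    L-uniq  : Unique L
    L-real  : ∀ l → l ∈ L → ∃ λ e → Realised G e × (lab e ≡ l)
    R       : List (Fin n)
    R-cover : ∀ x → ∃ λ r → (r ∈ R) × Conn G r x
    bound   : numDarts G + 4 * length R ≤ 2 * n + 2 * length L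
open Euler

does-cong : ∀ {A B : Set} (a : Dec A) (b : Dec B) → (A → B) → (B → A) → does a ≡ does b
does-cong (yes p) b f g = symm (does⇐ b (f p))
does-cong (no ¬p) b f g = symm (does⇐¬ b (λ q → ¬p (g q)))

fresh : List ℕ → ℕ
fresh xs = suc (sum xs)

fresh-∉ : ∀ xs → All (fresh xs ≢_) xs
fresh-∉ xs = All.map (λ le e → 1+n≰n (≤-trans (≤-reflexive e) le)) (below xs)
  where
  below : ∀ xs → All (_≤ sum xs) xs
  below []       = []
  below (x ∷ xs) = m≤m+n x (sum xs) ∷ All.map (λ le → ≤-trans le (m≤n+m (sum xs) x)) (below xs)

filter-length : ∀ c xs → Unique xs → length xs ≤ suc (length (filter (λ l → ¬? (l ≟ c)) xs))
filter-length c [] u = z≤n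
filter-length c (x ∷ xs) (x∉ ∷ u) with toSum (x ≟ c)
... | inj₂ ne   = ≤-trans (s≤s (filter-length c xs u))
                    (s≤s (≤-reflexive (symm (cong length (LP.filter-accept (λ l → ¬? (l ≟ c)) ne)))))
... | inj₁ refl = s≤s (≤-reflexive (symm (trans (cong length (LP.filter-reject (λ l → ¬? (l ≟ c)) (λ ne → ne refl)))
                    (cong length (LP.filter-all _ (All.map (λ ne e → ne (symm e)) x∉))))))

-- The rotation at `u` is one cycle, so a fixed neighbour is the whole of it and `u` is a leaf.
fixed-nbr : ∀ {n} {G : Graph n} (ρ : Rotation G) u v → adj G u v ≡ true → σ ρ u v ≡ v →
  ∀ w → adj G u w ≡ true → w ≡ v
fixed-nbr ρ u v p q w r with σ-cyc ρ u v w p r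
... | k , e = trans (symm e) (const k)
  where
  const : ∀ k → iter (σ ρ u) k v ≡ v
  const zero    = refl
  const (suc k) = trans (cong (σ ρ u) (const k)) q

-- Deleting an edge

module Edge {n} (a b : Fin n) where
  IsE : Dart n → Set
  IsE x = (x ≡ (a , b)) ⊎ (x ≡ (b , a))

  isE? : ∀ x → Dec (IsE x)
  isE? x with x ≟D (a , b) | x ≟D (b , a)
  ... | yes p | _     = yes (inj₁ p)
  ... | no p  | yes q = yes (inj₂ q)
  ... | no p  | no q  = no λ { (inj₁ r) → p r ; (inj₂ r) → q r }

  E-cases : ∀ x → IsE x ⊎ ¬ IsE x
  E-cases x = toSum (isE? x)

  IsE-flip : ∀ {u v} → IsE (u , v) → IsE (v , u)
  IsE-flip (inj₁ refl) = inj₂ refl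
  IsE-flip (inj₂ refl) = inj₁ refl

  IsE-uniq : a ≢ b → ∀ {u v w} → IsE (u , v) → IsE (u , w) → v ≡ w
  IsE-uniq a≢b (inj₁ refl) (inj₁ refl) = refl
  IsE-uniq a≢b (inj₁ refl) (inj₂ e)    = ⊥-elim (a≢b (cong proj₁ e))
  IsE-uniq a≢b (inj₂ refl) (inj₁ e)    = ⊥-elim (a≢b (symm (cong proj₁ e)))
  IsE-uniq a≢b (inj₂ refl) (inj₂ refl) = refl

module Delete {n} {G : Graph n} (ρ : Rotation G) (a b : Fin n) (ab : adj G a b ≡ true) where
  open Face ρ
  open import Data.List.Membership.DecPropositional (_≟D_ {n}) using (_∈?_)

  open Edge a b

  ba : adj G b a ≡ true
  ba = adj-flip {G = G} ab

  a≢b : a ≢ b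
  a≢b = adj⇒≢ {G = G} ab

  G⁻ : Graph n
  G⁻ = record
    { adj    = λ u v → adj G u v ∧ not (does (isE? (u , v)))
    ; sym    = λ u v → cong₂ _∧_ (sym G u v) (cong not (does-cong (isE? (u , v)) (isE? (v , u)) IsE-flip IsE-flip))
    ; irrefl = λ u → cong (_∧ not (does (isE? (u , u)))) (irrefl G u) }

  kept : ∀ {d} → isDart G d ≡ true → ¬ IsE d → isDart G⁻ d ≡ true
  kept {u , v} p q = ∧-intro p (not-intro (does⇐¬ (isE? (u , v)) q))

  kept⇒ : ∀ {d} → isDart G⁻ d ≡ true → (isDart G d ≡ true) × ¬ IsE d
  kept⇒ {u , v} p with ∧-elim {adj G u v} p
  ... | q , r = q , λ e → contra (does⇐ (isE? (u , v)) e) (not-elim r)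

  numDarts-del : numDarts G ≡ 2 + numDarts G⁻
  numDarts-del =
    trans (count₂-remove (isDart G) (a , b) ab)
     (cong suc (trans (count₂-remove _ (b , a) (∧-intro ba (not-intro
                        (does⇐¬ ((b , a) ≟D (a , b)) (λ e → a≢b (cong proj₂ e))))))
       (cong suc (count₂-cong same))))
    where
    same : ∀ x → (isDart G x ∧ not (does (x ≟D (a , b)))) ∧ not (does (x ≟D (b , a))) ≡ isDart G⁻ x
    same x with x ≟D (a , b) | x ≟D (b , a)
    ... | yes p | _     = cong (_∧ _) (∧-zeroʳ (isDart G x)) ∙ symm (∧-zeroʳ (isDart G x))
      where _∙_ = trans
    ... | no p  | yes q = trans (∧-zeroʳ _) (symm (∧-zeroʳ (isDart G x)))
    ... | no p  | no q  = ∧-identityʳ _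

  E-uniq : ∀ {u v w} → IsE (u , v) → IsE (u , w) → v ≡ w
  E-uniq = IsE-uniq a≢b

  σ⁻ : Fin n → Fin n → Fin n
  σ⁻ u v = if does (isE? (u , σ ρ u v)) then σ ρ u (σ ρ u v) else σ ρ u v

  σ⁻-keep : ∀ u v → ¬ IsE (u , σ ρ u v) → σ⁻ u v ≡ σ ρ u v
  σ⁻-keep u v q rewrite does⇐¬ (isE? (u , σ ρ u v)) q = refl

  σ⁻-skip : ∀ u v → IsE (u , σ ρ u v) → σ⁻ u v ≡ σ ρ u (σ ρ u v)
  σ⁻-skip u v q rewrite does⇐ (isE? (u , σ ρ u v)) q = refl

  -- One extra step past the removed neighbour suffices: two hits in a row would make `v` itself the
  -- removed neighbour.
  skip-kept : ∀ u v → isDart G⁻ (u , v) ≡ true → IsE (u , σ ρ u v) → ¬ IsE (u , σ ρ u (σ ρ u v))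
  skip-kept u v p e e′ with kept⇒ p
  ... | q , ne = ne (subst (λ z → IsE (u , z)) (symm (σ-inj ρ u v (σ ρ u v) q (σ-nbr ρ u v q) (E-uniq e e′))) e)

  ρ⁻ : Rotation G⁻
  ρ⁻ = record { σ = σ⁻ ; σ-nbr = nbr ; σ-inj = inj ; σ-cyc = λ u v w p r → cyc u v w p r }
    where
    nbr : ∀ u v → adj G⁻ u v ≡ true → adj G⁻ u (σ⁻ u v) ≡ true
    nbr u v p with isE? (u , σ ρ u v)
    ... | no q  = kept (σ-nbr ρ u v (proj₁ (kept⇒ p))) q
    ... | yes q = kept (σ-nbr ρ u _ (σ-nbr ρ u v (proj₁ (kept⇒ p)))) (skip-kept u v p q)
    inj : ∀ u v w → adj G⁻ u v ≡ true → adj G⁻ u w ≡ true → σ⁻ u v ≡ σ⁻ u w → v ≡ w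
    inj u v w p r eq with isE? (u , σ ρ u v) | isE? (u , σ ρ u w)
    ... | no _   | no _   = σ-inj ρ u v w (proj₁ (kept⇒ p)) (proj₁ (kept⇒ r)) eq
    ... | yes e  | yes e′ = σ-inj ρ u v w (proj₁ (kept⇒ p)) (proj₁ (kept⇒ r)) (E-uniq e e′)
    ... | no _   | yes e  = ⊥-elim (proj₂ (kept⇒ p) (subst (λ z → IsE (u , z))
          (symm (σ-inj ρ u v _ (proj₁ (kept⇒ p)) (σ-nbr ρ u w (proj₁ (kept⇒ r))) eq)) e))
    ... | yes e  | no _   = ⊥-elim (proj₂ (kept⇒ r) (subst (λ z → IsE (u , z))
          (σ-inj ρ u _ w (σ-nbr ρ u v (proj₁ (kept⇒ p))) (proj₁ (kept⇒ r)) eq) e))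
    cyc : ∀ u v w → adj G⁻ u v ≡ true → adj G⁻ u w ≡ true → ∃ λ k → iter (σ⁻ u) k v ≡ w
    cyc u v w p r with σ-cyc ρ u v w (proj₁ (kept⇒ p)) (proj₁ (kept⇒ r))
    ... | k , e = fin (walk k)
      where
      -- after k steps of σ, either σ⁻ has arrived at the same place, or σ is at
      -- the removed neighbour and σ⁻ waits just before it
      At : Fin n → Set
      At z = (∃ λ k′ → (iter (σ⁻ u) k′ v ≡ z) × (adj G⁻ u z ≡ true))
           ⊎ (IsE (u , z) × ∃ λ k′ → (σ ρ u (iter (σ⁻ u) k′ v) ≡ z) × (adj G⁻ u (iter (σ⁻ u) k′ v) ≡ true))
      walk : ∀ k → At (iter (σ ρ u) k v)
      walk zero = inj₁ (0 , refl , p)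
      walk (suc k) with walk k
      ... | inj₂ (ez , k′ , q , r′) = inj₁ (suc k′ , trans (σ⁻-skip u _ ez′) (cong (σ ρ u) q) ,
                subst (λ z → adj G⁻ u z ≡ true) (trans (σ⁻-skip u _ ez′) (cong (σ ρ u) q)) (nbr u _ r′))
        where ez′ = subst (λ z → IsE (u , z)) (symm q) ez
      ... | inj₁ (k′ , q , r′) with E-cases (u , σ ρ u (iter (σ ρ u) k v))
      ...   | inj₁ e′ = inj₂ (e′ , k′ , cong (σ ρ u) q , subst (λ z → adj G⁻ u z ≡ true) (symm q) r′)
      ...   | inj₂ ne = inj₁ (suc k′ , trans (cong (σ⁻ u) q) (σ⁻-keep u _ ne)
                          , kept (σ-nbr ρ u _ (proj₁ (kept⇒ r′))) ne)
      fin : At (iter (σ ρ u) k v) → ∃ λ k → iter (σ⁻ u) k v ≡ w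
      fin (inj₁ (k′ , q , _)) = k′ , trans q e
      fin (inj₂ (ez , _))     = ⊥-elim (proj₂ (kept⇒ r) (subst (λ z → IsE (u , z)) e ez))

  φ⁻ : Dart n → Dart n
  φ⁻ = faceStep ρ⁻

  φ⁻-keep : ∀ d → ¬ IsE (φ d) → φ⁻ d ≡ φ d
  φ⁻-keep (u , v) q = cong (v ,_) (σ⁻-keep v u q)

  -- A face walk about to enter the deleted edge continues as if it had just come back along that
  -- edge.
  φ⁻-skip : ∀ d → IsE (φ d) → φ⁻ d ≡ φ (flip (φ d))
  φ⁻-skip (u , v) q = cong (v ,_) (σ⁻-skip v u q)

  conn-mono : (Conn G⁻ a b) → ∀ {x y} → Conn G x y → Conn G⁻ x y
  conn-mono c stop = stop
  conn-mono c (step {y} {z} q e) with isE? (y , z)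
  ... | no ne            = step (conn-mono c q) (kept e ne)
  ... | yes (inj₁ refl)  = conn-trans (conn-mono c q) c
  ... | yes (inj₂ refl)  = conn-trans (conn-mono c q) (conn-sym c)

  -- Cut the walk at its last use of the deleted edge: the remainder starts at one of the two ends
  -- and survives.
  conn-last : ∀ {x y} → Conn G x y → Conn G⁻ x y ⊎ (Conn G⁻ a y ⊎ Conn G⁻ b y)
  conn-last stop = inj₁ stop
  conn-last (step {y} {z} q e) with isE? (y , z)
  ... | yes (inj₁ refl) = inj₂ (inj₂ stop)
  ... | yes (inj₂ refl) = inj₂ (inj₁ stop)
  ... | no ne with conn-last q
  ...   | inj₁ c        = inj₁ (step c (kept e ne))
  ...   | inj₂ (inj₁ c) = inj₂ (inj₁ (step c (kept e ne)))
  ...   | inj₂ (inj₂ c) = inj₂ (inj₂ (step c (kept e ne)))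

  isolated-mono : ∀ {x} → Isolated G x → Isolated G⁻ x
  isolated-mono {x} i y = cong (_∧ not (does (isE? (x , y)))) (i y)

  d d′ : Dart n
  d  = (a , b)
  d′ = (b , a)

  d≢d′ : d ≢ d′
  d≢d′ e = a≢b (cong proj₁ e)

  -- if both sides of ab lie on the same face, that face is split
  module Split (ε : Euler ρ) (k : ℕ) (end : iter φ (suc k) d ≡ d′)
               (below : ∀ j → j < k → ¬ IsE (iter φ (suc j) d)) where
    -- The arc of the common face strictly between `d` and `d′`. It closes up to a face of its own
    -- and receives the new label.
    A : List (Dart n)
    A = map (λ j → iter φ (suc j) d) (upTo k)

    A⁺ : ∀ {j} → j < k → iter φ (suc j) d ∈ A
    A⁺ lt = ∈-map⁺ (λ j → iter φ (suc j) d) (∈-upTo⁺ lt)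

    A⁻ : ∀ {e} → e ∈ A → ∃ λ j → (j < k) × (e ≡ iter φ (suc j) d)
    A⁻ q with ∈-map⁻ (λ j → iter φ (suc j) d) q
    ... | j , j∈ , e = j , ∈-upTo⁻ j∈ , e

    A-lab : ∀ j → lab ε (iter φ j d) ≡ lab ε d
    A-lab zero    = refl
    A-lab (suc j) = trans (lab-inv ε _ (iter-dart j d ab)) (A-lab j)

    A-noE : ∀ {e} → e ∈ A → ¬ IsE e
    A-noE q r with A⁻ q
    ... | j , lt , refl = below j lt r

    A-dart : ∀ {e} → e ∈ A → isDart G e ≡ true
    A-dart q with A⁻ q
    ... | j , lt , refl = iter-dart (suc j) d ab

    A-fwd : ∀ {e} → e ∈ A → ¬ IsE (φ e) → φ e ∈ A
    A-fwd q ne with A⁻ q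
    ... | j , lt , refl with m≤n⇒m<n∨m≡n lt
    ...   | inj₁ lt′  = A⁺ lt′
    ...   | inj₂ refl = ⊥-elim (ne (inj₂ end))

    A-bwd : ∀ {e} → isDart G e ≡ true → φ e ∈ A → (e ≡ d) ⊎ (e ∈ A)
    A-bwd {e} p q with A⁻ q
    ... | zero  , lt , eq = inj₁ (φ-inj e d p ab eq)
    ... | suc j , lt , eq = inj₂ (subst (_∈ A) (symm (φ-inj e _ p (iter-dart (suc j) d ab) eq)) (A⁺ (<-trans (n<1+n j) lt)))

    new : ℕ
    new = fresh (L ε)

    -- The two diagonal pairs are labelled as well: if `a` or `b` was a leaf, it becomes isolated
    -- and no dart is left there to carry the label of its part.
    lab⁻ : Dart n → ℕ
    lab⁻ e = if does (e ∈? ((b , b) ∷ A)) then new else (if does (e ≟D (a , a)) then lab ε d else lab ε e)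

    lab-in : ∀ {e} → e ∈ (b , b) ∷ A → lab⁻ e ≡ new
    lab-in {e} q rewrite does⇐ (e ∈? ((b , b) ∷ A)) q = refl

    aa∉ : (a , a) ∉ (b , b) ∷ A
    aa∉ (here e)  = a≢b (cong proj₁ e)
    aa∉ (there q) = adj⇒≢ {G = G} (A-dart q) refl

    lab-aa : lab⁻ (a , a) ≡ lab ε d
    lab-aa rewrite does⇐¬ ((a , a) ∈? ((b , b) ∷ A)) aa∉ | does⇐ ((a , a) ≟D (a , a)) refl = refl

    lab-out : ∀ {u v} → (u , v) ∉ A → (u , v) ≢ (b , b) → (u , v) ≢ (a , a) → lab⁻ (u , v) ≡ lab ε (u , v)
    lab-out {u} {v} nA nb na rewrite does⇐¬ ((u , v) ∈? ((b , b) ∷ A)) (λ { (here e) → nb e ; (there q) → nA q })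
      | does⇐¬ ((u , v) ≟D (a , a)) na = refl

    dart≢diag : ∀ {e x} → isDart G e ≡ true → e ≢ (x , x)
    dart≢diag p refl = adj⇒≢ {G = G} p refl

    lab-dart : ∀ {e} → isDart G e ≡ true → e ∉ A → lab⁻ e ≡ lab ε e
    lab-dart {u , v} p nA = lab-out nA (dart≢diag p) (dart≢diag p)

    φd′∉A : φ d′ ∉ A
    φd′∉A q with A-bwd ba q
    ... | inj₁ e = d≢d′ (symm e)
    ... | inj₂ r = A-noE r (inj₂ refl)

    lab-d′ : lab ε d′ ≡ lab ε d
    lab-d′ = trans (cong (lab ε) (symm end)) (A-lab (suc k))

    inv : ∀ e → isDart G⁻ e ≡ true → lab⁻ (φ⁻ e) ≡ lab⁻ e
    inv e p⁻ with kept⇒ p⁻ | toSum (e ∈? A) | E-cases (φ e)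
    ... | p , ne | inj₁ q | inj₂ nf = trans (cong lab⁻ (φ⁻-keep e nf))
                                     (trans (lab-in (there (A-fwd q nf))) (symm (lab-in (there q))))
    ... | p , ne | inj₂ q | inj₂ nf = trans (cong lab⁻ (φ⁻-keep e nf))
          (trans (lab-dart (φ-dart e p) (λ r → out (A-bwd p r))) (trans (lab-inv ε e p) (symm (lab-dart p q))))
      where
      out : (e ≡ d) ⊎ (e ∈ A) → ⊥
      out (inj₁ r) = ne (inj₁ r)
      out (inj₂ r) = q r
    ... | p , ne | inj₁ q | inj₁ f@(inj₁ fe) with A⁻ q
    ...   | j , lt , refl with m≤n⇒m<n∨m≡n lt
    ...     | inj₁ lt′  = ⊥-elim (below (suc j) lt′ (inj₁ fe))
    ...     | inj₂ refl = ⊥-elim (d≢d′ (trans (symm fe) end))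
    inv e p⁻ | p , ne | inj₁ q | inj₁ f@(inj₂ fe) =
      trans (cong lab⁻ (trans (φ⁻-skip e f) (cong (λ z → φ (flip z)) fe)))
            (trans (first k refl q) (symm (lab-in (there q))))
      where
      first : ∀ k′ → k′ ≡ k → e ∈ A → lab⁻ (φ d) ≡ new
      first zero    refl r with A⁻ r
      ... | _ , () , _
      first (suc _) refl r = lab-in (there (A⁺ (s≤s z≤n)))
    inv e p⁻ | p , ne | inj₂ q | inj₁ f@(inj₁ fe) =
      trans (cong lab⁻ (trans (φ⁻-skip e f) (cong (λ z → φ (flip z)) fe)))
        (trans (lab-dart (φ-dart d′ ba) φd′∉A)
          (trans (lab-inv ε d′ ba) (trans lab-d′
            (trans (cong (lab ε) (symm fe)) (trans (lab-inv ε e p) (symm (lab-dart p q)))))))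
    inv e p⁻ | p , ne | inj₂ q | inj₁ f@(inj₂ fe) = ⊥-elim (last k refl)
      where
      last : ∀ k′ → k′ ≡ k → ⊥
      last zero    refl = ne (inj₁ (φ-inj e d p ab (trans fe (symm end))))
      last (suc j) refl = q (subst (_∈ A) (φ-inj _ e (iter-dart (suc j) d ab) p (trans end (symm fe))) (A⁺ ≤-refl))

    lone : ∀ {u v} → IsE (u , v) → adj G u v ≡ true → σ ρ u v ≡ v → Isolated G⁻ u
    lone {u} {v} e p q y with adj G u y in eq
    ... | false = refl
    ... | true with fixed-nbr ρ u v p q y eq
    ...   | refl = cong not (does⇐ (isE? (u , y)) e)

    real-new : ∃ λ e → Realised G⁻ e × (lab⁻ e ≡ new)
    real-new with σ ρ b a F.≟ a
    ... | yes q = (b , b) , inj₂ (refl , lone (inj₂ refl) ba q) , lab-in (here refl)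
    ... | no  q = φ d , inj₁ (kept (φ-dart d ab) (A-noE (in-A k refl))) , lab-in (there (in-A k refl))
      where
      in-A : ∀ k′ → k′ ≡ k → φ d ∈ A
      in-A zero    refl = ⊥-elim (q (cong proj₂ end))
      in-A (suc _) refl = A⁺ (s≤s z≤n)

    real-d : ∃ λ e → Realised G⁻ e × (lab⁻ e ≡ lab ε d)
    real-d with σ ρ a b F.≟ b
    ... | yes q = (a , a) , inj₂ (refl , lone (inj₁ refl) ab q) , lab-aa
    ... | no  q = φ d′ , inj₁ (kept (φ-dart d′ ba) notE)
                , trans (lab-dart (φ-dart d′ ba) φd′∉A) (trans (lab-inv ε d′ ba) lab-d′)
      where
      notE : ¬ IsE (φ d′)
      notE (inj₁ r) = q (cong proj₂ r)
      notE (inj₂ r) = a≢b (cong proj₁ r)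

    real : ∀ l → l ∈ new ∷ L ε → ∃ λ e → Realised G⁻ e × (lab⁻ e ≡ l)
    real l (here refl) = real-new
    real l (there q) with L-real ε l q
    ... | (u , v) , inj₂ (refl , i) , refl = (u , u) , inj₂ (refl , isolated-mono i)
                  , lab-out (λ r → adj⇒≢ {G = G} (A-dart r) refl) (λ { refl → contra ba (i a) }) (λ { refl → contra ab (i b) })
    ... | e@(u , v) , inj₁ p , refl with e ∈? A | isE? e
    ...   | yes r | _ = subst (λ z → ∃ λ e → Realised G⁻ e × (lab⁻ e ≡ z)) (eq (A⁻ r)) real-d
      where
      eq : (∃ λ j → (j < k) × (e ≡ iter φ (suc j) d)) → lab ε d ≡ lab ε e
      eq (j , lt , z) = symm (trans (cong (lab ε) z) (A-lab (suc j)))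
    ...   | no r | no ne = e , inj₁ (kept p ne) , lab-dart p r
    ...   | no r | yes (inj₁ refl) = real-d
    ...   | no r | yes (inj₂ refl) = subst (λ z → ∃ λ e → Realised G⁻ e × (lab⁻ e ≡ z)) (symm lab-d′) real-d

    -- A connection broken by the deletion still reaches `y` from `a` or from `b`. An old
    -- representative `r₀` is still connected to one of these two, so adding the other restores the
    -- cover.
    cover : ∃ λ x → ∀ y → ∃ λ r → (r ∈ x ∷ R ε) × Conn G⁻ r y
    cover with R-cover ε a
    ... | r₀ , r₀∈ , c = pick (conn-last (conn-sym c))
      where
      via : ∀ {s t} → Conn G⁻ r₀ s → (∀ {y} → Conn G⁻ a y ⊎ Conn G⁻ b y → Conn G⁻ s y ⊎ Conn G⁻ t y) →
            ∀ y → ∃ λ r → (r ∈ t ∷ R ε) × Conn G⁻ r y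
      via {s} {t} c₀ h y with R-cover ε y
      ... | r , r∈ , c′ with conn-last c′
      ...   | inj₁ c″ = r , there r∈ , c″
      ...   | inj₂ c″ with h c″
      ...     | inj₁ c₁ = r₀ , there r₀∈ , conn-trans c₀ c₁
      ...     | inj₂ c₂ = t , here refl , c₂
      swap : ∀ {y} → Conn G⁻ a y ⊎ Conn G⁻ b y → Conn G⁻ b y ⊎ Conn G⁻ a y
      swap (inj₁ c) = inj₂ c
      swap (inj₂ c) = inj₁ c
      pick : Conn G⁻ a r₀ ⊎ (Conn G⁻ a r₀ ⊎ Conn G⁻ b r₀) → _
      pick (inj₁ c)        = b , via (conn-sym c) (λ z → z)
      pick (inj₂ (inj₁ c)) = b , via (conn-sym c) (λ z → z)
      pick (inj₂ (inj₂ c)) = a , via (conn-sym c) swap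

    result : Euler ρ⁻
    result = record
      { lab = lab⁻ ; lab-inv = inv ; L = new ∷ L ε ; L-uniq = fresh-∉ (L ε) ∷ L-uniq ε ; L-real = real
      ; R = proj₁ cover ∷ R ε ; R-cover = proj₂ cover
      -- Two darts fewer, one representative and one label more: both sides grow by 2.
      ; bound = +-cancelˡ-≤ 2 _ _ (subst₂′ (bound ε)) }
      where
      subst₂′ : numDarts G + 4 * length (R ε) ≤ 2 * n + 2 * length (L ε) →
        2 + (numDarts G⁻ + 4 * suc (length (R ε))) ≤ 2 + (2 * n + 2 * suc (length (L ε)))
      subst₂′ h rewrite numDarts-del = begin
        2 + (numDarts G⁻ + 4 * suc (length (R ε)))  ≡⟨ solve 2 (λ x y → con 2 :+ (x :+ con 4 :* (con 1 :+ y)) := con 4 :+ ((con 2 :+ x) :+ con 4 :* y)) refl (numDarts G⁻) (length (R ε)) ⟩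
        4 + ((2 + numDarts G⁻) + 4 * length (R ε))  ≤⟨ +-monoʳ-≤ 4 h ⟩
        4 + (2 * n + 2 * length (L ε))              ≡⟨ solve 2 (λ x y → con 4 :+ (con 2 :* x :+ con 2 :* y) := con 2 :+ (con 2 :* x :+ con 2 :* (con 1 :+ y))) refl n (length (L ε)) ⟩
        2 + (2 * n + 2 * suc (length (L ε)))        ∎
        where
        open ≤-Reasoning
        open +-*-Solver

  -- if the two sides of ab lie on different faces, these are merged
  module Merge (ε : Euler ρ) (k : ℕ) (end : iter φ (suc k) d ≡ d)
               (below : ∀ j → j < k → ¬ IsE (iter φ (suc j) d)) where
    φd′≢d : φ d′ ≢ d
    φd′≢d e = go k refl
      where
      go : ∀ k′ → k′ ≡ k → ⊥
      go zero    refl = a≢b (symm (cong proj₁ end))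
      go (suc j) refl = below j ≤-refl (inj₂ (φ-inj _ d′ (iter-dart (suc j) d ab) ba (trans end (symm e))))

    walk : ∀ j → j ≤ k → Conn G⁻ b (proj₁ (iter φ (suc j) d))
    walk zero    _  = stop
    walk (suc j) lt = step (walk j (≤-trans (n≤1+n j) lt)) (kept (iter-dart (suc j) d ab) (below j lt))

    -- The rest of the face of `d` leads from `b` back to `a` without the edge, so `R` still meets
    -- every component.
    joined : Conn G⁻ a b
    joined = conn-sym (subst (λ z → Conn G⁻ b (proj₁ z)) end (walk k ≤-refl))

    lab⁻ : Dart n → ℕ
    lab⁻ e = if does (lab ε e ≟ lab ε d) then lab ε d′ else lab ε e

    lab-eq : ∀ {e} → lab ε e ≡ lab ε d → lab⁻ e ≡ lab ε d′
    lab-eq {e} q rewrite does⇐ (lab ε e ≟ lab ε d) q = refl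

    lab-ne : ∀ {e} → lab ε e ≢ lab ε d → lab⁻ e ≡ lab ε e
    lab-ne {e} q rewrite does⇐¬ (lab ε e ≟ lab ε d) q = refl

    lab-eq′ : ∀ {e} → lab ε e ≡ lab ε d′ → lab⁻ e ≡ lab ε d′
    lab-eq′ {e} q with toSum (lab ε e ≟ lab ε d)
    ... | inj₁ r = lab-eq r
    ... | inj₂ r = trans (lab-ne r) q

    inv : ∀ e → isDart G⁻ e ≡ true → lab⁻ (φ⁻ e) ≡ lab⁻ e
    inv e p⁻ with kept⇒ p⁻ | E-cases (φ e)
    ... | p , ne | inj₂ nf = trans (cong lab⁻ (φ⁻-keep e nf))
                             (cong (λ z → if does (z ≟ lab ε d) then lab ε d′ else z) (lab-inv ε e p))
    ... | p , ne | inj₁ f@(inj₁ fe) = trans (cong lab⁻ (trans (φ⁻-skip e f) (cong (λ z → φ (flip z)) fe)))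
          (trans (lab-eq′ (lab-inv ε d′ ba)) (symm (lab-eq (trans (symm (lab-inv ε e p)) (cong (lab ε) fe)))))
    ... | p , ne | inj₁ f@(inj₂ fe) = trans (cong lab⁻ (trans (φ⁻-skip e f) (cong (λ z → φ (flip z)) fe)))
          (trans (lab-eq (lab-inv ε d ab)) (symm (lab-eq′ (trans (symm (lab-inv ε e p)) (cong (lab ε) fe)))))

    L⁻ : List ℕ
    L⁻ = filter (λ l → ¬? (l ≟ lab ε d)) (L ε)

    real : ∀ l → l ∈ L⁻ → ∃ λ e → Realised G⁻ e × (lab⁻ e ≡ l)
    real l q with ∈-filter⁻ (λ l → ¬? (l ≟ lab ε d)) {xs = L ε} q
    ... | l∈ , l≢ with L-real ε l l∈
    ...   | (u , v) , inj₂ (refl , i) , refl = (u , u) , inj₂ (refl , isolated-mono i) , lab-ne l≢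
    ...   | e@(u , v) , inj₁ p , refl with isE? e
    ...     | no ne           = e , inj₁ (kept p ne) , lab-ne l≢
    ...     | yes (inj₁ refl) = ⊥-elim (l≢ refl)
    ...     | yes (inj₂ refl) = φ d′ , inj₁ (kept (φ-dart d′ ba) notE)
                              , lab-eq′ (lab-inv ε d′ ba)
      where
      notE : ¬ IsE (φ d′)
      notE (inj₁ r) = φd′≢d r
      notE (inj₂ r) = a≢b (cong proj₁ r)

    result : Euler ρ⁻
    result = record
      { lab = lab⁻ ; lab-inv = inv ; L = L⁻ ; L-uniq = filter⁺ _ (L-uniq ε) ; L-real = real
      ; R = R ε ; R-cover = λ x → let r , r∈ , c = R-cover ε x in r , r∈ , conn-mono joined c
      ; bound = +-cancelˡ-≤ 2 _ _ (go (bound ε)) }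
      where
      open import Data.List.Relation.Unary.Unique.Propositional.Properties using (filter⁺)
      go : numDarts G + 4 * length (R ε) ≤ 2 * n + 2 * length (L ε) →
        2 + (numDarts G⁻ + 4 * length (R ε)) ≤ 2 + (2 * n + 2 * length L⁻)
      go h rewrite numDarts-del = begin
        2 + (numDarts G⁻ + 4 * length (R ε))  ≤⟨ h ⟩
        2 * n + 2 * length (L ε)              ≤⟨ +-monoʳ-≤ (2 * n) (*-monoʳ-≤ 2 (filter-length (lab ε d) (L ε) (L-uniq ε))) ⟩
        2 * n + 2 * suc (length L⁻)           ≡⟨ solve 2 (λ x y → con 2 :* x :+ con 2 :* (con 1 :+ y) := con 2 :+ (con 2 :* x :+ con 2 :* y)) refl n (length L⁻) ⟩
        2 + (2 * n + 2 * length L⁻)           ∎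
        where
        open ≤-Reasoning
        open +-*-Solver

  -- The face walk from `d` is followed until it first meets the edge again. Meeting `d` means that
  -- the other side lies on another face; meeting `d′` means that both sides share one.
  euler-delete : Euler ρ → Euler ρ⁻
  euler-delete ε with return d ab
  ... | N , _ , e with least (λ k → isE? (iter φ (suc k) d)) N (inj₁ e)
  ...   | k , inj₁ end , below = Merge.result ε k end below
  ...   | k , inj₂ end , below = Split.result ε k end below

-- Inserting a chord into a face

module InsertCycle {n} (N : Fin n → Bool) (f : Fin n → Fin n)
  (nbr : ∀ v → N v ≡ true → N (f v) ≡ true)
  (inj : ∀ v w → N v ≡ true → N w ≡ true → f v ≡ f w → v ≡ w)
  (cyc : ∀ v w → N v ≡ true → N w ≡ true → ∃ λ k → iter f k v ≡ w)
  (q c : Fin n) (Nq : N q ≡ true) (Nc : N c ≡ false) where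

  ins : Fin n → Fin n
  ins v = if does (v F.≟ c) then f q else (if does (v F.≟ q) then c else f v)

  In : Fin n → Set
  In v = (N v ≡ true) ⊎ (v ≡ c)

  N≢c : ∀ {v} → N v ≡ true → v ≢ c
  N≢c p refl = contra p Nc

  ins-c : ins c ≡ f q
  ins-c rewrite does⇐ (c F.≟ c) refl = refl

  ins-q : ins q ≡ c
  ins-q rewrite does⇐¬ (q F.≟ c) (N≢c Nq) | does⇐ (q F.≟ q) refl = refl

  ins-o : ∀ {v} → v ≢ c → v ≢ q → ins v ≡ f v
  ins-o {v} nc nq rewrite does⇐¬ (v F.≟ c) nc | does⇐¬ (v F.≟ q) nq = refl

  data Kind (v : Fin n) : Set where
    isC   : v ≡ c → ins v ≡ f q → Kind v
    isQ   : v ≡ q → ins v ≡ c → Kind v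
    other : N v ≡ true → v ≢ q → ins v ≡ f v → Kind v

  kind : ∀ {v} → In v → Kind v
  kind (inj₂ refl) = isC refl ins-c
  kind {v} (inj₁ p) with toSum (v F.≟ q)
  ... | inj₁ refl = isQ refl ins-q
  ... | inj₂ nq   = other p nq (ins-o (N≢c p) nq)

  ins-nbr : ∀ v → In v → In (ins v)
  ins-nbr v i with kind i
  ... | isC _ e     = inj₁ (trans (cong N e) (nbr q Nq))
  ... | isQ _ e     = inj₂ e
  ... | other p _ e = inj₁ (trans (cong N e) (nbr v p))

  ins-inj : ∀ v w → In v → In w → ins v ≡ ins w → v ≡ w
  ins-inj v w i j eq with kind i | kind j
  ... | isC refl _     | isC refl _     = refl
  ... | isQ refl _     | isQ refl _     = refl
  ... | isC _ e        | isQ _ e′       = ⊥-elim (N≢c (nbr q Nq) (trans (symm e) (trans eq e′)))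
  ... | isQ _ e        | isC _ e′       = ⊥-elim (N≢c (nbr q Nq) (trans (symm e′) (trans (symm eq) e)))
  ... | isC _ e        | other p nq e′  = ⊥-elim (nq (symm (inj q w Nq p (trans (symm e) (trans eq e′)))))
  ... | other p nq e   | isC _ e′       = ⊥-elim (nq (inj v q p Nq (trans (symm e) (trans eq e′))))
  ... | isQ _ e        | other p _ e′   = ⊥-elim (N≢c (nbr w p) (trans (symm e′) (trans (symm eq) e)))
  ... | other p _ e    | isQ _ e′       = ⊥-elim (N≢c (nbr v p) (trans (symm e) (trans eq e′)))
  ... | other p _ e    | other p′ _ e′  = inj v w p p′ (trans (symm e) (trans eq e′))

  -- `ins` imitates `f`, spending one additional step on the detour through `c` whenever `f` leaves
  -- `q`.
  walk : ∀ x → N x ≡ true → ∀ k → (∃ λ k′ → iter ins k′ x ≡ iter f k x) × (N (iter f k x) ≡ true)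
  walk x p zero = (0 , refl) , p
  walk x p (suc k) with walk x p k
  ... | (k′ , e) , pz with toSum (iter f k x F.≟ q)
  ...   | inj₂ nq = (suc k′ , trans (cong ins e) (ins-o (N≢c pz) nq)) , nbr _ pz
  ...   | inj₁ eq = (suc (suc k′) , trans (cong (λ z → ins (ins z)) (trans e eq))
                       (trans (cong ins ins-q) (trans ins-c (cong f (symm eq))))) , nbr _ pz

  fromN : ∀ x → N x ≡ true → ∀ w → In w → ∃ λ k → iter ins k x ≡ w
  fromN x p w (inj₁ pw) with cyc x w p pw
  ... | k , e = let (k′ , e′) , _ = walk x p k in k′ , trans e′ e
  fromN x p w (inj₂ refl) with cyc x q p Nq
  ... | k , e = let (k′ , e′) , _ = walk x p k in suc k′ , trans (cong ins (trans e′ e)) ins-q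

  ins-cyc : ∀ v w → In v → In w → ∃ λ k → iter ins k v ≡ w
  ins-cyc v w (inj₁ p)    j = fromN v p w j
  ins-cyc v w (inj₂ refl) j with fromN (f q) (nbr q Nq) w j
  ... | k , e = k + 1 , trans (iter-+ ins k 1 c) (trans (cong (iter ins k) ins-c) e)

-- Adding the chord ab inside the face that runs from the dart (p , a) to the
-- dart (r , b).
module Insert {n} {G : Graph n} (ρ : Rotation G) (p a r b : Fin n) (pa : adj G p a ≡ true)
  (a≢b : a ≢ b) (ab : adj G a b ≡ false) (j : ℕ)
  (hit : iter (faceStep ρ) (suc j) (p , a) ≡ (r , b))
  (away : ∀ i → i ≤ j → iter (faceStep ρ) (suc i) (p , a) ≢ (p , a)) where
  open Face ρ
  open Edge a b
  open import Data.List.Membership.DecPropositional (_≟D_ {n}) using (_∈?_)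

  e₁ e₂ : Dart n
  e₁ = (p , a)
  e₂ = (r , b)

  rb : adj G r b ≡ true
  rb = subst (λ z → isDart G z ≡ true) hit (iter-dart (suc j) e₁ pa)

  ba : adj G b a ≡ false
  ba = trans (sym G b a) ab

  G⁺ : Graph n
  G⁺ = record
    { adj    = λ u v → adj G u v ∨ does (isE? (u , v))
    ; sym    = λ u v → cong₂ _∨_ (sym G u v) (does-cong (isE? (u , v)) (isE? (v , u)) IsE-flip IsE-flip)
    ; irrefl = λ u → cong₂ _∨_ (irrefl G u) (does⇐¬ (isE? (u , u)) λ { (inj₁ refl) → a≢b refl ; (inj₂ refl) → a≢b refl }) }

  old : ∀ {u v} → adj G u v ≡ true → adj G⁺ u v ≡ true
  old q = ∨-introˡ q

  new : ∀ {u v} → IsE (u , v) → adj G⁺ u v ≡ true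
  new {u} {v} q = ∨-introʳ {adj G u v} (does⇐ (isE? (u , v)) q)

  dart⁺ : ∀ {u v} → adj G⁺ u v ≡ true → (adj G u v ≡ true) ⊎ IsE (u , v)
  dart⁺ {u} {v} q with ∨-elim {adj G u v} q
  ... | inj₁ x = inj₁ x
  ... | inj₂ x = inj₂ (does⇒ (isE? (u , v)) x)

  notE : ∀ {d} → isDart G d ≡ true → ¬ IsE d
  notE q (inj₁ refl) = contra q ab
  notE q (inj₂ refl) = contra q ba

  numDarts-ins : numDarts G⁺ ≡ 2 + numDarts G
  numDarts-ins =
    trans (count₂-remove (isDart G⁺) (a , b) (new (inj₁ refl)))
     (cong suc (trans (count₂-remove _ (b , a) (∧-intro (new (inj₂ refl)) (not-intro
                        (does⇐¬ ((b , a) ≟D (a , b)) (λ e → a≢b (cong proj₂ e))))))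
       (cong suc (count₂-cong same))))
    where
    same : ∀ x → (isDart G⁺ x ∧ not (does (x ≟D (a , b)))) ∧ not (does (x ≟D (b , a))) ≡ isDart G x
    same x with x ≟D (a , b) | x ≟D (b , a)
    ... | yes refl | _     = trans (cong (_∧ _) (∧-zeroʳ (isDart G x ∨ true))) (symm ab)
    ... | no _  | yes refl = trans (∧-zeroʳ _) (symm ba)
    ... | no _  | no _     = trans (∧-identityʳ _) (trans (∧-identityʳ _) (∨-identityʳ _))

  module Ia = InsertCycle (adj G a) (σ ρ a) (σ-nbr ρ a) (σ-inj ρ a) (σ-cyc ρ a) p b (adj-flip {G = G} pa) ab
  module Ib = InsertCycle (adj G b) (σ ρ b) (σ-nbr ρ b) (σ-inj ρ b) (σ-cyc ρ b) r a (adj-flip {G = G} rb) ba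

  σ⁺ : Fin n → Fin n → Fin n
  σ⁺ u = if does (u F.≟ a) then Ia.ins else (if does (u F.≟ b) then Ib.ins else σ ρ u)

  σ⁺-a : σ⁺ a ≡ Ia.ins
  σ⁺-a rewrite does⇐ (a F.≟ a) refl = refl

  σ⁺-b : σ⁺ b ≡ Ib.ins
  σ⁺-b rewrite does⇐¬ (b F.≟ a) (λ e → a≢b (symm e)) | does⇐ (b F.≟ b) refl = refl

  σ⁺-o : ∀ {u} → u ≢ a → u ≢ b → σ⁺ u ≡ σ ρ u
  σ⁺-o {u} na nb rewrite does⇐¬ (u F.≟ a) na | does⇐¬ (u F.≟ b) nb = refl

  data Where (u : Fin n) : Set where
    at-a : u ≡ a → Where u
    at-b : u ≡ b → Where u
    off  : u ≢ a → u ≢ b → Where u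

  locate : ∀ u → Where u
  locate u with u F.≟ a | u F.≟ b
  ... | yes e | _     = at-a e
  ... | no _  | yes e = at-b e
  ... | no x  | no y  = off x y

  In-a : ∀ {v} → adj G⁺ a v ≡ true → Ia.In v
  In-a q with dart⁺ q
  ... | inj₁ x           = inj₁ x
  ... | inj₂ (inj₁ refl) = inj₂ refl
  ... | inj₂ (inj₂ e)    = ⊥-elim (a≢b (cong proj₁ e))

  In-b : ∀ {v} → adj G⁺ b v ≡ true → Ib.In v
  In-b q with dart⁺ q
  ... | inj₁ x           = inj₁ x
  ... | inj₂ (inj₂ refl) = inj₂ refl
  ... | inj₂ (inj₁ e)    = ⊥-elim (a≢b (symm (cong proj₁ e)))

  In-o : ∀ {u v} → u ≢ a → u ≢ b → adj G⁺ u v ≡ true → adj G u v ≡ true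
  In-o na nb q with dart⁺ q
  ... | inj₁ x        = x
  ... | inj₂ (inj₁ e) = ⊥-elim (na (cong proj₁ e))
  ... | inj₂ (inj₂ e) = ⊥-elim (nb (cong proj₁ e))

  In-a⇒ : ∀ {v} → Ia.In v → adj G⁺ a v ≡ true
  In-a⇒ (inj₁ x)    = old x
  In-a⇒ (inj₂ refl) = new (inj₁ refl)

  In-b⇒ : ∀ {v} → Ib.In v → adj G⁺ b v ≡ true
  In-b⇒ (inj₁ x)    = old x
  In-b⇒ (inj₂ refl) = new (inj₂ refl)

  ρ⁺ : Rotation G⁺
  ρ⁺ = record { σ = σ⁺ ; σ-nbr = nbr ; σ-inj = inj ; σ-cyc = cyc }
    where
    nbr : ∀ u v → adj G⁺ u v ≡ true → adj G⁺ u (σ⁺ u v) ≡ true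
    nbr u v q with locate u
    ... | at-a refl rewrite σ⁺-a = In-a⇒ (Ia.ins-nbr v (In-a q))
    ... | at-b refl rewrite σ⁺-b = In-b⇒ (Ib.ins-nbr v (In-b q))
    ... | off x y rewrite σ⁺-o x y = old (σ-nbr ρ u v (In-o x y q))
    inj : ∀ u v w → adj G⁺ u v ≡ true → adj G⁺ u w ≡ true → σ⁺ u v ≡ σ⁺ u w → v ≡ w
    inj u v w q q′ e with locate u
    ... | at-a refl rewrite σ⁺-a = Ia.ins-inj v w (In-a q) (In-a q′) e
    ... | at-b refl rewrite σ⁺-b = Ib.ins-inj v w (In-b q) (In-b q′) e
    ... | off x y rewrite σ⁺-o x y = σ-inj ρ u v w (In-o x y q) (In-o x y q′) e
    cyc : ∀ u v w → adj G⁺ u v ≡ true → adj G⁺ u w ≡ true → ∃ λ k → iter (σ⁺ u) k v ≡ w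
    cyc u v w q q′ with locate u
    ... | at-a refl rewrite σ⁺-a = Ia.ins-cyc v w (In-a q) (In-a q′)
    ... | at-b refl rewrite σ⁺-b = Ib.ins-cyc v w (In-b q) (In-b q′)
    ... | off x y rewrite σ⁺-o x y = σ-cyc ρ u v w (In-o x y q) (In-o x y q′)

  φ⁺ : Dart n → Dart n
  φ⁺ = faceStep ρ⁺

  -- The four equations for `φ⁺` cut the old face in two: one part continues `e₁`, `(a , b)`,
  -- `φ e₂`, the other `e₂`, `(b , a)`, `φ e₁`.
  φ⁺-e₁ : φ⁺ e₁ ≡ (a , b)
  φ⁺-e₁ = cong (a ,_) (trans (cong (λ f → f p) σ⁺-a) Ia.ins-q)

  φ⁺-ab : φ⁺ (a , b) ≡ φ e₂
  φ⁺-ab = cong (b ,_) (trans (cong (λ f → f a) σ⁺-b) Ib.ins-c)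

  φ⁺-e₂ : φ⁺ e₂ ≡ (b , a)
  φ⁺-e₂ = cong (b ,_) (trans (cong (λ f → f r) σ⁺-b) Ib.ins-q)

  φ⁺-ba : φ⁺ (b , a) ≡ φ e₁
  φ⁺-ba = cong (a ,_) (trans (cong (λ f → f b) σ⁺-a) Ia.ins-c)

  φ⁺-o : ∀ d → isDart G d ≡ true → d ≢ e₁ → d ≢ e₂ → φ⁺ d ≡ φ d
  φ⁺-o (u , v) q n₁ n₂ = cong (v ,_) (go (locate v))
    where
    go : Where v → σ⁺ v u ≡ σ ρ v u
    go (at-a refl) = trans (cong (λ f → f u) σ⁺-a)
      (Ia.ins-o (Ia.N≢c (adj-flip {G = G} q)) (λ { refl → n₁ refl }))
    go (at-b refl) = trans (cong (λ f → f u) σ⁺-b)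
      (Ib.ins-o (Ib.N≢c (adj-flip {G = G} q)) (λ { refl → n₂ refl }))
    go (off x y)   = cong (λ f → f u) (σ⁺-o x y)

  A : List (Dart n)
  A = map (λ i → iter φ (suc i) e₁) (upTo (suc j))

  A⁺ : ∀ {i} → i ≤ j → iter φ (suc i) e₁ ∈ A
  A⁺ le = ∈-map⁺ (λ i → iter φ (suc i) e₁) (∈-upTo⁺ (s≤s le))

  A⁻ : ∀ {e} → e ∈ A → ∃ λ i → (i ≤ j) × (e ≡ iter φ (suc i) e₁)
  A⁻ q with ∈-map⁻ (λ i → iter φ (suc i) e₁) q
  ... | i , i∈ , e = i , ≤-pred (∈-upTo⁻ i∈) , e

  A-dart : ∀ {e} → e ∈ A → isDart G e ≡ true
  A-dart q with A⁻ q
  ... | i , _ , refl = iter-dart (suc i) e₁ pa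

  e₁∉A : e₁ ∉ A
  e₁∉A q with A⁻ q
  ... | i , le , e = away i le (symm e)

  e₂∈A : e₂ ∈ A
  e₂∈A = subst (_∈ A) hit (A⁺ ≤-refl)

  A-fwd : ∀ {e} → e ∈ A → e ≢ e₂ → φ e ∈ A
  A-fwd q ne with A⁻ q
  ... | i , le , refl with m≤n⇒m<n∨m≡n le
  ...   | inj₁ lt   = A⁺ lt
  ...   | inj₂ refl = ⊥-elim (ne hit)

  A-bwd : ∀ {e} → isDart G e ≡ true → φ e ∈ A → (e ≡ e₁) ⊎ (∃ λ i → (suc i ≤ j) × (e ≡ iter φ (suc i) e₁))
  A-bwd {e} q m with A⁻ m
  ... | zero  , le , eq = inj₁ (φ-inj e e₁ q pa eq)
  ... | suc i , le , eq = inj₂ (i , le , φ-inj e _ q (iter-dart (suc i) e₁ pa) eq)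

  -- Otherwise `e₂` would occur earlier on the arc, or be `e₁`; cancelling the common steps closes
  -- the orbit before `away` permits it.
  φe₂∉A : φ e₂ ∉ A
  φe₂∉A q with A-bwd rb q
  ... | inj₁ e = away j ≤-refl (trans hit e)
  ... | inj₂ (i , le , e) = away (j ∸ suc i) (m∸n≤m j (suc i))
      (symm (iter-cancel (suc i) (suc (j ∸ suc i)) e₁ pa
        (trans (symm e) (trans (symm hit) (cong (λ z → iter φ z e₁) (symm
          (cong suc (trans (+-suc i (j ∸ suc i)) (m+[n∸m]≡n le)))))))))

  module _ (ε : Euler ρ) where
    newL : ℕ
    newL = fresh (L ε)

    A-lab : ∀ i → lab ε (iter φ i e₁) ≡ lab ε e₁
    A-lab zero    = refl
    A-lab (suc i) = trans (lab-inv ε _ (iter-dart i e₁ pa)) (A-lab i)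

    lab⁺ : Dart n → ℕ
    lab⁺ e = if does (e ∈? ((b , a) ∷ A)) then newL else (if does (e ≟D (a , b)) then lab ε e₁ else lab ε e)

    lab-in : ∀ {e} → e ∈ (b , a) ∷ A → lab⁺ e ≡ newL
    lab-in {e} q rewrite does⇐ (e ∈? ((b , a) ∷ A)) q = refl

    ab∉ : (a , b) ∉ (b , a) ∷ A
    ab∉ (here e)  = a≢b (cong proj₁ e)
    ab∉ (there q) = contra (A-dart q) ab

    lab-ab : lab⁺ (a , b) ≡ lab ε e₁
    lab-ab rewrite does⇐¬ ((a , b) ∈? ((b , a) ∷ A)) ab∉ | does⇐ ((a , b) ≟D (a , b)) refl = refl

    lab-out : ∀ {e} → e ∉ A → ¬ IsE e → lab⁺ e ≡ lab ε e
    lab-out {e} nA ne rewrite does⇐¬ (e ∈? ((b , a) ∷ A)) (λ { (here x) → ne (inj₂ x) ; (there x) → nA x })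
      | does⇐¬ (e ≟D (a , b)) (λ x → ne (inj₁ x)) = refl

    inv-old : ∀ e → isDart G e ≡ true → lab⁺ (φ⁺ e) ≡ lab⁺ e
    inv-old e q with toSum (e ≟D e₁) | toSum (e ≟D e₂)
    ... | inj₁ refl | _ = trans (cong lab⁺ φ⁺-e₁) (trans lab-ab (symm (lab-out e₁∉A (notE q))))
    ... | inj₂ n₁ | inj₁ refl = trans (cong lab⁺ φ⁺-e₂) (trans (lab-in (here refl)) (symm (lab-in (there e₂∈A))))
    ... | inj₂ n₁ | inj₂ n₂ with toSum (e ∈? A)
    ...   | inj₁ m = trans (cong lab⁺ (φ⁺-o e q n₁ n₂)) (trans (lab-in (there (A-fwd m n₂))) (symm (lab-in (there m))))
    ...   | inj₂ m = trans (cong lab⁺ (φ⁺-o e q n₁ n₂))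
              (trans (lab-out (λ x → out (A-bwd q x)) (notE (φ-dart e q))) (trans (lab-inv ε e q) (symm (lab-out m (notE q)))))
      where
      out : (e ≡ e₁) ⊎ (∃ λ i → (suc i ≤ j) × (e ≡ iter φ (suc i) e₁)) → ⊥
      out (inj₁ x) = n₁ x
      out (inj₂ (i , le , x)) = m (subst (_∈ A) (symm x) (A⁺ (≤-trans (n≤1+n i) le)))

    inv : ∀ e → isDart G⁺ e ≡ true → lab⁺ (φ⁺ e) ≡ lab⁺ e
    inv e@(u , v) q with dart⁺ {u} {v} q
    ... | inj₁ x = inv-old e x
    ... | inj₂ (inj₁ refl) = trans (cong lab⁺ φ⁺-ab) (trans (lab-out φe₂∉A (notE (φ-dart e₂ rb)))
            (trans (lab-inv ε e₂ rb) (trans (cong (lab ε) (symm hit)) (trans (A-lab (suc j)) (symm lab-ab)))))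
    ... | inj₂ (inj₂ refl) = trans (cong lab⁺ φ⁺-ba) (trans (lab-in (there (A⁺ z≤n))) (symm (lab-in (here refl))))

    real : ∀ l → l ∈ newL ∷ L ε → ∃ λ e → Realised G⁺ e × (lab⁺ e ≡ l)
    real l (here refl) = e₂ , inj₁ (old rb) , lab-in (there e₂∈A)
    real l (there m) with L-real ε l m
    ... | (u , v) , inj₂ (refl , i) , refl = (u , u) , inj₂ (refl , iso)
        , lab-out (λ x → adj⇒≢ {G = G} (A-dart x) refl) (λ { (inj₁ refl) → a≢b refl ; (inj₂ refl) → a≢b refl })
      where
      iso : Isolated G⁺ u
      iso y = ≢true λ q → go (dart⁺ q)
        where
        go : (adj G u y ≡ true) ⊎ IsE (u , y) → ⊥
        go (inj₁ x) = contra x (i y)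
        go (inj₂ (inj₁ refl)) = contra (adj-flip {G = G} pa) (i p)
        go (inj₂ (inj₂ refl)) = contra (adj-flip {G = G} rb) (i r)
    ... | e@(u , v) , inj₁ q , refl with toSum (e ∈? A)
    ...   | inj₂ nA = e , inj₁ (old q) , lab-out nA (notE q)
    ...   | inj₁ x with A⁻ x
    ...     | i , _ , eq = e₁ , inj₁ (old pa) , trans (lab-out e₁∉A (notE pa)) (symm (trans (cong (lab ε) eq) (A-lab (suc i))))

    conn-old : ∀ {x y} → Conn G x y → Conn G⁺ x y
    conn-old stop       = stop
    conn-old (step c q) = step (conn-old c) (old q)

    euler-insert : Euler ρ⁺
    euler-insert = record
      { lab = lab⁺ ; lab-inv = inv ; L = newL ∷ L ε ; L-uniq = fresh-∉ (L ε) ∷ L-uniq ε ; L-real = real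
      ; R = R ε ; R-cover = λ x → let y , y∈ , c = R-cover ε x in y , y∈ , conn-old c
      ; bound = go (bound ε) }
      where
      go : numDarts G + 4 * length (R ε) ≤ 2 * n + 2 * length (L ε) →
        numDarts G⁺ + 4 * length (R ε) ≤ 2 * n + 2 * suc (length (L ε))
      go h rewrite numDarts-ins = begin
        2 + numDarts G + 4 * length (R ε)   ≤⟨ +-monoʳ-≤ 2 h ⟩
        2 + (2 * n + 2 * length (L ε))      ≡⟨ solve 2 (λ x y → con 2 :+ (con 2 :* x :+ con 2 :* y) := con 2 :* x :+ con 2 :* (con 1 :+ y)) refl n (length (L ε)) ⟩
        2 * n + 2 * suc (length (L ε))      ∎
        where
        open ≤-Reasoning
        open +-*-Solver

-- The Euler witness of a plane graph

key-inj : ∀ {n} {d e : Dart n} → key d ≡ key e → d ≡ e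
key-inj {n} {u , v} {u′ , v′} q = cong₂ _,_ (proj₁ eqs) (proj₂ eqs)
  where
  shape : ∀ (u v : Fin n) → n * toℕ u + toℕ v ≡ toℕ u * n + toℕ v
  shape u v = cong (_+ toℕ v) (*-comm n (toℕ u))
  eqs : (u ≡ u′) × (v ≡ v′)
  eqs = FP.combine-injective u v u′ v′ (FP.toℕ-injective (trans (FP.toℕ-combine u v)
          (trans (shape u v) (trans q (trans (symm (shape u′ v′)) (symm (FP.toℕ-combine u′ v′)))))))

reach⇒Conn : ∀ {n} (G : Graph n) k u w → reach G k u w ≡ true → Conn G u w
reach⇒Conn G zero u w q with does⇒ (u F.≟ w) q
... | refl = stop
reach⇒Conn G (suc k) u w q with ∨-elim {reach G k u w} q
... | inj₁ r = reach⇒Conn G k u w r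
... | inj₂ r with anyB⇒ _ r
...   | x , s with ∧-elim {reach G k u x} s
...     | s₁ , s₂ = step (reach⇒Conn G k u x s₁) s₂

module Init {n} {G : Graph n} (ρ : Rotation G)
  (planar : 2 * n + 2 * numFaces ρ + 2 * numIsolated G ≡ numDarts G + 4 * numComponents G) where
  open Face ρ

  low : ℕ → Dart n → ℕ
  low zero    e = key e
  low (suc N) e = key (iter φ (suc N) e) ⊓ low N e

  low-≤ : ∀ N e k → k ≤ N → low N e ≤ key (iter φ k e)
  low-≤ zero    e zero z≤n = ≤-refl
  low-≤ (suc N) e k le with m≤n⇒m<n∨m≡n le
  ... | inj₂ refl = m⊓n≤m _ _
  ... | inj₁ lt   = ≤-trans (m⊓n≤n _ _) (low-≤ N e k (≤-pred lt))

  low-at : ∀ N e → ∃ λ k → low N e ≡ key (iter φ k e)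
  low-at zero    e = 0 , refl
  low-at (suc N) e with ⊓-sel (key (iter φ (suc N) e)) (low N e) | low-at N e
  ... | inj₁ q | _      = suc N , q
  ... | inj₂ q | k , q′ = k , trans q q′

  -- The period found by `return` is at most `n * n`, so the bounded searches in `low (n * n)` and
  -- `orbitMin` see the whole orbit.
  short : ∀ d → isDart G d ≡ true → ∀ k → ∃ λ k′ → (k′ ≤ n * n) × (iter φ k′ d ≡ iter φ k d)
  short d p k with return d p
  ... | T , T≤ , back = let k′ , lt , e = go k in k′ , ≤-trans (≤-pred lt) (≤-trans (n≤1+n T) T≤) , e
    where
    go : ∀ k → ∃ λ k′ → (k′ < suc T) × (iter φ k′ d ≡ iter φ k d)
    go zero = 0 , s≤s z≤n , refl
    go (suc k) with go k
    ... | k′ , s≤s lt , e with m≤n⇒m<n∨m≡n lt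
    ...   | inj₁ lt′  = suc k′ , s≤s lt′ , cong φ e
    ...   | inj₂ refl = 0 , s≤s z≤n , trans (symm back) (cong φ e)

  low-orbit : ∀ d e → isDart G d ≡ true → (∀ k → ∃ λ k′ → iter φ k e ≡ iter φ k′ d) → low (n * n) d ≤ low (n * n) e
  low-orbit d e p h with low-at (n * n) e
  ... | k , q with h k
  ...   | k′ , q′ with short d p k′
  ...     | k″ , le , q″ = ≤-trans (low-≤ (n * n) d k″ le) (≤-reflexive (trans (cong key (trans q″ (symm q′))) (symm q)))

  -- A face is named by the least key among its darts, an isolated vertex by the key of its diagonal
  -- pair. Injectivity of `key` keeps all these names apart.
  lab₀ : Dart n → ℕ
  lab₀ e = if isDart G e then low (n * n) e else key e

  lab₀-dart : ∀ {e} → isDart G e ≡ true → lab₀ e ≡ low (n * n) e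
  lab₀-dart {u , v} p rewrite p = refl

  iter-φ : ∀ k d → iter φ k (φ d) ≡ iter φ (suc k) d
  iter-φ k d = trans (symm (iter-+ φ k 1 d)) (cong (λ z → iter φ z d) (+-comm k 1))

  inv : ∀ d → isDart G d ≡ true → lab₀ (φ d) ≡ lab₀ d
  inv d p = trans (lab₀-dart (φ-dart d p)) (trans (≤-antisym
      (low-orbit (φ d) d (φ-dart d p) back)
      (low-orbit d (φ d) p (λ k → suc k , iter-φ k d))) (symm (lab₀-dart p)))
    where
    back : ∀ k → ∃ λ k′ → iter φ k d ≡ iter φ k′ (φ d)
    back k with return d p
    ... | T , _ , e = k + T , trans (cong (iter φ k) (trans (symm e) (symm (iter-φ T d)))) (symm (iter-+ φ k T (φ d)))

  isMin : Dart n → Bool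
  isMin (u , v) = adj G u v ∧ orbitMin ρ (u , v)

  isIso : Fin n → Bool
  isIso u = not (anyB (adj G u))

  private
    faces = CountDart.#-elems (numFaces ρ) isMin ≤-refl
    isos  = #-elems (numIsolated G) isIso ≤-refl

  diag : Fin n → Dart n
  diag x = (x , x)

  reps : List (Dart n)
  reps = proj₁ faces ++ map diag (proj₁ isos)

  reps-real : ∀ {e} → e ∈ reps → Realised G e × (lab₀ e ≡ key e)
  reps-real {u , v} q with ∈-++⁻ (proj₁ faces) q
    where
    open import Data.List.Membership.Propositional.Properties using (∈-++⁻)
  ... | inj₁ m with ∧-elim {adj G u v} (All.lookup (proj₁ (proj₂ (proj₂ faces))) m)
  ...   | p , o = inj₁ p , trans (lab₀-dart p) (≤-antisym (low-≤ (n * n) (u , v) 0 z≤n) least-key)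
    where
    least-key : key (u , v) ≤ low (n * n) (u , v)
    least-key with low-at (n * n) (u , v)
    ... | k , q′ with short (u , v) p k
    ...   | k′ , le , q″ = ≤-trans (≤ᵇ⇒ {key (u , v)} (allB⇒ (λ i → key (u , v) ≤ᵇ key (iter φ (toℕ i) (u , v))) o (fromℕ< (s≤s le))))
              (≤-reflexive (trans (cong (λ z → key (iter φ z (u , v))) (FP.toℕ-fromℕ< (s≤s le)))
                (trans (cong key q″) (symm q′))))
  reps-real {u , v} q | inj₂ m with ∈-map⁻ diag m
  ... | x , x∈ , refl = inj₂ (refl , anyB-false _ (not-elim (All.lookup (proj₁ (proj₂ (proj₂ isos))) x∈)))
      , cong (λ z → if z then low (n * n) (x , x) else key (x , x)) (irrefl G x)

  reps-uniq : Unique reps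
  reps-uniq = ++⁺ (proj₁ (proj₂ faces)) (map⁺ (cong proj₁) (proj₁ (proj₂ isos))) disj
    where
    open import Data.List.Relation.Unary.Unique.Propositional.Properties using (++⁺; map⁺)
    disj : ∀ {e} → ¬ (e ∈ proj₁ faces × e ∈ map diag (proj₁ isos))
    disj (p , q) with ∈-map⁻ diag q
    ... | x , _ , refl = contra (proj₁ (∧-elim {adj G x x} (All.lookup (proj₁ (proj₂ (proj₂ faces))) p))) (irrefl G x)

  isRoot : Fin n → Bool
  isRoot u = allB (λ w → not (reach G n u w) ∨ (toℕ u ≤ᵇ toℕ w))

  private
    roots = #-elems (numComponents G) isRoot ≤-refl

  root-∈ : ∀ x → isRoot x ≡ true → x ∈ proj₁ roots
  root-∈ = unique-full isRoot (proj₁ (proj₂ roots)) (proj₁ (proj₂ (proj₂ roots)))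
             (≤-reflexive (symm (proj₂ (proj₂ (proj₂ roots)))))

  -- Descent on the index: a vertex that is not a root reaches one of smaller index.
  cover : ∀ N x → toℕ x < N → ∃ λ r → (r ∈ proj₁ roots) × Conn G r x
  cover (suc N) x (s≤s lt) with isRoot x in eq
  ... | true  = x , root-∈ x eq , stop
  ... | false with allB-false _ eq
  ...   | w , q with reach G n x w in rq | q
  ...     | true | q′ with cover N w (≤-trans (≰⇒> (λ le → contra (⇒≤ᵇ le) q′)) lt)
  ...       | r , r∈ , c = r , r∈ , conn-trans c (conn-sym (reach⇒Conn G n x w rq))

  euler-init : Euler ρ
  euler-init = record
    { lab = lab₀ ; lab-inv = inv ; L = map key reps
    ; L-uniq = map⁺ key-inj reps-uniq
    ; L-real = λ l q → let e , e∈ , eq = ∈-map⁻ key q ; r , s = reps-real e∈ in e , r , trans s (symm eq)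
    ; R = proj₁ roots ; R-cover = λ x → cover n x (FP.toℕ<n x)
    ; bound = ≤-reflexive count-up }
    where
    open import Data.List.Relation.Unary.Unique.Propositional.Properties using (map⁺)
    len : length (map key reps) ≡ numFaces ρ + numIsolated G
    len = trans (LP.length-map key reps) (trans (LP.length-++ (proj₁ faces))
            (cong₂ _+_ (proj₂ (proj₂ (proj₂ faces))) (trans (LP.length-map diag (proj₁ isos)) (proj₂ (proj₂ (proj₂ isos))))))
    count-up : numDarts G + 4 * length (proj₁ roots) ≡ 2 * n + 2 * length (map key reps)
    count-up rewrite len | proj₂ (proj₂ (proj₂ roots)) = trans (symm planar)
      (solve 3 (λ x y z → con 2 :* x :+ con 2 :* y :+ con 2 :* z := con 2 :* x :+ con 2 :* (y :+ z)) refl n (numFaces ρ) (numIsolated G))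
      where
      open +-*-Solver

-- Restriction to a set of vertices, and counting faces

-- Edges leaving `K` are deleted one by one, each deletion carrying the witness along. The last
-- clause says that a turn to a surviving neighbour is unchanged; `K4` needs it to follow a face
-- walk into the restricted graph.
restrict : ∀ {n} (K : Fin n → Bool) fuel {G : Graph n} (ρ : Rotation G) → Euler ρ → numDarts G ≤ fuel →
  Σ (Graph n) λ H → Σ (Rotation H) λ ρ′ → Euler ρ′
    × (∀ u v → adj H u v ≡ adj G u v ∧ (K u ∧ K v))
    × (∀ u v → adj H v u ≡ true → adj H v (σ ρ v u) ≡ true → σ ρ′ v u ≡ σ ρ v u)
restrict {n} K fuel {G} ρ ε le with search₂ (λ d → isDart G d ∧ not (K (proj₁ d) ∧ K (proj₂ d)))
... | inj₂ none = G , ρ , ε , same , λ _ _ _ _ → refl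
  where
  same : ∀ u v → adj G u v ≡ adj G u v ∧ (K u ∧ K v)
  same u v with adj G u v | K u ∧ K v | none (u , v)
  ... | false | _    | _ = refl
  ... | true  | true | _ = refl
restrict {n} K zero {G} ρ ε le | inj₁ ((a , b) , bad) =
  ⊥-elim (n≮0 {1 + numDarts G⁻} (subst (_≤ 0) numDarts-del le))
  where
  open Delete ρ a b (proj₁ (∧-elim {adj G a b} bad))
restrict {n} K (suc fuel) {G} ρ ε le | inj₁ ((a , b) , bad) =
  let H , ρ′ , ε′ , eq , keep = restrict K fuel ρ⁻ (euler-delete ε)
                                 (≤-trans (n≤1+n _) (≤-pred (subst (_≤ suc fuel) numDarts-del le)))
  in H , ρ′ , ε′ , (λ u v → trans (eq u v) (same u v)) , keeps {H} {ρ′} eq keep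
  where
  open Delete ρ a b (proj₁ (∧-elim {adj G a b} bad))
  open Edge a b
  noK : ∀ {u v} → IsE (u , v) → K u ∧ K v ≡ false
  noK (inj₁ refl) = not-elim (proj₂ (∧-elim {adj G a b} bad))
  noK (inj₂ refl) = trans (∧-comm (K b) (K a)) (not-elim (proj₂ (∧-elim {adj G a b} bad)))
  same : ∀ u v → adj G⁻ u v ∧ (K u ∧ K v) ≡ adj G u v ∧ (K u ∧ K v)
  same u v with isE? (u , v)
  ... | no _  = cong (_∧ (K u ∧ K v)) (∧-identityʳ (adj G u v))
  ... | yes e rewrite noK e = trans (∧-zeroʳ _) (symm (∧-zeroʳ _))
  keeps : ∀ {H : Graph n} {ρ′ : Rotation H} → (∀ u v → adj H u v ≡ adj G⁻ u v ∧ (K u ∧ K v)) →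
    (∀ u v → adj H v u ≡ true → adj H v (σ⁻ v u) ≡ true → σ ρ′ v u ≡ σ⁻ v u) →
    ∀ u v → adj H v u ≡ true → adj H v (σ ρ v u) ≡ true → σ ρ′ v u ≡ σ ρ v u
  keeps {H} eq keep u v p q = trans (keep u v p (subst (λ z → adj H v z ≡ true) (symm s) q)) s
    where
    s : σ⁻ v u ≡ σ ρ v u
    s = σ⁻-keep v u (proj₂ (kept⇒ {v , σ ρ v u} (proj₁ (∧-elim {adj G⁻ v (σ ρ v u)} (trans (symm (eq v (σ ρ v u))) q)))))

count-not : ∀ {n} (p : Fin n → Bool) → count p + count (λ x → not (p x)) ≡ n
count-not {zero}  p = refl
count-not {suc n} p with p F.zero
... | true  = cong suc (count-not (λ i → p (F.suc i)))
... | false = trans (+-suc _ _) (cong suc (count-not (λ i → p (F.suc i))))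

module Faces {n} {G : Graph n} (ρ : Rotation G) (ε : Euler ρ) where
  open Face ρ

  live : Fin n → Bool
  live u = anyB (adj G u)

  DartLabel : ℕ → Set
  DartLabel l = ∃ λ e → (isDart G e ≡ true) × (lab ε e ≡ l)

  -- Separates genuine faces from the labels owed to isolated vertices. The inclusions into `ls` are
  -- carried along to keep both lists free of repetition.
  split : ∀ ls → Unique ls → (∀ l → l ∈ ls → ∃ λ e → Realised G e × (lab ε e ≡ l)) →
    Σ (List ℕ) λ ds → Σ (List (Fin n)) λ xs →
      Unique ds × All DartLabel ds × (∀ l → l ∈ ds → l ∈ ls) ×
      Unique xs × All (λ x → not (live x) ≡ true) xs × (∀ x → x ∈ xs → lab ε (x , x) ∈ ls) ×
      (length ls ≡ length ds + length xs)
  split [] u h = [] , [] , [] , [] , (λ _ ()) , [] , [] , (λ _ ()) , refl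
  split (l ∷ ls) (l∉ ∷ u) h with split ls u (λ m q → h m (there q)) | h l (here refl)
  ... | ds , xs , ud , ad , sd , ux , ax , sx , len | e , inj₁ p , q =
      l ∷ ds , xs , (¬Any⇒All¬ ds (λ m → All¬⇒¬Any l∉ (sd l m)) ∷ ud) , ((e , p , q) ∷ ad)
      , (λ { m (here r) → here r ; m (there r) → there (sd m r) })
      , ux , ax , (λ x r → there (sx x r)) , cong suc len
  ... | ds , xs , ud , ad , sd , ux , ax , sx , len | (x , _) , inj₂ (refl , i) , q =
      ds , x ∷ xs , ud , ad , (λ m r → there (sd m r))
      , (¬Any⇒All¬ xs (λ r → All¬⇒¬Any l∉ (subst (_∈ ls) q (sx x r))) ∷ ux)
      , (not-intro (≢true λ t → let y , py = anyB⇒ _ t in contra py (i y)) ∷ ax)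
      , (λ { y (here refl) → here q ; y (there r) → there (sx y r) })
      , trans (cong suc len) (symm (+-suc (length ds) (length xs)))

  conn-isolated : ∀ {x y} → Isolated G y → Conn G x y → x ≡ y
  conn-isolated i stop = refl
  conn-isolated i (step {y} c e) = contra (adj-flip {G = G} e) (i y)

  -- Isolated vertices cancel: each contributes at most 2 + 2 on the right, as a vertex and as a
  -- label, but must represent itself in `R`, which costs 4. One further representative is needed
  -- for `x`.
  euler-live : ∀ x → live x ≡ true →
    Σ (List ℕ) λ ds → Unique ds × All DartLabel ds × (numDarts G + 4 ≤ 2 * count live + 2 * length ds)
  euler-live x lx with split (L ε) (L-uniq ε) (L-real ε)
  ... | ds , xs , ud , ad , _ , ux , ax , _ , len = ds , ud , ad ,
        arith (count live) (count (λ u → not (live u))) (length xs) (length (R ε)) (length ds)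
          (unique-≤-# _ ux ax) roots (subst₂′ (bound ε))
    where
    subst₂′ : numDarts G + 4 * length (R ε) ≤ 2 * n + 2 * length (L ε) →
      numDarts G + 4 * length (R ε) ≤ 2 * (count live + count (λ u → not (live u))) + 2 * (length ds + length xs)
    subst₂′ h rewrite count-not live | symm len = h
    iso⇒ : ∀ y → not (live y) ≡ true → Isolated G y
    iso⇒ y q = anyB-false _ (not-elim q)
    r₀ = R-cover ε x
    r₀-live : not (live (proj₁ r₀)) ≡ false
    r₀-live = ≢true λ q → contra (subst (λ z → live z ≡ true) (symm (conn-isolated′ (iso⇒ _ q) (proj₂ (proj₂ r₀)))) lx)
                                 (not-elim q)
      where
      conn-isolated′ : ∀ {x y} → Isolated G x → Conn G x y → x ≡ y
      conn-isolated′ i c = symm (conn-isolated i (conn-sym c))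
    roots : count (λ u → not (live u)) + 1 ≤ length (R ε)
    roots = ≤-trans (#-mono+ (λ u → not (live u)) q (λ u h → ∨-introˡ h) ([] ∷ [])
                       ((∨-introʳ {not (live (proj₁ r₀))} (==-refl (proj₁ r₀)) , r₀-live) ∷ []))
                    (#-≤-cover q (R ε) inR)
      where
      q : Fin n → Bool
      q u = not (live u) ∨ (u == proj₁ r₀)
      inR : ∀ u → q u ≡ true → u ∈ R ε
      inR u h with ∨-elim {not (live u)} h
      ... | inj₂ e = subst (_∈ R ε) (symm (does⇒ (u F.≟ proj₁ r₀) e)) (proj₁ (proj₂ r₀))
      ... | inj₁ i with R-cover ε u
      ...   | r , r∈ , c = subst (_∈ R ε) (conn-isolated (iso⇒ u i) c) r∈
    arith : ∀ N I X R D → X ≤ I → I + 1 ≤ R → numDarts G + 4 * R ≤ 2 * (N + I) + 2 * (D + X) →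
      numDarts G + 4 ≤ 2 * N + 2 * D
    arith N I X R D x≤ r≤ h = +-cancelʳ-≤ (4 * I) _ _ (begin
      numDarts G + 4 + 4 * I           ≡⟨ solve 2 (λ d i → d :+ con 4 :+ con 4 :* i := d :+ con 4 :* (i :+ con 1)) refl (numDarts G) I ⟩
      numDarts G + 4 * (I + 1)         ≤⟨ +-monoʳ-≤ (numDarts G) (*-monoʳ-≤ 4 r≤) ⟩
      numDarts G + 4 * R               ≤⟨ h ⟩
      2 * (N + I) + 2 * (D + X)        ≤⟨ +-monoʳ-≤ (2 * (N + I)) (*-monoʳ-≤ 2 (+-monoʳ-≤ D x≤)) ⟩
      2 * (N + I) + 2 * (D + I)        ≡⟨ solve 3 (λ a i d → con 2 :* (a :+ i) :+ con 2 :* (d :+ i) := con 2 :* a :+ con 2 :* d :+ con 4 :* i) refl N I D ⟩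
      2 * N + 2 * D + 4 * I            ∎)
      where
      open ≤-Reasoning
      open +-*-Solver

  module _ (nofix : ∀ u v → adj G u v ≡ true → σ ρ u v ≢ v) where
    -- There are no loops, and without fixed rotations a face walk never turns straight back along
    -- its edge.
    three : ∀ e → isDart G e ≡ true → Unique (e ∷ φ e ∷ φ (φ e) ∷ [])
    three e@(u , v) p = (ne ∷ (λ q → nofix v u (adj-flip {G = G} p) (symm (cong proj₁ q))) ∷ [])
                        ∷ (ne′ ∷ []) ∷ [] ∷ []
      where
      ne : e ≢ φ e
      ne q = adj⇒≢ {G = G} p (cong proj₁ q)
      ne′ : φ e ≢ φ (φ e)
      ne′ q = adj⇒≢ {G = G} (φ-dart e p) (cong proj₁ q)

    -- Each label supplies three darts of its face; constancy of `lab` along faces keeps the triples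
    -- of different labels disjoint.
    pack : ∀ ds → Unique ds → All DartLabel ds →
      Σ (List (Dart n)) λ es → Unique es × All (λ e → isDart G e ≡ true) es × (∀ e → e ∈ es → lab ε e ∈ ds)
        × (length es ≡ 3 * length ds)
    pack [] _ _ = [] , [] , [] , (λ _ ()) , refl
    pack (l ∷ ds) (l∉ ∷ u) ((e , p , refl) ∷ a) with pack ds u a
    ... | es , ue , ae , se , len =
        e ∷ φ e ∷ φ (φ e) ∷ es , join (three e p) , (p ∷ p₁ ∷ p₂ ∷ ae)
        , (λ { _ (here refl) → here refl ; _ (there (here refl)) → here l₁ ; _ (there (there (here refl))) → here l₂
             ; x (there (there (there q))) → there (se x q) })
        , trans (cong (3 +_) len) (symm (*-suc 3 (length ds)))
      where
      p₁ = φ-dart e p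
      p₂ = φ-dart (φ e) p₁
      l₁ : lab ε (φ e) ≡ lab ε e
      l₁ = lab-inv ε e p
      l₂ : lab ε (φ (φ e)) ≡ lab ε e
      l₂ = trans (lab-inv ε (φ e) p₁) l₁
      sep : ∀ {x} → lab ε x ≡ lab ε e → All (x ≢_) es
      sep {x} q = All.tabulate λ {y} y∈ r → All.lookup l∉ (se y y∈) (trans (symm q) (cong (lab ε) r))
      join : Unique (e ∷ φ e ∷ φ (φ e) ∷ []) → Unique (e ∷ φ e ∷ φ (φ e) ∷ es)
      join ((x ∷ y ∷ []) ∷ (z ∷ []) ∷ _) = (x ∷ y ∷ sep refl) ∷ (z ∷ sep l₁) ∷ sep l₂ ∷ ue

    3F≤D : ∀ ds → Unique ds → All DartLabel ds → 3 * length ds ≤ numDarts G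
    3F≤D ds u a with pack ds u a
    ... | es , ue , ae , _ , len = subst (_≤ numDarts G) len (CountDart.unique-≤-# (isDart G) ue ae)

    -- The label of `f` is taken out and contributes four darts, every other label three.
    3F<D : ∀ ds → Unique ds → All DartLabel ds → ∀ f → isDart G f ≡ true →
      Unique (f ∷ φ f ∷ φ (φ f) ∷ φ (φ (φ f)) ∷ []) → 3 * length ds + 1 ≤ numDarts G
    3F<D ds u a f p uf with pack ds⁻ (filter⁺ _ u) (All.tabulate (λ m → All.lookup a (proj₁ (∈-filter⁻ f? {xs = ds} m))))
      where
      open import Data.List.Relation.Unary.Unique.Propositional.Properties using (filter⁺)
      f? = λ l → ¬? (l ≟ lab ε f)
      ds⁻ = filter f? ds
    ... | es , ue , ae , se , len = begin
        3 * length ds + 1                 ≤⟨ +-monoˡ-≤ 1 (*-monoʳ-≤ 3 (filter-length (lab ε f) ds u)) ⟩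
        3 * suc (length ds⁻) + 1          ≡⟨ solve 1 (λ x → con 3 :* (con 1 :+ x) :+ con 1 := con 4 :+ con 3 :* x) refl (length ds⁻) ⟩
        4 + 3 * length ds⁻                ≡⟨ cong (4 +_) (symm len) ⟩
        4 + length es                     ≤⟨ CountDart.unique-≤-# (isDart G) (join uf) (p ∷ p₁ ∷ p₂ ∷ p₃ ∷ ae) ⟩
        numDarts G                        ∎
      where
      open ≤-Reasoning
      open +-*-Solver
      f? = λ l → ¬? (l ≟ lab ε f)
      ds⁻ = filter f? ds
      p₁ = φ-dart f p
      p₂ = φ-dart (φ f) p₁
      p₃ = φ-dart (φ (φ f)) p₂
      l₁ : lab ε (φ f) ≡ lab ε f
      l₁ = lab-inv ε f p
      l₂ : lab ε (φ (φ f)) ≡ lab ε f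
      l₂ = trans (lab-inv ε (φ f) p₁) l₁
      l₃ : lab ε (φ (φ (φ f))) ≡ lab ε f
      l₃ = trans (lab-inv ε (φ (φ f)) p₂) l₂
      sep : ∀ {x} → lab ε x ≡ lab ε f → All (x ≢_) es
      sep {x} q = All.tabulate λ {y} y∈ r → proj₂ (∈-filter⁻ f? {xs = ds} (se y y∈)) (trans (cong (lab ε) (symm r)) q)
      join : Unique (f ∷ φ f ∷ φ (φ f) ∷ φ (φ (φ f)) ∷ []) → Unique (f ∷ φ f ∷ φ (φ f) ∷ φ (φ (φ f)) ∷ es)
      join ((x₁ ∷ x₂ ∷ x₃ ∷ []) ∷ (y₁ ∷ y₂ ∷ []) ∷ (z₁ ∷ []) ∷ _) =
        (x₁ ∷ x₂ ∷ x₃ ∷ sep refl) ∷ (y₁ ∷ y₂ ∷ sep l₁) ∷ (z₁ ∷ sep l₂) ∷ sep l₃ ∷ ue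

-- Triangulating

count-≤ : ∀ {n} (p : Fin n → Bool) → count p ≤ n
count-≤ p = ≤-trans (m≤m+n (count p) _) (≤-reflexive (count-not p))

sumF-≤ : ∀ {n} c (f : Fin n → ℕ) → (∀ i → f i ≤ c) → sumF f ≤ n * c
sumF-≤ {zero}  c f h = z≤n
sumF-≤ {suc n} c f h = +-mono-≤ (h F.zero) (sumF-≤ c _ (λ i → h (F.suc i)))

numDarts-≤ : ∀ {n} (G : Graph n) → numDarts G ≤ n * n
numDarts-≤ {n} G = sumF-≤ n _ (λ u → count-≤ (adj G u))

nofix-deg : ∀ {n} {G : Graph n} (ρ : Rotation G) u v → 2 ≤ count (adj G u) → adj G u v ≡ true → σ ρ u v ≢ v
nofix-deg {G = G} ρ u v d p q =
  1+n≰n (≤-trans d (#-≤-cover (adj G u) (v ∷ []) (λ w r → here (fixed-nbr ρ u v p q w r))))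

-- In a plane K₄ every face is a triangle.
module K4 {n} {G : Graph n} (ρ : Rotation G) (ε : Euler ρ) (b₁ b₂ b₃ b₄ : Fin n)
  (a12 : adj G b₁ b₂ ≡ true) (a13 : adj G b₁ b₃ ≡ true) (a14 : adj G b₁ b₄ ≡ true)
  (a23 : adj G b₂ b₃ ≡ true) (a24 : adj G b₂ b₄ ≡ true) (a34 : adj G b₃ b₄ ≡ true)
  (turn₂ : σ ρ b₂ b₁ ≡ b₃) (turn₃ : σ ρ b₃ b₂ ≡ b₄) where

  open import Data.List.Membership.DecPropositional (F._≟_ {n}) using (_∈?_)

  B : List (Fin n)
  B = b₁ ∷ b₂ ∷ b₃ ∷ b₄ ∷ []

  K : Fin n → Bool
  K x = does (x ∈? B)

  ne : ∀ {u v} → adj G u v ≡ true → u ≢ v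
  ne = adj⇒≢ {G = G}

  fl : ∀ {u v} → adj G u v ≡ true → adj G v u ≡ true
  fl = adj-flip {G = G}

  -- After restriction to the four vertices, the prescribed turns give one face four darts with
  -- different tails. Combined with Euler's bound on four vertices this leaves at most 10 darts,
  -- whereas K₄ has 12.
  absurd : ⊥
  absurd with restrict K (numDarts G) ρ ε ≤-refl
  ... | H , ρ′ , ε′ , eq , keep = go (euler-live b₁ (anyB⇐ _ b₂ h12))
    where
    inB : ∀ {x} → x ∈ B → K x ≡ true
    inB {x} q = does⇐ (x ∈? B) q
    up : ∀ {u v} → u ∈ B → v ∈ B → adj G u v ≡ true → adj H u v ≡ true
    up {u} {v} p q a = trans (eq u v) (∧-intro a (∧-intro (inB p) (inB q)))
    i₁ : b₁ ∈ B
    i₁ = here refl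
    i₂ : b₂ ∈ B
    i₂ = there (here refl)
    i₃ : b₃ ∈ B
    i₃ = there (there (here refl))
    i₄ : b₄ ∈ B
    i₄ = there (there (there (here refl)))
    h12 = up i₁ i₂ a12
    h13 = up i₁ i₃ a13
    h14 = up i₁ i₄ a14
    h21 = up i₂ i₁ (fl a12)
    h23 = up i₂ i₃ a23
    h24 = up i₂ i₄ a24
    h31 = up i₃ i₁ (fl a13)
    h32 = up i₃ i₂ (fl a23)
    h34 = up i₃ i₄ a34
    h41 = up i₄ i₁ (fl a14)
    h42 = up i₄ i₂ (fl a24)
    h43 = up i₄ i₃ (fl a34)
    deg3 : ∀ {x y z w} → adj H x y ≡ true → adj H x z ≡ true → adj H x w ≡ true →
      y ≢ z → y ≢ w → z ≢ w → 3 ≤ count (adj H x)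
    deg3 p q r n₁ n₂ n₃ = unique-≤-# _ ((n₁ ∷ n₂ ∷ []) ∷ (n₃ ∷ []) ∷ [] ∷ []) (p ∷ q ∷ r ∷ [])
    d₁ = deg3 h12 h13 h14 (ne a23) (ne a24) (ne a34)
    d₂ = deg3 h21 h23 h24 (ne a13) (ne a14) (ne a34)
    d₃ = deg3 h31 h32 h34 (ne a12) (ne a14) (ne a24)
    d₄ = deg3 h41 h42 h43 (ne a12) (ne a13) (ne a23)
    inK : ∀ {u v} → adj H u v ≡ true → u ∈ B
    inK {u} {v} p = does⇒ (u ∈? B) (proj₁ (∧-elim {K u} (proj₂ (∧-elim {adj G u v} (trans (symm (eq u v)) p)))))
    deg-B : ∀ {u} → u ∈ B → 3 ≤ count (adj H u)
    deg-B (here refl) = d₁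
    deg-B (there (here refl)) = d₂
    deg-B (there (there (here refl))) = d₃
    deg-B (there (there (there (here refl)))) = d₄
    open Face ρ′
    open Faces ρ′ ε′
    nofix : ∀ u v → adj H u v ≡ true → σ ρ′ u v ≢ v
    nofix u v p = nofix-deg ρ′ u v (≤-trans (n≤1+n 2) (deg-B (inK p))) p
    uB : Unique B
    uB = (ne a12 ∷ ne a13 ∷ ne a14 ∷ []) ∷ (ne a23 ∷ ne a24 ∷ []) ∷ (ne a34 ∷ []) ∷ [] ∷ []
    D≥12 : 12 ≤ numDarts H
    D≥12 = ≤-trans (+-mono-≤ d₁ (+-mono-≤ d₂ (+-mono-≤ d₃ (+-mono-≤ d₄ z≤n)))) (sum-list-≤ (λ u → count (adj H u)) uB)
    N≤4 : count live ≤ 4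
    N≤4 = #-≤-cover live B (λ x q → inK (proj₂ (anyB⇒ (adj H x) q)))
    t₂ : σ ρ′ b₂ b₁ ≡ b₃
    t₂ = trans (keep b₁ b₂ h21 (subst (λ z → adj H b₂ z ≡ true) (symm turn₂) h23)) turn₂
    t₃ : σ ρ′ b₃ b₂ ≡ b₄
    t₃ = trans (keep b₂ b₃ h32 (subst (λ z → adj H b₃ z ≡ true) (symm turn₃) h34)) turn₃
    f = (b₁ , b₂)
    f₁ : φ f ≡ (b₂ , b₃)
    f₁ = cong (b₂ ,_) t₂
    f₂ : φ (φ f) ≡ (b₃ , b₄)
    f₂ = trans (cong φ f₁) (cong (b₃ ,_) t₃)
    f₃ : φ (φ (φ f)) ≡ (b₄ , σ ρ′ b₄ b₃)
    f₃ = cong φ f₂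
    tails : ∀ {x y : Dart n} {s t} → proj₁ x ≡ s → proj₁ y ≡ t → s ≢ t → x ≢ y
    tails p q n r = n (trans (symm p) (trans (cong proj₁ r) q))
    uf : Unique (f ∷ φ f ∷ φ (φ f) ∷ φ (φ (φ f)) ∷ [])
    uf = (tails refl p₁ (ne a12) ∷ tails refl p₂ (ne a13) ∷ tails refl p₃ (ne a14) ∷ [])
       ∷ (tails p₁ p₂ (ne a23) ∷ tails p₁ p₃ (ne a24) ∷ []) ∷ (tails p₂ p₃ (ne a34) ∷ []) ∷ [] ∷ []
      where
      p₁ : proj₁ (φ f) ≡ b₂
      p₁ = cong proj₁ f₁
      p₂ : proj₁ (φ (φ f)) ≡ b₃
      p₂ = cong proj₁ f₂
      p₃ : proj₁ (φ (φ (φ f))) ≡ b₄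
      p₃ = cong proj₁ f₃
    go : (Σ (List ℕ) λ ds → Unique ds × All DartLabel ds × (numDarts H + 4 ≤ 2 * count live + 2 * length ds)) → ⊥
    go (ds , ud , ad , le) = 1+n≰n {10} (≤-trans (n≤1+n 11) (≤-trans D≥12 D≤10))
      where
      D≤10 : numDarts H ≤ 10
      D≤10 = +-cancelʳ-≤ (2 * numDarts H + 14) _ _ (begin
        numDarts H + (2 * numDarts H + 14)         ≡⟨ solve 1 (λ x → x :+ (con 2 :* x :+ con 14) := con 3 :* (x :+ con 4) :+ con 2) refl (numDarts H) ⟩
        3 * (numDarts H + 4) + 2                   ≤⟨ +-monoˡ-≤ 2 (*-monoʳ-≤ 3 le) ⟩
        3 * (2 * count live + 2 * length ds) + 2   ≤⟨ +-monoˡ-≤ 2 (*-monoʳ-≤ 3 (+-monoˡ-≤ (2 * length ds) (*-monoʳ-≤ 2 N≤4))) ⟩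
        3 * (2 * 4 + 2 * length ds) + 2            ≡⟨ solve 1 (λ y → con 3 :* (con 8 :+ con 2 :* y) :+ con 2 := con 24 :+ con 2 :* (con 3 :* y :+ con 1)) refl (length ds) ⟩
        24 + 2 * (3 * length ds + 1)               ≤⟨ +-monoʳ-≤ 24 (*-monoʳ-≤ 2 (3F<D nofix ds ud ad f h12 uf)) ⟩
        24 + 2 * numDarts H                        ≡⟨ solve 1 (λ x → con 24 :+ con 2 :* x := con 10 :+ (con 2 :* x :+ con 14)) refl (numDarts H) ⟩
        10 + (2 * numDarts H + 14)                 ∎)
        where
        open ≤-Reasoning
        open +-*-Solver

Triangular : ∀ {n} {G : Graph n} → Rotation G → Set
Triangular {G = G} ρ = ∀ d → isDart G d ≡ true → iter (faceStep ρ) 3 d ≡ d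

MinDeg5 : ∀ {n} → Graph n → Set
MinDeg5 G = ∀ u v → adj G u v ≡ true → 5 ≤ count (adj G u)

-- The second half keeps isolated vertices isolated; without it `MinDeg5`, which speaks of
-- non-isolated vertices only, would not be inherited.
_⊑_ : ∀ {n} → Graph n → Graph n → Set
G ⊑ H = (∀ u v → adj G u v ≡ true → adj H u v ≡ true) × (∀ u v → adj H u v ≡ true → ∃ λ w → adj G u w ≡ true)

⊑-trans : ∀ {n} {G H I : Graph n} → G ⊑ H → H ⊑ I → G ⊑ I
⊑-trans (f , f′) (g , g′) = (λ u v p → g u v (f u v p)) , (λ u v p → let w , q = g′ u v p in f′ u w q)

minDeg-⊑ : ∀ {n} {G H : Graph n} → G ⊑ H → MinDeg5 G → MinDeg5 H
minDeg-⊑ {G = G} {H} (f , f′) m u v p = let w , q = f′ u v p in ≤-trans (m u w q) (#-mono (adj G u) (adj H u) (f u))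

module Chord {n} {G : Graph n} (ρ : Rotation G) (ε : Euler ρ) (md : MinDeg5 G) where
  open Face ρ

  Bigger : Set
  Bigger = Σ (Graph n) λ H → Σ (Rotation H) λ ρ′ → Euler ρ′ × (G ⊑ H) × (numDarts H ≡ 2 + numDarts G)

  nofix : ∀ u v → adj G u v ≡ true → σ ρ u v ≢ v
  nofix u v p = nofix-deg ρ u v (≤-trans (s≤s (s≤s z≤n)) (md u v p)) p

  insert : ∀ p a r b (pa : adj G p a ≡ true) (a≢b : a ≢ b) (ab : adj G a b ≡ false) j
    (hit : iter φ (suc j) (p , a) ≡ (r , b)) (away : ∀ i → i ≤ j → iter φ (suc i) (p , a) ≢ (p , a)) → Bigger
  insert p a r b pa a≢b ab j hit away = G⁺ , ρ⁺ , euler-insert ε , ((λ u v → old) , back) , numDarts-ins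
    where
    open Insert ρ p a r b pa a≢b ab j hit away
    back : ∀ u v → adj G⁺ u v ≡ true → ∃ λ w → adj G u w ≡ true
    back u v q with dart⁺ {u} {v} q
    ... | inj₁ x           = v , x
    ... | inj₂ (inj₁ refl) = p , adj-flip {G = G} pa
    ... | inj₂ (inj₂ refl) = r , adj-flip {G = G} rb

  module _ (b₀ b₁ : Fin n) (a01 : adj G b₀ b₁ ≡ true) where
    b₂ = σ ρ b₁ b₀
    b₃ = σ ρ b₂ b₁
    b₄ = σ ρ b₃ b₂
    a12 : adj G b₁ b₂ ≡ true
    a12 = φ-dart (b₀ , b₁) a01
    a23 : adj G b₂ b₃ ≡ true
    a23 = φ-dart (b₁ , b₂) a12
    a34 : adj G b₃ b₄ ≡ true
    a34 = φ-dart (b₂ , b₃) a23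
    b₁≢b₃ : b₁ ≢ b₃
    b₁≢b₃ e = nofix b₂ b₁ (adj-flip {G = G} a12) (symm e)
    b₂≢b₄ : b₂ ≢ b₄
    b₂≢b₄ e = nofix b₃ b₂ (adj-flip {G = G} a23) (symm e)

    -- The graph must stay simple, so `b₁b₃`, `b₁b₄` and `b₂b₄` are tried in turn. If all three are
    -- edges already, the corners `b₁`, `b₂`, `b₃`, `b₄` span a K₄ with a face walk through all four
    -- of them.
    quad : iter φ 3 (b₀ , b₁) ≢ (b₀ , b₁) → b₁ ≢ b₄ → Bigger
    quad long b₁≢b₄ with adj G b₁ b₃ in a13 | adj G b₁ b₄ in a14 | adj G b₂ b₄ in a24
    ... | false | _ | _ = insert b₀ b₁ b₂ b₃ a01 b₁≢b₃ a13 1 refl away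
      where
      away : ∀ i → i ≤ 1 → iter φ (suc i) (b₀ , b₁) ≢ (b₀ , b₁)
      away zero    _ e = adj⇒≢ {G = G} a01 (symm (cong proj₁ e))
      away (suc zero) _ e = b₁≢b₃ (symm (cong proj₂ e))
      away (suc (suc i)) (s≤s ())
    ... | true | false | _ = insert b₀ b₁ b₃ b₄ a01 b₁≢b₄ a14 2 refl away
      where
      away : ∀ i → i ≤ 2 → iter φ (suc i) (b₀ , b₁) ≢ (b₀ , b₁)
      away zero    _ e = adj⇒≢ {G = G} a01 (symm (cong proj₁ e))
      away (suc zero) _ e = b₁≢b₃ (symm (cong proj₂ e))
      away (suc (suc zero)) _ e = long e
      away (suc (suc (suc i))) (s≤s (s≤s ()))
    ... | true | true | false = insert b₁ b₂ b₃ b₄ a12 b₂≢b₄ a24 1 refl away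
      where
      away : ∀ i → i ≤ 1 → iter φ (suc i) (b₁ , b₂) ≢ (b₁ , b₂)
      away zero    _ e = adj⇒≢ {G = G} a12 (symm (cong proj₁ e))
      away (suc zero) _ e = b₁≢b₃ (symm (cong proj₁ e))
      away (suc (suc i)) (s≤s ())
    ... | true | true | true = ⊥-elim (K4.absurd ρ ε b₁ b₂ b₃ b₄ a12 a13 a14 a23 a24 a34 refl refl)

  -- When the corners b₁ and b₄ coincide, the next corner b₅ differs from b₂.
  chord : ∀ b₀ b₁ → adj G b₀ b₁ ≡ true → iter φ 3 (b₀ , b₁) ≢ (b₀ , b₁) → Bigger
  chord b₀ b₁ p long with toSum (b₁ F.≟ b₄ b₀ b₁ p)
  ... | inj₂ ne = quad b₀ b₁ p long ne
  ... | inj₁ eq = quad b₁ (b₂ b₀ b₁ p) p₁ long′ ne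
    where
    p₁ = φ-dart (b₀ , b₁) p
    long′ : iter φ 3 (φ (b₀ , b₁)) ≢ φ (b₀ , b₁)
    long′ e = long (φ-inj _ _ (iter-dart 3 (b₀ , b₁) p) p e)
    ne : b₂ b₀ b₁ p ≢ b₄ b₁ (b₂ b₀ b₁ p) p₁
    ne e = long′ (cong₂ _,_ (symm eq) (symm e))

-- `m` is fuel: there are never more than `n * n` darts, and every chord adds two.
triangulate : ∀ {n} m {G : Graph n} (ρ : Rotation G) → Euler ρ → MinDeg5 G → n * n < numDarts G + m →
  Σ (Graph n) λ H → Σ (Rotation H) λ ρ′ → Euler ρ′ × (G ⊑ H) × Triangular ρ′
triangulate m {G} ρ ε md lt with search₂ (λ d → isDart G d ∧ not (does (iter (faceStep ρ) 3 d ≟D d)))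
... | inj₂ none = G , ρ , ε , ((λ _ _ p → p) , (λ _ v p → v , p)) , tri
  where
  tri : Triangular ρ
  tri d p with toSum (iter (faceStep ρ) 3 d ≟D d)
  ... | inj₁ e  = e
  ... | inj₂ ne = contra (∧-intro p (not-intro (does⇐¬ (iter (faceStep ρ) 3 d ≟D d) ne))) (none d)
triangulate zero {G} ρ ε md lt | inj₁ _ =
  ⊥-elim (<⇒≱ (subst (_ <_) (+-identityʳ _) lt) (numDarts-≤ G))
triangulate {n} (suc m) {G} ρ ε md lt | inj₁ ((u , v) , bad)
  with Chord.chord ρ ε md u v (proj₁ (∧-elim {adj G u v} bad))
         (λ e → contra (does⇐ (iter (faceStep ρ) 3 (u , v) ≟D (u , v)) e) (not-elim (proj₂ (∧-elim {adj G u v} bad))))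
... | H , ρ′ , ε′ , sub , more with triangulate m ρ′ ε′ (minDeg-⊑ {G = G} {H} sub md)
         (≤-trans lt (≤-trans (≤-reflexive (+-suc (numDarts G) m)) (≤-trans (n≤1+n _) (≤-reflexive (cong (_+ m) (symm more))))))
...   | I , ρ″ , ε″ , sub′ , tri = I , ρ″ , ε″ , ⊑-trans {G = G} {H} {I} sub sub′ , tri

-- The faces are eliminated through `3F ≤ D`. As `numDarts` is the degree sum, the charges `deg − 6`
-- of the non-isolated vertices add up to at most -12.
euler-bound : ∀ {n} {G : Graph n} (ρ : Rotation G) → Euler ρ → MinDeg5 G →
  ∀ x → anyB (adj G x) ≡ true → numDarts G + 12 ≤ 6 * count (λ u → anyB (adj G u))
euler-bound {G = G} ρ ε md x lx with Faces.euler-live ρ ε x lx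
... | ds , ud , ad , le = +-cancelʳ-≤ (2 * numDarts G) _ _ (begin
    numDarts G + 12 + 2 * numDarts G                ≡⟨ solve 1 (λ x → x :+ con 12 :+ con 2 :* x := con 3 :* (x :+ con 4)) refl (numDarts G) ⟩
    3 * (numDarts G + 4)                            ≤⟨ *-monoʳ-≤ 3 le ⟩
    3 * (2 * N + 2 * length ds)                     ≡⟨ solve 2 (λ x y → con 3 :* (con 2 :* x :+ con 2 :* y) := con 6 :* x :+ con 2 :* (con 3 :* y)) refl N (length ds) ⟩
    6 * N + 2 * (3 * length ds)                     ≤⟨ +-monoʳ-≤ (6 * N) (*-monoʳ-≤ 2 (Faces.3F≤D ρ ε nofix ds ud ad)) ⟩
    6 * N + 2 * numDarts G                          ∎)
  where
  open ≤-Reasoning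
  open +-*-Solver
  N = count (λ u → anyB (adj G u))
  nofix : ∀ u v → adj G u v ≡ true → σ ρ u v ≢ v
  nofix u v p = nofix-deg ρ u v (≤-trans (s≤s (s≤s z≤n)) (md u v p)) p

-- Triangulations in which no deletion lets six vertices be collected

-- S v is the least set containing v and closed under collecting.
record Setting : Set where
  field
    n        : ℕ
    G        : Graph n
    ρ        : Rotation G
    md       : MinDeg5 G
    tri      : Triangular ρ
    S        : Fin n → Fin n → Bool
    S-self   : ∀ v → S v v ≡ true
    S-size   : ∀ v → count (S v) ≤ 6
    -- The lower bound on the degree bars isolated vertices, which stand for those collected before
    -- the core was reached.
    S-closed : ∀ v w → 5 ≤ count (adj G w) → count (adj G w) ≤ 4 + count (λ x → adj G w x ∧ S v x) → S v w ≡ true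
    S-min    : ∀ v (X : Fin n → Bool) → X v ≡ true →
               (∀ w → 5 ≤ count (adj G w) → count (adj G w) ≤ 4 + count (λ x → adj G w x ∧ X x) → X w ≡ true) →
               ∀ w → S v w ≡ true → X w ≡ true

countL : ∀ {A : Set} → (A → Bool) → List A → ℕ
countL p []       = 0
countL p (x ∷ xs) = (if p x then 1 else 0) + countL p xs

count-countL : ∀ {n} (p : Fin n → Bool) xs (q : Fin n → Bool) → Unique xs → All (λ x → q x ≡ true) xs →
  (∀ x → q x ≡ true → x ∈ xs) → count (λ w → q w ∧ p w) ≡ countL p xs
count-countL p [] q _ _ h = count-none _ (λ x → ≢true λ r → none (h x (proj₁ (∧-elim {q x} r))))
  where
  none : ∀ {x} → x ∈ [] → ⊥
  none ()
count-countL {n} p (x ∷ xs) q (x∉ ∷ u) (qx ∷ qs) h = trans (split (bool-cases (p x))) (cong (_ +_) rest)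
  where
  q⁻ : Fin n → Bool
  q⁻ y = q y ∧ not (does (y F.≟ x))
  rest : count (λ w → q⁻ w ∧ p w) ≡ countL p xs
  rest = count-countL p xs q⁻ u (go x∉ qs) cover
    where
    go : ∀ {ys} → All (x ≢_) ys → All (λ y → q y ≡ true) ys → All (λ y → q⁻ y ≡ true) ys
    go [] [] = []
    go {y ∷ ys} (ne ∷ a) (qy ∷ b) = ∧-intro qy (not-intro (does⇐¬ (y F.≟ x) (λ e → ne (symm e)))) ∷ go a b
    cover : ∀ y → q⁻ y ≡ true → y ∈ xs
    cover y r with ∧-elim {q y} r
    ... | qy , ny with h y qy
    ...   | there m  = m
    ...   | here eq  = contra (does⇐ (y F.≟ x) eq) (not-elim ny)
  split : (p x ≡ true) ⊎ (p x ≡ false) → count (λ w → q w ∧ p w) ≡ (if p x then 1 else 0) + count (λ w → q⁻ w ∧ p w)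
  split (inj₁ t) = trans (count-remove (λ w → q w ∧ p w) x (∧-intro qx t))
      (trans (cong suc (count-cong λ y → perm (q y) (p y) _)) (cong (_+ count (λ w → q⁻ w ∧ p w)) (symm (if-suc (p x) t))))
    where
    perm : ∀ a b c → (a ∧ b) ∧ c ≡ (a ∧ c) ∧ b
    perm true  b c = ∧-comm b c
    perm false b c = refl
  split (inj₂ f) = trans (count-cong same) (cong (_+ count (λ w → q⁻ w ∧ p w)) (zero-if (p x) f))
    where
    zero-if : ∀ b → b ≡ false → 0 ≡ (if b then 1 else 0)
    zero-if false _ = refl
    same : ∀ y → q y ∧ p y ≡ q⁻ y ∧ p y
    same y with toSum (y F.≟ x)
    ... | inj₂ ne = cong (_∧ p y) (symm (trans (cong (λ z → q y ∧ not z) (does⇐¬ (y F.≟ x) ne)) (∧-identityʳ (q y))))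
    ... | inj₁ refl = trans (cong (q y ∧_) f) (trans (∧-zeroʳ (q y)) (symm (trans (cong (q⁻ y ∧_) f) (∧-zeroʳ (q⁻ y)))))

-- Rotation and collecting in a triangulation

module Basics (St : Setting) where
  open Setting St public
  open Face ρ using (φ; φ-dart)

  infix 4 _~_ _∋_

  _~_ : Fin n → Fin n → Set
  x ~ y = adj G x y ≡ true

  _∋_ : Fin n → Fin n → Set
  v ∋ x = S v x ≡ true

  deg : Fin n → ℕ
  deg x = count (adj G x)

  nx : Fin n → Fin n → Fin n
  nx = σ ρ

  -- The third corner of the triangle beyond the link edge from `r` to `nx v r`, seen from `v`.
  opp : Fin n → Fin n → Fin n
  opp v r = nx (nx v r) r

  ~sym : ∀ {x y} → x ~ y → y ~ x
  ~sym = adj-flip {G = G}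

  ~≢ : ∀ {x y} → x ~ y → x ≢ y
  ~≢ = adj⇒≢ {G = G}

  ≢sym : ∀ {x y : Fin n} → x ≢ y → y ≢ x
  ≢sym p q = p (symm q)

  deg≥5 : ∀ {x y} → x ~ y → 5 ≤ deg x
  deg≥5 {x} {y} = md x y

  -- the cyclic order around v sends r to nx v r; the triangle v, r, nx v r
  -- yields the corresponding steps around its two other corners
  nx-nbr : ∀ {v r} → v ~ r → v ~ nx v r
  nx-nbr {v} {r} = σ-nbr ρ v r

  turn₁ : ∀ {v r} → v ~ r → nx (nx v r) v ≡ r
  turn₁ {v} {r} p = cong proj₁ (tri (r , v) (~sym p))

  turn₂ : ∀ {v r} → v ~ r → nx r (nx v r) ≡ v
  turn₂ {v} {r} p = trans (cong (λ z → nx z (nx v r)) (symm (turn₁ p))) (cong proj₂ (tri (r , v) (~sym p)))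

  nx-link : ∀ {v r} → v ~ r → r ~ nx v r
  nx-link {v} {r} p = ~sym (subst (nx v r ~_) (turn₁ p) (σ-nbr ρ (nx v r) v (~sym (nx-nbr p))))

  pv-nbr : ∀ {v r} → v ~ r → v ~ nx r v
  pv-nbr p = nx-link (~sym p)

  pv-link : ∀ {v r} → v ~ r → r ~ nx r v
  pv-link p = nx-nbr (~sym p)

  -- one of the two directions of rotation around v
  record Dir (v : Fin n) : Set where
    field
      st   : Fin n → Fin n
      nbr  : ∀ {x} → v ~ x → v ~ st x
      lnk  : ∀ {x} → v ~ x → x ~ st x
      inj  : ∀ {x y} → v ~ x → v ~ y → st x ≡ st y → x ≡ y
      cyc  : ∀ {x y} → v ~ x → v ~ y → ∃ λ k → iter st k x ≡ y
      orient : ∀ {x} → v ~ x → (st x ≡ nx v x) ⊎ (st (nx v x) ≡ x)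
  open Dir

  fwd : ∀ v → Dir v
  fwd v = record
    { st = nx v ; nbr = nx-nbr ; lnk = nx-link
    ; inj = λ {x} {y} → σ-inj ρ v x y ; cyc = λ {x} {y} → σ-cyc ρ v x y
    ; orient = λ p → inj₁ refl }

  iter-nbr : ∀ {v} (d : Dir v) {x} → v ~ x → ∀ i → v ~ iter (st d) i x
  iter-nbr d p zero    = p
  iter-nbr d p (suc i) = nbr d (iter-nbr d p i)

  -- The triangle on the edge `vx` makes `nx x v` the predecessor of `x` around `v`, so the inverse
  -- rotation needs no search.
  bwd : ∀ v → Dir v
  bwd v = record
    { st = λ x → nx x v ; nbr = pv-nbr ; lnk = pv-link
    ; inj = λ {x} {y} p q e → trans (symm (turn₂ (~sym p))) (trans (cong (nx v) e) (turn₂ (~sym q)))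
    ; cyc = λ p q → let k , e = σ-cyc ρ v _ _ q p in k , undo p q k e
    ; orient = λ p → inj₂ (turn₁ p) }
    where
    undo : ∀ {x y} → v ~ x → v ~ y → ∀ k → iter (nx v) k y ≡ x → iter (λ z → nx z v) k x ≡ y
    undo p q zero    e = symm e
    undo {x} {y} p q (suc k) e = trans (cong (λ z → nx z v) (undo′ k)) (turn₁ q)
      where
      shift : ∀ k → iter (nx v) (suc k) y ≡ iter (nx v) k (nx v y)
      shift k = trans (cong (λ z → iter (nx v) z y) (+-comm 1 k)) (iter-+ (nx v) k 1 y)
      undo′ : ∀ k′ → {{k′ ≡ k}} → iter (λ z → nx z v) k′ x ≡ nx v y
      undo′ k′ {{refl}} = undo p (nx-nbr q) k (trans (symm (shift k)) e)

  module Ring {v} (D : Dir v) {x₀} (p₀ : v ~ x₀) where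
    r : ℕ → Fin n
    r i = iter (st D) i x₀

    r~ : ∀ i → v ~ r i
    r~ = iter-nbr D p₀

    rr : ∀ i → r i ~ r (suc i)
    rr i = lnk D (r~ i)

    r-cancel : ∀ i k → r i ≡ r (i + k) → x₀ ≡ r k
    r-cancel zero    k e = e
    r-cancel (suc i) k e = r-cancel i k (inj D (r~ i) (r~ (i + k)) e)

    private
      loop = cyc D (nbr D p₀) p₀
      period = least (λ k → r (suc k) F.≟ x₀) (proj₁ loop)
                 (trans (cong (λ z → iter (st D) z x₀) (+-comm 1 (proj₁ loop)))
                   (trans (iter-+ (st D) (proj₁ loop) 1 x₀) (proj₂ loop)))
      P = suc (proj₁ period)

      inj-P : ∀ {i j} → i < j → j < P → r i ≢ r j
      inj-P {i} {j} i<j j<P e = proj₂ (proj₂ period) (j ∸ suc i)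
          (≤-trans (≤-reflexive (symm (+-∸-assoc 1 i<j))) (≤-trans (m∸n≤m j i) (≤-pred j<P)))
          (symm (r-cancel i (suc (j ∸ suc i)) (trans e (cong r (symm (trans (+-suc i _) (m+[n∸m]≡n i<j)))))))

    list : ℕ → List (Fin n)
    list zero    = []
    list (suc k) = r k ∷ list k

    list⁻ : ∀ k {x} → x ∈ list k → ∃ λ i → (i < k) × (x ≡ r i)
    list⁻ (suc k) (here e)  = k , ≤-refl , e
    list⁻ (suc k) (there m) = let i , lt , e = list⁻ k m in i , ≤-trans lt (n≤1+n k) , e

    list⁺ : ∀ k {i} → i < k → r i ∈ list k
    list⁺ (suc k) {i} (s≤s le) with m≤n⇒m<n∨m≡n le
    ... | inj₁ lt   = there (list⁺ k lt)
    ... | inj₂ refl = here refl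

    list-nbr : ∀ k → All (v ~_) (list k)
    list-nbr zero    = []
    list-nbr (suc k) = r~ k ∷ list-nbr k

    private
      uniq-P : ∀ k → k ≤ P → Unique (list k)
      uniq-P zero    _  = []
      uniq-P (suc k) le = All.tabulate (λ m e → let i , lt , e′ = list⁻ k m in inj-P lt le (symm (trans e e′)))
                          ∷ uniq-P k (≤-trans (n≤1+n k) le)

      reduce : ∀ k → ∃ λ i → (i < P) × (r i ≡ r k)
      reduce zero = 0 , s≤s z≤n , refl
      reduce (suc k) with reduce k
      ... | i , s≤s lt , e with m≤n⇒m<n∨m≡n lt
      ...   | inj₁ lt′  = suc i , s≤s lt′ , cong (st D) e
      ...   | inj₂ refl = 0 , s≤s z≤n , trans (symm (proj₁ (proj₂ period))) (cong (st D) e)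

      all-P : ∀ y → v ~ y → y ∈ list P
      all-P y q with cyc D p₀ q
      ... | k , e with reduce k
      ...   | i , lt , e′ = subst (_∈ list P) (trans e′ e) (list⁺ P lt)

      len : ∀ k → length (list k) ≡ k
      len zero    = refl
      len (suc k) = cong suc (len k)

      P≡deg : P ≡ deg v
      P≡deg = ≤-antisym (subst (_≤ deg v) (len P) (unique-≤-# (adj G v) (uniq-P P ≤-refl) (list-nbr P)))
                        (subst (deg v ≤_) (len P) (#-≤-cover (adj G v) (list P) all-P))

    r-inj : ∀ {i j} → i < j → j < deg v → r i ≢ r j
    r-inj lt lt′ = inj-P lt (subst (_ <_) (symm P≡deg) lt′)

    r-wrap : r (deg v) ≡ x₀
    r-wrap = trans (cong r (symm P≡deg)) (proj₁ (proj₂ period))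

    r-sep : ∀ i k → 0 < k → k < deg v → r i ≢ r (i + k)
    r-sep i k lt lt′ e = r-inj lt lt′ (r-cancel i k e)

    r-shift : ∀ i → r (i + deg v) ≡ r i
    r-shift i = trans (iter-+ (st D) i (deg v) x₀) (cong (iter (st D) i) r-wrap)

    r-uniq : Unique (list (deg v))
    r-uniq = uniq-P _ (≤-reflexive (symm P≡deg))

    r-all : ∀ y → v ~ y → y ∈ list (deg v)
    r-all y q = subst (λ z → y ∈ list z) P≡deg (all-P y q)

    r-count : ∀ p → count (λ w → adj G v w ∧ p w) ≡ countL p (list (deg v))
    r-count p = count-countL p _ (adj G v) r-uniq (list-nbr (deg v)) r-all

    r-some : ∀ y → v ~ y → ∃ λ i → (i < deg v) × (y ≡ r i)
    r-some y q = list⁻ (deg v) (r-all y q)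

  abstract
    -- The workhorse: listed neighbours of `w` that are already gone leave at most four. The
    -- variants `coll1`, `coll2`, `coll3` handle degrees 5, 6 and 7.
    coll : ∀ {s w x xs} → Unique (x ∷ xs) → All (λ y → (w ~ y) × (s ∋ y)) (x ∷ xs) →
      deg w ≤ 4 + length (x ∷ xs) → s ∋ w
    coll {s} {w} u a@((wx , _) ∷ _) le = S-closed s w (deg≥5 wx)
      (≤-trans le (+-monoʳ-≤ 4 (unique-≤-# (λ y → adj G w y ∧ S s y) u (All.map (λ q → ∧-intro (proj₁ q) (proj₂ q)) a))))

    coll1 : ∀ {s w x} → w ~ x → s ∋ x → deg w ≤ 5 → s ∋ w
    coll1 p q = coll ([] ∷ []) ((p , q) ∷ [])

    coll2 : ∀ {s w x y} → w ~ x → s ∋ x → w ~ y → s ∋ y → x ≢ y → deg w ≤ 6 → s ∋ w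
    coll2 p q p′ q′ ne = coll ((ne ∷ []) ∷ [] ∷ []) ((p , q) ∷ (p′ , q′) ∷ [])

    coll3 : ∀ {s w x y z} → w ~ x → s ∋ x → w ~ y → s ∋ y → w ~ z → s ∋ z → x ≢ y → x ≢ z → y ≢ z → deg w ≤ 7 → s ∋ w
    coll3 p q p′ q′ p″ q″ a b c = coll ((a ∷ b ∷ []) ∷ (c ∷ []) ∷ [] ∷ []) ((p , q) ∷ (p′ , q′) ∷ (p″ , q″) ∷ [])

    over : ∀ {s xs} → Unique xs → All (s ∋_) xs → 7 ≤ length xs → ⊥
    over {s} u a le = 1+n≰n (≤-trans le (≤-trans (unique-≤-# (S s) u a) (S-size s)))

    size≥ : ∀ {s xs} → Unique xs → All (s ∋_) xs → length xs ≤ count (S s)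
    size≥ {s} u a = unique-≤-# (S s) u a

    exact : ∀ {s xs} → Unique xs → All (s ∋_) xs → count (S s) ≤ length xs → ∀ {q} → s ∋ q → q ∈ xs
    exact {s} u a le {q} m = unique-full (S s) u a le q m

    -- `S s` contains `v` and is closed, hence contains the least such set.
    sub : ∀ {s v} → s ∋ v → ∀ {x} → v ∋ x → s ∋ x
    sub {s} {v} m {x} = S-min v (S s) m (λ w → S-closed s w) x

    grow : ∀ {s v ys} → s ∋ v → Unique ys → All (λ y → (s ∋ y) × (S v y ≡ false)) ys → count (S v) + length ys ≤ 6
    grow {s} {v} m u a = ≤-trans (#-mono+ (S v) (S s) (λ x → sub m) u a) (S-size s)

    -- The first vertex collected has lost only `v`. Formally, if no such `f` exists, the singleton
    -- of `v` is closed and `S-min` applies to it.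
    seed : ∀ {v x} → v ∋ x → x ≢ v → ∃ λ f → (v ~ f) × (deg f ≤ 5)
    seed {v} {x} m ne with search (λ f → adj G v f ∧ (deg f ≤ᵇ 5))
    ... | inj₁ (f , q) = f , proj₁ (∧-elim {adj G v f} q) , ≤ᵇ⇒ (proj₂ (∧-elim {adj G v f} q))
    ... | inj₂ none = ⊥-elim (ne (does⇒ (x F.≟ v) (S-min v (_== v) (==-refl v) closed x m)))
      where
      closed : ∀ w → 5 ≤ deg w → deg w ≤ 4 + count (λ y → adj G w y ∧ (y == v)) → (w == v) ≡ true
      closed w ge le with adj G w v in eq
      ... | true  = contra (∧-intro (~sym eq) (⇒≤ᵇ (≤-trans le (+-monoʳ-≤ 4
                     (#-≤-cover _ (v ∷ []) (λ y q → here (does⇒ (y F.≟ v) (proj₂ (∧-elim {adj G w y} q))))))))) (none w)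
      ... | false = ⊥-elim (1+n≰n (≤-trans ge (≤-trans le (≤-reflexive (cong (4 +_) (count-none _ (λ y → ≢true λ q → no-v y (∧-elim {adj G w y} q))))))))
        where
        no-v : ∀ y → (adj G w y ≡ true) × ((y == v) ≡ true) → ⊥
        no-v y (p , q) with does⇒ (y F.≟ v) q
        ... | refl = contra p eq

  small≢big : ∀ {x y} → deg x ≤ 6 → 7 ≤ deg y → x ≢ y
  small≢big p q refl = 1+n≰n (≤-trans q p)

-- Exhaustive checks of link patterns

data Cl : Set where
  cF cZ cO : Cl

isF isZ isO : Cl → Bool
isF cF = true
isF _  = false
isZ cZ = true
isZ _  = false
isO cO = true
isO _  = false

all3 : ℕ → (List Cl → Bool) → Bool
all3 zero    f = f []
all3 (suc k) f = all3 k (λ v → f (cF ∷ v)) ∧ (all3 k (λ v → f (cZ ∷ v)) ∧ all3 k (λ v → f (cO ∷ v)))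

all3-sound : ∀ k f → all3 k f ≡ true → ∀ v → length v ≡ k → f v ≡ true
all3-sound zero    f q [] refl = q
all3-sound (suc k) f q (c ∷ v) refl with ∧-elim {all3 k (λ v → f (cF ∷ v))} q
... | q₁ , q′ with ∧-elim {all3 k (λ v → f (cZ ∷ v))} q′
...   | q₂ , q₃ = pick c
  where
  pick : ∀ c → f (c ∷ v) ≡ true
  pick cF = all3-sound k _ q₁ v refl
  pick cZ = all3-sound k _ q₂ v refl
  pick cO = all3-sound k _ q₃ v refl

_⇒ᵇ_ : Bool → Bool → Bool
a ⇒ᵇ b = not a ∨ b

⇒ᵇ-elim : ∀ {a b} → (a ⇒ᵇ b) ≡ true → a ≡ true → b ≡ true
⇒ᵇ-elim {true} q refl = q

⇒ᵇ-intro : ∀ {a b} → (a ≡ true → b ≡ true) → (a ⇒ᵇ b) ≡ true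
⇒ᵇ-intro {true}  h = h refl
⇒ᵇ-intro {false} h = refl

-- Seven consecutive neighbours of a vertex of degree 7; cF: degree 5, cZ: collected but not of
-- degree 5, cO: not collected.
chk : Cl → Cl → Cl → Cl → Cl → Bool
chk a b c d e = isO c ⇒ᵇ (not (isF b ∧ isF d) ∧ (not (isF a ∧ isF b) ∧ not (isF d ∧ isF e)))

goodS : List Cl → Bool
goodS (a ∷ b ∷ c ∷ d ∷ e ∷ f ∷ g ∷ []) =
  chk a b c d e ∧ (chk b c d e f ∧ (chk c d e f g ∧ (chk d e f g a ∧ (chk e f g a b ∧ (chk f g a b c ∧ chk g a b c d)))))
goodS _ = true

-- Decided by evaluation on all 3⁷ patterns. The bound 5 is the room that `S v` has beside `v`
-- itself.
claimS : List Cl → Bool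
claimS cs = (goodS cs ∧ (countL isF cs + countL isZ cs ≤ᵇ 5)) ⇒ᵇ
  ((countL isF cs ≤ᵇ 3) ∧ ((3 ≤ᵇ countL isF cs) ⇒ᵇ (5 ≤ᵇ countL isF cs + countL isZ cs)))

claimS-true : ∀ cs → length cs ≡ 7 → claimS cs ≡ true
claimS-true = all3-sound 7 claimS refl

-- Now cZ marks a neighbour r with E′ v r; lists are in decreasing order of position.
chkE : Cl → Cl → Cl → Cl → Bool
chkE a b c d = isZ c ⇒ᵇ (not (isF a) ∧ (not (isF b) ∧ not (isF d)))

chk7 : Bool → Cl → Cl → Cl → Cl → Cl → Cl → Cl → Bool
chk7 any a b c d e f g = chkE e f g a
  ∧ (not (isZ g ∧ (isZ f ∧ (any ∨ isZ e))) ∧ not (isZ g ∧ (isF d ∧ (isF c ∧ isF b))))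

goodE7 : List Cl → Bool
goodE7 cs@(a ∷ b ∷ c ∷ d ∷ e ∷ f ∷ g ∷ []) = let any = 1 ≤ᵇ countL isF cs in
  chk7 any a b c d e f g ∧ (chk7 any b c d e f g a ∧ (chk7 any c d e f g a b ∧ (chk7 any d e f g a b c ∧
  (chk7 any e f g a b c d ∧ (chk7 any f g a b c d e ∧ chk7 any g a b c d e f)))))
goodE7 _ = true

-- How many times 12 still fits into 60 beside the payments of `p7` to the given number of
-- neighbours of degree 5. The search shows that the local geometry never asks for more.
tab7 : ℕ → ℕ → Bool
tab7 0 k = k ≤ᵇ 5
tab7 1 k = k ≤ᵇ 2
tab7 2 k = k ≤ᵇ 1
tab7 _ k = k ≤ᵇ 0

claimE7 : List Cl → Bool
claimE7 cs = goodE7 cs ⇒ᵇ tab7 (countL isF cs) (countL isZ cs)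

claimE7-true : ∀ cs → length cs ≡ 7 → claimE7 cs ≡ true
claimE7-true = all3-sound 7 claimE7 refl

chk8 : Cl → Cl → Cl → Cl → Cl → Cl → Cl → Cl → Bool
chk8 a b c d e f g h = chkE f g h a ∧ not (isZ h ∧ (isF e ∧ (isF d ∧ (isF c ∧ isF b))))

goodE8 : List Cl → Bool
goodE8 (a ∷ b ∷ c ∷ d ∷ e ∷ f ∷ g ∷ h ∷ []) =
  chk8 a b c d e f g h ∧ (chk8 b c d e f g h a ∧ (chk8 c d e f g h a b ∧ (chk8 d e f g h a b c ∧
  (chk8 e f g h a b c d ∧ (chk8 f g h a b c d e ∧ (chk8 g h a b c d e f ∧ chk8 h a b c d e f g))))))
goodE8 _ = true

-- The same allowance at degree 8, where 120 is available and `p8` fixes the payments.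
tab8 : ℕ → ℕ → Bool
tab8 0 k = k ≤ᵇ 10
tab8 1 k = k ≤ᵇ 5
tab8 2 k = k ≤ᵇ 3
tab8 3 k = k ≤ᵇ 2
tab8 _ k = k ≤ᵇ 0

claimE8 : List Cl → Bool
claimE8 cs = goodE8 cs ⇒ᵇ tab8 (countL isF cs) (countL isZ cs)

claimE8-true : ∀ cs → length cs ≡ 8 → claimE8 cs ≡ true
claimE8-true = all3-sound 8 claimE8 refl

-- A cyclic sequence starting with e at 0, in which an f is preceded by two and followed by one
-- place carrying neither e nor f.
module Spread (e f : ℕ → Bool) (start : e 0 ≡ true)
  (ef₀ : ∀ i → e i ≡ true → f i ≡ false) (ef₁ : ∀ i → e i ≡ true → f (suc i) ≡ false)
  (ef₂ : ∀ i → e i ≡ true → f (suc (suc i)) ≡ false) (fe : ∀ i → f i ≡ true → e (suc i) ≡ false) where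

  cnt : (ℕ → Bool) → ℕ → ℕ
  cnt p zero    = 0
  cnt p (suc k) = (if p k then 1 else 0) + cnt p k

  tot : ℕ → ℕ
  tot k = cnt e k + cnt f k

  one : ∀ k → tot (suc k) ≤ suc (tot k)
  one k with e k in p | f k in q
  ... | true  | true  = contra q (ef₀ k p)
  ... | true  | false = ≤-refl
  ... | false | true  = ≤-reflexive (+-suc (cnt e k) (cnt f k))
  ... | false | false = n≤1+n _

  none : ∀ k → e k ≡ false → f k ≡ false → tot (suc k) ≡ tot k
  none k p q rewrite p | q = refl

  tot≤ : ∀ k → tot k ≤ k
  tot≤ zero    = z≤n
  tot≤ (suc k) = ≤-trans (one k) (s≤s (tot≤ k))

  -- How far `tot` lags behind the number of places. The first f leaves the two places before it
  -- empty; the place after a run of f's cannot carry e and is the third.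
  data Inv (k : ℕ) : Set where
    no-f   : (∀ i → i < suc k → f i ≡ false) → Inv k
    at-f   : f k ≡ true → tot (suc k) + 2 ≤ suc k → Inv k
    past-f : f k ≡ false → tot (suc k) + 3 ≤ suc k → Inv k

  inv : ∀ k → Inv k
  inv zero = no-f λ { zero _ → ef₀ 0 start ; (suc i) (s≤s ()) }
  inv (suc k) with bool-cases (f (suc k)) | inv k
  ... | inj₁ t | at-f q le   = at-f t (≤-trans (+-monoˡ-≤ 2 (one (suc k))) (s≤s le))
  ... | inj₁ t | past-f q le = at-f t (≤-trans (+-monoˡ-≤ 2 (one (suc k))) (s≤s (≤-trans (+-monoʳ-≤ (tot (suc k)) (n≤1+n 2)) le)))
  ... | inj₂ h | at-f q le   = past-f h (≤-trans (≤-reflexive (trans (cong (_+ 3) (none (suc k) (fe k q) h)) (+-suc _ 2))) (s≤s le))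
  ... | inj₂ h | past-f q le = past-f h (≤-trans (+-monoˡ-≤ 3 (one (suc k))) (s≤s le))
  ... | inj₂ h | no-f q = no-f λ i lt → last i (m≤n⇒m<n∨m≡n lt)
    where
    last : ∀ i → (suc i < suc (suc k)) ⊎ (suc i ≡ suc (suc k)) → f i ≡ false
    last i (inj₁ (s≤s lt)) = q i lt
    last i (inj₂ refl)     = h
  inv (suc zero)    | inj₁ t | no-f q = contra t (ef₁ 0 start)
  inv (suc (suc k)) | inj₁ t | no-f q = at-f t (≤-trans (+-monoˡ-≤ 2 (one (suc (suc k))))
      (s≤s (≤-trans (≤-reflexive (trans (+-comm _ 2) (cong (2 +_) flat))) (s≤s (s≤s (tot≤ k))))))
    where
    flat : tot (suc (suc k)) ≡ tot k
    flat = trans (none (suc k) (≢true λ p → contra t (ef₁ (suc k) p)) (q (suc k) ≤-refl))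
                 (none k (≢true λ p → contra t (ef₂ k p)) (q k (n≤1+n _)))

  bound₃ : ∀ k → f k ≡ false → 1 ≤ cnt f (suc k) → tot (suc k) + 3 ≤ suc k
  bound₃ k fk ge with inv k
  ... | at-f q _    = contra q fk
  ... | past-f _ le = le
  ... | no-f q      = ⊥-elim (1+n≰n (≤-trans ge (≤-reflexive (zero-f (suc k) q))))
    where
    zero-f : ∀ k → (∀ i → i < k → f i ≡ false) → cnt f k ≡ 0
    zero-f zero    h = refl
    zero-f (suc k) h rewrite h k ≤-refl = zero-f k (λ i lt → h i (≤-trans lt (n≤1+n k)))

-- A condition on every window of a periodic sequence becomes the cyclic condition on one list,
-- indices past its end being reduced by `cw`.
module Wrap7 (c : ℕ → Cl) (cw : ∀ i → c (7 + i) ≡ c i) where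
  goodS-intro : (∀ i → chk (c (4 + i)) (c (3 + i)) (c (2 + i)) (c (1 + i)) (c i) ≡ true) →
    goodS (c 6 ∷ c 5 ∷ c 4 ∷ c 3 ∷ c 2 ∷ c 1 ∷ c 0 ∷ []) ≡ true
  goodS-intro h = ∧-intro (h 2) (∧-intro (h 1) (∧-intro (h 0) (∧-intro h₆ (∧-intro h₅ (∧-intro h₄ h₃)))))
    where
    h₆ : chk (c 3) (c 2) (c 1) (c 0) (c 6) ≡ true
    h₆ rewrite symm (cw 0) | symm (cw 1) | symm (cw 2) | symm (cw 3) = h 6
    h₅ : chk (c 2) (c 1) (c 0) (c 6) (c 5) ≡ true
    h₅ rewrite symm (cw 0) | symm (cw 1) | symm (cw 2) = h 5
    h₄ : chk (c 1) (c 0) (c 6) (c 5) (c 4) ≡ true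
    h₄ rewrite symm (cw 0) | symm (cw 1) = h 4
    h₃ : chk (c 0) (c 6) (c 5) (c 4) (c 3) ≡ true
    h₃ rewrite symm (cw 0) = h 3

  goodE7-intro : let cs = c 6 ∷ c 5 ∷ c 4 ∷ c 3 ∷ c 2 ∷ c 1 ∷ c 0 ∷ [] in
    (∀ i → chk7 (1 ≤ᵇ countL isF cs) (c (6 + i)) (c (5 + i)) (c (4 + i)) (c (3 + i)) (c (2 + i)) (c (1 + i)) (c i) ≡ true) →
    goodE7 cs ≡ true
  goodE7-intro h = ∧-intro (h 0) (∧-intro (go₆ (h 6)) (∧-intro (go₅ (h 5)) (∧-intro (go₄ (h 4))
      (∧-intro (go₃ (h 3)) (∧-intro (go₂ (h 2)) (go₁ (h 1)))))))
    where
    go₁ : ∀ {y} → chk7 y (c 7) (c 6) (c 5) (c 4) (c 3) (c 2) (c 1) ≡ true → chk7 y (c 0) (c 6) (c 5) (c 4) (c 3) (c 2) (c 1) ≡ true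
    go₁ q rewrite cw 0 = q
    go₂ : ∀ {y} → chk7 y (c 8) (c 7) (c 6) (c 5) (c 4) (c 3) (c 2) ≡ true → chk7 y (c 1) (c 0) (c 6) (c 5) (c 4) (c 3) (c 2) ≡ true
    go₂ q rewrite cw 0 | cw 1 = q
    go₃ : ∀ {y} → chk7 y (c 9) (c 8) (c 7) (c 6) (c 5) (c 4) (c 3) ≡ true → chk7 y (c 2) (c 1) (c 0) (c 6) (c 5) (c 4) (c 3) ≡ true
    go₃ q rewrite cw 0 | cw 1 | cw 2 = q
    go₄ : ∀ {y} → chk7 y (c 10) (c 9) (c 8) (c 7) (c 6) (c 5) (c 4) ≡ true → chk7 y (c 3) (c 2) (c 1) (c 0) (c 6) (c 5) (c 4) ≡ true
    go₄ q rewrite cw 0 | cw 1 | cw 2 | cw 3 = q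
    go₅ : ∀ {y} → chk7 y (c 11) (c 10) (c 9) (c 8) (c 7) (c 6) (c 5) ≡ true → chk7 y (c 4) (c 3) (c 2) (c 1) (c 0) (c 6) (c 5) ≡ true
    go₅ q rewrite cw 0 | cw 1 | cw 2 | cw 3 | cw 4 = q
    go₆ : ∀ {y} → chk7 y (c 12) (c 11) (c 10) (c 9) (c 8) (c 7) (c 6) ≡ true → chk7 y (c 5) (c 4) (c 3) (c 2) (c 1) (c 0) (c 6) ≡ true
    go₆ q rewrite cw 0 | cw 1 | cw 2 | cw 3 | cw 4 | cw 5 = q

  tab7-true : let cs = c 6 ∷ c 5 ∷ c 4 ∷ c 3 ∷ c 2 ∷ c 1 ∷ c 0 ∷ [] in
    (∀ i → chk7 (1 ≤ᵇ countL isF cs) (c (6 + i)) (c (5 + i)) (c (4 + i)) (c (3 + i)) (c (2 + i)) (c (1 + i)) (c i) ≡ true) →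
    tab7 (countL isF cs) (countL isZ cs) ≡ true
  tab7-true h = ⇒ᵇ-elim {goodE7 (c 6 ∷ c 5 ∷ c 4 ∷ c 3 ∷ c 2 ∷ c 1 ∷ c 0 ∷ [])} (claimE7-true (c 6 ∷ c 5 ∷ c 4 ∷ c 3 ∷ c 2 ∷ c 1 ∷ c 0 ∷ []) refl) (goodE7-intro h)

module Wrap8 (c : ℕ → Cl) (cw : ∀ i → c (8 + i) ≡ c i) where
  goodE8-intro :
    (∀ i → chk8 (c (7 + i)) (c (6 + i)) (c (5 + i)) (c (4 + i)) (c (3 + i)) (c (2 + i)) (c (1 + i)) (c i) ≡ true) →
    goodE8 (c 7 ∷ c 6 ∷ c 5 ∷ c 4 ∷ c 3 ∷ c 2 ∷ c 1 ∷ c 0 ∷ []) ≡ true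
  goodE8-intro h = ∧-intro (h 0) (∧-intro (go₇ (h 7)) (∧-intro (go₆ (h 6)) (∧-intro (go₅ (h 5)) (∧-intro (go₄ (h 4))
      (∧-intro (go₃ (h 3)) (∧-intro (go₂ (h 2)) (go₁ (h 1))))))))
    where
    go₁ : chk8 (c 8) (c 7) (c 6) (c 5) (c 4) (c 3) (c 2) (c 1) ≡ true → chk8 (c 0) (c 7) (c 6) (c 5) (c 4) (c 3) (c 2) (c 1) ≡ true
    go₁ q rewrite cw 0 = q
    go₂ : chk8 (c 9) (c 8) (c 7) (c 6) (c 5) (c 4) (c 3) (c 2) ≡ true → chk8 (c 1) (c 0) (c 7) (c 6) (c 5) (c 4) (c 3) (c 2) ≡ true
    go₂ q rewrite cw 0 | cw 1 = q
    go₃ : chk8 (c 10) (c 9) (c 8) (c 7) (c 6) (c 5) (c 4) (c 3) ≡ true → chk8 (c 2) (c 1) (c 0) (c 7) (c 6) (c 5) (c 4) (c 3) ≡ true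
    go₃ q rewrite cw 0 | cw 1 | cw 2 = q
    go₄ : chk8 (c 11) (c 10) (c 9) (c 8) (c 7) (c 6) (c 5) (c 4) ≡ true → chk8 (c 3) (c 2) (c 1) (c 0) (c 7) (c 6) (c 5) (c 4) ≡ true
    go₄ q rewrite cw 0 | cw 1 | cw 2 | cw 3 = q
    go₅ : chk8 (c 12) (c 11) (c 10) (c 9) (c 8) (c 7) (c 6) (c 5) ≡ true → chk8 (c 4) (c 3) (c 2) (c 1) (c 0) (c 7) (c 6) (c 5) ≡ true
    go₅ q rewrite cw 0 | cw 1 | cw 2 | cw 3 | cw 4 = q
    go₆ : chk8 (c 13) (c 12) (c 11) (c 10) (c 9) (c 8) (c 7) (c 6) ≡ true → chk8 (c 5) (c 4) (c 3) (c 2) (c 1) (c 0) (c 7) (c 6) ≡ true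
    go₆ q rewrite cw 0 | cw 1 | cw 2 | cw 3 | cw 4 | cw 5 = q
    go₇ : chk8 (c 14) (c 13) (c 12) (c 11) (c 10) (c 9) (c 8) (c 7) ≡ true → chk8 (c 6) (c 5) (c 4) (c 3) (c 2) (c 1) (c 0) (c 7) ≡ true
    go₇ q rewrite cw 0 | cw 1 | cw 2 | cw 3 | cw 4 | cw 5 | cw 6 = q

  tab8-true : let cs = c 7 ∷ c 6 ∷ c 5 ∷ c 4 ∷ c 3 ∷ c 2 ∷ c 1 ∷ c 0 ∷ [] in
    (∀ i → chk8 (c (7 + i)) (c (6 + i)) (c (5 + i)) (c (4 + i)) (c (3 + i)) (c (2 + i)) (c (1 + i)) (c i) ≡ true) →
    tab8 (countL isF cs) (countL isZ cs) ≡ true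
  tab8-true h = ⇒ᵇ-elim {goodE8 (c 7 ∷ c 6 ∷ c 5 ∷ c 4 ∷ c 3 ∷ c 2 ∷ c 1 ∷ c 0 ∷ [])} (claimE8-true (c 7 ∷ c 6 ∷ c 5 ∷ c 4 ∷ c 3 ∷ c 2 ∷ c 1 ∷ c 0 ∷ []) refl) (goodE8-intro h)

countL-map : ∀ {A B : Set} (g : A → B) (p : B → Bool) (q : A → Bool) → (∀ x → p (g x) ≡ q x) → ∀ xs → countL p (map g xs) ≡ countL q xs
countL-map g p q h []       = refl
countL-map g p q h (x ∷ xs) = cong₂ (λ b m → (if b then 1 else 0) + m) (h x) (countL-map g p q h xs)

countL-+ : ∀ (xs : List Cl) → countL isF xs + countL isZ xs ≡ countL (λ c → not (isO c)) xs
countL-+ []        = refl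
countL-+ (cF ∷ xs) = cong suc (countL-+ xs)
countL-+ (cZ ∷ xs) = trans (+-suc _ _) (cong suc (countL-+ xs))
countL-+ (cO ∷ xs) = countL-+ xs

-- Hubs, and collected neighbours of a vertex of degree 7

module Local (St : Setting) where
  open Basics St public
  open Dir public

  five big : Fin n → Bool
  five x = deg x ≤ᵇ 5
  big  x = 7 ≤ᵇ deg x

  n5 nb : Fin n → ℕ
  n5 v = count (λ x → adj G v x ∧ five x)
  nb v = count (λ x → adj G v x ∧ big x)

  -- One big neighbour at most, so direct payments may fall short; all other neighbours have degree
  -- exactly 6.
  hub : Fin n → Bool
  hub h = five h ∧ ((nb h ≤ᵇ 1) ∧ (n5 h ≤ᵇ 0))

  -- the edge from r to nx v r separates v from a hub to which v sends charge
  E′ : Fin n → Fin n → Bool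
  E′ v r = (hub (opp v r) ∧ not (adj G v (opp v r))) ∧ ((deg r ≤ᵇ 6) ∧ (deg (nx v r) ≤ᵇ 6))

  k : Fin n → ℕ
  k v = count (λ r → adj G v r ∧ E′ v r)

  notbig : ∀ {x} → big x ≡ false → deg x ≤ 6
  notbig {x} q = ≤-pred (≰⇒> {7} λ le → contra (⇒≤ᵇ le) q)

  F-in : ∀ {v f} → v ~ f → deg f ≤ 5 → v ∋ f
  F-in p le = coll1 (~sym p) (S-self _) le

  -- All neighbours of degree 5 lie in `S v`, so every other known member takes one of their places.
  n5-room : ∀ {v xs} → Unique xs → All (λ x → (v ∋ x) × (adj G v x ∧ five x ≡ false)) xs → n5 v + length xs ≤ count (S v)
  n5-room {v} u a = #-mono+ (λ x → adj G v x ∧ five x) (S v)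
    (λ x q → F-in (proj₁ (∧-elim {adj G v x} q)) (≤ᵇ⇒ (proj₂ (∧-elim {adj G v x} q)))) u a

  not5 : ∀ {v x} → 6 ≤ deg x → adj G v x ∧ five x ≡ false
  not5 {v} {x} le = ≢true λ q → 1+n≰n (≤-trans le (≤ᵇ⇒ (proj₂ (∧-elim {adj G v x} q))))

  notself : ∀ v → adj G v v ∧ five v ≡ false
  notself v = cong (_∧ five v) (irrefl G v)

  n5<S : ∀ v → n5 v < count (S v)
  n5<S v = subst (_≤ count (S v)) (+-comm (n5 v) 1) (n5-room {v} ([] ∷ []) ((S-self v , notself v) ∷ []))

  n5≤5 : ∀ v → n5 v ≤ 5
  n5≤5 v = ≤-pred (≤-trans (n5<S v) (S-size v))

  n5-≥ : ∀ {v xs} → Unique xs → All (λ x → (v ~ x) × (deg x ≤ 5)) xs → length xs ≤ n5 v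
  n5-≥ {v} u a = unique-≤-# (λ x → adj G v x ∧ five x) u (All.map (λ q → ∧-intro (proj₁ q) (⇒≤ᵇ (proj₂ q))) a)

  n5-elems : ∀ v m → m ≤ n5 v → ∃ λ xs → Unique xs × All (λ x → (v ~ x) × (deg x ≤ 5)) xs × (length xs ≡ m)
  n5-elems v m le with #-elems m (λ x → adj G v x ∧ five x) le
  ... | xs , u , a , l = xs , u , All.map (λ {x} q → proj₁ (∧-elim {adj G v x} q) , ≤ᵇ⇒ (proj₂ (∧-elim {adj G v x} q))) a , l

  module _ {v h} (h5 : deg h ≤ 5) (nb1 : nb h ≤ 1) (no5 : n5 h ≤ 0) (vh : adj G v h ≡ false) (v≢h : v ≢ h) where
    -- Together with `v` and `h` the four vertices fill `S v`. By `seed` a neighbour of `v` of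
    -- degree 5 is among the six, but `h` is not adjacent to `v` and a hub has no neighbour of
    -- degree 5.
    hub-four : v ∋ h → ∀ {y₁ y₂ y₃ y₄} → Unique (y₁ ∷ y₂ ∷ y₃ ∷ y₄ ∷ []) →
      All (λ y → (h ~ y) × (v ∋ y)) (y₁ ∷ y₂ ∷ y₃ ∷ y₄ ∷ []) → ⊥
    hub-four vh∋ {y₁} {y₂} {y₃} {y₄} u a with seed vh∋ (≢sym v≢h)
    ... | f , vf , f5 = bad (exact u6 a6 (S-size v) (F-in vf f5))
      where
      v≢ : All (λ y → (h ~ y) × (v ∋ y)) (y₁ ∷ y₂ ∷ y₃ ∷ y₄ ∷ []) → All (v ≢_) (y₁ ∷ y₂ ∷ y₃ ∷ y₄ ∷ [])
      v≢ = All.map (λ { (p , _) refl → contra (~sym p) vh })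
      u6 : Unique (v ∷ h ∷ y₁ ∷ y₂ ∷ y₃ ∷ y₄ ∷ [])
      u6 = (v≢h ∷ v≢ a) ∷ All.map (λ q → ~≢ (proj₁ q)) a ∷ u
      a6 : All (v ∋_) (v ∷ h ∷ y₁ ∷ y₂ ∷ y₃ ∷ y₄ ∷ [])
      a6 = S-self v ∷ vh∋ ∷ All.map proj₂ a
      bad : f ∈ v ∷ h ∷ y₁ ∷ y₂ ∷ y₃ ∷ y₄ ∷ [] → ⊥
      bad (here refl) = ~≢ vf refl
      bad (there (here refl)) = contra vf vh
      bad (there (there m)) = 1+n≰n {0} (≤-trans (n5-≥ ([] ∷ []) ((proj₁ (All.lookup a m) , f5) ∷ [])) no5)

    -- If `x` were collected, so would be `h`, and then collecting spreads around `h` in both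
    -- directions, each small neighbour having lost `h` and its predecessor. A single big neighbour
    -- cannot stop both directions short of four vertices.
    hub-out : ∀ {x} → h ~ x → deg x ≤ 6 → S v x ≡ false
    hub-out {x} hx x6 = ≢true λ vx → go vx (coll1 hx vx h5)
      where
      open Ring (fwd h) hx
      d5 : deg h ≡ 5
      d5 = ≤-antisym h5 (deg≥5 hx)
      sep : ∀ {i j} → i < j → j < 5 → r i ≢ r j
      sep lt lt′ = r-inj lt (subst (_ <_) (symm d5) lt′)
      u4 : ∀ {i j k l} → i < j → j < k → k < l → l < 5 → Unique (r i ∷ r j ∷ r k ∷ r l ∷ [])
      u4 a b c d = (sep a (<-trans b (<-trans c d)) ∷ sep (<-trans a b) (<-trans c d) ∷ sep (<-trans a (<-trans b c)) d ∷ [])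
        ∷ (sep b (<-trans c d) ∷ sep (<-trans b c) d ∷ []) ∷ (sep c d ∷ []) ∷ [] ∷ []
      wrap : r 5 ≡ x
      wrap = trans (cong r (symm d5)) r-wrap
      two-big : ∀ {i j} → r i ≢ r j → big (r i) ≡ true → big (r j) ≡ true → ⊥
      two-big {i} {j} ne p q = 1+n≰n {1} (≤-trans (unique-≤-# (λ y → adj G h y ∧ big y) ((ne ∷ []) ∷ [] ∷ [])
        (∧-intro (r~ i) p ∷ ∧-intro (r~ j) q ∷ [])) nb1)
      up : v ∋ h → ∀ i → v ∋ r i → big (r (suc i)) ≡ false → v ∋ r (suc i)
      up vh∋ i m q = coll2 (~sym (r~ (suc i))) vh∋ (~sym (rr i)) m (~≢ (r~ i)) (notbig q)
      down : v ∋ h → ∀ i → v ∋ r (suc i) → big (r i) ≡ false → v ∋ r i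
      down vh∋ i m q = coll2 (~sym (r~ i)) vh∋ (rr i) m (~≢ (r~ (suc i))) (notbig q)
      go : v ∋ x → v ∋ h → ⊥
      go vx vh∋ with bool-cases (big (r 1)) | bool-cases (big (r 2)) | bool-cases (big (r 3)) | bool-cases (big (r 4))
      ... | inj₁ a | inj₁ b | _ | _ = two-big {1} {2} (sep ≤-refl (s≤s (s≤s (s≤s z≤n)))) a b
      ... | inj₁ a | inj₂ _ | inj₁ b | _ = two-big {1} {3} (sep (s≤s (s≤s z≤n)) (s≤s (s≤s (s≤s (s≤s z≤n))))) a b
      ... | inj₁ a | inj₂ _ | inj₂ _ | inj₁ b = two-big {1} {4} (sep (s≤s (s≤s z≤n)) ≤-refl) a b
      ... | inj₂ _ | inj₁ a | inj₁ b | _ = two-big {2} {3} (sep ≤-refl (s≤s (s≤s (s≤s (s≤s z≤n))))) a b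
      ... | inj₂ _ | inj₁ a | inj₂ _ | inj₁ b = two-big {2} {4} (sep (s≤s (s≤s (s≤s z≤n))) ≤-refl) a b
      ... | inj₂ _ | inj₂ _ | inj₁ a | inj₁ b = two-big {3} {4} (sep ≤-refl ≤-refl) a b
      ... | inj₁ _ | inj₂ s₂ | inj₂ s₃ | inj₂ s₄ = hub-four vh∋ (u4 {0} {2} {3} {4} (s≤s z≤n) ≤-refl ≤-refl ≤-refl)
              ((hx , vx) ∷ (r~ 2 , m₂) ∷ (r~ 3 , m₃) ∷ (r~ 4 , m₄) ∷ [])
        where
        m₄ = down vh∋ 4 (subst (v ∋_) (symm wrap) vx) s₄
        m₃ = down vh∋ 3 m₄ s₃
        m₂ = down vh∋ 2 m₃ s₂
      ... | inj₂ s₁ | inj₁ _ | inj₂ s₃ | inj₂ s₄ = hub-four vh∋ (u4 {0} {1} {3} {4} (s≤s z≤n) (s≤s (s≤s z≤n)) ≤-refl ≤-refl)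
              ((hx , vx) ∷ (r~ 1 , up vh∋ 0 vx s₁) ∷ (r~ 3 , m₃) ∷ (r~ 4 , m₄) ∷ [])
        where
        m₄ = down vh∋ 4 (subst (v ∋_) (symm wrap) vx) s₄
        m₃ = down vh∋ 3 m₄ s₃
      ... | inj₂ s₁ | inj₂ s₂ | _ | inj₂ s₄ = hub-four vh∋ (u4 {0} {1} {2} {4} (s≤s z≤n) ≤-refl (s≤s (s≤s (s≤s z≤n))) ≤-refl)
              ((hx , vx) ∷ (r~ 1 , m₁) ∷ (r~ 2 , up vh∋ 1 m₁ s₂) ∷ (r~ 4 , down vh∋ 4 (subst (v ∋_) (symm wrap) vx) s₄) ∷ [])
        where
        m₁ = up vh∋ 0 vx s₁
      ... | inj₂ s₁ | inj₂ s₂ | inj₂ s₃ | inj₁ _ = hub-four vh∋ (u4 {0} {1} {2} {3} (s≤s z≤n) ≤-refl ≤-refl (s≤s (s≤s (s≤s (s≤s z≤n)))))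
              ((hx , vx) ∷ (r~ 1 , m₁) ∷ (r~ 2 , m₂) ∷ (r~ 3 , up vh∋ 2 m₂ s₃) ∷ [])
        where
        m₁ = up vh∋ 0 vx s₁
        m₂ = up vh∋ 1 m₁ s₂

  -- two consecutive neighbours x , y of v facing a common hub on the other side
  record Facing (v x y : Fin n) : Set where
    field
      h   : Fin n
      hx  : h ~ x
      hy  : h ~ y
      h5  : deg h ≤ 5
      vh  : adj G v h ≡ false
      x6  : deg x ≤ 6
      y6  : deg y ≤ 6
      x∉  : S v x ≡ false
      y∉  : S v y ≡ false
      xy  : x ~ y
      h≢v : h ≢ v

  facing : ∀ {v x} → 7 ≤ deg v → v ~ x → E′ v x ≡ true → Facing v x (nx v x)
  facing {v} {x} v7 vx q = record
      { h = opp v x ; hx = ~sym hx ; hy = ~sym hy ; h5 = h5 ; vh = vh ; x6 = x6 ; y6 = y6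
      ; x∉ = hub-out h5 n1 n0 vh v≢h (~sym hx) x6
      ; y∉ = hub-out h5 n1 n0 vh v≢h (~sym hy) y6
      ; xy = nx-link vx ; h≢v = ≢sym v≢h }
    where
    q₁ = ∧-elim {hub (opp v x) ∧ not (adj G v (opp v x))} q
    q₂ = ∧-elim {hub (opp v x)} (proj₁ q₁)
    q₃ = ∧-elim {five (opp v x)} (proj₁ q₂)
    q₄ = ∧-elim {nb (opp v x) ≤ᵇ 1} (proj₂ q₃)
    q₅ = ∧-elim {deg x ≤ᵇ 6} (proj₂ q₁)
    h5 : deg (opp v x) ≤ 5
    h5 = ≤ᵇ⇒ (proj₁ q₃)
    n1 : nb (opp v x) ≤ 1
    n1 = ≤ᵇ⇒ (proj₁ q₄)
    n0 : n5 (opp v x) ≤ 0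
    n0 = ≤ᵇ⇒ (proj₂ q₄)
    x6 : deg x ≤ 6
    x6 = ≤ᵇ⇒ (proj₁ q₅)
    y6 : deg (nx v x) ≤ 6
    y6 = ≤ᵇ⇒ (proj₂ q₅)
    vh : adj G v (opp v x) ≡ false
    vh = not-elim (proj₂ q₂)
    yx : nx v x ~ x
    yx = ~sym (nx-link vx)
    hy : nx v x ~ opp v x
    hy = nx-nbr yx
    hx : x ~ opp v x
    hx = nx-link yx
    v≢h : v ≢ opp v x
    v≢h e = small≢big (≤-trans h5 (n≤1+n 5)) v7 (symm e)

  facing-flip : ∀ {v x y} → Facing v x y → Facing v y x
  facing-flip f = record { h = h ; hx = hy ; hy = hx ; h5 = h5 ; vh = vh ; x6 = y6 ; y6 = x6 ; x∉ = y∉ ; y∉ = x∉ ; xy = ~sym xy ; h≢v = h≢v }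
    where
    open Facing f

  -- Losing both `v` and `z` would collect `x`, which lies outside `S v`.
  beside : ∀ {v x y z} → Facing v x y → v ~ x → v ~ z → x ~ z → S v z ≡ false
  beside f vx vz xz = ≢true λ m → contra (coll2 (~sym vx) (S-self _) xz m (~≢ vz) (Facing.x6 f)) (Facing.x∉ f)

  abstract
    nbr-of : ∀ {v} → 1 ≤ deg v → ∃ λ x → v ~ x
    nbr-of {v} le with #-elems 1 (adj G v) le
    ... | x ∷ _ , _ , p ∷ _ , _ = x , p

  -- Deleting `t` would collect the whole of `S v`, with `t` as the seventh member.
  capture : ∀ {v t} → t ∋ v → S v t ≡ false → 6 ≤ count (S v) → ⊥
  capture {v} {t} m q le = 1+n≰n (≤-trans (≤-reflexive (+-comm 1 6)) (≤-trans (+-monoˡ-≤ 1 le) (grow m ([] ∷ []) ((S-self t , q) ∷ []))))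

  module _ {v} (d7 : deg v ≡ 7) where
    private
      p₀ = proj₂ (nbr-of (≤-trans (s≤s z≤n) (≤-reflexive (symm d7))))
    open Ring (fwd v) p₀

    private
      sep : ∀ i j → 0 < j → j < 7 → r i ≢ r (j + i)
      sep i j lt lt′ e = r-sep i j lt (subst (j <_) (symm d7) lt′) (trans e (cong r (+-comm j i)))
      wrap : ∀ i → r (7 + i) ≡ r i
      wrap i = trans (cong r (trans (+-comm 7 i) (cong (i +_) (symm d7)))) (r-shift i)

      clsS : Fin n → Cl
      clsS x = if five x then cF else (if S v x then cZ else cO)

      F-clsS : ∀ x → isF (clsS x) ≡ five x
      F-clsS x with five x | S v x
      ... | true  | _     = refl
      ... | false | true  = refl
      ... | false | false = refl

      O-clsS : ∀ x → v ~ x → not (isO (clsS x)) ≡ S v x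
      O-clsS x p with five x in eq | S v x in eq′
      ... | true  | true  = refl
      ... | true  | false = contra (F-in p (≤ᵇ⇒ eq)) eq′
      ... | false | true  = refl
      ... | false | false = refl

      in-count : countL (λ c → not (isO c)) (map clsS (list 7)) ≡ count (λ x → adj G v x ∧ S v x)
      in-count = trans (go (list 7) (list-nbr 7)) (symm (trans (r-count (S v)) (cong (λ z → countL (S v) (list z)) d7)))
        where
        go : ∀ xs → All (v ~_) xs → countL (λ c → not (isO c)) (map clsS xs) ≡ countL (S v) xs
        go [] [] = refl
        go (x ∷ xs) (p ∷ ps) = cong₂ (λ b m → (if b then 1 else 0) + m) (O-clsS x p) (go xs ps)

      five-count : countL isF (map clsS (list 7)) ≡ n5 v
      five-count = trans (countL-map clsS isF five F-clsS (list 7))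
                     (symm (trans (r-count five) (cong (λ z → countL five (list z)) d7)))

    S-nbrs : count (λ x → adj G v x ∧ S v x) ≤ 5
    S-nbrs = ≤-pred (subst (_≤ 6) (+-comm _ 1) (≤-trans (#-mono+ (λ x → adj G v x ∧ S v x) (S v)
        (λ x q → proj₂ (∧-elim {adj G v x} q)) ([] ∷ []) ((S-self v , cong (_∧ S v v) (irrefl G v)) ∷ [])) (S-size v)))

    module _ (full : 6 ≤ count (S v)) where
      cap7 : ∀ {t x y} → S v t ≡ false → v ~ t → v ~ x → v ~ y → t ∋ x → t ∋ y → t ≢ x → t ≢ y → x ≢ y → ⊥
      cap7 {t} nt vt vx vy mx my a b c =
        capture (coll3 vt (S-self t) vx mx vy my a b c (≤-reflexive d7)) nt full

      private
        -- Let `c` be the uncollected middle vertex. A vertex of degree 5 on each side, or two in a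
        -- row on one side, would be collected by deleting `c`; with `c` they are three lost
        -- neighbours of `v`, and `cap7` applies.
        chkS : ∀ i → chk (clsS (r (4 + i))) (clsS (r (3 + i))) (clsS (r (2 + i))) (clsS (r (1 + i))) (clsS (r i)) ≡ true
        chkS i = ⇒ᵇ-intro λ o → ∧-intro (no₁ (notS o)) (∧-intro (no₂ (notS o)) (no₃ (notS o)))
          where
          c = r (2 + i)
          notS : isO (clsS c) ≡ true → S v c ≡ false
          notS o = trans (symm (O-clsS c (r~ (2 + i)))) (cong not o)
          f⇒ : ∀ {x} → isF (clsS x) ≡ true → deg x ≤ 5
          f⇒ {x} q = ≤ᵇ⇒ (trans (symm (F-clsS x)) q)
          lost₁ : isF (clsS (r (1 + i))) ≡ true → c ∋ r (1 + i)
          lost₁ q = coll1 (rr (1 + i)) (S-self c) (f⇒ q)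
          lost₃ : isF (clsS (r (3 + i))) ≡ true → c ∋ r (3 + i)
          lost₃ q = coll1 (~sym (rr (2 + i))) (S-self c) (f⇒ q)
          no₁ : S v c ≡ false → not (isF (clsS (r (3 + i))) ∧ isF (clsS (r (1 + i)))) ≡ true
          no₁ ns = not-intro (≢true λ q → let q₃ , q₁ = ∧-elim {isF (clsS (r (3 + i)))} q in
            cap7 ns (r~ (2 + i)) (r~ (3 + i)) (r~ (1 + i)) (lost₃ q₃) (lost₁ q₁)
              (~≢ (rr (2 + i))) (≢sym (~≢ (rr (1 + i)))) (≢sym (sep (1 + i) 2 (s≤s z≤n) (s≤s (s≤s (s≤s z≤n))))))
          no₂ : S v c ≡ false → not (isF (clsS (r (4 + i))) ∧ isF (clsS (r (3 + i)))) ≡ true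
          no₂ ns = not-intro (≢true λ q → let q₄ , q₃ = ∧-elim {isF (clsS (r (4 + i)))} q in
            cap7 ns (r~ (2 + i)) (r~ (3 + i)) (r~ (4 + i)) (lost₃ q₃) (coll1 (~sym (rr (3 + i))) (lost₃ q₃) (f⇒ q₄))
              (~≢ (rr (2 + i))) (sep (2 + i) 2 (s≤s z≤n) (s≤s (s≤s (s≤s z≤n)))) (~≢ (rr (3 + i))))
          no₃ : S v c ≡ false → not (isF (clsS (r (1 + i))) ∧ isF (clsS (r i))) ≡ true
          no₃ ns = not-intro (≢true λ q → let q₁ , q₀ = ∧-elim {isF (clsS (r (1 + i)))} q in
            cap7 ns (r~ (2 + i)) (r~ (1 + i)) (r~ i) (lost₁ q₁) (coll1 (rr i) (lost₁ q₁) (f⇒ q₀))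
              (≢sym (~≢ (rr (1 + i)))) (≢sym (sep i 2 (s≤s z≤n) (s≤s (s≤s (s≤s z≤n))))) (≢sym (~≢ (rr i))))

        sums = countL-+ (map clsS (list 7))

        result = ∧-elim {countL isF (map clsS (list 7)) ≤ᵇ 3} (⇒ᵇ-elim (claimS-true (map clsS (list 7)) refl)
          (∧-intro (Wrap7.goodS-intro (λ i → clsS (r i)) (λ i → cong clsS (wrap i)) chkS)
            (⇒≤ᵇ (≤-trans (≤-reflexive (trans sums in-count)) S-nbrs))))

      n5≤3 : n5 v ≤ 3
      n5≤3 = subst (_≤ 3) five-count (≤ᵇ⇒ (proj₁ result))

      -- By the pattern search five members of `S v` are neighbours of `v`; with `v` itself these
      -- are all six.
      all-nbrs : 3 ≤ n5 v → ∀ {x} → v ∋ x → x ≢ v → v ~ x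
      all-nbrs ge {x} m ne = ≢false λ q → 1+n≰n {6} (≤-trans
          (subst (λ z → 7 ≤ z) (+-comm 2 _) (+-monoʳ-≤ 2 five-in))
          (≤-trans (#-mono+ (λ y → adj G v y ∧ S v y) (S v) (λ y h → proj₂ (∧-elim {adj G v y} h))
            ((ne ∷ []) ∷ [] ∷ []) ((m , cong (_∧ S v x) q) ∷ (S-self v , cong (_∧ S v v) (irrefl G v)) ∷ [])) (S-size v)))
        where
        five-in : 5 ≤ count (λ y → adj G v y ∧ S v y)
        five-in = ≤-trans (≤ᵇ⇒ (⇒ᵇ-elim (proj₂ result) (⇒≤ᵇ (subst (3 ≤_) (symm five-count) ge)))) (≤-reflexive (trans sums in-count))

-- The charge paid to each neighbour of degree 5, in units of 1/60: a vertex of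
-- degree d ≥ 7 owns 60 (d − 6), is joined to a vertices of degree 5, and pays 12
-- for each of the k edges facing a hub.
p7 : ℕ → ℕ → ℕ
p7 0 k = 36
p7 1 k = 36
p7 2 0 = 30
p7 2 (suc k) = 24
p7 3 k = 20
p7 (suc (suc (suc (suc a)))) k = 15

p8 : ℕ → ℕ
p8 0 = 60
p8 1 = 60
p8 2 = 40
p8 3 = 30
p8 4 = 30
p8 (suc (suc (suc (suc (suc a))))) = 24

-- A neighbour with no other big neighbour is paid in full, which forces 30 for the rest. Otherwise
-- the rate is 45, the complement of the smallest payment 15, as long as the budget bears it.
p9 : ℕ → ℕ → Bool → Bool → ℕ
p9 d a hv hu = if hv then (if hu then 60 else 30) else (if (5 ≤ᵇ a) ∨ ((d ≤ᵇ 9) ∧ (4 ≤ᵇ a)) then 30 else 45)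

pay : ℕ → ℕ → ℕ → Bool → Bool → ℕ
pay 7 a k hv hu = p7 a k
pay 8 a k hv hu = p8 a
pay d a k hv hu = p9 d a hv hu

pay9 : ∀ d a k hv hu → 9 ≤ d → pay d a k hv hu ≡ p9 d a hv hu
pay9 (suc (suc (suc (suc (suc (suc (suc (suc (suc d))))))))) a k hv hu le = refl
pay9 zero a k hv hu ()
pay9 1 a k hv hu (s≤s ())
pay9 2 a k hv hu (s≤s (s≤s ()))
pay9 3 a k hv hu (s≤s (s≤s (s≤s ())))
pay9 4 a k hv hu (s≤s (s≤s (s≤s (s≤s ()))))
pay9 5 a k hv hu (s≤s (s≤s (s≤s (s≤s (s≤s ())))))
pay9 6 a k hv hu (s≤s (s≤s (s≤s (s≤s (s≤s (s≤s ()))))))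
pay9 7 a k hv hu (s≤s (s≤s (s≤s (s≤s (s≤s (s≤s (s≤s ())))))))
pay9 8 a k hv hu (s≤s (s≤s (s≤s (s≤s (s≤s (s≤s (s≤s (s≤s ()))))))))

budget7 : ∀ a k → a ≤ 4 → tab7 a k ≡ true → p7 a k * a + 12 * k ≤ 60
budget7 0 k _ q = *-monoʳ-≤ 12 (≤ᵇ⇒ {k} {5} q)
budget7 1 k _ q = +-monoʳ-≤ 36 (*-monoʳ-≤ 12 (≤ᵇ⇒ {k} {2} q))
budget7 2 0 _ q = ≤-refl
budget7 2 1 _ q = ≤-refl
budget7 2 (suc (suc k)) _ ()
budget7 3 0 _ q = ≤-refl
budget7 4 0 _ q = ≤-refl
budget7 (suc (suc (suc (suc (suc a))))) k (s≤s (s≤s (s≤s (s≤s ())))) q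

budget8 : ∀ a k → a ≤ 5 → tab8 a k ≡ true → p8 a * a + 12 * k ≤ 120
budget8 0 k _ q = *-monoʳ-≤ 12 (≤ᵇ⇒ {k} {10} q)
budget8 1 k _ q = +-monoʳ-≤ 60 (*-monoʳ-≤ 12 (≤ᵇ⇒ {k} {5} q))
budget8 2 k _ q = ≤-trans (+-monoʳ-≤ 80 (*-monoʳ-≤ 12 (≤ᵇ⇒ {k} {3} q))) (≤ᵇ⇒ {116} {120} refl)
budget8 3 k _ q = ≤-trans (+-monoʳ-≤ 90 (*-monoʳ-≤ 12 (≤ᵇ⇒ {k} {2} q))) (≤ᵇ⇒ {114} {120} refl)
budget8 4 0 _ q = ≤-refl
budget8 5 0 _ q = ≤-refl
budget8 (suc (suc (suc (suc (suc (suc a)))))) k (s≤s (s≤s (s≤s (s≤s (s≤s ()))))) q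

sum-if : ∀ {n} c (p : Fin n → Bool) → sumF (λ u → if p u then c else 0) ≡ c * count p
sum-if {n} c p = trans (sumF-cong (λ u → go (p u))) (trans (sumF-* c (λ u → if p u then 1 else 0)) (cong (c *_) (symm (count-sum p))))
  where
  go : ∀ b → (if b then c else 0) ≡ c * (if b then 1 else 0)
  go true  = symm (*-identityʳ c)
  go false = symm (*-zeroʳ c)

sum-fibres : ∀ {n} (p : Fin n → Bool) (g : Fin n → Fin n) → sumF (λ u → count (λ r → p r ∧ (g r == u))) ≡ count p
sum-fibres {n} p g = trans (sumF-cong (λ u → count-sum (λ r → p r ∧ (g r == u))))
  (trans (sumF-swap (λ u r → if p r ∧ (g r == u) then 1 else 0))
    (trans (sumF-cong (λ r → inner (p r) (g r))) (symm (count-sum p))))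
  where
  inner : ∀ b x → sumF (λ u → if b ∧ (x == u) then 1 else 0) ≡ (if b then 1 else 0)
  inner false x = sumF-0 n
  inner true  x = trans (sumF-remove (λ u → if x == u then 1 else 0) x) (trans (cong₂ _+_ (cong (λ z → if z then 1 else 0) (==-refl x))
      (trans (sumF-cong off) (sumF-0 n))) refl)
    where
    off : ∀ u → (if does (u F.≟ x) then 0 else (if x == u then 1 else 0)) ≡ 0
    off u with toSum (u F.≟ x)
    ... | inj₁ e  = cong (λ z → if z then 0 else (if x == u then 1 else 0)) (does⇐ (u F.≟ x) e)
    ... | inj₂ ne = trans (cong (λ z → if z then 0 else (if x == u then 1 else 0)) (does⇐¬ (u F.≟ x) ne))
                          (cong (λ z → if z then 1 else 0) (does⇐¬ (x F.≟ u) (λ e → ne (symm e))))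

-- How many hub edges a big vertex can have

module Budget (St : Setting) where
  open Local St public

  lone hasHub : Fin n → Bool
  lone u   = nb u ≤ᵇ 1
  hasHub v = anyB (λ u → (adj G v u ∧ five u) ∧ lone u)

  P : Fin n → Fin n → ℕ
  P v u = pay (deg v) (n5 v) (k v) (hasHub v) (lone u)

  F-∉ : ∀ {v x} → v ~ x → S v x ≡ false → five x ≡ false
  F-∉ p q = ≢true λ t → contra (F-in p (≤ᵇ⇒ t)) q

  module _ {v} (v7 : 7 ≤ deg v) where
    abstract
      clsE : Fin n → Cl
      clsE x = if five x then cF else (if E′ v x then cZ else cO)

      F-clsE : ∀ x → isF (clsE x) ≡ five x
      F-clsE x with five x | E′ v x
      ... | true  | _     = refl
      ... | false | true  = refl
      ... | false | false = refl

      Z-clsE : ∀ {x} → v ~ x → isZ (clsE x) ≡ E′ v x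
      Z-clsE {x} p with five x in eq | E′ v x in eq′
      ... | true  | true  = contra eq (F-∉ p (Facing.x∉ (facing v7 p eq′)))
      ... | true  | false = refl
      ... | false | true  = refl
      ... | false | false = refl

    countL-Z : ∀ xs → All (v ~_) xs → countL isZ (map clsE xs) ≡ countL (E′ v) xs
    countL-Z [] [] = refl
    countL-Z (x ∷ xs) (p ∷ ps) = cong₂ (λ b m → (if b then 1 else 0) + m) (Z-clsE p) (countL-Z xs ps)

    -- The ends of an edge facing a hub and the next neighbour on either side all lie outside `S v`,
    -- so none of these four has degree 5.
    module Near {x₀} (p₀ : v ~ x₀) where
      open Ring (fwd v) p₀
      fac : ∀ i → E′ v (r i) ≡ true → Facing v (r i) (r (1 + i))
      fac i = facing v7 (r~ i)

      ∉₂ : ∀ i → E′ v (r i) ≡ true → S v (r (2 + i)) ≡ false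
      ∉₂ i q = beside (facing-flip (fac i q)) (r~ (1 + i)) (r~ (2 + i)) (rr (1 + i))

      ∉₋ : ∀ i → E′ v (r (1 + i)) ≡ true → S v (r i) ≡ false
      ∉₋ i q = beside (fac (1 + i) q) (r~ (1 + i)) (r~ i) (~sym (rr i))

    private
      p₀ : ∃ λ x → v ~ x
      p₀ = nbr-of (≤-trans (s≤s z≤n) v7)
    open Ring (fwd v) (proj₂ p₀)
    open Near (proj₂ p₀)

    private
      c : ℕ → Cl
      c i = clsE (r i)

      Z⇒ : ∀ i → isZ (c i) ≡ true → E′ v (r i) ≡ true
      Z⇒ i q = trans (symm (Z-clsE (r~ i))) q

      F⇒ : ∀ i → isF (c i) ≡ true → deg (r i) ≤ 5
      F⇒ i q = ≤ᵇ⇒ (trans (symm (F-clsE (r i))) q)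

      ¬F : ∀ i → S v (r i) ≡ false → not (isF (c i)) ≡ true
      ¬F i q = not-intro (trans (F-clsE (r i)) (F-∉ (r~ i) q))

      chkE-true : ∀ m → (∀ i → r (suc m + i) ≡ r i) → ∀ i → chkE (c (2 + i)) (c (1 + i)) (c i) (c (m + i)) ≡ true
      chkE-true m wrap i = ⇒ᵇ-intro λ z → let e = Z⇒ i z in
        ∧-intro (¬F (2 + i) (∉₂ i e)) (∧-intro (¬F (1 + i) (Facing.y∉ (fac i e)))
          (¬F (m + i) (∉₋ (m + i) (subst (λ y → E′ v y ≡ true) (symm (wrap i)) e))))

      chain : ∀ i → E′ v (r i) ≡ true → r (2 + i) ∋ v → r (2 + i) ∋ r (1 + i)
      chain i e m = coll2 (~sym (r~ (1 + i))) m (rr (1 + i)) (S-self _) (~≢ (r~ (2 + i))) (Facing.y6 (fac i e))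

    module _ (d7 : deg v ≡ 7) where
      private
        sep : ∀ i j → 0 < j → j < 7 → r i ≢ r (j + i)
        sep i j lt lt′ e = r-sep i j lt (subst (j <_) (symm d7) lt′) (trans e (cong r (+-comm j i)))
        wrap : ∀ i → r (7 + i) ≡ r i
        wrap i = trans (cong r (trans (+-comm 7 i) (cong (i +_) (symm d7)))) (r-shift i)
        cs : List Cl
        cs = map clsE (list 7)
        f-count : countL isF cs ≡ n5 v
        f-count = trans (countL-map clsE isF five F-clsE (list 7)) (symm (trans (r-count five) (cong (λ z → countL five (list z)) d7)))
        z-count : countL isZ cs ≡ k v
        z-count = trans (countL-Z (list 7) (list-nbr 7)) (symm (trans (r-count (E′ v)) (cong (λ z → countL (E′ v) (list z)) d7)))

        -- Deleting the common corner collects both hubs, then the two outer corners, then `v`. That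
        -- makes six, so the set is known completely and any further member is a contradiction.
        consecutive : ∀ i → E′ v (r i) ≡ true → E′ v (r (1 + i)) ≡ true → ∀ q → r (1 + i) ∋ q →
          q ∈ r (1 + i) ∷ opp v (r i) ∷ opp v (r (1 + i)) ∷ r i ∷ r (2 + i) ∷ v ∷ []
        consecutive i e e′ q = exact u a (S-size y)
          where
          y = r (1 + i)
          f  = fac i e
          f′ = fac (1 + i) e′
          h  = opp v (r i)
          h′ = opp v y
          hx : h ~ r i
          hx = Facing.hx f
          hy : h ~ y
          hy = Facing.hy f
          h′y : h′ ~ y
          h′y = Facing.hx f′
          h′z : h′ ~ r (2 + i)
          h′z = Facing.hy f′
          off : ∀ {w} → v ~ w → h ≢ w
          off p refl = contra p (Facing.vh f)
          off′ : ∀ {w} → v ~ w → h′ ≢ w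
          off′ p refl = contra p (Facing.vh f′)
          e₁ : nx y h′ ≡ r (2 + i)
          e₁ = turn₂ {r (2 + i)} {y} (~sym (rr (1 + i)))
          e₂ : nx y (r (2 + i)) ≡ v
          e₂ = turn₂ {v} {y} (r~ (1 + i))
          e₃ : nx y v ≡ r i
          e₃ = turn₁ {v} {r i} (r~ i)
          four : iter (nx y) 4 h′ ≡ h
          four = cong (nx y) (trans (cong (nx y) (trans (cong (nx y) e₁) e₂)) e₃)
          -- Four steps of the rotation around `y` lead from `h′` to `h`, while `y` has at least
          -- five neighbours.
          h≢h′ : h ≢ h′
          h≢h′ eq = Ring.r-inj (fwd y) {h′} (~sym h′y) {0} {4} (s≤s z≤n) (deg≥5 (~sym h′y)) (trans (symm eq) (symm four))
          u : Unique (y ∷ h ∷ h′ ∷ r i ∷ r (2 + i) ∷ v ∷ [])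
          u = (≢sym (~≢ hy) ∷ ≢sym (~≢ h′y) ∷ ≢sym (~≢ (rr i)) ∷ ~≢ (rr (1 + i)) ∷ ≢sym (~≢ (r~ (1 + i))) ∷ [])
            ∷ (h≢h′ ∷ off (r~ i) ∷ off (r~ (2 + i)) ∷ Facing.h≢v f ∷ [])
            ∷ (off′ (r~ i) ∷ off′ (r~ (2 + i)) ∷ Facing.h≢v f′ ∷ [])
            ∷ (sep i 2 (s≤s z≤n) (s≤s (s≤s (s≤s z≤n))) ∷ ≢sym (~≢ (r~ i)) ∷ []) ∷ (≢sym (~≢ (r~ (2 + i))) ∷ []) ∷ [] ∷ []
          m₁ : y ∋ h
          m₁ = coll1 hy (S-self y) (Facing.h5 f)
          m₂ : y ∋ h′
          m₂ = coll1 h′y (S-self y) (Facing.h5 f′)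
          m₃ : y ∋ r i
          m₃ = coll2 (rr i) (S-self y) (~sym hx) m₁ (≢sym (~≢ hy)) (Facing.x6 f)
          m₄ : y ∋ r (2 + i)
          m₄ = coll2 (~sym (rr (1 + i))) (S-self y) (~sym h′z) m₂ (≢sym (~≢ h′y)) (Facing.y6 f′)
          m₅ : y ∋ v
          m₅ = coll3 (r~ (1 + i)) (S-self y) (r~ i) m₃ (r~ (2 + i)) m₄ (≢sym (~≢ (rr i))) (~≢ (rr (1 + i)))
                 (sep i 2 (s≤s z≤n) (s≤s (s≤s (s≤s z≤n)))) (≤-reflexive d7)
          a : All (y ∋_) (y ∷ h ∷ h′ ∷ r i ∷ r (2 + i) ∷ v ∷ [])
          a = S-self y ∷ m₁ ∷ m₂ ∷ m₃ ∷ m₄ ∷ m₅ ∷ []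

        extra : ∀ i → E′ v (r i) ≡ true → E′ v (r (1 + i)) ≡ true → ∀ q → r (1 + i) ∋ q → v ~ q →
          q ≢ r i → q ≢ r (1 + i) → q ≢ r (2 + i) → ⊥
        extra i e e′ q m vq n₀ n₁ n₂ = go (consecutive i e e′ q m)
          where
          off : ∀ {h} → adj G v h ≡ false → q ≢ h
          off p z = contra (subst (v ~_) z vq) p
          go : q ∈ r (1 + i) ∷ opp v (r i) ∷ opp v (r (1 + i)) ∷ r i ∷ r (2 + i) ∷ v ∷ [] → ⊥
          go (here x) = n₁ x
          go (there (here x)) = off (Facing.vh (fac i e)) x
          go (there (there (here x))) = off (Facing.vh (fac (1 + i) e′)) x
          go (there (there (there (here x)))) = n₀ x
          go (there (there (there (there (here x))))) = n₂ x
          go (there (there (there (there (there (here x)))))) = ~≢ vq (symm x)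

        v∈ : ∀ i → E′ v (r i) ≡ true → E′ v (r (1 + i)) ≡ true → r (1 + i) ∋ r (2 + i) × r (1 + i) ∋ v
        v∈ i e e′ = z , coll3 (r~ (1 + i)) (S-self _) (r~ i) x (r~ (2 + i)) z (≢sym (~≢ (rr i))) (~≢ (rr (1 + i)))
                 (sep i 2 (s≤s z≤n) (s≤s (s≤s (s≤s z≤n)))) (≤-reflexive d7)
          where
          f  = fac i e
          f′ = fac (1 + i) e′
          x = coll2 (rr i) (S-self _) (~sym (Facing.hx f)) (coll1 (Facing.hy f) (S-self _) (Facing.h5 f)) (≢sym (~≢ (Facing.hy f))) (Facing.x6 f)
          z = coll2 (~sym (rr (1 + i))) (S-self _) (~sym (Facing.hy f′)) (coll1 (Facing.hx f′) (S-self _) (Facing.h5 f′)) (≢sym (~≢ (Facing.hx f′))) (Facing.y6 f′)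

        any-bad : ∀ i → E′ v (r i) ≡ true → E′ v (r (1 + i)) ≡ true → 1 ≤ n5 v → ⊥
        any-bad i e e′ ge with n5-elems v 1 ge
        ... | f ∷ _ , _ , (vf , f5) ∷ _ , _ = extra i e e′ f (coll1 (~sym vf) (proj₂ (v∈ i e e′)) f5) vf
              (λ { refl → contra (F-in vf f5) (Facing.x∉ (fac i e)) })
              (λ { refl → contra (F-in vf f5) (Facing.y∉ (fac i e)) })
              (λ { refl → contra (F-in vf f5) (Facing.y∉ (fac (1 + i) e′)) })

        -- The far end of the third edge has degree at most 6 and loses both `v` and `r (2 + i)`, so
        -- it would be a seventh member.
        triple-bad : ∀ i → E′ v (r i) ≡ true → E′ v (r (1 + i)) ≡ true → E′ v (r (2 + i)) ≡ true → ⊥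
        triple-bad i e e′ e″ = extra i e e′ (r (3 + i))
          (coll2 (~sym (rr (2 + i))) (proj₁ (v∈ i e e′)) (~sym (r~ (3 + i))) (proj₂ (v∈ i e e′)) (≢sym (~≢ (r~ (2 + i)))) (Facing.y6 (fac (2 + i) e″)))
          (r~ (3 + i)) (≢sym (sep i 3 (s≤s z≤n) (s≤s (s≤s (s≤s (s≤s z≤n)))))) (≢sym (sep (1 + i) 2 (s≤s z≤n) (s≤s (s≤s (s≤s z≤n))))) (≢sym (~≢ (rr (2 + i))))

        -- Deleting `t` runs through the three vertices of degree 5, then takes `v`, then
        -- `r (1 + i)` and finally the hub: seven in all.
        run-bad : ∀ i → E′ v (r i) ≡ true → deg (r (3 + i)) ≤ 5 → deg (r (4 + i)) ≤ 5 → deg (r (5 + i)) ≤ 5 → ⊥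
        run-bad i e f₃ f₄ f₅ = over u (S-self t ∷ m₃ ∷ m₄ ∷ m₅ ∷ m₁ ∷ mv ∷ mh ∷ []) ≤-refl
          where
          t = r (2 + i)
          h = opp v (r i)
          f = fac i e
          m₃ : t ∋ r (3 + i)
          m₃ = coll1 (~sym (rr (2 + i))) (S-self t) f₃
          m₄ : t ∋ r (4 + i)
          m₄ = coll1 (~sym (rr (3 + i))) m₃ f₄
          m₅ : t ∋ r (5 + i)
          m₅ = coll1 (~sym (rr (4 + i))) m₄ f₅
          mv : t ∋ v
          mv = coll3 (r~ (2 + i)) (S-self t) (r~ (3 + i)) m₃ (r~ (4 + i)) m₄ (~≢ (rr (2 + i)))
                 (sep (2 + i) 2 (s≤s z≤n) (s≤s (s≤s (s≤s z≤n)))) (~≢ (rr (3 + i))) (≤-reflexive d7)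
          m₁ : t ∋ r (1 + i)
          m₁ = chain i e mv
          mh : t ∋ h
          mh = coll1 (Facing.hy f) m₁ (Facing.h5 f)
          off : ∀ {w} → v ~ w → w ≢ h
          off p refl = contra p (Facing.vh f)
          s₂ : ∀ j → r j ≢ r (2 + j)
          s₂ j = sep j 2 (s≤s z≤n) (s≤s (s≤s (s≤s z≤n)))
          s₃ : ∀ j → r j ≢ r (3 + j)
          s₃ j = sep j 3 (s≤s z≤n) (s≤s (s≤s (s≤s (s≤s z≤n))))
          u : Unique (t ∷ r (3 + i) ∷ r (4 + i) ∷ r (5 + i) ∷ r (1 + i) ∷ v ∷ h ∷ [])
          u = (~≢ (rr (2 + i)) ∷ s₂ (2 + i) ∷ s₃ (2 + i) ∷ ≢sym (~≢ (rr (1 + i))) ∷ ≢sym (~≢ (r~ (2 + i))) ∷ off (r~ (2 + i)) ∷ [])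
            ∷ (~≢ (rr (3 + i)) ∷ s₂ (3 + i) ∷ ≢sym (s₂ (1 + i)) ∷ ≢sym (~≢ (r~ (3 + i))) ∷ off (r~ (3 + i)) ∷ [])
            ∷ (~≢ (rr (4 + i)) ∷ ≢sym (s₃ (1 + i)) ∷ ≢sym (~≢ (r~ (4 + i))) ∷ off (r~ (4 + i)) ∷ [])
            ∷ (≢sym (sep (1 + i) 4 (s≤s z≤n) (s≤s (s≤s (s≤s (s≤s (s≤s z≤n)))))) ∷ ≢sym (~≢ (r~ (5 + i))) ∷ off (r~ (5 + i)) ∷ [])
            ∷ (≢sym (~≢ (r~ (1 + i))) ∷ off (r~ (1 + i)) ∷ []) ∷ (≢sym (Facing.h≢v f) ∷ []) ∷ [] ∷ []

        chk7-true : ∀ i → chk7 (1 ≤ᵇ countL isF cs) (c (6 + i)) (c (5 + i)) (c (4 + i)) (c (3 + i)) (c (2 + i)) (c (1 + i)) (c i) ≡ true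
        chk7-true i = ∧-intro (chkE-true 6 wrap i) (∧-intro (not-intro (≢true ee)) (not-intro (≢true fff)))
          where
          ee : isZ (c i) ∧ (isZ (c (1 + i)) ∧ ((1 ≤ᵇ countL isF cs) ∨ isZ (c (2 + i)))) ≢ true
          ee q with ∧-elim {isZ (c i)} q
          ... | z₀ , q′ with ∧-elim {isZ (c (1 + i))} q′
          ...   | z₁ , q″ with ∨-elim {1 ≤ᵇ countL isF cs} q″
          ...     | inj₁ a = any-bad i (Z⇒ i z₀) (Z⇒ (1 + i) z₁) (subst (1 ≤_) f-count (≤ᵇ⇒ a))
          ...     | inj₂ z₂ = triple-bad i (Z⇒ i z₀) (Z⇒ (1 + i) z₁) (Z⇒ (2 + i) z₂)
          fff : isZ (c i) ∧ (isF (c (3 + i)) ∧ (isF (c (4 + i)) ∧ isF (c (5 + i)))) ≢ true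
          fff q with ∧-elim {isZ (c i)} q
          ... | z₀ , q′ with ∧-elim {isF (c (3 + i))} q′
          ...   | a , q″ with ∧-elim {isF (c (4 + i))} q″
          ...     | b , d = run-bad i (Z⇒ i z₀) (F⇒ (3 + i) a) (F⇒ (4 + i) b) (F⇒ (5 + i) d)

      bound7 : tab7 (n5 v) (k v) ≡ true
      bound7 = subst₂ (λ a b → tab7 a b ≡ true) f-count z-count (Wrap7.tab7-true c (λ i → cong clsE (wrap i)) chk7-true)

    module _ (d8 : deg v ≡ 8) where
      private
        sep : ∀ i j → 0 < j → j < 8 → r i ≢ r (j + i)
        sep i j lt lt′ e = r-sep i j lt (subst (j <_) (symm d8) lt′) (trans e (cong r (+-comm j i)))
        wrap : ∀ i → r (8 + i) ≡ r i
        wrap i = trans (cong r (trans (+-comm 8 i) (cong (i +_) (symm d8)))) (r-shift i)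
        cs : List Cl
        cs = map clsE (list 8)
        f-count : countL isF cs ≡ n5 v
        f-count = trans (countL-map clsE isF five F-clsE (list 8)) (symm (trans (r-count five) (cong (λ z → countL five (list z)) d8)))
        z-count : countL isZ cs ≡ k v
        z-count = trans (countL-Z (list 8) (list-nbr 8)) (symm (trans (r-count (E′ v)) (cong (λ z → countL (E′ v) (list z)) d8)))

        -- At degree 8 four lost neighbours are needed for `v`; with a run of four, the vertices `v`
        -- and `r (1 + i)` bring the total to seven.
        run-bad : ∀ i → E′ v (r i) ≡ true → deg (r (3 + i)) ≤ 5 → deg (r (4 + i)) ≤ 5 → deg (r (5 + i)) ≤ 5 → deg (r (6 + i)) ≤ 5 → ⊥
        run-bad i e f₃ f₄ f₅ f₆ = over u (S-self t ∷ m₃ ∷ m₄ ∷ m₅ ∷ m₆ ∷ chain i e mv ∷ mv ∷ []) ≤-refl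
          where
          t = r (2 + i)
          m₃ : t ∋ r (3 + i)
          m₃ = coll1 (~sym (rr (2 + i))) (S-self t) f₃
          m₄ : t ∋ r (4 + i)
          m₄ = coll1 (~sym (rr (3 + i))) m₃ f₄
          m₅ : t ∋ r (5 + i)
          m₅ = coll1 (~sym (rr (4 + i))) m₄ f₅
          m₆ : t ∋ r (6 + i)
          m₆ = coll1 (~sym (rr (5 + i))) m₅ f₆
          s₂ : ∀ j → r j ≢ r (2 + j)
          s₂ j = sep j 2 (s≤s z≤n) (s≤s (s≤s (s≤s z≤n)))
          s₃ : ∀ j → r j ≢ r (3 + j)
          s₃ j = sep j 3 (s≤s z≤n) (s≤s (s≤s (s≤s (s≤s z≤n))))
          s₄ : ∀ j → r j ≢ r (4 + j)
          s₄ j = sep j 4 (s≤s z≤n) (s≤s (s≤s (s≤s (s≤s (s≤s z≤n)))))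
          mv : t ∋ v
          mv = coll ((~≢ (rr (2 + i)) ∷ s₂ (2 + i) ∷ s₃ (2 + i) ∷ []) ∷ (~≢ (rr (3 + i)) ∷ s₂ (3 + i) ∷ []) ∷ (~≢ (rr (4 + i)) ∷ []) ∷ [] ∷ [])
                 ((r~ (2 + i) , S-self t) ∷ (r~ (3 + i) , m₃) ∷ (r~ (4 + i) , m₄) ∷ (r~ (5 + i) , m₅) ∷ []) (≤-reflexive d8)
          u : Unique (t ∷ r (3 + i) ∷ r (4 + i) ∷ r (5 + i) ∷ r (6 + i) ∷ r (1 + i) ∷ v ∷ [])
          u = (~≢ (rr (2 + i)) ∷ s₂ (2 + i) ∷ s₃ (2 + i) ∷ s₄ (2 + i) ∷ ≢sym (~≢ (rr (1 + i))) ∷ ≢sym (~≢ (r~ (2 + i))) ∷ [])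
            ∷ (~≢ (rr (3 + i)) ∷ s₂ (3 + i) ∷ s₃ (3 + i) ∷ ≢sym (s₂ (1 + i)) ∷ ≢sym (~≢ (r~ (3 + i))) ∷ [])
            ∷ (~≢ (rr (4 + i)) ∷ s₂ (4 + i) ∷ ≢sym (s₃ (1 + i)) ∷ ≢sym (~≢ (r~ (4 + i))) ∷ [])
            ∷ (~≢ (rr (5 + i)) ∷ ≢sym (s₄ (1 + i)) ∷ ≢sym (~≢ (r~ (5 + i))) ∷ [])
            ∷ (≢sym (sep (1 + i) 5 (s≤s z≤n) (s≤s (s≤s (s≤s (s≤s (s≤s (s≤s z≤n))))))) ∷ ≢sym (~≢ (r~ (6 + i))) ∷ [])
            ∷ (≢sym (~≢ (r~ (1 + i))) ∷ []) ∷ [] ∷ []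

        chk8-true : ∀ i → chk8 (c (7 + i)) (c (6 + i)) (c (5 + i)) (c (4 + i)) (c (3 + i)) (c (2 + i)) (c (1 + i)) (c i) ≡ true
        chk8-true i = ∧-intro (chkE-true 7 wrap i) (not-intro (≢true ffff))
          where
          ffff : isZ (c i) ∧ (isF (c (3 + i)) ∧ (isF (c (4 + i)) ∧ (isF (c (5 + i)) ∧ isF (c (6 + i))))) ≢ true
          ffff q with ∧-elim {isZ (c i)} q
          ... | z₀ , q₁ with ∧-elim {isF (c (3 + i))} q₁
          ...   | a , q₂ with ∧-elim {isF (c (4 + i))} q₂
          ...     | b , q₃ with ∧-elim {isF (c (5 + i))} q₃
          ...       | d , e = run-bad i (Z⇒ i z₀) (F⇒ (3 + i) a) (F⇒ (4 + i) b) (F⇒ (5 + i) d) (F⇒ (6 + i) e)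

      bound8 : tab8 (n5 v) (k v) ≡ true
      bound8 = subst₂ (λ a b → tab8 a b ≡ true) f-count z-count (Wrap8.tab8-true c (λ i → cong clsE (wrap i)) chk8-true)

    -- The round is started at an edge facing a hub, so that `Spread` finds three places free of
    -- both kinds.
    bound9 : 1 ≤ n5 v → 1 ≤ k v → k v + n5 v + 3 ≤ deg v
    bound9 f≥1 k≥1 with #-elems 1 (λ x → adj G v x ∧ E′ v x) k≥1
    ... | x ∷ _ , _ , q ∷ _ , _ = go (deg v) refl
      where
      vx = proj₁ (∧-elim {adj G v x} q)
      module R = Ring (fwd v) vx
      module N = Near vx
      e f : ℕ → Bool
      e i = E′ v (R.r i)
      f i = five (R.r i)
      module Sp = Spread e f (proj₂ (∧-elim {adj G v x} q))
        (λ i t → F-∉ (R.r~ i) (Facing.x∉ (N.fac i t))) (λ i t → F-∉ (R.r~ (1 + i)) (Facing.y∉ (N.fac i t)))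
        (λ i t → F-∉ (R.r~ (2 + i)) (N.∉₂ i t)) (λ i t → ≢true λ t′ → contra t (F-∉ (R.r~ i) (N.∉₋ i t′)))
      same : ∀ p m → Sp.cnt (λ i → p (R.r i)) m ≡ countL p (R.list m)
      same p zero    = refl
      same p (suc m) = cong ((if p (R.r m) then 1 else 0) +_) (same p m)
      cnt-f : Sp.cnt f (deg v) ≡ n5 v
      cnt-f = trans (same five (deg v)) (symm (R.r-count five))
      cnt-e : Sp.cnt e (deg v) ≡ k v
      cnt-e = trans (same (E′ v) (deg v)) (symm (R.r-count (E′ v)))
      go : ∀ d → d ≡ deg v → k v + n5 v + 3 ≤ deg v
      go zero    eq = ⊥-elim (n≮0 {6} (≤-trans v7 (≤-reflexive (symm eq))))
      go (suc m) eq = subst (λ z → z + 3 ≤ deg v) (cong₂ _+_ cnt-e cnt-f)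
          (subst (λ z → Sp.tot z + 3 ≤ z) eq (Sp.bound₃ m last (subst (λ z → 1 ≤ Sp.cnt f z) (symm eq) (subst (1 ≤_) (symm cnt-f) f≥1))))
        where
        -- Cyclically, place `m` comes just before place 0, where an edge faces a hub; this closes
        -- the gap after the last vertex of degree 5.
        last : f m ≡ false
        last = F-∉ (R.r~ m) (N.∉₋ m (subst (λ z → E′ v z ≡ true) (symm (trans (cong R.r eq) R.r-wrap)) (proj₂ (∧-elim {adj G v x} q))))

-- Bounding `k` by `d − a − 3` at 12 apiece removes it from the inequality; 324 is 360 - 36.
budget9 : ∀ c ex a k d → k + a + 3 ≤ d → (c * a + ex) + 324 ≤ 48 * d + 12 * a → (c * a + ex) + 12 * k + 360 ≤ 60 * d
budget9 c ex a k d le h = begin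
  (c * a + ex) + 12 * k + 360            ≡⟨ solve 2 (λ x y → x :+ con 12 :* y :+ con 360 := (x :+ con 324) :+ (con 12 :* y :+ con 36)) refl (c * a + ex) k ⟩
  ((c * a + ex) + 324) + (12 * k + 36)   ≤⟨ +-monoˡ-≤ (12 * k + 36) h ⟩
  (48 * d + 12 * a) + (12 * k + 36)      ≡⟨ solve 3 (λ x y z → (con 48 :* x :+ con 12 :* y) :+ (con 12 :* z :+ con 36) := con 48 :* x :+ con 12 :* (z :+ y :+ con 3)) refl d a k ⟩
  48 * d + 12 * (k + a + 3)              ≤⟨ +-monoʳ-≤ (48 * d) (*-monoʳ-≤ 12 le) ⟩
  48 * d + 12 * d                        ≡⟨ solve 1 (λ x → con 48 :* x :+ con 12 :* x := con 60 :* x) refl d ⟩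
  60 * d                                 ∎
  where
  open ≤-Reasoning
  open +-*-Solver

scale : ∀ {x a d} m → m ≤ d → (x ≤ᵇ 48 * m + 12 * a) ≡ true → x ≤ 48 * d + 12 * a
scale {x} {a} m le q = ≤-trans (≤ᵇ⇒ q) (+-monoˡ-≤ (12 * a) (*-monoʳ-≤ 48 le))

-- The link of a vertex of degree 5

module Geometry (St : Setting) where
  open Budget St public

  -- u has degree 5 and its neighbours in cyclic order are a, b, c, d, e
  record Pent⁺ (u a b c d e : Fin n) : Set where
    field
      u5 : deg u ≡ 5
      ua : u ~ a
      e₁ : nx u a ≡ b
      e₂ : nx u b ≡ c
      e₃ : nx u c ≡ d
      e₄ : nx u d ≡ e
      e₅ : nx u e ≡ a

  abstract
    rot⁺ : ∀ {u a b c d e} → Pent⁺ u a b c d e → Pent⁺ u b c d e a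
    rot⁺ p = record { u5 = u5 ; ua = subst (_ ~_) e₁ (nx-nbr ua) ; e₁ = e₂ ; e₂ = e₃ ; e₃ = e₄ ; e₄ = e₅ ; e₅ = e₁ }
      where
      open Pent⁺ p

    pent⁺ : ∀ {u x} → u ~ x → deg u ≤ 5 → ∃ λ b → ∃ λ c → ∃ λ d → ∃ λ e → Pent⁺ u x b c d e
    pent⁺ {u} {x} ux le = _ , _ , _ , _ , record
      { u5 = d5 ; ua = ux ; e₁ = refl ; e₂ = refl ; e₃ = refl ; e₄ = refl
      ; e₅ = trans (cong (λ z → iter (nx u) z x) (symm d5)) (Ring.r-wrap (fwd u) ux) }
      where
      d5 : deg u ≡ 5
      d5 = ≤-antisym le (deg≥5 ux)

  -- z is the third corner of a triangle on the edge xy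
  Fc : Fin n → Fin n → Fin n → Set
  Fc x y z = (z ≡ nx x y) ⊎ (z ≡ nx y x)

  Fc-swap : ∀ {x y z} → Fc x y z → Fc y x z
  Fc-swap (inj₁ e) = inj₂ e
  Fc-swap (inj₂ e) = inj₁ e

  Fc-rot : ∀ {x y z} → x ~ y → Fc x y z → Fc x z y
  Fc-rot p (inj₁ refl) = inj₂ (symm (turn₁ p))
  Fc-rot p (inj₂ refl) = inj₁ (symm (turn₂ (~sym p)))

  Fc-link : ∀ {x y z} → x ~ y → Fc x y z → y ~ z
  Fc-link p (inj₁ refl) = nx-link p
  Fc-link p (inj₂ refl) = pv-link p

  Fc-nbr : ∀ {x y z} → x ~ y → Fc x y z → x ~ z
  Fc-nbr p (inj₁ refl) = nx-nbr p
  Fc-nbr p (inj₂ refl) = pv-nbr p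

  -- `Pent⁺` without its orientation: triangles are recorded by `Fc`, so that configurations can be
  -- reflected by `mirror` as well as rotated.
  record Pent (u a b c d e : Fin n) : Set where
    field
      u5 : deg u ≡ 5
      ua : u ~ a
      ub : u ~ b
      uc : u ~ c
      ud : u ~ d
      ue : u ~ e
      fab : Fc u a b
      fbc : Fc u b c
      fcd : Fc u c d
      fde : Fc u d e
      fea : Fc u e a
      uniq : Unique (a ∷ b ∷ c ∷ d ∷ e ∷ [])
      all  : ∀ q → u ~ q → q ∈ a ∷ b ∷ c ∷ d ∷ e ∷ []
    ab = Fc-link ua fab
    bc = Fc-link ub fbc
    cd = Fc-link uc fcd
    de = Fc-link ud fde
    ea = Fc-link ue fea

  abstract
    pent : ∀ {u a b c d e} → Pent⁺ u a b c d e → Pent u a b c d e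
    pent {u} {a} p with Pent⁺.e₁ p | Pent⁺.e₂ p | Pent⁺.e₃ p | Pent⁺.e₄ p
    ... | refl | refl | refl | refl = record
      { u5 = u5 ; ua = ua ; ub = r~ 1 ; uc = r~ 2 ; ud = r~ 3 ; ue = r~ 4
      ; fab = inj₁ refl ; fbc = inj₁ refl ; fcd = inj₁ refl ; fde = inj₁ refl ; fea = inj₁ (symm e₅)
      ; uniq = (s {0} {1} (s≤s z≤n) (s≤s (s≤s z≤n)) ∷ s {0} {2} (s≤s z≤n) (s≤s (s≤s (s≤s z≤n))) ∷ s {0} {3} (s≤s z≤n) (s≤s (s≤s (s≤s (s≤s z≤n)))) ∷ s {0} {4} (s≤s z≤n) ≤-refl ∷ [])
          ∷ (s {1} {2} ≤-refl (s≤s (s≤s (s≤s z≤n))) ∷ s {1} {3} (s≤s (s≤s z≤n)) (s≤s (s≤s (s≤s (s≤s z≤n)))) ∷ s {1} {4} (s≤s (s≤s z≤n)) ≤-refl ∷ [])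
          ∷ (s {2} {3} ≤-refl (s≤s (s≤s (s≤s (s≤s z≤n)))) ∷ s {2} {4} (s≤s (s≤s (s≤s z≤n))) ≤-refl ∷ []) ∷ (s {3} {4} ≤-refl ≤-refl ∷ []) ∷ [] ∷ []
      ; all = λ q uq → rev (subst (λ z → q ∈ list z) u5 (r-all q uq)) }
      where
      open Pent⁺ p
      open Ring (fwd u) ua
      s : ∀ {i j} → i < j → j < 5 → r i ≢ r j
      s lt lt′ = r-inj lt (subst (_ <_) (symm u5) lt′)
      rev : ∀ {q} → q ∈ list 5 → q ∈ r 0 ∷ r 1 ∷ r 2 ∷ r 3 ∷ r 4 ∷ []
      rev (here x) = there (there (there (there (here x))))
      rev (there (here x)) = there (there (there (here x)))
      rev (there (there (here x))) = there (there (here x))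
      rev (there (there (there (here x)))) = there (here x)
      rev (there (there (there (there (here x))))) = here x

    rot : ∀ {u a b c d e} → Pent u a b c d e → Pent u b c d e a
    rot {u} {a} {b} {c} {d} {e} p = record
      { u5 = u5 ; ua = ub ; ub = uc ; uc = ud ; ud = ue ; ue = ua ; fab = fbc ; fbc = fcd ; fcd = fde ; fde = fea ; fea = fab
      ; uniq = un uniq ; all = λ q uq → re (all q uq) }
      where
      open Pent p
      un : Unique (a ∷ b ∷ c ∷ d ∷ e ∷ []) → Unique (b ∷ c ∷ d ∷ e ∷ a ∷ [])
      un ((x₁ ∷ x₂ ∷ x₃ ∷ x₄ ∷ []) ∷ (y₁ ∷ y₂ ∷ y₃ ∷ []) ∷ (z₁ ∷ z₂ ∷ []) ∷ (w ∷ []) ∷ _) =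
        (y₁ ∷ y₂ ∷ y₃ ∷ ≢sym x₁ ∷ []) ∷ (z₁ ∷ z₂ ∷ ≢sym x₂ ∷ []) ∷ (w ∷ ≢sym x₃ ∷ []) ∷ (≢sym x₄ ∷ []) ∷ [] ∷ []
      re : ∀ {q} → q ∈ a ∷ b ∷ c ∷ d ∷ e ∷ [] → q ∈ b ∷ c ∷ d ∷ e ∷ a ∷ []
      re (here x) = there (there (there (there (here x))))
      re (there (here x)) = here x
      re (there (there (here x))) = there (here x)
      re (there (there (there (here x)))) = there (there (here x))
      re (there (there (there (there (here x))))) = there (there (there (here x)))

    mirror : ∀ {u a b c d e} → Pent u a b c d e → Pent u e d c b a
    mirror {u} {a} {b} {c} {d} {e} p = record
      { u5 = u5 ; ua = ue ; ub = ud ; uc = uc ; ud = ub ; ue = ua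
      ; fab = Fc-rot ud fde ; fbc = Fc-rot uc fcd ; fcd = Fc-rot ub fbc ; fde = Fc-rot ua fab ; fea = Fc-rot ue fea
      ; uniq = un uniq ; all = λ q uq → re (all q uq) }
      where
      open Pent p
      un : Unique (a ∷ b ∷ c ∷ d ∷ e ∷ []) → Unique (e ∷ d ∷ c ∷ b ∷ a ∷ [])
      un ((x₁ ∷ x₂ ∷ x₃ ∷ x₄ ∷ []) ∷ (y₁ ∷ y₂ ∷ y₃ ∷ []) ∷ (z₁ ∷ z₂ ∷ []) ∷ (w ∷ []) ∷ _) =
        (≢sym w ∷ ≢sym z₂ ∷ ≢sym y₃ ∷ ≢sym x₄ ∷ []) ∷ (≢sym z₁ ∷ ≢sym y₂ ∷ ≢sym x₃ ∷ []) ∷ (≢sym y₁ ∷ ≢sym x₂ ∷ []) ∷ (≢sym x₁ ∷ []) ∷ [] ∷ []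
      re : ∀ {q} → q ∈ a ∷ b ∷ c ∷ d ∷ e ∷ [] → q ∈ e ∷ d ∷ c ∷ b ∷ a ∷ []
      re (here x) = there (there (there (there (here x))))
      re (there (here x)) = there (there (there (here x)))
      re (there (there (here x))) = there (there (here x))
      re (there (there (there (here x)))) = there (here x)
      re (there (there (there (there (here x))))) = here x

  no-3-cycle : ∀ {c x y z} → c ~ x → nx c x ≡ y → nx c y ≡ z → nx c z ≢ x
  no-3-cycle {c} {x} cx refl refl e = Ring.r-inj (fwd c) cx {0} {3} (s≤s z≤n) (≤-trans (s≤s (s≤s (s≤s (s≤s z≤n)))) (deg≥5 cx)) (symm e)

  module Opp {u a b c d e} (p : Pent⁺ u a b c d e) where
    open Pent⁺ p
    private
      ub = Pent⁺.ua (rot⁺ p)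
      uc = Pent⁺.ua (rot⁺ (rot⁺ p))
      ud = Pent⁺.ua (rot⁺ (rot⁺ (rot⁺ p)))
      ue = Pent⁺.ua (rot⁺ (rot⁺ (rot⁺ (rot⁺ p))))
      un = Pent.uniq (pent p)

    -- rotation around each neighbour, read off the triangles at u
    aft : ∀ {x y} → u ~ x → nx u x ≡ y → nx x y ≡ u
    aft ux refl = turn₂ ux

    bef : ∀ {x y} → u ~ x → nx u x ≡ y → nx y u ≡ x
    bef ux refl = turn₁ ux

    y : Fin n
    y = nx b a

    ba : b ~ a
    ba = ~sym (Pent.ab (pent p))

    yb : b ~ y
    yb = nx-nbr ba

    ya : a ~ y
    ya = nx-link ba

    nx-yb : nx y b ≡ a
    nx-yb = turn₁ ba

    opp-yb : opp y b ≡ u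
    opp-yb = trans (cong (λ z → nx z b) nx-yb) (aft ua e₁)

    y≢u : y ≢ u
    y≢u eq = Ring.r-inj (fwd b) (~sym ub) {0} {2} (s≤s z≤n) (≤-trans (s≤s (s≤s (s≤s z≤n))) (deg≥5 ba))
               (symm (trans (cong (nx b) (bef ua e₁)) eq))

    y≢c : y ≢ c
    y≢c eq = no-3-cycle (~sym ub) (bef ua e₁) eq (aft ub e₂)

    y≢e : y ≢ e
    y≢e eq = no-3-cycle {a} {e} (~sym (Pent.ea (pent p)) ) (trans (cong (nx a) (symm eq)) (turn₂ ba)) (aft ua e₁) (bef ue e₅)

    module _ (d6 : deg d ≤ 6) where
      private
        -- Around `d` the rotation would read `e`, `u`, `c` and later `b`, `a`. With at most six
        -- places, either `b` follows `c` directly or `a` precedes `e` directly, giving `c` or `e`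
        -- degree 3, or `a` and `e` coincide.
        split : y ≡ d → ⊥
        split eq = go (Ring.r-some (fwd d) de b db)
          where
          de : d ~ e
          de = Pent.de (pent p)
          db : d ~ b
          db = ~sym (subst (b ~_) eq yb)
          da : nx d b ≡ a
          da = trans (cong (λ z → nx z b) (symm eq)) nx-yb
          open Ring (fwd d) de
          r₁ : r 1 ≡ u
          r₁ = aft ud e₄
          r₂ : r 2 ≡ c
          r₂ = trans (cong (nx d) r₁) (bef uc e₃)
          ne : Unique (a ∷ b ∷ c ∷ d ∷ e ∷ []) → (a ≢ e) × (b ≢ e) × (b ≢ c)
          ne ((_ ∷ _ ∷ _ ∷ x ∷ []) ∷ (z ∷ _ ∷ w ∷ []) ∷ _) = x , w , z
          at₃ : b ≡ r 3 → ⊥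
          at₃ q = no-3-cycle {c} {b} (~sym (Pent.bc (pent p))) cb (aft uc e₃) (bef ub e₂)
            where
            cb : nx c b ≡ d
            cb = trans (cong (nx c) (trans q (cong (nx d) r₂))) (turn₂ (~sym (Pent.cd (pent p))))
          at₄ : deg d ≡ 6 → b ≡ r 4 → ⊥
          at₄ q q′ = no-3-cycle (Pent.ea (pent p)) (aft ue e₅) (bef ud e₄) ed
            where
            da′ : nx d a ≡ e
            da′ = trans (cong (nx d) (trans (symm da) (cong (nx d) q′))) (trans (cong r (symm q)) r-wrap)
            ed : nx e d ≡ a
            ed = trans (cong (λ z → nx z d) (symm da′)) (turn₁ (subst (_~ a) eq (~sym ya)))
          wraps : ∀ i → deg d ≡ suc i → b ≡ r i → ⊥
          wraps i q q′ = proj₁ (ne un) (trans (symm da) (trans (cong (nx d) q′) (trans (cong r (symm q)) r-wrap)))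
          go : (∃ λ i → (i < deg d) × (b ≡ r i)) → ⊥
          go (0 , _ , q) = proj₁ (proj₂ (ne un)) q
          go (1 , _ , q) = ~≢ ub (symm (trans q r₁))
          go (2 , _ , q) = proj₂ (proj₂ (ne un)) (trans q r₂)
          go (3 , _ , q) = at₃ q
          go (4 , lt , q) with m≤n⇒m<n∨m≡n lt
          ... | inj₂ eq₅ = wraps 4 (symm eq₅) q
          ... | inj₁ lt₅ = at₄ (≤-antisym d6 lt₅) q
          go (5 , lt , q) = wraps 5 (≤-antisym d6 lt) q
          go (suc (suc (suc (suc (suc (suc i))))) , lt , q) = 1+n≰n {6} (≤-trans (m≤m+n 7 i) (≤-trans lt d6))

      abstract
        out : y ∉ u ∷ a ∷ b ∷ c ∷ d ∷ e ∷ []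
        out (here q) = y≢u q
        out (there (here q)) = ~≢ ya (symm q)
        out (there (there (here q))) = ~≢ yb (symm q)
        out (there (there (there (here q)))) = y≢c q
        out (there (there (there (there (here q))))) = split q
        out (there (there (there (there (there (here q)))))) = y≢e q

    -- Around `a` stand `b`, `u`, `e` and two further vertices. Inside the wheel these could only be
    -- `c` and `d` in this order, but `nx c d` is `u`, not `a`.
    outside : deg a ≤ 5 → ¬ (∀ q → a ~ q → q ∈ u ∷ a ∷ b ∷ c ∷ d ∷ e ∷ [])
    outside a5 h = go (h A (r~ 3)) (h B (r~ 4))
      where
      ab : a ~ b
      ab = Pent.ab (pent p)
      d5 : deg a ≡ 5
      d5 = ≤-antisym a5 (deg≥5 ab)
      open Ring (fwd a) ab
      A = r 3
      B = r 4
      s : ∀ {i j} → i < j → j < 5 → r i ≢ r j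
      s lt lt′ = r-inj lt (subst (_ <_) (symm d5) lt′)
      r₁ : r 1 ≡ u
      r₁ = aft ua e₁
      r₂ : r 2 ≡ e
      r₂ = trans (cong (nx a) r₁) (bef ue e₅)
      Bb : nx a B ≡ b
      Bb = trans (cong r (symm d5)) r-wrap
      B≡y : y ≡ B
      B≡y = trans (cong (λ z → nx z a) (symm Bb)) (turn₁ (r~ 4))
      ends : A ≡ c → B ≡ d → ⊥
      ends ac bd = ~≢ ua (symm (trans (symm ca) (aft uc e₃)))
        where
        ca : nx c d ≡ a
        ca = trans (cong (nx c) (trans (symm bd) (cong (nx a) ac))) (turn₂ (subst (a ~_) ac (r~ 3)))
      goB : A ≡ c → B ∈ u ∷ a ∷ b ∷ c ∷ d ∷ e ∷ [] → ⊥
      goB ac (here q) = s {1} {4} (s≤s (s≤s z≤n)) ≤-refl (trans r₁ (symm q))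
      goB ac (there (here q)) = ~≢ (r~ 4) (symm q)
      goB ac (there (there (here q))) = s {0} {4} (s≤s z≤n) ≤-refl (symm q)
      goB ac (there (there (there (here q)))) = y≢c (trans B≡y q)
      goB ac (there (there (there (there (here q))))) = ends ac q
      goB ac (there (there (there (there (there (here q)))))) = s {2} {4} (s≤s (s≤s (s≤s z≤n))) ≤-refl (trans r₂ (symm q))
      goD : A ≡ d → B ∈ u ∷ a ∷ b ∷ c ∷ d ∷ e ∷ [] → ⊥
      goD ad (here q) = s {1} {4} (s≤s (s≤s z≤n)) ≤-refl (trans r₁ (symm q))
      goD ad (there (here q)) = ~≢ (r~ 4) (symm q)
      goD ad (there (there (here q))) = s {0} {4} (s≤s z≤n) ≤-refl (symm q)
      goD ad (there (there (there (here q)))) = y≢c (trans B≡y q)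
      goD ad (there (there (there (there (here q))))) = s {3} {4} ≤-refl ≤-refl (trans ad (symm q))
      goD ad (there (there (there (there (there (here q)))))) = s {2} {4} (s≤s (s≤s (s≤s z≤n))) ≤-refl (trans r₂ (symm q))
      go : A ∈ u ∷ a ∷ b ∷ c ∷ d ∷ e ∷ [] → B ∈ u ∷ a ∷ b ∷ c ∷ d ∷ e ∷ [] → ⊥
      go (here q) _ = s {1} {3} (s≤s (s≤s z≤n)) (s≤s (s≤s (s≤s (s≤s z≤n)))) (trans r₁ (symm q))
      go (there (here q)) _ = ~≢ (r~ 3) (symm q)
      go (there (there (here q))) _ = s {0} {3} (s≤s z≤n) (s≤s (s≤s (s≤s (s≤s z≤n)))) (symm q)
      go (there (there (there (here q)))) m = goB q m
      go (there (there (there (there (here q))))) m = goD q m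
      go (there (there (there (there (there (here q)))))) _ = s {2} {3} ≤-refl (s≤s (s≤s (s≤s (s≤s z≤n)))) (trans r₂ (symm q))

  abstract
    full-nbr : ∀ {u f} → u ~ f → deg u ≤ 5 → deg f ≤ 5 → ¬ (∀ q → f ~ q → (q ≡ u) ⊎ (u ~ q))
    full-nbr {u} {f} uf u5 f5 h with pent⁺ uf u5
    ... | b , c , d , e , p = Opp.outside p f5 λ q fq → place q (h q fq)
      where
      place : ∀ q → (q ≡ u) ⊎ (u ~ q) → q ∈ u ∷ f ∷ b ∷ c ∷ d ∷ e ∷ []
      place q (inj₁ refl) = here refl
      place q (inj₂ uq)   = there (Pent.all (pent p) q uq)

    spread : ∀ {s u x y} → s ∋ u → s ∋ x → u ~ x → Fc u x y → deg y ≤ 6 → s ∋ y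
    spread mu mx ux f y6 = coll2 (~sym (Fc-nbr ux f)) mu (~sym (Fc-link ux f)) mx (~≢ ux) y6

  module Quad {u a b c d e} (p : Pent u a b c d e) (a6 : deg a ≤ 6) (b6 : deg b ≤ 6) (c6 : deg c ≤ 6) (d6 : deg d ≤ 6) where
    open Pent p
    abstract
      -- With `u` gone, collecting passes between consecutive small neighbours, each losing `u` and
      -- the previous one; the path `a`, `b`, `c`, `d` is swept whatever the start.
      quad : ∀ {s x} → s ∋ u → s ∋ x → x ∈ a ∷ b ∷ c ∷ d ∷ e ∷ [] → (s ∋ a) × (s ∋ b) × (s ∋ c) × (s ∋ d)
      quad {s} mu mx i = from i mx
        where
        ba′ : s ∋ b → s ∋ a
        ba′ m = spread mu m ub (Fc-rot ua fab) a6
        ab′ : s ∋ a → s ∋ b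
        ab′ m = spread mu m ua fab b6
        bc′ : s ∋ b → s ∋ c
        bc′ m = spread mu m ub fbc c6
        cb′ : s ∋ c → s ∋ b
        cb′ m = spread mu m uc (Fc-rot ub fbc) b6
        cd′ : s ∋ c → s ∋ d
        cd′ m = spread mu m uc fcd d6
        dc′ : s ∋ d → s ∋ c
        dc′ m = spread mu m ud (Fc-rot uc fcd) c6
        ea′ : s ∋ e → s ∋ a
        ea′ m = spread mu m ue fea a6
        fa : s ∋ a → (s ∋ a) × (s ∋ b) × (s ∋ c) × (s ∋ d)
        fa m = m , ab′ m , bc′ (ab′ m) , cd′ (bc′ (ab′ m))
        from : ∀ {x} → x ∈ a ∷ b ∷ c ∷ d ∷ e ∷ [] → s ∋ x → (s ∋ a) × (s ∋ b) × (s ∋ c) × (s ∋ d)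
        from (here refl) m = fa m
        from (there (here refl)) m = fa (ba′ m)
        from (there (there (here refl))) m = fa (ba′ (cb′ m))
        from (there (there (there (here refl)))) m = fa (ba′ (cb′ (dc′ m)))
        from (there (there (there (there (here refl))))) m = fa (ea′ m)

      e∋u : e ∋ u
      e∋u = F-in (~sym ue) (≤-reflexive u5)

      members : All (e ∋_) (u ∷ a ∷ b ∷ c ∷ d ∷ e ∷ [])
      members with quad e∋u (S-self e) (there (there (there (there (here refl)))))
      ... | ma , mb , mc , md = e∋u ∷ ma ∷ mb ∷ mc ∷ md ∷ S-self e ∷ []

      u6 : Unique (u ∷ a ∷ b ∷ c ∷ d ∷ e ∷ [])
      u6 = (~≢ ua ∷ ~≢ ub ∷ ~≢ uc ∷ ~≢ ud ∷ ~≢ ue ∷ []) ∷ uniq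

      only : ∀ {q} → e ∋ q → q ∈ u ∷ a ∷ b ∷ c ∷ d ∷ e ∷ []
      only = exact u6 members (S-size e)

-- No big vertex overspends

module Outflow (St : Setting) where
  open Geometry St public

  P7 : ∀ {v} → deg v ≡ 7 → ∀ u → P v u ≡ p7 (n5 v) (k v)
  P7 {v} q u = cong (λ z → pay z (n5 v) (k v) (hasHub v) (lone u)) q

  P8 : ∀ {v} → deg v ≡ 8 → ∀ u → P v u ≡ p8 (n5 v)
  P8 {v} q u = cong (λ z → pay z (n5 v) (k v) (hasHub v) (lone u)) q

  P9 : ∀ {v} → 9 ≤ deg v → ∀ u → P v u ≡ p9 (deg v) (n5 v) (hasHub v) (lone u)
  P9 {v} q u = pay9 (deg v) (n5 v) (k v) (hasHub v) (lone u) q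

  two-big : ∀ {h x y} → nb h ≤ 1 → h ~ x → h ~ y → x ≢ y → 7 ≤ deg x → deg y ≤ 6
  two-big {h} {x} {y} n1 hx hy ne x7 = ≤-pred (≰⇒> {7} λ y7 → 1+n≰n {1} (≤-trans
    (unique-≤-# (λ z → adj G h z ∧ big z) ((ne ∷ []) ∷ [] ∷ []) (∧-intro hx (⇒≤ᵇ x7) ∷ ∧-intro hy (⇒≤ᵇ y7) ∷ [])) n1))

  -- With the other four neighbours of `h` small, deleting the big `v` sweeps the whole wheel: `S v`
  -- is exactly the closed neighbourhood of `h`.
  record HubAt (v h : Fin n) : Set where
    field
      {a b c d} : Fin n
      pent₀ : Pent⁺ h v a b c d
      a6 : deg a ≤ 6
      b6 : deg b ≤ 6
      c6 : deg c ≤ 6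
      d6 : deg d ≤ 6
    pent₁ : Pent⁺ h a b c d v
    pent₁ = rot⁺ pent₀
    open Quad (pent pent₁) a6 b6 c6 d6 public
    open Pent (pent pent₁) public

    S-nbr : ∀ {q} → v ∋ q → (q ≡ h) ⊎ (h ~ q)
    S-nbr {q} m = go (only m)
      where
      go : q ∈ h ∷ a ∷ b ∷ c ∷ d ∷ v ∷ [] → (q ≡ h) ⊎ (h ~ q)
      go (here e) = inj₁ e
      go (there (here refl)) = inj₂ ua
      go (there (there (here refl))) = inj₂ ub
      go (there (there (there (here refl)))) = inj₂ uc
      go (there (there (there (there (here refl))))) = inj₂ ud
      go (there (there (there (there (there (here refl)))))) = inj₂ ue

    nbr-S : ∀ {q} → h ~ q → v ∋ q
    nbr-S {q} hq = All.lookup members (there (all q hq))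

  abstract
    hub-at : ∀ {v h} → 7 ≤ deg v → v ~ h → deg h ≤ 5 → nb h ≤ 1 → HubAt v h
    hub-at {v} {h} v7 vh h5 n1 with pent⁺ (~sym vh) h5
    ... | a , b , c , d , p = record { pent₀ = p ; a6 = sm ub (ne₁ uniq) ; b6 = sm uc (ne₂ uniq) ; c6 = sm ud (ne₃ uniq) ; d6 = sm ue (ne₄ uniq) }
      where
      open Pent (pent p)
      sm : ∀ {x} → h ~ x → v ≢ x → deg x ≤ 6
      sm hx ne = two-big n1 (~sym vh) hx ne v7
      ne₁ : Unique (v ∷ a ∷ b ∷ c ∷ d ∷ []) → v ≢ a
      ne₁ ((x ∷ _) ∷ _) = x
      ne₂ : Unique (v ∷ a ∷ b ∷ c ∷ d ∷ []) → v ≢ b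
      ne₂ ((_ ∷ x ∷ _) ∷ _) = x
      ne₃ : Unique (v ∷ a ∷ b ∷ c ∷ d ∷ []) → v ≢ c
      ne₃ ((_ ∷ _ ∷ x ∷ _) ∷ _) = x
      ne₄ : Unique (v ∷ a ∷ b ∷ c ∷ d ∷ []) → v ≢ d
      ne₄ ((_ ∷ _ ∷ _ ∷ x ∷ _) ∷ _) = x

  -- Two such vertices would be adjacent and share the closed neighbourhood `S v`, which `full-nbr`
  -- excludes.
  hub-unique : ∀ {v h h′} → 7 ≤ deg v → v ~ h → deg h ≤ 5 → nb h ≤ 1 → v ~ h′ → deg h′ ≤ 5 → nb h′ ≤ 1 → h′ ≡ h
  hub-unique {v} {h} {h′} v7 vh h5 n1 vh′ h5′ n1′ with h′ F.≟ h
  ... | yes e = e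
  ... | no ne = ⊥-elim (full-nbr hh′ h5 h5′ (λ q h′q → HubAt.S-nbr H (HubAt.nbr-S H′ h′q)))
    where
    H = hub-at v7 vh h5 n1
    H′ = hub-at v7 vh′ h5′ n1′
    hh′ : h ~ h′
    hh′ with HubAt.S-nbr H (F-in vh′ h5′)
    ... | inj₁ e = ⊥-elim (ne e)
    ... | inj₂ q = q

  -- `S v` is both `v` with five neighbours of degree 5 and the wheel at `h`, so the whole rim
  -- beside `v` has degree 5 and is adjacent to `v`. Deleting the vertex beyond the edge `ab` then
  -- collects the wheel, including `v` with its five lost neighbours.
  hub-nine : ∀ {v h} → v ~ h → deg h ≤ 5 → nb h ≤ 1 → deg v ≡ 9 → 5 ≤ n5 v → ⊥
  hub-nine {v} {h} vh h5 n1 d9 ge with n5-elems v 5 ge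
  ... | xs , uxs , axs , len = over (¬Any⇒All¬ _ y∉ ∷ u6)
      (my ∷ mh ∷ ma ∷ proj₁ (proj₂ m4) ∷ proj₁ (proj₂ (proj₂ m4)) ∷ proj₂ (proj₂ (proj₂ m4)) ∷ mv ∷ []) ≤-refl
    where
    H = hub-at (≤-trans (≤ᵇ⇒ {7} {9} refl) (≤-reflexive (symm d9))) vh h5 n1
    open HubAt H
    y = Opp.y pent₁
    y∉ = Opp.out pent₁ d6
    u6xs : Unique (v ∷ xs)
    u6xs = All.map (λ q → ~≢ (proj₁ q)) axs ∷ uxs
    in-xs : ∀ {q} → v ∋ q → q ≢ v → (v ~ q) × (deg q ≤ 5)
    in-xs m ne with exact u6xs (S-self v ∷ All.map (λ q → F-in (proj₁ q) (proj₂ q)) axs)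
                     (≤-trans (S-size v) (≤-reflexive (cong suc (symm len)))) m
    ... | here e = ⊥-elim (ne e)
    ... | there i = All.lookup axs i
    vn : ∀ {q} → h ~ q → q ≢ v → (v ~ q) × (deg q ≤ 5)
    vn hq ne = in-xs (nbr-S hq) ne
    nes : Unique (h ∷ a ∷ b ∷ c ∷ d ∷ v ∷ []) → (a ≢ v) × (b ≢ v) × (c ≢ v) × (d ≢ v)
    nes (_ ∷ (_ ∷ _ ∷ _ ∷ x ∷ []) ∷ (_ ∷ _ ∷ y ∷ []) ∷ (_ ∷ z ∷ []) ∷ (w ∷ []) ∷ _) = x , y , z , w
    va = vn ua (proj₁ (nes u6))
    vb = vn ub (proj₁ (proj₂ (nes u6)))
    vc = vn uc (proj₁ (proj₂ (proj₂ (nes u6))))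
    vd = vn ud (proj₂ (proj₂ (proj₂ (nes u6))))
    my = S-self y
    ma : y ∋ a
    ma = coll1 (Opp.ya pent₁) my (proj₂ va)
    mh : y ∋ h
    mh = coll1 ua ma h5
    m4 = quad mh ma (here refl)
    u5h : Unique (h ∷ a ∷ b ∷ c ∷ d ∷ v ∷ []) → Unique (h ∷ a ∷ b ∷ c ∷ d ∷ [])
    u5h ((x₁ ∷ x₂ ∷ x₃ ∷ x₄ ∷ _) ∷ (y₁ ∷ y₂ ∷ y₃ ∷ _) ∷ (z₁ ∷ z₂ ∷ _) ∷ (w ∷ _) ∷ _) =
      (x₁ ∷ x₂ ∷ x₃ ∷ x₄ ∷ []) ∷ (y₁ ∷ y₂ ∷ y₃ ∷ []) ∷ (z₁ ∷ z₂ ∷ []) ∷ (w ∷ []) ∷ [] ∷ []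
    mv : y ∋ v
    mv = coll (u5h u6) ((vh , mh) ∷ (proj₁ va , ma) ∷ (proj₁ vb , proj₁ (proj₂ m4)) ∷ (proj₁ vc , proj₁ (proj₂ (proj₂ m4)))
           ∷ (proj₁ vd , proj₂ (proj₂ (proj₂ m4))) ∷ []) (≤-reflexive d9)

  flow : Fin n → Fin n → ℕ
  flow v u = (if big v ∧ (adj G v u ∧ five u) then P v u else 0)
           + (if big v then 12 * count (λ r → (adj G v r ∧ E′ v r) ∧ (opp v r == u)) else 0)

  direct : Fin n → ℕ
  direct v = sumF (λ u → if adj G v u ∧ five u then P v u else 0)

  flow-big : ∀ {v} → 7 ≤ deg v → sumF (flow v) ≡ direct v + 12 * k v
  flow-big {v} v7 = trans (sumF-cong split) (trans (sumF-+ {n} (λ u → if adj G v u ∧ five u then P v u else 0) (λ u → 12 * fib u))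
      (cong (direct v +_) (trans (sumF-* {n} 12 fib) (cong (12 *_) (sum-fibres (λ r → adj G v r ∧ E′ v r) (opp v))))))
    where
    fib : Fin n → ℕ
    fib u = count (λ r → (adj G v r ∧ E′ v r) ∧ (opp v r == u))
    split : ∀ u → flow v u ≡ (if adj G v u ∧ five u then P v u else 0) + 12 * fib u
    split u = cong₂ _+_ (cong (λ z → if z ∧ (adj G v u ∧ five u) then P v u else 0) (⇒≤ᵇ v7))
                        (cong (λ z → if z then 12 * fib u else 0) (⇒≤ᵇ v7))

  flow-small : ∀ {v} → deg v ≤ 6 → sumF (flow v) ≡ 0
  flow-small {v} v6 = trans (sumF-cong zeros) (sumF-0 n)
    where
    nb′ : big v ≡ false
    nb′ = ≢true λ q → 1+n≰n (≤-trans (≤ᵇ⇒ q) v6)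
    zeros : ∀ u → flow v u ≡ 0
    zeros u = cong₂ _+_ (cong (λ z → if z ∧ (adj G v u ∧ five u) then P v u else 0) nb′)
                        (cong (λ z → if z then 12 * count (λ r → (adj G v r ∧ E′ v r) ∧ (opp v r == u)) else 0) nb′)

  direct-const : ∀ {v} c → (∀ u → P v u ≡ c) → direct v ≡ c * n5 v
  direct-const {v} c h = trans (sumF-cong (λ u → cong (λ z → if adj G v u ∧ five u then z else 0) (h u))) (sum-if c (λ u → adj G v u ∧ five u))

  n5≤4 : ∀ {v} → deg v ≡ 7 → n5 v ≤ 4
  n5≤4 {v} d7 with m≤n⇒m<n∨m≡n (S-size v)
  ... | inj₂ e  = ≤-trans (n5≤3 d7 (≤-reflexive (symm e))) (n≤1+n 3)
  ... | inj₁ lt = ≤-pred (≤-trans (n5<S v) (≤-pred lt))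

  module _ {v} (v9 : 9 ≤ deg v) where
    private
      v7 : 7 ≤ deg v
      v7 = ≤-trans (≤ᵇ⇒ {7} {9} refl) v9
      k≤ : k v ≤ deg v
      k≤ = #-mono (λ r → adj G v r ∧ E′ v r) (adj G v) (λ r q → proj₁ (∧-elim {adj G v r} q))

    -- Three regimes: without hub edges the 180 owned at degree 9 suffices; when both kinds occur
    -- `budget9` applies; with hub edges alone, at most 12 per neighbour is spent and 48 · 9 exceeds
    -- 360.
    arith : ∀ c ex a kk → kk ≤ deg v → (1 ≤ a → 1 ≤ kk → kk + a + 3 ≤ deg v) → c * a + ex ≤ 180 →
      (a ≡ 0 → ex ≡ 0) → (1 ≤ kk → (c * a + ex) + 324 ≤ 48 * deg v + 12 * a) → (c * a + ex) + 12 * kk + 360 ≤ 60 * deg v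
    arith c ex a zero kl b small z h = begin
      (c * a + ex) + 12 * 0 + 360  ≡⟨ cong (_+ 360) (+-identityʳ (c * a + ex)) ⟩
      (c * a + ex) + 360           ≤⟨ +-monoˡ-≤ 360 small ⟩
      60 * 9                       ≤⟨ *-monoʳ-≤ 60 v9 ⟩
      60 * deg v                   ∎
      where
      open ≤-Reasoning
    arith c ex (suc a) (suc kk) kl b small z h = budget9 c ex (suc a) (suc kk) (deg v) (b (s≤s z≤n) (s≤s z≤n)) (h (s≤s z≤n))
    arith c ex zero (suc kk) kl b small z h rewrite z refl | *-zeroʳ c = begin
      12 * suc kk + 360      ≤⟨ +-monoˡ-≤ 360 (*-monoʳ-≤ 12 kl) ⟩
      12 * deg v + 360       ≤⟨ +-monoʳ-≤ (12 * deg v) (≤ᵇ⇒ {360} {48 * 9} refl) ⟩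
      12 * deg v + 48 * 9    ≤⟨ +-monoʳ-≤ (12 * deg v) (*-monoʳ-≤ 48 v9) ⟩
      12 * deg v + 48 * deg v ≡⟨ solve 1 (λ x → con 12 :* x :+ con 48 :* x := con 60 :* x) refl (deg v) ⟩
      60 * deg v             ∎
      where
      open ≤-Reasoning
      open +-*-Solver

    nums30 : ∀ a → a ≤ 5 → (30 * a + 0 ≤ 180) × (30 * a + 0 + 324 ≤ 48 * deg v + 12 * a)
    nums30 0 _ = z≤n , scale {a = 0} 9 v9 refl
    nums30 1 _ = ≤ᵇ⇒ {30} {180} refl , scale {a = 1} 9 v9 refl
    nums30 2 _ = ≤ᵇ⇒ {60} {180} refl , scale {a = 2} 9 v9 refl
    nums30 3 _ = ≤ᵇ⇒ {90} {180} refl , scale {a = 3} 9 v9 refl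
    nums30 4 _ = ≤ᵇ⇒ {120} {180} refl , scale {a = 4} 9 v9 refl
    nums30 5 _ = ≤ᵇ⇒ {150} {180} refl , scale {a = 5} 9 v9 refl
    nums30 (suc (suc (suc (suc (suc (suc a)))))) (s≤s (s≤s (s≤s (s≤s (s≤s ())))))

    -- Four payments of 45 violate the second inequality at degree 9, with 504 against 480. This is
    -- the origin of the guard in `p9`.
    nums45 : ∀ a → ((5 ≤ᵇ a) ∨ ((deg v ≤ᵇ 9) ∧ (4 ≤ᵇ a))) ≡ false →
      (45 * a + 0 ≤ 180) × (45 * a + 0 + 324 ≤ 48 * deg v + 12 * a)
    nums45 0 _ = z≤n , scale {a = 0} 9 v9 refl
    nums45 1 _ = ≤ᵇ⇒ {45} {180} refl , scale {a = 1} 9 v9 refl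
    nums45 2 _ = ≤ᵇ⇒ {90} {180} refl , scale {a = 2} 9 v9 refl
    nums45 3 _ = ≤ᵇ⇒ {135} {180} refl , scale {a = 3} 9 v9 refl
    nums45 4 q = ≤ᵇ⇒ {180} {180} refl , scale {a = 4} {deg v} 10 (≰⇒> {deg v} {9} (λ le → contra (∧-intro (⇒≤ᵇ {deg v} {9} le) refl) q)) refl
    nums45 (suc (suc (suc (suc (suc a))))) ()

    -- Five at degree 9 would give 504 against 492; `hub-nine` supplies the hypothesis that rules
    -- this out.
    nums-hub : ∀ a → a ≤ 5 → (deg v ≡ 9 → a ≤ 4) → (30 * a + 30 ≤ 180) × (30 * a + 30 + 324 ≤ 48 * deg v + 12 * a)
    nums-hub 0 _ _ = ≤ᵇ⇒ {30} {180} refl , scale {a = 0} 9 v9 refl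
    nums-hub 1 _ _ = ≤ᵇ⇒ {60} {180} refl , scale {a = 1} 9 v9 refl
    nums-hub 2 _ _ = ≤ᵇ⇒ {90} {180} refl , scale {a = 2} 9 v9 refl
    nums-hub 3 _ _ = ≤ᵇ⇒ {120} {180} refl , scale {a = 3} 9 v9 refl
    nums-hub 4 _ _ = ≤ᵇ⇒ {150} {180} refl , scale {a = 4} 9 v9 refl
    nums-hub 5 _ h = ≤ᵇ⇒ {180} {180} refl , scale {a = 5} 10 (≤∧≢⇒< v9 (λ e → 1+n≰n {4} (h (symm e)))) refl
    nums-hub (suc (suc (suc (suc (suc (suc a)))))) (s≤s (s≤s (s≤s (s≤s (s≤s ()))))) _

    plain : ∀ c → (∀ u → P v u ≡ c) → (c * n5 v + 0 ≤ 180) × (c * n5 v + 0 + 324 ≤ 48 * deg v + 12 * n5 v) →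
      direct v + 12 * k v + 360 ≤ 60 * deg v
    plain c eq (le , le′) = subst (λ z → z + 12 * k v + 360 ≤ 60 * deg v) (trans (+-identityʳ (c * n5 v)) (symm (direct-const c eq)))
      (arith c 0 (n5 v) (k v) k≤ (bound9 v7) le (λ _ → refl) (λ _ → le′))

    with-hub : hasHub v ≡ true → ∀ {h} → v ~ h → deg h ≤ 5 → nb h ≤ 1 → direct v + 12 * k v + 360 ≤ 60 * deg v
    with-hub hh {h} vh h5 h1 = ≤-trans (+-monoˡ-≤ 360 (+-monoˡ-≤ (12 * k v) le))
              (arith 30 30 (n5 v) (k v) k≤ (bound9 v7) (proj₁ nums) (λ e → ⊥-elim (1+n≰n (≤-trans some (≤-reflexive e)))) (λ _ → proj₂ nums))
      where
      Fv Lv : Fin n → Bool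
      Fv u = adj G v u ∧ five u
      Lv u = Fv u ∧ lone u
      some : 1 ≤ n5 v
      some = n5-≥ ([] ∷ []) ((vh , h5) ∷ [])
      nums = nums-hub (n5 v) (n5≤5 v) (λ e → ≤-pred (≰⇒> (λ ge → hub-nine vh h5 h1 e ge)))
      one : count Lv ≤ 1
      one = #-≤-cover Lv (h ∷ []) (λ u r → here (hub-unique v7 vh h5 h1 (proj₁ (∧-elim {adj G v u} (proj₁ (∧-elim {Fv u} r))))
              (≤ᵇ⇒ (proj₂ (∧-elim {adj G v u} (proj₁ (∧-elim {Fv u} r))))) (≤ᵇ⇒ (proj₂ (∧-elim {Fv u} r)))))
      go : ∀ f l → (if f then (if l then 60 else 30) else 0) ≡ (if f then 30 else 0) + (if f ∧ l then 30 else 0)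
      go true  true  = refl
      go true  false = refl
      go false l     = refl
      eq : ∀ u → (if Fv u then P v u else 0) ≡ (if Fv u then 30 else 0) + (if Lv u then 30 else 0)
      eq u = trans (cong (λ z → if Fv u then z else 0) (trans (P9 v9 u) (cong (λ z → p9 (deg v) (n5 v) z (lone u)) hh))) (go (Fv u) (lone u))
      le : direct v ≤ 30 * n5 v + 30
      le = ≤-trans (≤-reflexive (trans (sumF-cong eq) (trans (sumF-+ (λ u → if Fv u then 30 else 0) (λ u → if Lv u then 30 else 0)) (cong₂ _+_ (sum-if 30 Fv) (sum-if 30 Lv)))))
             (+-monoʳ-≤ (30 * n5 v) (*-monoʳ-≤ 30 one))

    direct9 : direct v + 12 * k v + 360 ≤ 60 * deg v
    direct9 = hubs (bool-cases (hasHub v))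
      where
      rate : Bool
      rate = (5 ≤ᵇ n5 v) ∨ ((deg v ≤ᵇ 9) ∧ (4 ≤ᵇ n5 v))
      value : hasHub v ≡ false → ∀ {t} → rate ≡ t → ∀ u → P v u ≡ (if t then 30 else 45)
      value nh t u = trans (P9 v9 u) (trans (cong (λ z → p9 (deg v) (n5 v) z (lone u)) nh) (cong (λ z → if z then 30 else 45) t))
      rates : hasHub v ≡ false → (rate ≡ true) ⊎ (rate ≡ false) → direct v + 12 * k v + 360 ≤ 60 * deg v
      rates nh (inj₁ t) = plain 30 (value nh t) (nums30 (n5 v) (n5≤5 v))
      rates nh (inj₂ t) = plain 45 (value nh t) (nums45 (n5 v) t)
      hub-case : hasHub v ≡ true → (∃ λ h → (adj G v h ∧ five h) ∧ lone h ≡ true) → direct v + 12 * k v + 360 ≤ 60 * deg v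
      hub-case hh (h , q) = with-hub hh (proj₁ (∧-elim {adj G v h} (proj₁ (∧-elim {adj G v h ∧ five h} q))))
        (≤ᵇ⇒ (proj₂ (∧-elim {adj G v h} (proj₁ (∧-elim {adj G v h ∧ five h} q))))) (≤ᵇ⇒ (proj₂ (∧-elim {adj G v h ∧ five h} q)))
      hubs : (hasHub v ≡ true) ⊎ (hasHub v ≡ false) → direct v + 12 * k v + 360 ≤ 60 * deg v
      hubs (inj₂ nh) = rates nh (bool-cases rate)
      hubs (inj₁ hh) = hub-case hh (anyB⇒ (λ u → (adj G v u ∧ five u) ∧ lone u) hh)

  flow-bound : ∀ {v} → 7 ≤ deg v → sumF (flow v) + 360 ≤ 60 * deg v
  flow-bound {v} v7 = subst (λ z → z + 360 ≤ 60 * deg v) (symm (flow-big v7)) (go (m≤n⇒m<n∨m≡n v7))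
    where
    go : (7 < deg v) ⊎ (7 ≡ deg v) → direct v + 12 * k v + 360 ≤ 60 * deg v
    go (inj₂ e) = ≤-trans (+-monoˡ-≤ 360 (≤-trans (≤-reflexive (cong (_+ 12 * k v) (direct-const (p7 (n5 v) (k v)) (P7 (symm e)))))
        (budget7 (n5 v) (k v) (n5≤4 (symm e)) (bound7 v7 (symm e))))) (≤-reflexive (cong (60 *_) e))
    go (inj₁ lt) = go′ (m≤n⇒m<n∨m≡n lt)
      where
      go′ : (8 < deg v) ⊎ (8 ≡ deg v) → direct v + 12 * k v + 360 ≤ 60 * deg v
      go′ (inj₂ e) = ≤-trans (+-monoˡ-≤ 360 (≤-trans (≤-reflexive (cong (_+ 12 * k v) (direct-const (p8 (n5 v)) (P8 (symm e)))))
        (budget8 (n5 v) (k v) (n5≤5 v) (bound8 v7 (symm e))))) (≤-reflexive (cong (60 *_) e))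
      go′ (inj₁ lt′) = direct9 lt′

-- Lower bounds for the payments

p7≥15 : ∀ a k → 15 ≤ p7 a k
p7≥15 0 k = ≤ᵇ⇒ {15} {36} refl
p7≥15 1 k = ≤ᵇ⇒ {15} {36} refl
p7≥15 2 0 = ≤ᵇ⇒ {15} {30} refl
p7≥15 2 (suc k) = ≤ᵇ⇒ {15} {24} refl
p7≥15 3 k = ≤ᵇ⇒ {15} {20} refl
p7≥15 (suc (suc (suc (suc a)))) k = ≤-refl

p7≥20 : ∀ a k → a ≤ 3 → 20 ≤ p7 a k
p7≥20 0 k _ = ≤ᵇ⇒ {20} {36} refl
p7≥20 1 k _ = ≤ᵇ⇒ {20} {36} refl
p7≥20 2 0 _ = ≤ᵇ⇒ {20} {30} refl
p7≥20 2 (suc k) _ = ≤ᵇ⇒ {20} {24} refl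
p7≥20 3 k _ = ≤-refl
p7≥20 (suc (suc (suc (suc a)))) k (s≤s (s≤s (s≤s ())))

p7≥24 : ∀ a k → a ≤ 2 → 24 ≤ p7 a k
p7≥24 0 k _ = ≤ᵇ⇒ {24} {36} refl
p7≥24 1 k _ = ≤ᵇ⇒ {24} {36} refl
p7≥24 2 0 _ = ≤ᵇ⇒ {24} {30} refl
p7≥24 2 (suc k) _ = ≤-refl
p7≥24 (suc (suc (suc a))) k (s≤s (s≤s ()))

p7≥30 : ∀ a k → a ≤ 2 → (2 ≤ a → 1 ≤ k → ⊥) → 30 ≤ p7 a k
p7≥30 0 k _ _ = ≤ᵇ⇒ {30} {36} refl
p7≥30 1 k _ _ = ≤ᵇ⇒ {30} {36} refl
p7≥30 2 0 _ _ = ≤-refl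
p7≥30 2 (suc k) _ h = ⊥-elim (h ≤-refl (s≤s z≤n))
p7≥30 (suc (suc (suc a))) k (s≤s (s≤s ())) _

p7≥36 : ∀ a k → a ≤ 1 → 36 ≤ p7 a k
p7≥36 0 k _ = ≤-refl
p7≥36 1 k _ = ≤-refl
p7≥36 (suc (suc a)) k (s≤s ())

p8≥24 : ∀ a → 24 ≤ p8 a
p8≥24 0 = ≤ᵇ⇒ {24} {60} refl
p8≥24 1 = ≤ᵇ⇒ {24} {60} refl
p8≥24 2 = ≤ᵇ⇒ {24} {40} refl
p8≥24 3 = ≤ᵇ⇒ {24} {30} refl
p8≥24 4 = ≤ᵇ⇒ {24} {30} refl
p8≥24 (suc (suc (suc (suc (suc a))))) = ≤-refl

p8≥30 : ∀ a → a ≤ 4 → 30 ≤ p8 a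
p8≥30 0 _ = ≤ᵇ⇒ {30} {60} refl
p8≥30 1 _ = ≤ᵇ⇒ {30} {60} refl
p8≥30 2 _ = ≤ᵇ⇒ {30} {40} refl
p8≥30 3 _ = ≤-refl
p8≥30 4 _ = ≤-refl
p8≥30 (suc (suc (suc (suc (suc a))))) (s≤s (s≤s (s≤s (s≤s ()))))

p8≥40 : ∀ a → a ≤ 2 → 40 ≤ p8 a
p8≥40 0 _ = ≤ᵇ⇒ {40} {60} refl
p8≥40 1 _ = ≤ᵇ⇒ {40} {60} refl
p8≥40 2 _ = ≤-refl
p8≥40 (suc (suc (suc a))) (s≤s (s≤s ()))

p8≥60 : ∀ a → a ≤ 1 → 60 ≤ p8 a
p8≥60 0 _ = ≤-refl
p8≥60 1 _ = ≤-refl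
p8≥60 (suc (suc a)) (s≤s ())

p9≥30 : ∀ d a hv hu → 30 ≤ p9 d a hv hu
p9≥30 d a true true = ≤ᵇ⇒ {30} {60} refl
p9≥30 d a true false = ≤-refl
p9≥30 d a false hu = go ((5 ≤ᵇ a) ∨ ((d ≤ᵇ 9) ∧ (4 ≤ᵇ a)))
  where
  go : ∀ b → 30 ≤ (if b then 30 else 45)
  go true  = ≤-refl
  go false = ≤ᵇ⇒ {30} {45} refl

p9≡45 : ∀ d a hu → a ≤ 4 → (d ≤ 9 → a ≤ 3) → p9 d a false hu ≡ 45
p9≡45 d a hu a4 h = cong (λ z → if z then 30 else 45) (≢true λ q → go (∨-elim {5 ≤ᵇ a} q))
  where
  go : ((5 ≤ᵇ a) ≡ true) ⊎ (((d ≤ᵇ 9) ∧ (4 ≤ᵇ a)) ≡ true) → ⊥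
  go (inj₁ q) = 1+n≰n (≤-trans (≤ᵇ⇒ {5} {a} q) a4)
  go (inj₂ q) = 1+n≰n (≤-trans (≤ᵇ⇒ {4} {a} (proj₂ (∧-elim {d ≤ᵇ 9} q))) (h (≤ᵇ⇒ {d} {9} (proj₁ (∧-elim {d ≤ᵇ 9} q)))))

-- Poor payers, and when degree 7 can pay a half

module Inflow (St : Setting) where
  open Outflow St public

  data Big (v : Fin n) : Set where
    is7 : deg v ≡ 7 → Big v
    is8 : deg v ≡ 8 → Big v
    is9 : 9 ≤ deg v → Big v

  classify : ∀ {v} → 7 ≤ deg v → Big v
  classify le = go (m≤n⇒m<n∨m≡n le)
    where
    go : ∀ {v} → (7 < deg v) ⊎ (7 ≡ deg v) → Big v
    go (inj₂ e) = is7 (symm e)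
    go {v} (inj₁ lt) = go′ (m≤n⇒m<n∨m≡n lt)
      where
      go′ : (8 < deg v) ⊎ (8 ≡ deg v) → Big v
      go′ (inj₂ e)   = is8 (symm e)
      go′ (inj₁ lt′) = is9 lt′

  P≥15 : ∀ {v} u → 7 ≤ deg v → 15 ≤ P v u
  P≥15 {v} u le = go (classify le)
    where
    go : Big v → 15 ≤ P v u
    go (is7 e) = subst (15 ≤_) (symm (P7 e u)) (p7≥15 (n5 v) (k v))
    go (is8 e) = subst (15 ≤_) (symm (P8 e u)) (≤-trans (≤ᵇ⇒ {15} {24} refl) (p8≥24 (n5 v)))
    go (is9 e) = subst (15 ≤_) (symm (P9 e u)) (≤-trans (≤ᵇ⇒ {15} {30} refl) (p9≥30 (deg v) (n5 v) (hasHub v) (lone u)))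

  P≥20 : ∀ {v} u → 7 ≤ deg v → (deg v ≡ 7 → n5 v ≤ 3) → 20 ≤ P v u
  P≥20 {v} u le h = go (classify le)
    where
    go : Big v → 20 ≤ P v u
    go (is7 e) = subst (20 ≤_) (symm (P7 e u)) (p7≥20 (n5 v) (k v) (h e))
    go (is8 e) = subst (20 ≤_) (symm (P8 e u)) (≤-trans (≤ᵇ⇒ {20} {24} refl) (p8≥24 (n5 v)))
    go (is9 e) = subst (20 ≤_) (symm (P9 e u)) (≤-trans (≤ᵇ⇒ {20} {30} refl) (p9≥30 (deg v) (n5 v) (hasHub v) (lone u)))

  P≥24 : ∀ {v} u → 7 ≤ deg v → (deg v ≡ 7 → n5 v ≤ 2) → 24 ≤ P v u
  P≥24 {v} u le h = go (classify le)
    where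
    go : Big v → 24 ≤ P v u
    go (is7 e) = subst (24 ≤_) (symm (P7 e u)) (p7≥24 (n5 v) (k v) (h e))
    go (is8 e) = subst (24 ≤_) (symm (P8 e u)) (p8≥24 (n5 v))
    go (is9 e) = subst (24 ≤_) (symm (P9 e u)) (≤-trans (≤ᵇ⇒ {24} {30} refl) (p9≥30 (deg v) (n5 v) (hasHub v) (lone u)))

  P≥30 : ∀ {v} u → 7 ≤ deg v → (deg v ≡ 7 → 30 ≤ P v u) → (deg v ≡ 8 → n5 v ≤ 4) → 30 ≤ P v u
  P≥30 {v} u le h h′ = go (classify le)
    where
    go : Big v → 30 ≤ P v u
    go (is7 e) = h e
    go (is8 e) = subst (30 ≤_) (symm (P8 e u)) (p8≥30 (n5 v) (h′ e))
    go (is9 e) = subst (30 ≤_) (symm (P9 e u)) (p9≥30 (deg v) (n5 v) (hasHub v) (lone u))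

  -- Such a vertex pays only 15. By `n5≤3` its `S v` is not full, so it consists of `v` and four
  -- neighbours of degree 5. A big `w` that collects `v` collects these four too and, with little
  -- room left, pays at least 24.
  module Poor {v} (d7 : deg v ≡ 7) (p4 : 4 ≤ n5 v) where
    private
      fours = n5-elems v 4 p4
      xs = proj₁ fours
      uxs = proj₁ (proj₂ fours)
      axs = proj₁ (proj₂ (proj₂ fours))
      len = proj₂ (proj₂ (proj₂ fours))

    size≤5 : count (S v) ≤ 5
    size≤5 = ≤-pred (≰⇒> {6} λ le → 1+n≰n (≤-trans p4 (n5≤3 d7 le)))

    uvx : Unique (v ∷ xs)
    uvx = All.map (λ q → ~≢ (proj₁ q)) axs ∷ uxs

    avx : All (v ∋_) (v ∷ xs)
    avx = S-self v ∷ All.map (λ q → F-in (proj₁ q) (proj₂ q)) axs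

    S-only : ∀ {q} → v ∋ q → q ≢ v → (v ~ q) × (deg q ≤ 5)
    S-only {q} m ne = go (exact uvx avx (≤-trans size≤5 (≤-reflexive (cong suc (symm len)))) m)
      where
      go : q ∈ v ∷ xs → (v ~ q) × (deg q ≤ 5)
      go (here e)  = ⊥-elim (ne e)
      go (there i) = All.lookup axs i

    module _ {w} (w7 : 7 ≤ deg w) (wv : w ∋ v) (w≢v : w ≢ v) where
      uw : Unique (w ∷ v ∷ xs)
      uw = (w≢v ∷ All.map (λ q e → small≢big (≤-trans (proj₂ q) (n≤1+n 5)) w7 (symm e)) axs) ∷ uvx

      cap-size : 6 ≤ count (S w)
      cap-size = ≤-trans (≤-reflexive (cong (2 +_) (symm len))) (size≥ uw (S-self w ∷ All.map (sub wv) avx))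

      cap-n5≤4 : n5 w ≤ 4
      cap-n5≤4 = +-cancelʳ-≤ 2 (n5 w) 4 (≤-trans (n5-room {w} ((w≢v ∷ []) ∷ [] ∷ [])
        ((S-self w , notself w) ∷ (wv , not5 (≤-trans (n≤1+n 6) (≤-reflexive (symm d7)))) ∷ [])) (S-size w))

      -- With three, `all-nbrs` would make all of `xs` neighbours of `w`, four of degree 5, against
      -- `n5≤3` for the full `S w`.
      cap-n5≤2 : deg w ≡ 7 → n5 w ≤ 2
      cap-n5≤2 w7′ = ≤-pred (≰⇒> λ ge → 1+n≰n (≤-trans
        (subst (_≤ n5 w) len (n5-≥ uxs (All.tabulate λ {x} i → all-nbrs w7′ cap-size ge (sub wv (All.lookup avx (there i)))
          (λ e → small≢big (≤-trans (proj₂ (All.lookup axs i)) (n≤1+n 5)) w7 e) , proj₂ (All.lookup axs i))))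
        (n5≤3 w7′ cap-size)))

      cap24 : ∀ u → 24 ≤ P w u
      cap24 u = P≥24 u w7 cap-n5≤2

  link : ∀ {v u y z} → v ~ u → Fc v u y → Fc v u z → y ≢ z → Σ (Dir v) λ D → (st D u ≡ y) × (st D z ≡ u)
  link {v} {u} vu (inj₁ refl) (inj₁ e)    ne = ⊥-elim (ne (symm e))
  link {v} {u} vu (inj₁ refl) (inj₂ refl) ne = fwd v , refl , turn₂ (~sym vu)
  link {v} {u} vu (inj₂ refl) (inj₁ refl) ne = bwd v , refl , turn₁ vu
  link {v} {u} vu (inj₂ refl) (inj₂ e)    ne = ⊥-elim (ne (symm e))

  -- If both neighbours y, s of u around v are collected with v (or s collects v but little else),
  -- then v pays no hub unless u is the only vertex of degree 5 at v.
  module Sides {v u y s} (d7 : deg v ≡ 7) (u5 : deg u ≤ 5) (vu : v ~ u) (fy : Fc v u y) (fs : Fc v u s) (y≢s : y ≢ s)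
    (my : v ∋ y) (size : 5 ≤ count (S v))
    (ms : (v ∋ s) ⊎ ((7 ≤ deg s) × (s ∋ v) × (∀ q → s ∋ q → (v ∋ q) ⊎ (q ≡ s)))) where

    private
      D = proj₁ (link vu fy fs y≢s)
      v7 : 7 ≤ deg v
      v7 = ≤-reflexive (symm d7)
    open Ring D vu

    private
      sep : ∀ {i j} → i < j → j < 7 → r i ≢ r j
      sep lt lt′ = r-inj lt (subst (_ <_) (symm d7) lt′)
      r₁ : r 1 ≡ y
      r₁ = proj₁ (proj₂ (link vu fy fs y≢s))
      r₇ : r 7 ≡ u
      r₇ = trans (cong r (symm d7)) r-wrap
      r₆ : r 6 ≡ s
      r₆ = inj D (r~ 6) (Fc-nbr vu fs) (trans r₇ (symm (proj₂ (proj₂ (link vu fy fs y≢s)))))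
      mu : v ∋ u
      mu = F-in vu u5
      m₁ : v ∋ r 1
      m₁ = subst (v ∋_) (symm r₁) my

      -- The ring runs in direction `D`, possibly against `nx`, so the edge found through `E′` may
      -- have to be read from its other end.
      edge : 1 ≤ k v → ∃ λ z → (v ~ z) × Facing v z (st D z)
      edge ge = go (#-elems 1 (λ r → adj G v r ∧ E′ v r) ge)
        where
        orient′ : ∀ {x} → v ~ x → Facing v x (nx v x) → (st D x ≡ nx v x) ⊎ (st D (nx v x) ≡ x) → ∃ λ z → (v ~ z) × Facing v z (st D z)
        orient′ {x} p f (inj₁ e) = x , p , subst (Facing v x) (symm e) f
        orient′ {x} p f (inj₂ e) = nx v x , nx-nbr p , subst (Facing v (nx v x)) (symm e) (facing-flip f)
        go : (∃ λ xs → Unique xs × All (λ x → adj G v x ∧ E′ v x ≡ true) xs × (length xs ≡ 1)) → ∃ λ z → (v ~ z) × Facing v z (st D z)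
        go (x ∷ _ , _ , q ∷ _ , _) = let p , e = ∧-elim {adj G v x} q in orient′ p (facing v7 p e) (orient D p)

      -- deleting t collects v and the hub side
      squeeze : ∀ {t g x} → S v t ≡ false → S v x ≡ false → v ~ t → v ~ x → v ~ g → g ~ t → u ~ g → x ~ t → deg g ≤ 5 → deg x ≤ 6 → t ≢ u → ⊥
      squeeze {t} {g} {x} nt nx′ vt vx vg gt ug xt g5 x6 t≢u =
        1+n≰n {6} (≤-trans (+-monoˡ-≤ 2 size) (grow tv ((≢sym (~≢ xt) ∷ []) ∷ [] ∷ []) ((S-self t , nt) ∷ (tx , nx′) ∷ [])))
        where
        tg : t ∋ g
        tg = coll1 gt (S-self t) g5
        tu : t ∋ u
        tu = coll1 ug tg u5
        tv : t ∋ v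
        tv = coll3 vt (S-self t) vg tg vu tu (≢sym (~≢ gt)) t≢u (≢sym (~≢ ug)) (≤-reflexive d7)
        tx : t ∋ x
        tx = coll2 xt (S-self t) (~sym vx) tv (≢sym (~≢ vt)) x6

      -- On the ring from `u`, with `y` at 1 and `s` at 6, every place but 3 is too close to `u`,
      -- `y` or `s`. At place 3 the second vertex of degree 5 can only sit at 1 or 6, where
      -- `squeeze` applies.
      place : ∀ j → j < 7 → Facing v (r j) (r (suc j)) → 2 ≤ n5 v → ⊥
      place 0 _ f ge = contra mu (Facing.x∉ f)
      place 1 _ f ge = contra m₁ (Facing.x∉ f)
      place 2 _ f ge = contra m₁ (beside f (r~ 2) (r~ 1) (~sym (rr 1)))
      place 6 _ f ge = contra (subst (v ∋_) (symm r₇) mu) (Facing.y∉ f)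
      place 5 _ f ge = go ms
        where
        go : (v ∋ s) ⊎ ((7 ≤ deg s) × (s ∋ v) × (∀ q → s ∋ q → (v ∋ q) ⊎ (q ≡ s))) → ⊥
        go (inj₁ m)       = contra (subst (v ∋_) (symm r₆) m) (Facing.y∉ f)
        go (inj₂ (b , _)) = small≢big (Facing.y6 f) b r₆
      place 4 _ f ge = go ms
        where
        go : (v ∋ s) ⊎ ((7 ≤ deg s) × (s ∋ v) × (∀ q → s ∋ q → (v ∋ q) ⊎ (q ≡ s))) → ⊥
        go (inj₁ m) = contra (subst (v ∋_) (symm r₆) m) (beside (facing-flip f) (r~ 5) (r~ 6) (rr 5))
        go (inj₂ (b , sv , only)) = fin (only (r 5) (coll2 (subst (r 5 ~_) r₆ (rr 5)) (S-self s) (~sym (r~ 5)) sv (≢sym (~≢ (Fc-nbr vu fs))) (Facing.y6 f)))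
          where
          fin : (v ∋ r 5) ⊎ (r 5 ≡ s) → ⊥
          fin (inj₁ m) = contra m (Facing.y∉ f)
          fin (inj₂ e) = small≢big (Facing.y6 f) b e
      place 3 _ f ge = go (n5-elems v 2 ge)
        where
        n₂ : S v (r 2) ≡ false
        n₂ = beside f (r~ 3) (r~ 2) (~sym (rr 2))
        n₅ : S v (r 5) ≡ false
        n₅ = beside (facing-flip f) (r~ 4) (r~ 5) (rr 4)
        five-at : ∀ g → v ~ g → deg g ≤ 5 → g ≢ u → (∃ λ i → (i < deg v) × (g ≡ r i)) → ⊥
        five-at g vg g5 ne (0 , _ , e) = ne e
        five-at g vg g5 ne (1 , _ , e) = squeeze n₂ (Facing.x∉ f) (r~ 2) (r~ 3) vg (subst (_~ r 2) (symm e) (rr 1)) (subst (u ~_) (symm e) (rr 0))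
          (~sym (rr 2)) g5 (Facing.x6 f) (≢sym (sep {0} {2} (s≤s z≤n) (s≤s (s≤s (s≤s z≤n)))))
        five-at g vg g5 ne (2 , _ , refl) = contra (F-in vg g5) n₂
        five-at g vg g5 ne (3 , _ , refl) = contra (F-in vg g5) (Facing.x∉ f)
        five-at g vg g5 ne (4 , _ , refl) = contra (F-in vg g5) (Facing.y∉ f)
        five-at g vg g5 ne (5 , _ , refl) = contra (F-in vg g5) n₅
        five-at g vg g5 ne (6 , _ , e) = squeeze n₅ (Facing.y∉ f) (r~ 5) (r~ 4) vg (subst (_~ r 5) (symm e) (~sym (rr 5)))
          (subst (u ~_) (symm e) (subst (_~ r 6) r₇ (~sym (rr 6)))) (rr 4) g5 (Facing.y6 f) (≢sym (sep {0} {5} (s≤s z≤n) (s≤s (s≤s (s≤s (s≤s (s≤s (s≤s z≤n))))))))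
        five-at g vg g5 ne (suc (suc (suc (suc (suc (suc (suc i)))))) , lt , _) =
          1+n≰n {7} (≤-trans (m≤m+n 8 i) (≤-trans lt (≤-reflexive d7)))
        go : (∃ λ xs → Unique xs × All (λ x → (v ~ x) × (deg x ≤ 5)) xs × (length xs ≡ 2)) → ⊥
        go (g ∷ g′ ∷ [] , (ne ∷ []) ∷ _ , (vg , g5) ∷ (vg′ , g5′) ∷ [] , _) = pick (toSum (g F.≟ u))
          where
          pick : (g ≡ u) ⊎ (g ≢ u) → ⊥
          pick (inj₂ q) = five-at g vg g5 q (r-some g vg)
          pick (inj₁ q) = five-at g′ vg′ g5′ (λ e → ne (trans q (symm e))) (r-some g′ vg′)
      place (suc (suc (suc (suc (suc (suc (suc j))))))) lt f ge = 1+n≰n {7} (≤-trans (m≤m+n 8 j) lt)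

    P-side : n5 v ≤ 2 → 30 ≤ P v u
    P-side le = subst (30 ≤_) (symm (P7 d7 u)) (p7≥30 (n5 v) (k v) le no-k)
      where
      no-k : 2 ≤ n5 v → 1 ≤ k v → ⊥
      no-k ge kg = let z , vz , f = edge kg ; j , lt , e = r-some z vz in
        place j (subst (j <_) d7 lt) (subst (λ w → Facing v w (st D w)) e f) ge

  poor? : ∀ v → ((deg v ≡ 7) × (4 ≤ n5 v)) ⊎ (deg v ≡ 7 → n5 v ≤ 3)
  poor? v = go (toSum (deg v ≟ 7)) (toSum (4 ≤? n5 v))
    where
    go : (deg v ≡ 7) ⊎ (deg v ≢ 7) → (4 ≤ n5 v) ⊎ ¬ (4 ≤ n5 v) → ((deg v ≡ 7) × (4 ≤ n5 v)) ⊎ (deg v ≡ 7 → n5 v ≤ 3)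
    go (inj₁ e) (inj₁ g) = inj₁ (e , g)
    go (inj₁ e) (inj₂ g) = inj₂ λ _ → ≤-pred (≰⇒> g)
    go (inj₂ e) _        = inj₂ λ e′ → ⊥-elim (e e′)

-- Vertices of degree 5 with two small neighbours

module TwoSmall (St : Setting) where
  open Inflow St public

  sum63 : ∀ {x y z} → 15 ≤ x → 24 ≤ y → 24 ≤ z → 60 ≤ x + y + z
  sum63 p q r = ≤-trans (≤ᵇ⇒ {60} {63} refl) (+-mono-≤ (+-mono-≤ p q) r)

  swap-last : ∀ {x y z} → 60 ≤ x + y + z → 60 ≤ x + z + y
  swap-last {x} {y} {z} p = subst (60 ≤_) (solve 3 (λ a b c → a :+ b :+ c := a :+ c :+ b) refl x y z) p
    where
    open +-*-Solver

  reverse₃ : ∀ {x y z} → 60 ≤ x + y + z → 60 ≤ z + y + x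
  reverse₃ {x} {y} {z} p = subst (60 ≤_) (solve 3 (λ a b c → a :+ b :+ c := c :+ b :+ a) refl x y z) p
    where
    open +-*-Solver

  swap-first : ∀ {x y z} → 60 ≤ x + y + z → 60 ≤ y + x + z
  swap-first {x} {y} {z} p = subst (60 ≤_) (cong (_+ z) (+-comm x y)) p

  module Adjacent {u a b c d e} (p : Pent u a b c d e) (a6 : deg a ≤ 6) (b6 : deg b ≤ 6)
    (c7 : 7 ≤ deg c) (d7 : 7 ≤ deg d) (e7 : 7 ≤ deg e) where
    open Pent p
    private
      u5′ : deg u ≤ 5
      u5′ = ≤-reflexive u5
      c∋u : c ∋ u
      c∋u = F-in (~sym uc) u5′
      d∋u : d ∋ u
      d∋u = F-in (~sym ud) u5′
      e∋u : e ∋ u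
      e∋u = F-in (~sym ue) u5′
      c∋b : c ∋ b
      c∋b = spread c∋u (S-self c) uc (Fc-rot ub fbc) b6
      c∋a : c ∋ a
      c∋a = spread c∋u c∋b ub (Fc-rot ua fab) a6
      e∋a : e ∋ a
      e∋a = spread e∋u (S-self e) ue fea a6
      e∋b : e ∋ b
      e∋b = spread e∋u e∋a ua fab b6
      a≢b : a ≢ b
      a≢b = ~≢ ab
      c≢d : c ≢ d
      c≢d = ~≢ cd
      e≢d : e ≢ d
      e≢d e = ~≢ de (symm e)
      nes : Unique (a ∷ b ∷ c ∷ d ∷ e ∷ []) → (c ≢ e) × (b ≢ d) × (a ≢ d)
      nes ((_ ∷ _ ∷ ad ∷ _) ∷ (_ ∷ bd ∷ _) ∷ (_ ∷ ce ∷ _) ∷ _) = ce , bd , ad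
      c≢e = proj₁ (nes uniq)
      b≢d = proj₁ (proj₂ (nes uniq))
      a≢d = proj₂ (proj₂ (nes uniq))

    -- Since `a` and `b` are in `S c`, they are neighbours of `c` of degree 5. This gives both `d`
    -- and `e` three lost neighbours of `c`, so each collects `c` and pays 24.
    poor-c : deg c ≡ 7 → 4 ≤ n5 c → 60 ≤ P c u + P d u + P e u
    poor-c dc pc = sum63 (P≥15 u c7) (Q.cap24 d7 d∋c (≢sym c≢d) u) (Q.cap24 e7 e∋c (≢sym c≢e) u)
      where
      module Q = Poor dc pc
      qa = Q.S-only c∋a (small≢big a6 c7)
      qb = Q.S-only c∋b (small≢big b6 c7)
      d∋c : d ∋ c
      d∋c = coll3 cd (S-self d) (~sym uc) d∋u (proj₁ qb) (coll1 (~sym ub) d∋u (proj₂ qb)) (≢sym (~≢ ud)) (≢sym b≢d) (~≢ ub) (≤-reflexive dc)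
      e∋c : e ∋ c
      e∋c = coll3 (~sym uc) e∋u (proj₁ qa) e∋a (proj₁ qb) e∋b (~≢ ua) (~≢ ub) a≢b (≤-reflexive dc)

    poor-d : deg d ≡ 7 → 4 ≤ n5 d → (deg a ≤ 5) ⊎ (deg b ≤ 5) → 60 ≤ P c u + P d u + P e u
    poor-d dd pd h = swap-first {P d u} {P c u} {P e u} (sum63 (P≥15 u d7) (Q.cap24 c7 c∋d c≢d u) (Q.cap24 e7 e∋d e≢d u))
      where
      module Q = Poor dd pd
      both : (deg a ≤ 5) ⊎ (deg b ≤ 5) → (d ∋ a) × (d ∋ b)
      both (inj₁ a5) = let m = coll1 (~sym ua) d∋u a5 in m , spread d∋u m ua fab b6
      both (inj₂ b5) = let m = coll1 (~sym ub) d∋u b5 in spread d∋u m ub (Fc-rot ua fab) a6 , m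
      qa = Q.S-only (proj₁ (both h)) (small≢big a6 d7)
      qb = Q.S-only (proj₂ (both h)) (small≢big b6 d7)
      c∋d : c ∋ d
      c∋d = coll3 (~sym cd) (S-self c) (~sym ud) c∋u (proj₁ qb) c∋b (≢sym (~≢ uc)) (≢sym (~≢ bc)) (~≢ ub) (≤-reflexive dd)
      e∋d : e ∋ d
      e∋d = coll3 de (S-self e) (~sym ud) e∋u (proj₁ qa) e∋a (≢sym (~≢ ue)) (~≢ ea) (~≢ ua) (≤-reflexive dd)

    -- c collects two vertices of degree 6, which leaves room for two of degree 5
    six-c : 6 ≤ deg a → 6 ≤ deg b → 24 ≤ P c u
    six-c a6′ b6′ = P≥24 u c7 λ dc → ≤-pred (≰⇒> λ ge → bad dc ge)
      where
      room : n5 c + 3 ≤ count (S c)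
      room = n5-room {c} ((small≢big′ a6 c7 ∷ small≢big′ b6 c7 ∷ []) ∷ (a≢b ∷ []) ∷ [] ∷ [])
               ((S-self c , notself c) ∷ (c∋a , not5 a6′) ∷ (c∋b , not5 b6′) ∷ [])
        where
        small≢big′ : ∀ {x y} → deg x ≤ 6 → 7 ≤ deg y → y ≢ x
        small≢big′ p q e = small≢big p q (symm e)
      room₄ : c ∋ e → n5 c + 4 ≤ 6
      room₄ m = ≤-trans (n5-room {c} (((λ x → small≢big a6 c7 (symm x)) ∷ (λ x → small≢big b6 c7 (symm x)) ∷ c≢e ∷ [])
           ∷ (a≢b ∷ small≢big a6 e7 ∷ []) ∷ (small≢big b6 e7 ∷ []) ∷ [] ∷ [])
               ((S-self c , notself c) ∷ (c∋a , not5 a6′) ∷ (c∋b , not5 b6′) ∷ (m , not5 (≤-trans (n≤1+n 6) e7)) ∷ [])) (S-size c)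
      bad : deg c ≡ 7 → 3 ≤ n5 c → ⊥
      bad dc ge = capture e∋c (≢true λ m → 1+n≰n {6} (≤-trans (+-monoˡ-≤ 4 ge) (room₄ m))) full
        where
        full : 6 ≤ count (S c)
        full = ≤-trans (+-monoˡ-≤ 3 ge) room
        ca : c ~ a
        ca = all-nbrs dc full ge c∋a (small≢big a6 c7)
        e∋c : e ∋ c
        e∋c = coll3 (~sym uc) e∋u ca e∋a (~sym bc) e∋b (~≢ ua) (~≢ ub) a≢b (≤-reflexive dc)

  adjacent : ∀ {u a b c d e} → Pent u a b c d e → deg a ≤ 6 → deg b ≤ 6 → 7 ≤ deg c → 7 ≤ deg d → 7 ≤ deg e → 60 ≤ P c u + P d u + P e u
  adjacent {u} {a} {b} {c} {d} {e} p a6 b6 c7 d7 e7 = go (poor? c) (poor? d) (poor? e)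
    where
    module X = Adjacent p a6 b6 c7 d7 e7
    module Y = Adjacent (rot (rot (rot (mirror p)))) b6 a6 e7 d7 c7
    deg5? : ∀ x → (deg x ≤ 5) ⊎ (6 ≤ deg x)
    deg5? x = go′ (toSum (deg x ≤? 5))
      where
      go′ : (deg x ≤ 5) ⊎ ¬ (deg x ≤ 5) → (deg x ≤ 5) ⊎ (6 ≤ deg x)
      go′ (inj₁ q) = inj₁ q
      go′ (inj₂ q) = inj₂ (≰⇒> q)
    dcase : deg d ≡ 7 → 4 ≤ n5 d → (deg a ≤ 5) ⊎ (6 ≤ deg a) → (deg b ≤ 5) ⊎ (6 ≤ deg b) → 60 ≤ P c u + P d u + P e u
    dcase q g (inj₁ x) _        = X.poor-d q g (inj₁ x)
    dcase q g (inj₂ _) (inj₁ x) = X.poor-d q g (inj₂ x)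
    dcase q g (inj₂ x) (inj₂ y) = swap-first {P d u} {P c u} {P e u} (sum63 (P≥15 u d7) (X.six-c x y) (Y.six-c y x))
    go : ((deg c ≡ 7) × (4 ≤ n5 c)) ⊎ (deg c ≡ 7 → n5 c ≤ 3) → ((deg d ≡ 7) × (4 ≤ n5 d)) ⊎ (deg d ≡ 7 → n5 d ≤ 3) →
         ((deg e ≡ 7) × (4 ≤ n5 e)) ⊎ (deg e ≡ 7 → n5 e ≤ 3) → 60 ≤ P c u + P d u + P e u
    go (inj₁ (q , g)) _ _ = X.poor-c q g
    go (inj₂ _) (inj₁ (q , g)) _ = dcase q g (deg5? a) (deg5? b)
    go (inj₂ _) (inj₂ _) (inj₁ (q , g)) = reverse₃ {P e u} {P d u} {P c u} (Y.poor-c q g)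
    go (inj₂ x) (inj₂ y) (inj₂ z) = +-mono-≤ (+-mono-≤ (P≥20 u c7 x) (P≥20 u d7 y)) (P≥20 u e7 z)

  module Apart {u a b c d e} (p : Pent u a b c d e) (a6 : deg a ≤ 6) (c6 : deg c ≤ 6)
    (b7 : 7 ≤ deg b) (d7 : 7 ≤ deg d) (e7 : 7 ≤ deg e) where
    open Pent p
    private
      u5′ : deg u ≤ 5
      u5′ = ≤-reflexive u5
      b∋u : b ∋ u
      b∋u = F-in (~sym ub) u5′
      d∋u : d ∋ u
      d∋u = F-in (~sym ud) u5′
      e∋u : e ∋ u
      e∋u = F-in (~sym ue) u5′
      b∋a : b ∋ a
      b∋a = spread b∋u (S-self b) ub (Fc-rot ua fab) a6
      b∋c : b ∋ c
      b∋c = spread b∋u (S-self b) ub fbc c6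
      d∋c : d ∋ c
      d∋c = spread d∋u (S-self d) ud (Fc-rot uc fcd) c6
      e∋a : e ∋ a
      e∋a = spread e∋u (S-self e) ue fea a6
      nes : Unique (a ∷ b ∷ c ∷ d ∷ e ∷ []) → (a ≢ c) × (b ≢ d) × (b ≢ e) × (a ≢ d)
      nes ((_ ∷ ac ∷ ad ∷ _) ∷ (_ ∷ bd ∷ be ∷ _) ∷ _) = ac , bd , be , ad
      a≢c = proj₁ (nes uniq)
      b≢d = proj₁ (proj₂ (nes uniq))
      b≢e = proj₁ (proj₂ (proj₂ (nes uniq)))
      a≢d = proj₂ (proj₂ (proj₂ (nes uniq)))
      c≢e : c ≢ e
      c≢e = small≢big c6 e7

    poor-b : deg b ≡ 7 → 4 ≤ n5 b → 60 ≤ P b u + P d u + P e u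
    poor-b db pb = sum63 (P≥15 u b7) (Q.cap24 d7 (cap d∋u) (≢sym b≢d) u) (Q.cap24 e7 (cap e∋u) (≢sym b≢e) u)
      where
      module Q = Poor db pb
      qa = Q.S-only b∋a (small≢big a6 b7)
      qc = Q.S-only b∋c (small≢big c6 b7)
      cap : ∀ {s} → s ∋ u → s ∋ b
      cap m = coll3 (~sym ub) m (proj₁ qa) (coll1 (~sym ua) m (proj₂ qa)) (proj₁ qc) (coll1 (~sym uc) m (proj₂ qc))
                (~≢ ua) (~≢ uc) a≢c (≤-reflexive db)

    -- `d` collects `e` in any case. If `c` has degree 5, so does `b`, and 15 + 24 + 24 suffices;
    -- otherwise `b` gives 20 and `Sides` raises `d` to 30.
    poor-e : (deg b ≡ 7 → n5 b ≤ 3) → deg e ≡ 7 → 4 ≤ n5 e → 60 ≤ P b u + P d u + P e u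
    poor-e rb de′ pe = go (toSum (deg c ≤? 5))
      where
      module Q = Poor de′ pe
      qa = Q.S-only e∋a (small≢big a6 e7)
      d∋e : d ∋ e
      d∋e = coll3 (~sym de) (S-self d) (~sym ue) d∋u (proj₁ qa) (coll1 (~sym ua) d∋u (proj₂ qa))
              (≢sym (~≢ ud)) (≢sym a≢d) (~≢ ua) (≤-reflexive de′)
      d≢e = ~≢ de
      side : deg d ≡ 7 → 30 ≤ P d u
      side dd = Sides.P-side dd u5′ (~sym ud) (Fc-swap (Fc-rot uc fcd)) (Fc-swap fde) c≢e d∋c
        (≤-trans (n≤1+n 5) (Q.cap-size d7 d∋e d≢e)) (inj₁ d∋e) (Q.cap-n5≤2 d7 d∋e d≢e dd)
      go : (deg c ≤ 5) ⊎ ¬ (deg c ≤ 5) → 60 ≤ P b u + P d u + P e u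
      go (inj₁ c5) = reverse₃ {P e u} {P d u} {P b u} (sum63 (P≥15 u e7) (Q.cap24 d7 d∋e d≢e u) (Q.cap24 b7 b∋e b≢e u))
        where
        qc = Q.S-only (coll1 (~sym uc) e∋u c5) c≢e
        b∋e : b ∋ e
        b∋e = coll3 (~sym ue) b∋u (proj₁ qa) b∋a (proj₁ qc) b∋c (~≢ ua) (~≢ uc) a≢c (≤-reflexive de′)
      go (inj₂ c6′) = ≤-trans (≤ᵇ⇒ {60} {65} refl) (+-mono-≤ (+-mono-≤ (P≥20 u b7 rb)
        (P≥30 u d7 side (λ _ → Q.cap-n5≤4 d7 d∋e d≢e))) (P≥15 u e7))

  apart : ∀ {u a b c d e} → Pent u a b c d e → deg a ≤ 6 → 7 ≤ deg b → deg c ≤ 6 → 7 ≤ deg d → 7 ≤ deg e → 60 ≤ P b u + P d u + P e u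
  apart {u} {a} {b} {c} {d} {e} p a6 b7 c6 d7 e7 = go (poor? b) (poor? d) (poor? e)
    where
    module X = Apart p a6 c6 b7 d7 e7
    module Y = Apart (rot (rot (mirror p))) c6 a6 b7 e7 d7
    go : ((deg b ≡ 7) × (4 ≤ n5 b)) ⊎ (deg b ≡ 7 → n5 b ≤ 3) → ((deg d ≡ 7) × (4 ≤ n5 d)) ⊎ (deg d ≡ 7 → n5 d ≤ 3) →
         ((deg e ≡ 7) × (4 ≤ n5 e)) ⊎ (deg e ≡ 7 → n5 e ≤ 3) → 60 ≤ P b u + P d u + P e u
    go (inj₁ (q , g)) _ _ = X.poor-b q g
    go (inj₂ rb) _ (inj₁ (q , g)) = X.poor-e rb q g
    go (inj₂ rb) (inj₁ (q , g)) (inj₂ _) = swap-last {P b u} {P e u} {P d u} (Y.poor-e rb q g)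
    go (inj₂ x) (inj₂ y) (inj₂ z) = +-mono-≤ (+-mono-≤ (P≥20 u b7 x) (P≥20 u d7 y)) (P≥20 u e7 z)

-- Vertices of degree 5 with three small neighbours

module ThreeSmall (St : Setting) where
  open TwoSmall St public

  -- u has degree 5, two big neighbours v, w, and three small ones, all collected with v and with w
  record Trio (u v w x y z : Fin n) : Set where
    field
      u5 : deg u ≡ 5
      uv : u ~ v
      uw : u ~ w
      ux : u ~ x
      uy : u ~ y
      uz : u ~ z
      uniq : Unique (v ∷ w ∷ x ∷ y ∷ z ∷ [])
      x6 : deg x ≤ 6
      y6 : deg y ≤ 6
      z6 : deg z ≤ 6
      v7 : 7 ≤ deg v
      w7 : 7 ≤ deg w
      vx : v ∋ x
      vy : v ∋ y
      vz : v ∋ z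
      wx : w ∋ x
      wy : w ∋ y
      wz : w ∋ z
      capv : deg v ≡ 7 → w ∋ v
      capw : deg w ≡ 7 → v ∋ w

  flipT : ∀ {u v w x y z} → Trio u v w x y z → Trio u w v x y z
  flipT {u} {v} {w} {x} {y} {z} t = record { u5 = u5 ; uv = uw ; uw = uv ; ux = ux ; uy = uy ; uz = uz ; uniq = un uniq ; x6 = x6 ; y6 = y6 ; z6 = z6
      ; v7 = w7 ; w7 = v7 ; vx = wx ; vy = wy ; vz = wz ; wx = vx ; wy = vy ; wz = vz ; capv = capw ; capw = capv }
    where
    open Trio t
    un : Unique (v ∷ w ∷ x ∷ y ∷ z ∷ []) → Unique (w ∷ v ∷ x ∷ y ∷ z ∷ [])
    un ((a ∷ b) ∷ c ∷ d) = (≢sym a ∷ c) ∷ b ∷ d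

  module OnTrio {u v w x y z} (t : Trio u v w x y z) where
    open Trio t public

    u5′ : deg u ≤ 5
    u5′ = ≤-reflexive u5

    U : List (Fin n)
    U = u ∷ v ∷ w ∷ x ∷ y ∷ z ∷ []

    uniqU : Unique U
    uniqU = (~≢ uv ∷ ~≢ uw ∷ ~≢ ux ∷ ~≢ uy ∷ ~≢ uz ∷ []) ∷ uniq

    v≢w : v ≢ w
    v≢w = go uniq
      where
      go : Unique (v ∷ w ∷ x ∷ y ∷ z ∷ []) → v ≢ w
      go ((a ∷ _) ∷ _) = a

    vu : v ∋ u
    vu = F-in (~sym uv) u5′

    wu : w ∋ u
    wu = F-in (~sym uw) u5′

    near : ∀ {q} → q ∈ U → (q ≡ u) ⊎ (u ~ q)
    near (here e) = inj₁ e
    near (there (here refl)) = inj₂ uv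
    near (there (there (here refl))) = inj₂ uw
    near (there (there (there (here refl)))) = inj₂ ux
    near (there (there (there (there (here refl))))) = inj₂ uy
    near (there (there (there (there (there (here refl)))))) = inj₂ uz

    exactV : v ∋ w → ∀ {q} → v ∋ q → q ∈ U
    exactV m = exact uniqU (vu ∷ S-self v ∷ m ∷ vx ∷ vy ∷ vz ∷ []) (S-size v)

    exactW : w ∋ v → ∀ {q} → w ∋ q → q ∈ U
    exactW m = exact uniqU (wu ∷ m ∷ S-self w ∷ wx ∷ wy ∷ wz ∷ []) (S-size w)

    fullW : w ∋ v → 6 ≤ count (S w)
    fullW m = size≥ uniqU (wu ∷ m ∷ S-self w ∷ wx ∷ wy ∷ wz ∷ [])

    uniq5 : Unique (u ∷ v ∷ x ∷ y ∷ z ∷ [])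
    uniq5 = go uniqU
      where
      go : Unique U → Unique (u ∷ v ∷ x ∷ y ∷ z ∷ [])
      go ((a ∷ _ ∷ b) ∷ (_ ∷ c) ∷ _ ∷ d) = (a ∷ b) ∷ c ∷ d

    sizeV : 5 ≤ count (S v)
    sizeV = size≥ uniq5 (vu ∷ S-self v ∷ vx ∷ vy ∷ vz ∷ [])

    -- every vertex outside S v next to a vertex of degree 5 of S v would collect v
    full : deg v ≡ 7 → v ∋ w → 3 ≤ n5 v → ⊥
    full d7 vw ge = go (n5-elems v 3 ge)
      where
      six : 6 ≤ count (S v)
      six = size≥ uniqU (vu ∷ S-self v ∷ vw ∷ vx ∷ vy ∷ vz ∷ [])
      go : (∃ λ xs → Unique xs × All (λ g → (v ~ g) × (deg g ≤ 5)) xs × (length xs ≡ 3)) → ⊥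
      go (g₁ ∷ g₂ ∷ g₃ ∷ [] , (n₁₂ ∷ n₁₃ ∷ []) ∷ (n₂₃ ∷ []) ∷ _ , (p₁ , f₁) ∷ (p₂ , f₂) ∷ (p₃ , f₃) ∷ [] , _) = pick (toSum (g₁ F.≟ u))
        where
        near′ : ∀ {g} → v ~ g → deg g ≤ 5 → (g ≡ u) ⊎ (u ~ g)
        near′ p f = near (exactV vw (F-in p f))
        lost : ∀ {q g} → q ∋ u → deg g ≤ 5 → (g ≡ u) ⊎ (u ~ g) → q ∋ g
        lost m f (inj₁ refl) = m
        lost m f (inj₂ ug)   = coll1 (~sym ug) m f
        outer : ∀ {g} → u ~ g → deg g ≤ 5 → ∀ q → g ~ q → (q ≡ u) ⊎ (u ~ q)
        outer {g} ug f q gq = by (bool-cases (S v q))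
          where
          by : (S v q ≡ true) ⊎ (S v q ≡ false) → (q ≡ u) ⊎ (u ~ q)
          by (inj₁ m) = near (exactV vw m)
          by (inj₂ m) = ⊥-elim (capture (coll3 p₁ (lost qu f₁ (near′ p₁ f₁)) p₂ (lost qu f₂ (near′ p₂ f₂)) p₃ (lost qu f₃ (near′ p₃ f₃))
                          n₁₂ n₁₃ n₂₃ (≤-reflexive d7)) m six)
            where
            qu : q ∋ u
            qu = coll1 ug (coll1 gq (S-self q) f) u5′
        bad : ∀ {g} → v ~ g → deg g ≤ 5 → g ≢ u → ⊥
        bad {g} p f ne = fin (near′ p f)
          where
          fin : (g ≡ u) ⊎ (u ~ g) → ⊥
          fin (inj₁ e)  = ne e
          fin (inj₂ ug) = full-nbr ug u5′ f (outer ug f)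
        pick : (g₁ ≡ u) ⊎ (g₁ ≢ u) → ⊥
        pick (inj₂ ne) = bad p₁ f₁ ne
        pick (inj₁ e)  = bad p₂ f₂ (λ e′ → n₁₂ (trans e (symm e′)))

    -- `S v` is filled by `v` and its neighbours of degree 5. Hence `u`, `x`, `y`, `z` are
    -- neighbours of `v`, and `w`, itself outside `S v`, collects `v` through them.
    eight : deg v ≡ 8 → 5 ≤ n5 v → ⊥
    eight d8 ge = go (n5-elems v 5 ge)
      where
      go : (∃ λ xs → Unique xs × All (λ g → (v ~ g) × (deg g ≤ 5)) xs × (length xs ≡ 5)) → ⊥
      go (xs , uxs , axs , len) = capture w∋v (≢true λ m → small≢big (≤-trans (proj₂ (inx m (≢sym v≢w))) (n≤1+n 5)) w7 refl)
          (≤-trans (≤-reflexive (cong suc (symm len))) (size≥ uvx avx))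
        where
        uvx : Unique (v ∷ xs)
        uvx = All.map (λ q → ~≢ (proj₁ q)) axs ∷ uxs
        avx : All (v ∋_) (v ∷ xs)
        avx = S-self v ∷ All.map (λ q → F-in (proj₁ q) (proj₂ q)) axs
        inx : ∀ {q} → v ∋ q → q ≢ v → (v ~ q) × (deg q ≤ 5)
        inx {q} m ne = at (exact uvx avx (≤-trans (S-size v) (≤-reflexive (cong suc (symm len)))) m)
          where
          at : q ∈ v ∷ xs → (v ~ q) × (deg q ≤ 5)
          at (here e)  = ⊥-elim (ne e)
          at (there i) = All.lookup axs i
        un : Unique U → Unique (u ∷ x ∷ y ∷ z ∷ [])
        un ((_ ∷ _ ∷ a) ∷ _ ∷ _ ∷ b) = a ∷ b
        w∋v : w ∋ v
        w∋v = coll (un uniqU) ((~sym uv , wu) ∷ (proj₁ (inx vx (small≢big x6 v7)) , wx) ∷ (proj₁ (inx vy (small≢big y6 v7)) , wy)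
                ∷ (proj₁ (inx vz (small≢big z6 v7)) , wz) ∷ []) (≤-reflexive d8)

    n5w≤4 : w ∋ v → n5 w ≤ 4
    n5w≤4 m = +-cancelʳ-≤ 2 (n5 w) 4 (≤-trans (n5-room {w} ((≢sym v≢w ∷ []) ∷ [] ∷ [])
      ((S-self w , notself w) ∷ (m , not5 (≤-trans (n≤1+n 6) v7)) ∷ [])) (S-size w))

    -- the case where v has three neighbours of degree 5 but does not collect w
    module Hard (d7 : deg v ≡ 7) (wv : w ∋ v) (nw : S v w ≡ false) where
      -- That `w` escapes `S v` caps the neighbours of `w` inside `S v`; the bounds on `n5 w` come
      -- from here.
      blocked : ∀ {q qs} → Unique (q ∷ qs) → All (λ g → (w ~ g) × (v ∋ g)) (q ∷ qs) → deg w ≤ 4 + length (q ∷ qs) → ⊥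
      blocked uq aq le = contra (coll uq aq le) nw

      fives : ∀ {g} → w ~ g → deg g ≤ 5 → g ∈ u ∷ x ∷ y ∷ z ∷ []
      fives {g} p f = at (exactW wv (F-in p f))
        where
        at : g ∈ U → g ∈ u ∷ x ∷ y ∷ z ∷ []
        at (here e) = here e
        at (there (here e)) = ⊥-elim (small≢big (≤-trans f (n≤1+n 5)) v7 e)
        at (there (there (here e))) = ⊥-elim (small≢big (≤-trans f (n≤1+n 5)) w7 e)
        at (there (there (there i))) = there i

      vfives : ∀ {g} → g ∈ u ∷ x ∷ y ∷ z ∷ [] → v ∋ g
      vfives = All.lookup (vu ∷ vx ∷ vy ∷ vz ∷ [])

      -- Otherwise `S w` would be a wheel with `w` as its only big vertex, but it contains the big
      -- vertex `v`. So `p9` can reach 45.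
      hubless : hasHub w ≡ false
      hubless = ≢true λ q → go (anyB⇒ (λ h → (adj G w h ∧ five h) ∧ lone h) q)
        where
        go : (∃ λ h → (adj G w h ∧ five h) ∧ lone h ≡ true) → ⊥
        go (h , q) = at (HubAt.only H wv)
          where
          q₁ = ∧-elim {adj G w h ∧ five h} q
          q₂ = ∧-elim {adj G w h} (proj₁ q₁)
          h5 : deg h ≤ 5
          h5 = ≤ᵇ⇒ (proj₂ q₂)
          H : HubAt w h
          H = hub-at w7 (proj₁ q₂) h5 (≤ᵇ⇒ (proj₂ q₁))
          at : v ∈ h ∷ HubAt.a H ∷ HubAt.b H ∷ HubAt.c H ∷ HubAt.d H ∷ w ∷ [] → ⊥
          at (here e) = small≢big (≤-trans h5 (n≤1+n 5)) v7 (symm e)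
          at (there (here e)) = small≢big (HubAt.a6 H) v7 (symm e)
          at (there (there (here e))) = small≢big (HubAt.b6 H) v7 (symm e)
          at (there (there (there (here e)))) = small≢big (HubAt.c6 H) v7 (symm e)
          at (there (there (there (there (here e))))) = small≢big (HubAt.d6 H) v7 (symm e)
          at (there (there (there (there (there (here e)))))) = v≢w e

      P45 : 9 ≤ deg w → (deg w ≤ 9 → n5 w ≤ 3) → 60 ≤ P v u + P w u
      P45 w9 h = +-mono-≤ (P≥15 u v7) (≤-reflexive (symm (trans (P9 w9 u)
        (trans (cong (λ b → p9 (deg w) (n5 w) b (lone u)) hubless) (p9≡45 (deg w) (n5 w) (lone u) (n5w≤4 wv) h)))))

      P40 : deg w ≡ 8 → n5 w ≤ 2 → n5 v ≤ 3 → 60 ≤ P v u + P w u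
      P40 w8 le le′ = +-mono-≤ (P≥20 u v7 (λ _ → le′)) (subst (40 ≤_) (symm (P8 w8 u)) (p8≥40 (n5 w) le))

    HardGoal : Set
    HardGoal = (d7 : deg v ≡ 7) (wv : w ∋ v) (nw : S v w ≡ false) → 8 ≤ deg w → 60 ≤ P v u + P w u

  -- Normally each pays 30. A vertex of degree 7 can fail to only with three neighbours of degree 5;
  -- by `full` it then leaves its partner uncollected, the partner has degree at least 8, and the
  -- hard case makes up the difference.
  trio : ∀ {u v w x y z} (t : Trio u v w x y z) → (deg v ≡ 7 → n5 v ≤ 2 → 30 ≤ P v u) → (deg w ≡ 7 → n5 w ≤ 2 → 30 ≤ P w u) →
    OnTrio.HardGoal t → OnTrio.HardGoal (flipT t) → 60 ≤ P v u + P w u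
  trio {u} {v} {w} t sv sw hardV hardW = go (toSum (deg v ≟ 7)) (toSum (deg w ≟ 7))
    where
    module X = OnTrio t
    module Y = OnTrio (flipT t)
    over7 : ∀ {q} → 7 ≤ deg q → deg q ≢ 7 → 8 ≤ deg q
    over7 le ne = ≤∧≢⇒< le (λ e → ne (symm e))
    one : deg v ≡ 7 → deg w ≢ 7 → (n5 v ≤ 2) ⊎ ¬ (n5 v ≤ 2) → 60 ≤ P v u + P w u
    one e ne (inj₁ le) = +-mono-≤ (sv e le) (P≥30 u X.w7 (λ e′ → ⊥-elim (ne e′)) (λ _ → X.n5w≤4 (X.capv e)))
    one e ne (inj₂ ge) = hardV e (X.capv e) (≢true λ m → X.full e m (≰⇒> ge)) (over7 X.w7 ne)
    other : deg v ≢ 7 → deg w ≡ 7 → (n5 w ≤ 2) ⊎ ¬ (n5 w ≤ 2) → 60 ≤ P v u + P w u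
    other ne e (inj₁ le) = +-mono-≤ (P≥30 u X.v7 (λ e′ → ⊥-elim (ne e′)) (λ _ → Y.n5w≤4 (X.capw e))) (sw e le)
    other ne e (inj₂ ge) = subst (60 ≤_) (+-comm (P w u) (P v u)) (hardW e (X.capw e) (≢true λ m → Y.full e m (≰⇒> ge)) (over7 X.v7 ne))
    go : (deg v ≡ 7) ⊎ (deg v ≢ 7) → (deg w ≡ 7) ⊎ (deg w ≢ 7) → 60 ≤ P v u + P w u
    go (inj₁ e) (inj₁ e′) = +-mono-≤ (sv e (≤-pred (≰⇒> (X.full e (X.capw e′))))) (sw e′ (≤-pred (≰⇒> (Y.full e′ (X.capv e)))))
    go (inj₁ e) (inj₂ ne) = one e ne (toSum (n5 v ≤? 2))
    go (inj₂ ne) (inj₁ e) = other ne e (toSum (n5 w ≤? 2))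
    go (inj₂ ne) (inj₂ ne′) = +-mono-≤ (P≥30 u X.v7 (λ e → ⊥-elim (ne e)) (λ e → ≤-pred (≰⇒> (X.eight e))))
                                       (P≥30 u X.w7 (λ e → ⊥-elim (ne′ e)) (λ e → ≤-pred (≰⇒> (Y.eight e))))

  -- small neighbours a, b, c in a row
  module Run {u a b c d e} (p : Pent u a b c d e) (a6 : deg a ≤ 6) (b6 : deg b ≤ 6) (c6 : deg c ≤ 6)
    (d7 : 7 ≤ deg d) (e7 : 7 ≤ deg e) where
    open Pent p
    private
      u5′ : deg u ≤ 5
      u5′ = ≤-reflexive u5
      d∋u : d ∋ u
      d∋u = F-in (~sym ud) u5′
      e∋u : e ∋ u
      e∋u = F-in (~sym ue) u5′
      d∋c : d ∋ c
      d∋c = spread d∋u (S-self d) ud (Fc-rot uc fcd) c6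
      d∋b : d ∋ b
      d∋b = spread d∋u d∋c uc (Fc-rot ub fbc) b6
      d∋a : d ∋ a
      d∋a = spread d∋u d∋b ub (Fc-rot ua fab) a6
      e∋a : e ∋ a
      e∋a = spread e∋u (S-self e) ue fea a6
      e∋b : e ∋ b
      e∋b = spread e∋u e∋a ua fab b6
      e∋c : e ∋ c
      e∋c = spread e∋u e∋b ub fbc c6
      un : Unique (a ∷ b ∷ c ∷ d ∷ e ∷ []) → Unique (d ∷ e ∷ a ∷ b ∷ c ∷ [])
      un ((x₁ ∷ x₂ ∷ x₃ ∷ x₄ ∷ []) ∷ (y₁ ∷ y₂ ∷ y₃ ∷ []) ∷ (z₁ ∷ z₂ ∷ []) ∷ (w ∷ []) ∷ _) =
        (w ∷ ≢sym x₃ ∷ ≢sym y₂ ∷ ≢sym z₁ ∷ []) ∷ (≢sym x₄ ∷ ≢sym y₃ ∷ ≢sym z₂ ∷ []) ∷ (x₁ ∷ x₂ ∷ []) ∷ (y₁ ∷ []) ∷ [] ∷ []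

    t : Trio u d e a b c
    t = record { u5 = u5 ; uv = ud ; uw = ue ; ux = ua ; uy = ub ; uz = uc ; uniq = un uniq ; x6 = a6 ; y6 = b6 ; z6 = c6 ; v7 = d7 ; w7 = e7
      ; vx = d∋a ; vy = d∋b ; vz = d∋c ; wx = e∋a ; wy = e∋b ; wz = e∋c
      ; capv = λ q → coll3 de (S-self e) (~sym ud) e∋u (~sym cd) e∋c (≢sym (~≢ ue)) (≢sym (small≢big c6 e7)) (~≢ uc) (≤-reflexive q)
      ; capw = λ q → coll3 (~sym de) (S-self d) (~sym ue) d∋u ea d∋a (≢sym (~≢ ud)) (≢sym (small≢big a6 d7)) (~≢ ua) (≤-reflexive q) }

    open OnTrio t using (exactW; sizeV; HardGoal; uniqU; fullW; v≢w)

    side : deg d ≡ 7 → n5 d ≤ 2 → 30 ≤ P d u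
    side q le = Sides.P-side q u5′ (~sym ud) (Fc-swap (Fc-rot uc fcd)) (Fc-swap fde) (small≢big c6 e7) d∋c sizeV (ms (bool-cases (S d e))) le
      where
      e∋d : e ∋ d
      e∋d = Trio.capv t q
      at : ∀ {g} → g ∈ u ∷ d ∷ e ∷ a ∷ b ∷ c ∷ [] → (d ∋ g) ⊎ (g ≡ e)
      at (here refl) = inj₁ d∋u
      at (there (here refl)) = inj₁ (S-self d)
      at (there (there (here z))) = inj₂ z
      at (there (there (there (here refl)))) = inj₁ d∋a
      at (there (there (there (there (here refl))))) = inj₁ d∋b
      at (there (there (there (there (there (here refl)))))) = inj₁ d∋c
      ms : (S d e ≡ true) ⊎ (S d e ≡ false) → (d ∋ e) ⊎ ((7 ≤ deg e) × (e ∋ d) × (∀ g → e ∋ g → (d ∋ g) ⊎ (g ≡ e)))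
      ms (inj₁ m) = inj₁ m
      ms (inj₂ _) = inj₂ (e7 , e∋d , λ g m → at (exactW e∋d m))

    hard : HardGoal
    hard q ed nde le = go (m≤n⇒m<n∨m≡n le)
      where
      open OnTrio.Hard t q ed nde
      d≢ : ∀ {g} → g ∈ u ∷ a ∷ b ∷ c ∷ [] → d ≢ g
      d≢ (here z) r = ~≢ ud (symm (trans r z))
      d≢ (there (here z)) r = small≢big a6 d7 (symm (trans r z))
      d≢ (there (there (here z))) r = small≢big b6 d7 (symm (trans r z))
      d≢ (there (there (there (here z)))) r = small≢big c6 d7 (symm (trans r z))
      -- with d, the vertices of degree 5 around e are too many to leave e uncollected
      few : ∀ m → deg e ≤ 5 + m → n5 e < m
      few m de′ = ≰⇒> λ ge → bad (n5-elems e m ge)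
        where
        bad : (∃ λ xs → Unique xs × All (λ g → (e ~ g) × (deg g ≤ 5)) xs × (length xs ≡ m)) → ⊥
        bad (xs , uxs , axs , len) = blocked {d} {xs} (All.map (λ g → d≢ (fives (proj₁ g) (proj₂ g))) axs ∷ uxs)
          ((~sym de , S-self d) ∷ All.map (λ g → proj₁ g , vfives (fives (proj₁ g) (proj₂ g))) axs)
          (≤-trans de′ (≤-reflexive (cong (5 +_) (symm len))))
      -- `t₂` is the neighbour of `e` just beyond `a`. Deleting it takes `a`, `u`, `b`, `c`, then
      -- `d`, and finally `e`, the seventh.
      poor : deg e ≡ 8 → 4 ≤ n5 d → ⊥
      poor e8 pd = over u7 (S-self t₂ ∷ m-u ∷ m-d ∷ m-e ∷ m-a ∷ m-b ∷ m-c ∷ []) ≤-refl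
        where
        module Q = Poor q pd
        qa = Q.S-only d∋a (small≢big a6 d7)
        qb = Q.S-only d∋b (small≢big b6 d7)
        qc = Q.S-only d∋c (small≢big c6 d7)
        lk = link (~sym ue) (Fc-swap fea) (Fc-swap (Fc-rot ud fde)) (small≢big a6 d7)
        open Ring (proj₁ lk) (~sym ue)
        r₁ : r 1 ≡ a
        r₁ = proj₁ (proj₂ lk)
        r₇ : r 7 ≡ d
        r₇ = inj (proj₁ lk) (r~ 7) (~sym de) (trans (trans (cong r (symm e8)) r-wrap) (symm (proj₂ (proj₂ lk))))
        sep : ∀ {i j} → i < j → j < 8 → r i ≢ r j
        sep lt lt′ = r-inj lt (subst (_ <_) (symm e8) lt′)
        t₂ = r 2
        at : a ~ t₂
        at = subst (_~ t₂) r₁ (rr 1)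
        t≢u : t₂ ≢ u
        t≢u = ≢sym (sep {0} {2} (s≤s z≤n) (s≤s (s≤s (s≤s z≤n))))
        t≢d : t₂ ≢ d
        t≢d z = sep {2} {7} (s≤s (s≤s (s≤s z≤n))) ≤-refl (trans z (symm r₇))
        t≢ : ∀ {g} → d ∋ g → g ≢ u → g ≢ d → g ≢ a → t₂ ≢ g
        t≢ {g} m nu nd na z = blocked {u} {d ∷ a ∷ g ∷ []} ((~≢ ud ∷ ~≢ ua ∷ ≢sym nu ∷ []) ∷ (≢sym (small≢big a6 d7) ∷ ≢sym nd ∷ []) ∷ (≢sym na ∷ []) ∷ [] ∷ [])
          ((~sym ue , d∋u) ∷ (~sym de , S-self d) ∷ (ea , d∋a) ∷ (subst (e ~_) z (r~ 2) , m) ∷ []) (≤-reflexive e8)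
        nes : Unique (a ∷ b ∷ c ∷ d ∷ e ∷ []) → (a ≢ b) × (a ≢ c)
        nes ((x ∷ y ∷ _) ∷ _) = x , y
        m-a : t₂ ∋ a
        m-a = coll1 at (S-self t₂) (proj₂ qa)
        m-u : t₂ ∋ u
        m-u = coll1 ua m-a u5′
        m-b : t₂ ∋ b
        m-b = coll1 (~sym ub) m-u (proj₂ qb)
        m-c : t₂ ∋ c
        m-c = coll1 (~sym uc) m-u (proj₂ qc)
        m-d : t₂ ∋ d
        m-d = coll3 (~sym ud) m-u (proj₁ qa) m-a (proj₁ qb) m-b (~≢ ua) (~≢ ub) (proj₁ (nes uniq)) (≤-reflexive q)
        m-e : t₂ ∋ e
        m-e = coll ((t≢u ∷ t≢d ∷ ≢sym (~≢ at) ∷ []) ∷ (~≢ ud ∷ ~≢ ua ∷ []) ∷ (≢sym (small≢big a6 d7) ∷ []) ∷ [] ∷ [])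
          ((r~ 2 , S-self t₂) ∷ (~sym ue , m-u) ∷ (~sym de , m-d) ∷ (ea , m-a) ∷ []) (≤-reflexive e8)
        u7 : Unique (t₂ ∷ u ∷ d ∷ e ∷ a ∷ b ∷ c ∷ [])
        u7 = (t≢u ∷ t≢d ∷ ≢sym (~≢ (r~ 2)) ∷ ≢sym (~≢ at)
            ∷ t≢ d∋b (≢sym (~≢ ub)) (small≢big b6 d7) (≢sym (proj₁ (nes uniq)))
            ∷ t≢ d∋c (≢sym (~≢ uc)) (small≢big c6 d7) (≢sym (proj₂ (nes uniq))) ∷ []) ∷ uniqU
      go : (8 < deg e) ⊎ (8 ≡ deg e) → 60 ≤ P d u + P e u
      go (inj₁ e9) = P45 e9 (λ le9 → ≤-pred (few 4 le9))
      go (inj₂ e8) = P40 (symm e8) (≤-pred (few 3 (≤-reflexive (symm e8)))) (≤-pred (≰⇒> (poor (symm e8))))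

  run : ∀ {u a b c d e} → Pent u a b c d e → deg a ≤ 6 → deg b ≤ 6 → deg c ≤ 6 → 7 ≤ deg d → 7 ≤ deg e → 60 ≤ P d u + P e u
  run {u} {a} {b} {c} {d} {e} p a6 b6 c6 d7 e7 = trio X.t X.side Y.side X.hard hardY
    where
    module X = Run p a6 b6 c6 d7 e7
    module Y = Run (rot (rot (mirror p))) c6 b6 a6 e7 d7
    hardY : OnTrio.HardGoal (flipT X.t)
    hardY = Y.hard

  -- small neighbours a, b and, across from them, d
  module Split {u a b c d e} (p : Pent u a b c d e) (a6 : deg a ≤ 6) (b6 : deg b ≤ 6) (c7 : 7 ≤ deg c)
    (d6 : deg d ≤ 6) (e7 : 7 ≤ deg e) where
    open Pent p
    private
      u5′ : deg u ≤ 5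
      u5′ = ≤-reflexive u5
      c∋u : c ∋ u
      c∋u = F-in (~sym uc) u5′
      e∋u : e ∋ u
      e∋u = F-in (~sym ue) u5′
      c∋b : c ∋ b
      c∋b = spread c∋u (S-self c) uc (Fc-rot ub fbc) b6
      c∋a : c ∋ a
      c∋a = spread c∋u c∋b ub (Fc-rot ua fab) a6
      c∋d : c ∋ d
      c∋d = spread c∋u (S-self c) uc fcd d6
      e∋a : e ∋ a
      e∋a = spread e∋u (S-self e) ue fea a6
      e∋b : e ∋ b
      e∋b = spread e∋u e∋a ua fab b6
      e∋d : e ∋ d
      e∋d = spread e∋u (S-self e) ue (Fc-rot ud fde) d6
      un : Unique (a ∷ b ∷ c ∷ d ∷ e ∷ []) → Unique (c ∷ e ∷ a ∷ b ∷ d ∷ [])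
      un ((x₁ ∷ x₂ ∷ x₃ ∷ x₄ ∷ []) ∷ (y₁ ∷ y₂ ∷ y₃ ∷ []) ∷ (z₁ ∷ z₂ ∷ []) ∷ (w ∷ []) ∷ _) =
        (z₂ ∷ ≢sym x₂ ∷ ≢sym y₁ ∷ z₁ ∷ []) ∷ (≢sym x₄ ∷ ≢sym y₃ ∷ ≢sym w ∷ []) ∷ (x₁ ∷ x₃ ∷ []) ∷ (y₂ ∷ []) ∷ [] ∷ []
      nes : Unique (a ∷ b ∷ c ∷ d ∷ e ∷ []) → (a ≢ d) × (b ≢ d)
      nes ((_ ∷ _ ∷ x ∷ _) ∷ (_ ∷ y ∷ _) ∷ _) = x , y
      a≢d = proj₁ (nes uniq)
      b≢d = proj₂ (nes uniq)

    t : Trio u c e a b d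
    t = record { u5 = u5 ; uv = uc ; uw = ue ; ux = ua ; uy = ub ; uz = ud ; uniq = un uniq ; x6 = a6 ; y6 = b6 ; z6 = d6 ; v7 = c7 ; w7 = e7
      ; vx = c∋a ; vy = c∋b ; vz = c∋d ; wx = e∋a ; wy = e∋b ; wz = e∋d
      ; capv = λ q → coll3 (~sym uc) e∋u (~sym bc) e∋b cd e∋d (~≢ ub) (~≢ ud) b≢d (≤-reflexive q)
      ; capw = λ q → coll3 (~sym ue) c∋u ea c∋a (~sym de) c∋d (~≢ ua) (~≢ ud) a≢d (≤-reflexive q) }

    open OnTrio t using (sizeV; HardGoal; uniqU; fullW; v≢w; exactW; U)

    side-c : deg c ≡ 7 → n5 c ≤ 2 → 30 ≤ P c u
    side-c q le = Sides.P-side q u5′ (~sym uc) (Fc-swap (Fc-rot ub fbc)) (Fc-swap fcd) b≢d c∋b sizeV (inj₁ c∋d) le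

    side-e : deg e ≡ 7 → n5 e ≤ 2 → 30 ≤ P e u
    side-e q le = Sides.P-side q u5′ (~sym ue) (Fc-swap fea) (Fc-swap (Fc-rot ud fde)) a≢d e∋a (OnTrio.sizeV (flipT t)) (inj₁ e∋d) le

    hard : HardGoal
    hard q ec nce le = go (m≤n⇒m<n∨m≡n le)
      where
      open OnTrio.Hard t q ec nce
      lk = link (~sym ue) (Fc-swap fea) (Fc-swap (Fc-rot ud fde)) a≢d
      open Ring (proj₁ lk) (~sym ue)
      r₁ : r 1 ≡ a
      r₁ = proj₁ (proj₂ lk)
      last : ∀ m → deg e ≡ suc m → r m ≡ d
      last m z = inj (proj₁ lk) (r~ m) (~sym de) (trans (trans (cong r (symm z)) r-wrap) (symm (proj₂ (proj₂ lk))))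
      at₂ : a ~ r 2
      at₂ = subst (_~ r 2) r₁ (rr 1)
      u≢ : Unique (u ∷ a ∷ d ∷ [])
      u≢ = (~≢ ua ∷ ~≢ ud ∷ []) ∷ (a≢d ∷ []) ∷ [] ∷ []

      -- Without `g` the list `xs` would have to hold all neighbours of `e` of degree 5, and it is
      -- too short.
      must : ∀ {xs} g → length xs < n5 e → (∀ h → e ~ h → deg h ≤ 5 → h ∈ g ∷ xs) → (e ~ g) × (deg g ≤ 5)
      must {xs} g lt h = fin (bool-cases (adj G e g ∧ five g))
        where
        drop : adj G e g ∧ five g ≡ false → ∀ z → adj G e z ∧ five z ≡ true → z ∈ xs
        drop ng z tz = at (h z (proj₁ (∧-elim {adj G e z} tz)) (≤ᵇ⇒ (proj₂ (∧-elim {adj G e z} tz))))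
          where
          at : z ∈ g ∷ xs → z ∈ xs
          at (here refl) = contra tz ng
          at (there i)   = i
        fin : (adj G e g ∧ five g ≡ true) ⊎ (adj G e g ∧ five g ≡ false) → (e ~ g) × (deg g ≤ 5)
        fin (inj₁ tg) = proj₁ (∧-elim {adj G e g} tg) , ≤ᵇ⇒ (proj₂ (∧-elim {adj G e g} tg))
        fin (inj₂ ng) = ⊥-elim (<⇒≱ lt (#-≤-cover (λ z → adj G e z ∧ five z) xs (drop ng)))

      module Eight (e8 : deg e ≡ 8) where
        no-b : ¬ (e ~ b)
        no-b eb = blocked {u} {a ∷ b ∷ d ∷ []} ((~≢ ua ∷ ~≢ ub ∷ ~≢ ud ∷ []) ∷ (~≢ ab ∷ a≢d ∷ []) ∷ (b≢d ∷ []) ∷ [] ∷ [])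
          ((~sym ue , c∋u) ∷ (ea , c∋a) ∷ (eb , c∋b) ∷ (~sym de , c∋d) ∷ []) (≤-reflexive e8)
        no-c : ¬ (e ~ c)
        no-c ec′ = blocked {u} {a ∷ c ∷ d ∷ []} ((~≢ ua ∷ ~≢ uc ∷ ~≢ ud ∷ []) ∷ (small≢big a6 c7 ∷ a≢d ∷ []) ∷ (~≢ cd ∷ []) ∷ [] ∷ [])
          ((~sym ue , c∋u) ∷ (ea , c∋a) ∷ (ec′ , S-self c) ∷ (~sym de , c∋d) ∷ []) (≤-reflexive e8)
        sep : ∀ {i j} → i < j → j < 8 → r i ≢ r j
        sep lt lt′ = r-inj lt (subst (_ <_) (symm e8) lt′)
        t≢u : r 2 ≢ u
        t≢u = ≢sym (sep {0} {2} (s≤s z≤n) (s≤s (s≤s (s≤s z≤n))))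
        t≢d : r 2 ≢ d
        t≢d z = sep {2} {7} (s≤s (s≤s (s≤s z≤n))) ≤-refl (trans z (symm (last 7 e8)))
        t∉ : r 2 ∉ U
        t∉ (here z) = t≢u z
        t∉ (there (here z)) = no-c (subst (e ~_) z (r~ 2))
        t∉ (there (there (here z))) = ~≢ (r~ 2) (symm z)
        t∉ (there (there (there (here z)))) = ~≢ at₂ (symm z)
        t∉ (there (there (there (there (here z))))) = no-b (subst (e ~_) z (r~ 2))
        t∉ (there (there (there (there (there (here z)))))) = t≢d z
        -- Deleting the neighbour `r 2` of `e` beyond `a` would collect `a`, `u`, `d` and thereby
        -- `e`, although `r 2` lies outside the full `S e`.
        no-ad : deg a ≤ 5 → deg d ≤ 5 → ⊥
        no-ad a5 d5 = capture m-e (≢true λ m → t∉ (exactW ec m)) (fullW ec)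
          where
          m-a : r 2 ∋ a
          m-a = coll1 at₂ (S-self _) a5
          m-u : r 2 ∋ u
          m-u = coll1 ua m-a u5′
          m-d : r 2 ∋ d
          m-d = coll1 (~sym ud) m-u d5
          m-e : r 2 ∋ e
          m-e = coll ((t≢u ∷ ≢sym (~≢ at₂) ∷ t≢d ∷ []) ∷ u≢)
            ((r~ 2 , S-self _) ∷ (~sym ue , m-u) ∷ (ea , m-a) ∷ (~sym de , m-d) ∷ []) (≤-reflexive e8)
        few : n5 e ≤ 2
        few = ≤-pred (≰⇒> λ ge → no-ad (proj₂ (must {u ∷ d ∷ []} a ge lista)) (proj₂ (must {u ∷ a ∷ []} d ge listd)))
          where
          lista : ∀ h → e ~ h → deg h ≤ 5 → h ∈ a ∷ u ∷ d ∷ []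
          lista h eh f = at (fives eh f)
            where
            at : h ∈ u ∷ a ∷ b ∷ d ∷ [] → h ∈ a ∷ u ∷ d ∷ []
            at (here z) = there (here z)
            at (there (here z)) = here z
            at (there (there (here z))) = ⊥-elim (no-b (subst (e ~_) z eh))
            at (there (there (there (here z)))) = there (there (here z))
          listd : ∀ h → e ~ h → deg h ≤ 5 → h ∈ d ∷ u ∷ a ∷ []
          listd h eh f = at (fives eh f)
            where
            at : h ∈ u ∷ a ∷ b ∷ d ∷ [] → h ∈ d ∷ u ∷ a ∷ []
            at (here z) = there (here z)
            at (there (here z)) = there (there (here z))
            at (there (there (here z))) = ⊥-elim (no-b (subst (e ~_) z eh))
            at (there (there (there (here z)))) = here z
        poor : 4 ≤ n5 c → ⊥
        poor pc = no-ad (proj₂ (Q.S-only c∋a (small≢big a6 c7))) (proj₂ (Q.S-only c∋d (small≢big d6 c7)))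
          where module Q = Poor q pc
        result : 60 ≤ P c u + P e u
        result = P40 e8 few (≤-pred (≰⇒> poor))

      -- The four neighbours of degree 5 must be `u`, `a`, `b`, `d`. A neighbour of `e` next to `a`
      -- or `d` and outside `U` collects all four and then `e`. `r 2` serves, unless it is `b`; then
      -- `r 7`, next to `d`, does.
      module Nine (e9 : deg e ≡ 9) (ge : 4 ≤ n5 e) where
        qa : (e ~ a) × (deg a ≤ 5)
        qa = must {u ∷ b ∷ d ∷ []} a ge (λ h p′ f → at (fives p′ f))
          where
          at : ∀ {h} → h ∈ u ∷ a ∷ b ∷ d ∷ [] → h ∈ a ∷ u ∷ b ∷ d ∷ []
          at (here z) = there (here z)
          at (there (here z)) = here z
          at (there (there i)) = there (there i)
        qb : (e ~ b) × (deg b ≤ 5)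
        qb = must {u ∷ a ∷ d ∷ []} b ge (λ h p′ f → at (fives p′ f))
          where
          at : ∀ {h} → h ∈ u ∷ a ∷ b ∷ d ∷ [] → h ∈ b ∷ u ∷ a ∷ d ∷ []
          at (here z) = there (here z)
          at (there (here z)) = there (there (here z))
          at (there (there (here z))) = here z
          at (there (there (there (here z)))) = there (there (there (here z)))
        qd : (e ~ d) × (deg d ≤ 5)
        qd = must {u ∷ a ∷ b ∷ []} d ge (λ h p′ f → at (fives p′ f))
          where
          at : ∀ {h} → h ∈ u ∷ a ∷ b ∷ d ∷ [] → h ∈ d ∷ u ∷ a ∷ b ∷ []
          at (here z) = there (here z)
          at (there (here z)) = there (there (here z))
          at (there (there (here z))) = there (there (there (here z)))
          at (there (there (there (here z)))) = here z
        uabd : Unique (u ∷ a ∷ b ∷ d ∷ [])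
        uabd = (~≢ ua ∷ ~≢ ub ∷ ~≢ ud ∷ []) ∷ (~≢ ab ∷ a≢d ∷ []) ∷ (b≢d ∷ []) ∷ [] ∷ []
        no-c : ¬ (e ~ c)
        no-c ec′ = blocked {c} {u ∷ a ∷ b ∷ d ∷ []} ((≢sym (~≢ uc) ∷ ≢sym (small≢big a6 c7) ∷ ≢sym (~≢ bc) ∷ ~≢ cd ∷ []) ∷ uabd)
          ((ec′ , S-self c) ∷ (~sym ue , c∋u) ∷ (ea , c∋a) ∷ (proj₁ qb , c∋b) ∷ (~sym de , c∋d) ∷ []) (≤-reflexive e9)
        bad : ∀ t → e ~ t → (a ~ t) ⊎ (d ~ t) → t ≢ u → t ≢ a → t ≢ b → t ≢ d → ⊥
        bad t et side tu ta tb td = capture m-e (≢true λ m → t∉ (exactW ec m)) (fullW ec)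
          where
          t∉ : t ∉ U
          t∉ (here z) = tu z
          t∉ (there (here z)) = no-c (subst (e ~_) z et)
          t∉ (there (there (here z))) = ~≢ et (symm z)
          t∉ (there (there (there (here z)))) = ta z
          t∉ (there (there (there (there (here z))))) = tb z
          t∉ (there (there (there (there (there (here z)))))) = td z
          first : (a ~ t) ⊎ (d ~ t) → t ∋ u
          first (inj₁ z) = coll1 ua (coll1 z (S-self t) (proj₂ qa)) u5′
          first (inj₂ z) = coll1 ud (coll1 z (S-self t) (proj₂ qd)) u5′
          m-u = first side
          m-e : t ∋ e
          m-e = coll ((tu ∷ ta ∷ tb ∷ td ∷ []) ∷ uabd)
            ((et , S-self t) ∷ (~sym ue , m-u) ∷ (ea , coll1 (~sym ua) m-u (proj₂ qa)) ∷ (proj₁ qb , coll1 (~sym ub) m-u (proj₂ qb))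
              ∷ (~sym de , coll1 (~sym ud) m-u (proj₂ qd)) ∷ []) (≤-reflexive e9)
        sep : ∀ {i j} → i < j → j < 9 → r i ≢ r j
        sep lt lt′ = r-inj lt (subst (_ <_) (symm e9) lt′)
        r₈ : r 8 ≡ d
        r₈ = last 8 e9
        absurd : ⊥
        absurd = go′ (toSum (r 2 F.≟ b))
          where
          go′ : (r 2 ≡ b) ⊎ (r 2 ≢ b) → ⊥
          go′ (inj₂ ne) = bad (r 2) (r~ 2) (inj₁ at₂) (≢sym (sep {0} {2} (s≤s z≤n) (≤ᵇ⇒ {3} {9} refl))) (≢sym (~≢ at₂)) ne
            (λ z → sep {2} {8} (≤ᵇ⇒ {3} {8} refl) ≤-refl (trans z (symm r₈)))
          go′ (inj₁ eb) = bad (r 7) (r~ 7) (inj₂ (~sym (subst (r 7 ~_) r₈ (rr 7)))) (≢sym (sep {0} {7} (s≤s z≤n) (≤ᵇ⇒ {8} {9} refl)))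
            (λ z → sep {1} {7} (≤ᵇ⇒ {2} {7} refl) (≤ᵇ⇒ {8} {9} refl) (trans r₁ (symm z)))
            (λ z → sep {2} {7} (≤ᵇ⇒ {3} {7} refl) (≤ᵇ⇒ {8} {9} refl) (trans eb (symm z)))
            (λ z → sep {7} {8} ≤-refl ≤-refl (trans z (symm r₈)))

      go : (8 < deg e) ⊎ (8 ≡ deg e) → 60 ≤ P c u + P e u
      go (inj₁ e9) = P45 e9 (λ le9 → ≤-pred (≰⇒> (Nine.absurd (≤-antisym le9 e9))))
      go (inj₂ e8) = Eight.result (symm e8)

  split : ∀ {u a b c d e} → Pent u a b c d e → deg a ≤ 6 → deg b ≤ 6 → 7 ≤ deg c → deg d ≤ 6 → 7 ≤ deg e → 60 ≤ P c u + P e u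
  split {u} {a} {b} {c} {d} {e} p a6 b6 c7 d6 e7 = trio X.t X.side-c X.side-e X.hard hardY
    where
    module X = Split p a6 b6 c7 d6 e7
    module Y = Split (rot (rot (rot (mirror p)))) b6 a6 e7 d6 c7
    hardY : OnTrio.HardGoal (flipT X.t)
    hardY = Y.hard

-- At least four small neighbours, and the final count

module Absurd (St : Setting) where
  open ThreeSmall St

  Sends : Fin n → Fin n → Fin n → Bool
  Sends u v r = big v ∧ ((adj G v r ∧ E′ v r) ∧ (opp v r == u))

  abstract
    direct-in hub-in inflow : Fin n → ℕ
    direct-in u = sumF (λ v → if big v ∧ (adj G v u ∧ five u) then P v u else 0)
    hub-in u = sumF (λ v → if big v then 12 * count (λ r → (adj G v r ∧ E′ v r) ∧ (opp v r == u)) else 0)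
    inflow u = sumF (λ v → flow v u)

    inflow-split : ∀ u → inflow u ≡ direct-in u + hub-in u
    inflow-split u = sumF-+ (λ v → if big v ∧ (adj G v u ∧ five u) then P v u else 0)
      (λ v → if big v then 12 * count (λ r → (adj G v r ∧ E′ v r) ∧ (opp v r == u)) else 0)

    direct≥ : ∀ {u xs} → deg u ≤ 5 → Unique xs → All (λ x → (u ~ x) × (7 ≤ deg x)) xs → sum (map (λ x → P x u) xs) ≤ direct-in u
    direct≥ {u} {xs} u5 uxs axs = ≤-trans (≤-reflexive (cong sum (same axs))) (sum-list-≤ (λ v → if big v ∧ (adj G v u ∧ five u) then P v u else 0) uxs)
      where
      same : ∀ {ys} → All (λ x → (u ~ x) × (7 ≤ deg x)) ys →
        map (λ x → P x u) ys ≡ map (λ v → if big v ∧ (adj G v u ∧ five u) then P v u else 0) ys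
      same [] = refl
      same {y ∷ ys} ((p , b) ∷ a) = cong₂ _∷_ (cong (λ z → if z then P y u else 0)
        (symm (∧-intro (⇒≤ᵇ b) (∧-intro (~sym p) (⇒≤ᵇ u5))))) (same a)

    hub≥ : ∀ {u rs} → Unique rs → All (λ r → ∃ λ v → Sends u v r ≡ true) rs → 12 * length rs ≤ hub-in u
    hub≥ {u} {rs} urs ars = ≤-trans (*-monoʳ-≤ 12 len) (≤-reflexive (symm total))
      where
      col : Fin n → ℕ
      col r = count (λ v → Sends u v r)
      len : length rs ≤ sumF col
      len = ≤-trans (go ars) (sum-list-≤ col urs)
        where
        go : ∀ {ys} → All (λ r → ∃ λ v → Sends u v r ≡ true) ys → length ys ≤ sum (map col ys)
        go [] = z≤n
        go {y ∷ ys} ((v , q) ∷ a) = +-mono-≤ (unique-≤-# (λ v → Sends u v y) ([] ∷ []) (q ∷ [])) (go a)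
      row : ∀ v → (if big v then 12 * count (λ r → (adj G v r ∧ E′ v r) ∧ (opp v r == u)) else 0) ≡ 12 * count (Sends u v)
      row v = pull (big v)
        where
        pull : ∀ b → (if b then 12 * count (λ r → (adj G v r ∧ E′ v r) ∧ (opp v r == u)) else 0) ≡ 12 * count (λ r → b ∧ ((adj G v r ∧ E′ v r) ∧ (opp v r == u)))
        pull true  = refl
        pull false = symm (cong (12 *_) (count-none {n} (λ _ → false) (λ _ → refl)))
      total : hub-in u ≡ 12 * sumF col
      total = trans (sumF-cong row) (trans (sumF-* 12 (λ v → count (Sends u v))) (cong (12 *_)
        (trans (sumF-cong (λ v → count-sum (Sends u v))) (trans (sumF-swap (λ v r → if Sends u v r then 1 else 0))
          (sumF-cong (λ r → symm (count-sum (λ v → Sends u v r))))))))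

    inflow-def : ∀ u → sumF (λ v → flow v u) ≡ inflow u
    inflow-def u = refl

  -- The sender is the vertex beyond the edge `ab`. The bound on `d` enters through `Opp.out`, which
  -- keeps the sender off the link of `u`, as `E′` demands.
  sends : ∀ {u a b c d e} (p : Pent⁺ u a b c d e) → hub u ≡ true → deg a ≤ 6 → deg b ≤ 6 → deg d ≤ 6 → 7 ≤ deg (Opp.y p) →
    ∃ λ v → Sends u v b ≡ true
  sends {u} {a} {b} p hu a6 b6 d6 y7 = y , ∧-intro (⇒≤ᵇ y7) (∧-intro (∧-intro (~sym yb) (∧-intro (∧-intro hub-ok far) (∧-intro (⇒≤ᵇ b6) a-ok)))
      (does⇐ (opp y b F.≟ u) opp-yb))
    where
    open Opp p
    hub-ok : hub (opp y b) ≡ true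
    hub-ok = trans (cong hub opp-yb) hu
    far : not (adj G y (opp y b)) ≡ true
    far = not-intro (≢true λ q → out d6 (there (Pent.all (pent p) y (~sym (subst (y ~_) opp-yb q)))))
    a-ok : (deg (nx y b) ≤ᵇ 6) ≡ true
    a-ok = trans (cong (λ z → deg z ≤ᵇ 6) nx-yb) (⇒≤ᵇ a6)

  u≤ : ∀ {u a b c d e} → Pent⁺ u a b c d e → deg u ≤ 5
  u≤ p = ≤-reflexive (Pent⁺.u5 p)

  -- A small vertex beyond the edge would lose both `a` and `b` and join `S s`, but all members of
  -- `S s` belong to the wheel.
  big-opp : ∀ {u a b c d e s} (p : Pent⁺ u a b c d e) → deg d ≤ 6 → s ∋ a → s ∋ b →
    (∀ {q} → s ∋ q → q ∈ u ∷ a ∷ b ∷ c ∷ d ∷ e ∷ []) → 7 ≤ deg (Opp.y p)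
  big-opp p d6 ma mb only = ≰⇒> λ le → Opp.out p d6
    (only (coll2 (~sym (Opp.ya p)) ma (~sym (Opp.yb p)) mb (≢sym (~≢ (Opp.ba p))) le))

  make-hub : ∀ {u e xs} → deg u ≤ 5 → (∀ q → u ~ q → q ∈ e ∷ xs) → All (λ x → (deg x ≤ 6) × (6 ≤ deg x)) xs → 6 ≤ deg e → hub u ≡ true
  make-hub {u} {e} {xs} u5 all sx e6 = ∧-intro (⇒≤ᵇ u5) (∧-intro
      (⇒≤ᵇ (#-≤-cover (λ x → adj G u x ∧ big x) (e ∷ []) bigs)) (⇒≤ᵇ (#-≤-cover (λ x → adj G u x ∧ five x) [] fives)))
    where
    bigs : ∀ x → adj G u x ∧ big x ≡ true → x ∈ e ∷ []
    bigs x q = at (all x (proj₁ (∧-elim {adj G u x} q)))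
      where
      at : x ∈ e ∷ xs → x ∈ e ∷ []
      at (here z)  = here z
      at (there i) = ⊥-elim (1+n≰n (≤-trans (≤ᵇ⇒ {7} {deg x} (proj₂ (∧-elim {adj G u x} q))) (proj₁ (All.lookup sx i))))
    fives : ∀ x → adj G u x ∧ five x ≡ true → x ∈ []
    fives x q = at (all x (proj₁ (∧-elim {adj G u x} q)))
      where
      x5 : deg x ≤ 5
      x5 = ≤ᵇ⇒ (proj₂ (∧-elim {adj G u x} q))
      at : x ∈ e ∷ xs → x ∈ []
      at (here refl) = ⊥-elim (1+n≰n (≤-trans e6 x5))
      at (there i)   = ⊥-elim (1+n≰n (≤-trans (proj₂ (All.lookup sx i)) x5))

  module Four {u a b c d e} (p : Pent⁺ u a b c d e) (a6 : deg a ≤ 6) (b6 : deg b ≤ 6) (c6 : deg c ≤ 6) (d6 : deg d ≤ 6) (e7 : 7 ≤ deg e) where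
    open Pent (pent p)
    open Quad (pent p) a6 b6 c6 d6
    private
      p′ : Pent⁺ u c d e a b
      p′ = rot⁺ (rot⁺ p)
      N : List (Fin n)
      N = u ∷ a ∷ b ∷ c ∷ d ∷ e ∷ []
      shift : ∀ {q} → q ∈ N → q ∈ u ∷ c ∷ d ∷ e ∷ a ∷ b ∷ []
      shift (here z) = here z
      shift (there (here z)) = there (there (there (there (here z))))
      shift (there (there (here z))) = there (there (there (there (there (here z)))))
      shift (there (there (there (here z)))) = there (here z)
      shift (there (there (there (there (here z))))) = there (there (here z))
      shift (there (there (there (there (there (here z)))))) = there (there (there (here z)))

    outer : ∀ {x} → x ∈ a ∷ b ∷ c ∷ d ∷ [] → ∃ λ q → (x ~ q) × (q ∉ N)
    outer (here refl) = Opp.y p , Opp.ya p , Opp.out p d6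
    outer (there (here refl)) = Opp.y p , Opp.yb p , Opp.out p d6
    outer (there (there (here refl))) = Opp.y p′ , Opp.ya p′ , λ i → Opp.out p′ a6 (shift i)
    outer (there (there (there (here refl)))) = Opp.y p′ , Opp.yb p′ , λ i → Opp.out p′ a6 (shift i)

    All4 : Fin n → Set
    All4 q = (q ∋ a) × (q ∋ b) × (q ∋ c) × (q ∋ d)

    four-in : ∀ {x} → x ∈ a ∷ b ∷ c ∷ d ∷ [] → x ∈ a ∷ b ∷ c ∷ d ∷ e ∷ []
    four-in (here z) = here z
    four-in (there (here z)) = there (here z)
    four-in (there (there (here z))) = there (there (here z))
    four-in (there (there (there (here z)))) = there (there (there (here z)))

    u~four : ∀ {x} → x ∈ a ∷ b ∷ c ∷ d ∷ [] → u ~ x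
    u~four = All.lookup (ua ∷ ub ∷ uc ∷ ud ∷ [])

    grab : ∀ {x q} → x ∈ a ∷ b ∷ c ∷ d ∷ [] → deg x ≤ 5 → x ~ q → (q ∋ u) × All4 q
    grab {x} {q} i x5 xq = mu , quad mu mx (four-in i)
      where
      mx : q ∋ x
      mx = coll1 xq (S-self q) x5
      mu : q ∋ u
      mu = coll1 (u~four i) mx (≤-reflexive u5)

    too-many : ∀ {q} → q ∉ N → (q ∋ u) × All4 q → q ∋ e → ⊥
    too-many {q} q∉ (mu , ma , mb , mc , md) me = over (¬Any⇒All¬ N q∉ ∷ u6) (S-self q ∷ mu ∷ ma ∷ mb ∷ mc ∷ md ∷ me ∷ []) ≤-refl

    private
      nes : Unique (a ∷ b ∷ c ∷ d ∷ e ∷ []) → (a ≢ d) × (b ≢ d) × (a ≢ c) × (b ≢ c)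
      nes ((_ ∷ y ∷ x ∷ _) ∷ (w ∷ z ∷ _) ∷ _) = x , z , y , w
      a≢d : a ≢ d
      a≢d = proj₁ (nes uniq)

    -- A neighbour of `x` outside the wheel would collect `x`, `u`, the rest of the path and then
    -- `e` through `u`, `a` and `d`: seven in all.
    no-five : deg e ≡ 7 → ∀ {x} → x ∈ a ∷ b ∷ c ∷ d ∷ [] → 6 ≤ deg x
    no-five e7′ {x} i = ≰⇒> λ x5 → done x5 (outer i)
      where
      done : deg x ≤ 5 → (∃ λ q → (x ~ q) × (q ∉ N)) → ⊥
      done x5 (q , xq , q∉) = go (grab i x5 xq)
        where
        go : (q ∋ u) × All4 q → ⊥
        go (mu , ma , mb , mc , md) = too-many q∉ (mu , ma , mb , mc , md) (coll3 (~sym ue) mu ea ma (~sym de) md (~≢ ua) (~≢ ud) a≢d (≤-reflexive e7′))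

    only-five : (∀ {x} → x ∈ a ∷ b ∷ c ∷ d ∷ [] → e ~ x → deg x ≤ 5 → ⊥) → n5 e ≤ 1
    only-five h = #-≤-cover (λ x → adj G e x ∧ five x) (u ∷ []) λ x q →
        at (proj₁ (∧-elim {adj G e x} q)) (≤ᵇ⇒ (proj₂ (∧-elim {adj G e x} q))) (only (F-in (proj₁ (∧-elim {adj G e x} q)) (≤ᵇ⇒ (proj₂ (∧-elim {adj G e x} q)))))
      where
      at : ∀ {x} → e ~ x → deg x ≤ 5 → x ∈ N → x ∈ u ∷ []
      at ex x5 (here z) = here z
      at ex x5 (there (here z)) = ⊥-elim (h (here z) ex x5)
      at ex x5 (there (there (here z))) = ⊥-elim (h (there (here z)) ex x5)
      at ex x5 (there (there (there (here z)))) = ⊥-elim (h (there (there (here z))) ex x5)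
      at ex x5 (there (there (there (there (here z))))) = ⊥-elim (h (there (there (there (here z)))) ex x5)
      at ex x5 (there (there (there (there (there (here z)))))) = ⊥-elim (~≢ ex (symm z))

    -- `e` pays 36, having no other neighbour of degree 5, and `u` is a hub that receives 12 across
    -- each of the edges `ab` and `cd`.
    seven : deg e ≡ 7 → 60 ≤ inflow u
    seven e7′ = subst (60 ≤_) (symm (inflow-split u)) (+-mono-≤
        (≤-trans (subst (36 ≤_) (symm (trans (+-identityʳ (P e u)) (P7 e7′ u))) (p7≥36 (n5 e) (k e) (only-five λ i ex x5 → 1+n≰n (≤-trans (no-five e7′ i) x5))))
                 (direct≥ {u} {e ∷ []} (≤-reflexive u5) ([] ∷ []) ((ue , e7) ∷ [])))
        (hub≥ ((proj₁ (proj₂ (nes uniq)) ∷ []) ∷ [] ∷ []) (sends p hb a6 b6 d6 y7 ∷ sends p′ hb c6 d6 a6 y7′ ∷ [])))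
      where
      hb : hub u ≡ true
      hb = make-hub {u} {e} {a ∷ b ∷ c ∷ d ∷ []} (≤-reflexive u5) (λ q uq → re (all q uq))
             ((a6 , no-five e7′ (here refl)) ∷ (b6 , no-five e7′ (there (here refl))) ∷ (c6 , no-five e7′ (there (there (here refl))))
               ∷ (d6 , no-five e7′ (there (there (there (here refl))))) ∷ []) (≤-trans (n≤1+n 6) e7)
        where
        re : ∀ {q} → q ∈ a ∷ b ∷ c ∷ d ∷ e ∷ [] → q ∈ e ∷ a ∷ b ∷ c ∷ d ∷ []
        re (here z) = there (here z)
        re (there (here z)) = there (there (here z))
        re (there (there (here z))) = there (there (there (here z)))
        re (there (there (there (here z)))) = there (there (there (there (here z))))
        re (there (there (there (there (here z))))) = here z
      mem : ∀ {x} → x ∈ N → e ∋ x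
      mem = All.lookup members
      y7 : 7 ≤ deg (Opp.y p)
      y7 = big-opp p d6 (mem (there (here refl))) (mem (there (there (here refl)))) only
      y7′ : 7 ≤ deg (Opp.y p′)
      y7′ = big-opp p′ a6 (mem (there (there (there (here refl))))) (mem (there (there (there (there (here refl)))))) (λ m → shift (only m))

    nine : 9 ≤ deg e → 60 ≤ inflow u
    nine e9 = subst (60 ≤_) (symm (inflow-split u)) (≤-trans (≤-trans (≤-reflexive (symm value)) (≤-trans (m≤m+n (P e u) 0)
        (direct≥ {u} {e ∷ []} (≤-reflexive u5) ([] ∷ []) ((ue , e7) ∷ [])))) (m≤m+n (direct-in u) (hub-in u)))
      where
      ln : lone u ≡ true
      ln = ⇒≤ᵇ (#-≤-cover (λ x → adj G u x ∧ big x) (e ∷ []) λ x q → at (≤ᵇ⇒ (proj₂ (∧-elim {adj G u x} q))) (all x (proj₁ (∧-elim {adj G u x} q))))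
        where
        at : ∀ {x} → 7 ≤ deg x → x ∈ a ∷ b ∷ c ∷ d ∷ e ∷ [] → x ∈ e ∷ []
        at x7 (here refl) = ⊥-elim (1+n≰n (≤-trans x7 a6))
        at x7 (there (here refl)) = ⊥-elim (1+n≰n (≤-trans x7 b6))
        at x7 (there (there (here refl))) = ⊥-elim (1+n≰n (≤-trans x7 c6))
        at x7 (there (there (there (here refl)))) = ⊥-elim (1+n≰n (≤-trans x7 d6))
        at x7 (there (there (there (there (here z))))) = here z
      hh : hasHub e ≡ true
      hh = anyB⇐ (λ x → (adj G e x ∧ five x) ∧ lone x) u (∧-intro (∧-intro (~sym ue) (⇒≤ᵇ (≤-reflexive u5))) ln)
      value : P e u ≡ 60
      value = trans (P9 e9 u) (cong₂ (λ x y → p9 (deg e) (n5 e) x y) hh ln)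

  -- The neighbour `t` of `e` beyond `a` decides. If `e` collects it, it is `b` or `c`, which gives
  -- `q` the fourth lost neighbour of `e`. If not, deleting `t` sweeps the wheel through `a`. Either
  -- way seven are reached.
  corner : ∀ {u a b c d e} (p : Pent u a b c d e) → deg a ≤ 6 → deg b ≤ 6 → deg c ≤ 6 → deg d ≤ 6 → deg e ≡ 8 → deg a ≤ 5 →
    ∀ {q} → q ∉ u ∷ a ∷ b ∷ c ∷ d ∷ e ∷ [] → q ∋ u → q ∋ a → q ∋ b → q ∋ c → q ∋ d → ⊥
  corner {u} {a} {b} {c} {d} {e} p a6 b6 c6 d6 e8 a5 {q} q∉ qu qa qb qc qd = go (bool-cases (S e t))
    where
    open Pent p
    open Quad p a6 b6 c6 d6
    N : List (Fin n)
    N = u ∷ a ∷ b ∷ c ∷ d ∷ e ∷ []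
    a≢d : a ≢ d
    a≢d = at uniq
      where
      at : Unique (a ∷ b ∷ c ∷ d ∷ e ∷ []) → a ≢ d
      at ((_ ∷ _ ∷ x ∷ _) ∷ _) = x
    lk = link (~sym ue) (Fc-swap fea) (Fc-swap (Fc-rot ud fde)) a≢d
    open Ring (proj₁ lk) (~sym ue)
    t = r 2
    sep : ∀ {i j} → i < j → j < 8 → r i ≢ r j
    sep lt lt′ = r-inj lt (subst (_ <_) (symm e8) lt′)
    at₂ : a ~ t
    at₂ = subst (_~ t) (proj₁ (proj₂ lk)) (rr 1)
    r₇ : r 7 ≡ d
    r₇ = inj (proj₁ lk) (r~ 7) (~sym de) (trans (trans (cong r (symm e8)) r-wrap) (symm (proj₂ (proj₂ lk))))
    t≢u : t ≢ u
    t≢u = ≢sym (sep {0} {2} (s≤s z≤n) (≤ᵇ⇒ {3} {8} refl))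
    t≢a : t ≢ a
    t≢a = ≢sym (~≢ at₂)
    t≢d : t ≢ d
    t≢d z = sep {2} {7} (≤ᵇ⇒ {3} {7} refl) ≤-refl (trans z (symm r₇))
    uad : Unique (u ∷ a ∷ d ∷ [])
    uad = (~≢ ua ∷ ~≢ ud ∷ []) ∷ (a≢d ∷ []) ∷ [] ∷ []
    fill : ∀ {s} → s ∋ t → s ∋ u → s ∋ a → s ∋ d → s ∋ e
    fill mt mu ma md = coll ((t≢u ∷ t≢a ∷ t≢d ∷ []) ∷ uad) ((r~ 2 , mt) ∷ (~sym ue , mu) ∷ (ea , ma) ∷ (~sym de , md) ∷ []) (≤-reflexive e8)
    over′ : ∀ {s} → s ∉ N → s ∋ u → s ∋ a → s ∋ b → s ∋ c → s ∋ d → s ∋ e → ⊥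
    over′ {s} s∉ mu ma mb mc md me = over (¬Any⇒All¬ N s∉ ∷ u6) (S-self s ∷ mu ∷ ma ∷ mb ∷ mc ∷ md ∷ me ∷ []) ≤-refl
    go : (e ∋ t) ⊎ (S e t ≡ false) → ⊥
    go (inj₁ m) = at (only m)
      where
      at : t ∈ N → ⊥
      at (here z) = t≢u z
      at (there (here z)) = t≢a z
      at (there (there (here z))) = over′ q∉ qu qa qb qc qd (fill (subst (q ∋_) (symm z) qb) qu qa qd)
      at (there (there (there (here z)))) = over′ q∉ qu qa qb qc qd (fill (subst (q ∋_) (symm z) qc) qu qa qd)
      at (there (there (there (there (here z))))) = t≢d z
      at (there (there (there (there (there (here z)))))) = ~≢ (r~ 2) (symm z)
    go (inj₂ m) = over′ (λ i → contra (All.lookup members i) m) tu ta (proj₁ (proj₂ t4)) (proj₁ (proj₂ (proj₂ t4))) td (fill (S-self t) tu ta td)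
      where
      ta : t ∋ a
      ta = coll1 at₂ (S-self t) a5
      tu : t ∋ u
      tu = coll1 ua ta (≤-reflexive u5)
      t4 = quad tu ta (here refl)
      td : t ∋ d
      td = proj₂ (proj₂ (proj₂ t4))

  four : ∀ {u a b c d e} → Pent⁺ u a b c d e → deg a ≤ 6 → deg b ≤ 6 → deg c ≤ 6 → deg d ≤ 6 → 7 ≤ deg e → 60 ≤ inflow u
  four {u} {a} {b} {c} {d} {e} p a6 b6 c6 d6 e7 = go (classify e7)
    where
    open Four p a6 b6 c6 d6 e7
    open Pent (pent p)
    eight : deg e ≡ 8 → ∀ {x} → x ∈ a ∷ b ∷ c ∷ d ∷ [] → e ~ x → deg x ≤ 5 → ⊥
    eight e8 {x} i ex x5 = at i (outer i)
      where
      nes : Unique (a ∷ b ∷ c ∷ d ∷ e ∷ []) → (a ≢ d) × (b ≢ d) × (a ≢ c) × (c ≢ d)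
      nes ((_ ∷ y ∷ x ∷ _) ∷ (_ ∷ z ∷ _) ∷ (w ∷ _) ∷ _) = x , z , y , w
      mid : x ≢ u → x ≢ a → x ≢ d → (∃ λ q → (x ~ q) × (q ∉ u ∷ a ∷ b ∷ c ∷ d ∷ e ∷ [])) → ⊥
      mid xu xa xd (q , xq , q∉) = too-many q∉ g (coll ((xu ∷ xa ∷ xd ∷ []) ∷ (~≢ ua ∷ ~≢ ud ∷ []) ∷ (proj₁ (nes uniq) ∷ []) ∷ [] ∷ [])
          ((ex , coll1 xq (S-self q) x5) ∷ (~sym ue , proj₁ g) ∷ (ea , proj₁ (proj₂ g)) ∷ (~sym de , proj₂ (proj₂ (proj₂ (proj₂ g)))) ∷ []) (≤-reflexive e8))
        where
        g = grab i x5 xq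
      swap : ∀ {q} → q ∈ u ∷ d ∷ c ∷ b ∷ a ∷ e ∷ [] → q ∈ u ∷ a ∷ b ∷ c ∷ d ∷ e ∷ []
      swap (here z) = here z
      swap (there (here z)) = there (there (there (there (here z))))
      swap (there (there (here z))) = there (there (there (here z)))
      swap (there (there (there (here z)))) = there (there (here z))
      swap (there (there (there (there (here z))))) = there (here z)
      swap (there (there (there (there (there (here z)))))) = there (there (there (there (there (here z)))))
      at : x ∈ a ∷ b ∷ c ∷ d ∷ [] → (∃ λ q → (x ~ q) × (q ∉ u ∷ a ∷ b ∷ c ∷ d ∷ e ∷ [])) → ⊥
      at (here refl) (q , xq , q∉) = let mu , ma , mb , mc , md = grab i x5 xq in corner (pent p) a6 b6 c6 d6 e8 x5 q∉ mu ma mb mc md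
      at (there (here refl)) o = mid (≢sym (~≢ ub)) (≢sym (~≢ ab)) (proj₁ (proj₂ (nes uniq))) o
      at (there (there (here refl))) o = mid (≢sym (~≢ uc)) (≢sym (proj₁ (proj₂ (proj₂ (nes uniq))))) (proj₂ (proj₂ (proj₂ (nes uniq)))) o
      at (there (there (there (here refl)))) (q , xq , q∉) = let mu , ma , mb , mc , md = grab i x5 xq in
        corner (rot (mirror (pent p))) d6 c6 b6 a6 e8 x5 (λ z → q∉ (swap z)) mu md mc mb ma
    go : Big e → 60 ≤ inflow u
    go (is7 e7′) = seven e7′
    go (is9 e9)  = nine e9
    go (is8 e8)  = subst (60 ≤_) (symm (inflow-split u)) (≤-trans (≤-trans (subst (60 ≤_) (symm (P8 e8 u)) (p8≥60 (n5 e) (only-five (eight e8))))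
        (≤-trans (m≤m+n (P e u) 0) (direct≥ {u} {e ∷ []} (≤-reflexive u5) ([] ∷ []) ((ue , e7) ∷ [])))) (m≤m+n (direct-in u) (hub-in u)))

  module Wheel {u a b c d e} (p : Pent⁺ u a b c d e) (a6 : deg a ≤ 6) (b6 : deg b ≤ 6) (c6 : deg c ≤ 6) (d6 : deg d ≤ 6) (e6 : deg e ≤ 6) where
    open Pent (pent p)
    open Quad (pent p) a6 b6 c6 d6

    all-in : ∀ {s} → s ∋ u → s ∋ a → All (s ∋_) (u ∷ a ∷ b ∷ c ∷ d ∷ e ∷ [])
    all-in {s} mu ma = go (quad mu ma (here refl))
      where
      go : (s ∋ a) × (s ∋ b) × (s ∋ c) × (s ∋ d) → All (s ∋_) (u ∷ a ∷ b ∷ c ∷ d ∷ e ∷ [])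
      go (m₁ , m₂ , m₃ , m₄) = mu ∷ m₁ ∷ m₂ ∷ m₃ ∷ m₄ ∷ spread mu m₄ ud fde e6 ∷ []

    six : 6 ≤ deg a
    six = ≰⇒> λ a5 → let ma = coll1 (Opp.ya p) (S-self (Opp.y p)) a5 in
      over (¬Any⇒All¬ (u ∷ a ∷ b ∷ c ∷ d ∷ e ∷ []) (Opp.out p d6) ∷ u6) (S-self (Opp.y p) ∷ all-in (coll1 ua ma (≤-reflexive u5)) ma) ≤-refl

    rim-big : 7 ≤ deg (Opp.y p)
    rim-big = big-opp p d6 (S-self a) (All.lookup rim (there (there (here refl)))) (exact u6 rim (S-size a))
      where
      rim : All (a ∋_) (u ∷ a ∷ b ∷ c ∷ d ∷ e ∷ [])
      rim = all-in (coll1 ua (S-self a) (≤-reflexive u5)) (S-self a)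

  -- No neighbour has degree 5, as a vertex beyond it would sweep the whole wheel. So `u` is a hub
  -- and each of its five link edges faces a big vertex: 5 · 12.
  wheel : ∀ {u a b c d e} → Pent⁺ u a b c d e → deg a ≤ 6 → deg b ≤ 6 → deg c ≤ 6 → deg d ≤ 6 → deg e ≤ 6 → 60 ≤ inflow u
  wheel {u} {a} {b} {c} {d} {e} p a6 b6 c6 d6 e6 = subst (60 ≤_) (symm (inflow-split u)) (≤-trans
      (hub≥ (Pent.uniq (pent p₁)) (sends p hb a6 b6 d6 W.rim-big ∷ sends p₁ hb b6 c6 e6 W₁.rim-big ∷ sends p₂ hb c6 d6 a6 W₂.rim-big
        ∷ sends p₃ hb d6 e6 b6 W₃.rim-big ∷ sends p₄ hb e6 a6 c6 W₄.rim-big ∷ [])) (m≤n+m (hub-in u) (direct-in u)))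
    where
    p₁ = rot⁺ p
    p₂ = rot⁺ p₁
    p₃ = rot⁺ p₂
    p₄ = rot⁺ p₃
    module W  = Wheel p  a6 b6 c6 d6 e6
    module W₁ = Wheel p₁ b6 c6 d6 e6 a6
    module W₂ = Wheel p₂ c6 d6 e6 a6 b6
    module W₃ = Wheel p₃ d6 e6 a6 b6 c6
    module W₄ = Wheel p₄ e6 a6 b6 c6 d6
    hb : hub u ≡ true
    hb = make-hub {u} {a} {b ∷ c ∷ d ∷ e ∷ []} (u≤ p) (Pent.all (pent p)) ((b6 , W₁.six) ∷ (c6 , W₂.six) ∷ (d6 , W₃.six) ∷ (e6 , W₄.six) ∷ []) W.six

  from-direct : ∀ {u m xs} → deg u ≤ 5 → Unique xs → All (λ x → (u ~ x) × (7 ≤ deg x)) xs → m ≤ sum (map (λ x → P x u) xs) → m ≤ inflow u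
  from-direct {u} {m} u5 uxs axs le = subst (m ≤_) (symm (inflow-split u)) (≤-trans le (≤-trans (direct≥ u5 uxs axs) (m≤m+n (direct-in u) (hub-in u))))

  sum₂ : ∀ {x y} → 60 ≤ x + y → 60 ≤ x + (y + 0)
  sum₂ {x} {y} = subst (λ z → 60 ≤ x + z) (symm (+-identityʳ y))

  sum₃ : ∀ {x y z} → 60 ≤ x + y + z → 60 ≤ x + (y + (z + 0))
  sum₃ {x} {y} {z} = subst (60 ≤_) (trans (+-assoc x y z) (cong (λ w → x + (y + w)) (symm (+-identityʳ z))))

  few-small : ∀ {u a b c d e} → Pent⁺ u a b c d e → 7 ≤ deg b → 7 ≤ deg c → 7 ≤ deg d → 7 ≤ deg e → 60 ≤ inflow u
  few-small {u} {a} {b} {c} {d} {e} p b7 c7 d7 e7 = from-direct (u≤ p) (un uniq) ((ub , b7) ∷ (uc , c7) ∷ (ud , d7) ∷ (ue , e7) ∷ [])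
      (+-mono-≤ (P≥15 u b7) (+-mono-≤ (P≥15 u c7) (+-mono-≤ (P≥15 u d7) (+-mono-≤ (P≥15 u e7) (z≤n {0})))))
    where
    open Pent (pent p)
    un : Unique (a ∷ b ∷ c ∷ d ∷ e ∷ []) → Unique (b ∷ c ∷ d ∷ e ∷ [])
    un (_ ∷ q) = q

  two-adjacent : ∀ {u a b c d e} → Pent⁺ u a b c d e → deg a ≤ 6 → deg b ≤ 6 → 7 ≤ deg c → 7 ≤ deg d → 7 ≤ deg e → 60 ≤ inflow u
  two-adjacent {u} {a} {b} {c} {d} {e} p a6 b6 c7 d7 e7 = from-direct (u≤ p) (un uniq) ((uc , c7) ∷ (ud , d7) ∷ (ue , e7) ∷ [])
      (sum₃ {P c u} {P d u} {P e u} (adjacent (pent p) a6 b6 c7 d7 e7))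
    where
    open Pent (pent p)
    un : Unique (a ∷ b ∷ c ∷ d ∷ e ∷ []) → Unique (c ∷ d ∷ e ∷ [])
    un (_ ∷ _ ∷ q) = q

  two-apart : ∀ {u a b c d e} → Pent⁺ u a b c d e → deg a ≤ 6 → 7 ≤ deg b → deg c ≤ 6 → 7 ≤ deg d → 7 ≤ deg e → 60 ≤ inflow u
  two-apart {u} {a} {b} {c} {d} {e} p a6 b7 c6 d7 e7 = from-direct (u≤ p) (un uniq) ((ub , b7) ∷ (ud , d7) ∷ (ue , e7) ∷ [])
      (sum₃ {P b u} {P d u} {P e u} (apart (pent p) a6 b7 c6 d7 e7))
    where
    open Pent (pent p)
    un : Unique (a ∷ b ∷ c ∷ d ∷ e ∷ []) → Unique (b ∷ d ∷ e ∷ [])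
    un (_ ∷ (_ ∷ x) ∷ _ ∷ q) = x ∷ q

  three-run : ∀ {u a b c d e} → Pent⁺ u a b c d e → deg a ≤ 6 → deg b ≤ 6 → deg c ≤ 6 → 7 ≤ deg d → 7 ≤ deg e → 60 ≤ inflow u
  three-run {u} {a} {b} {c} {d} {e} p a6 b6 c6 d7 e7 = from-direct (u≤ p) (un uniq) ((ud , d7) ∷ (ue , e7) ∷ [])
      (sum₂ {P d u} {P e u} (run (pent p) a6 b6 c6 d7 e7))
    where
    open Pent (pent p)
    un : Unique (a ∷ b ∷ c ∷ d ∷ e ∷ []) → Unique (d ∷ e ∷ [])
    un (_ ∷ _ ∷ _ ∷ q) = q

  three-split : ∀ {u a b c d e} → Pent⁺ u a b c d e → deg a ≤ 6 → deg b ≤ 6 → 7 ≤ deg c → deg d ≤ 6 → 7 ≤ deg e → 60 ≤ inflow u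
  three-split {u} {a} {b} {c} {d} {e} p a6 b6 c7 d6 e7 = from-direct (u≤ p) (un uniq) ((uc , c7) ∷ (ue , e7) ∷ [])
      (sum₂ {P c u} {P e u} (split (pent p) a6 b6 c7 d6 e7))
    where
    open Pent (pent p)
    un : Unique (a ∷ b ∷ c ∷ d ∷ e ∷ []) → Unique (c ∷ e ∷ [])
    un (_ ∷ _ ∷ (_ ∷ x ∷ []) ∷ _ ∷ q) = (x ∷ []) ∷ q

  size : ∀ x → (deg x ≤ 6) ⊎ (7 ≤ deg x)
  size x = go (toSum (deg x ≤? 6))
    where
    go : (deg x ≤ 6) ⊎ ¬ (deg x ≤ 6) → (deg x ≤ 6) ⊎ (7 ≤ deg x)
    go (inj₁ q) = inj₁ q
    go (inj₂ q) = inj₂ (≰⇒> q)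

  fed : ∀ {u x} → u ~ x → deg u ≤ 5 → 60 ≤ inflow u
  fed {u} {x} ux u5 = let b , c , d , e , p = pent⁺ ux u5 in by p (size x) (size b) (size c) (size d) (size e)
    where
    by : ∀ {a b c d e} → Pent⁺ u a b c d e → (deg a ≤ 6) ⊎ (7 ≤ deg a) → (deg b ≤ 6) ⊎ (7 ≤ deg b) → (deg c ≤ 6) ⊎ (7 ≤ deg c) →
      (deg d ≤ 6) ⊎ (7 ≤ deg d) → (deg e ≤ 6) ⊎ (7 ≤ deg e) → 60 ≤ inflow u
    by p (inj₁ a) (inj₁ b) (inj₁ c) (inj₁ d) (inj₁ e) = wheel p a b c d e
    by p (inj₁ a) (inj₁ b) (inj₁ c) (inj₁ d) (inj₂ e) = four p a b c d e
    by p (inj₁ a) (inj₁ b) (inj₁ c) (inj₂ d) (inj₁ e) = four (rot⁺ (rot⁺ (rot⁺ (rot⁺ p)))) e a b c d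
    by p (inj₁ a) (inj₁ b) (inj₁ c) (inj₂ d) (inj₂ e) = three-run p a b c d e
    by p (inj₁ a) (inj₁ b) (inj₂ c) (inj₁ d) (inj₁ e) = four (rot⁺ (rot⁺ (rot⁺ p))) d e a b c
    by p (inj₁ a) (inj₁ b) (inj₂ c) (inj₁ d) (inj₂ e) = three-split p a b c d e
    by p (inj₁ a) (inj₁ b) (inj₂ c) (inj₂ d) (inj₁ e) = three-run (rot⁺ (rot⁺ (rot⁺ (rot⁺ p)))) e a b c d
    by p (inj₁ a) (inj₁ b) (inj₂ c) (inj₂ d) (inj₂ e) = two-adjacent p a b c d e
    by p (inj₁ a) (inj₂ b) (inj₁ c) (inj₁ d) (inj₁ e) = four (rot⁺ (rot⁺ p)) c d e a b
    by p (inj₁ a) (inj₂ b) (inj₁ c) (inj₁ d) (inj₂ e) = three-split (rot⁺ (rot⁺ p)) c d e a b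
    by p (inj₁ a) (inj₂ b) (inj₁ c) (inj₂ d) (inj₁ e) = three-split (rot⁺ (rot⁺ (rot⁺ (rot⁺ p)))) e a b c d
    by p (inj₁ a) (inj₂ b) (inj₁ c) (inj₂ d) (inj₂ e) = two-apart p a b c d e
    by p (inj₁ a) (inj₂ b) (inj₂ c) (inj₁ d) (inj₁ e) = three-run (rot⁺ (rot⁺ (rot⁺ p))) d e a b c
    by p (inj₁ a) (inj₂ b) (inj₂ c) (inj₁ d) (inj₂ e) = two-apart (rot⁺ (rot⁺ (rot⁺ p))) d e a b c
    by p (inj₁ a) (inj₂ b) (inj₂ c) (inj₂ d) (inj₁ e) = two-adjacent (rot⁺ (rot⁺ (rot⁺ (rot⁺ p)))) e a b c d
    by p (inj₁ _) (inj₂ b) (inj₂ c) (inj₂ d) (inj₂ e) = few-small p b c d e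
    by p (inj₂ a) (inj₁ b) (inj₁ c) (inj₁ d) (inj₁ e) = four (rot⁺ p) b c d e a
    by p (inj₂ a) (inj₁ b) (inj₁ c) (inj₁ d) (inj₂ e) = three-run (rot⁺ p) b c d e a
    by p (inj₂ a) (inj₁ b) (inj₁ c) (inj₂ d) (inj₁ e) = three-split (rot⁺ p) b c d e a
    by p (inj₂ a) (inj₁ b) (inj₁ c) (inj₂ d) (inj₂ e) = two-adjacent (rot⁺ p) b c d e a
    by p (inj₂ a) (inj₁ b) (inj₂ c) (inj₁ d) (inj₁ e) = three-split (rot⁺ (rot⁺ (rot⁺ p))) d e a b c
    by p (inj₂ a) (inj₁ b) (inj₂ c) (inj₁ d) (inj₂ e) = two-apart (rot⁺ p) b c d e a
    by p (inj₂ a) (inj₁ b) (inj₂ c) (inj₂ d) (inj₁ e) = two-apart (rot⁺ (rot⁺ (rot⁺ (rot⁺ p)))) e a b c d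
    by p (inj₂ a) (inj₁ _) (inj₂ c) (inj₂ d) (inj₂ e) = few-small (rot⁺ p) c d e a
    by p (inj₂ a) (inj₂ b) (inj₁ c) (inj₁ d) (inj₁ e) = three-run (rot⁺ (rot⁺ p)) c d e a b
    by p (inj₂ a) (inj₂ b) (inj₁ c) (inj₁ d) (inj₂ e) = two-adjacent (rot⁺ (rot⁺ p)) c d e a b
    by p (inj₂ a) (inj₂ b) (inj₁ c) (inj₂ d) (inj₁ e) = two-apart (rot⁺ (rot⁺ p)) c d e a b
    by p (inj₂ a) (inj₂ b) (inj₁ _) (inj₂ d) (inj₂ e) = few-small (rot⁺ (rot⁺ p)) d e a b
    by p (inj₂ a) (inj₂ b) (inj₂ c) (inj₁ d) (inj₁ e) = two-adjacent (rot⁺ (rot⁺ (rot⁺ p))) d e a b c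
    by p (inj₂ a) (inj₂ b) (inj₂ c) (inj₁ _) (inj₂ e) = few-small (rot⁺ (rot⁺ (rot⁺ p))) e a b c
    by p (inj₂ a) (inj₂ b) (inj₂ c) (inj₂ d) (inj₁ _) = few-small (rot⁺ (rot⁺ (rot⁺ (rot⁺ p)))) a b c d
    by p (inj₂ _) (inj₂ b) (inj₂ c) (inj₂ d) (inj₂ e) = few-small p b c d e

  -- Summing `flow` both ways: each vertex affords its outflow beyond 360, except that the needy
  -- ones fall 60 short, and exactly this comes back to them as inflow. Hence the degree sum is at
  -- least `6 * N`.
  absurd : numDarts G + 12 ≤ 6 * count (λ u → anyB (adj G u)) → ⊥
  absurd euler = 1+n≰n {6 * N} (≤-trans (s≤s (*-cancelˡ-≤ 60 le)) (≤-trans (≤-trans (≤-reflexive (+-comm 1 (numDarts G))) (+-monoʳ-≤ (numDarts G) (s≤s z≤n))) euler))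
    where
    live needy : Fin n → Bool
    live u = anyB (adj G u)
    needy u = live u ∧ five u
    N = count live
    M = count needy
    one-if : Bool → ℕ
    one-if b = if b then 1 else 0
    vertex : ∀ v → sumF (flow v) + 360 * one-if (live v) ≤ 60 * deg v + 60 * one-if (needy v)
    vertex v = go (bool-cases (live v)) (size v)
      where
      dead : live v ≡ false → deg v ≡ 0
      dead q = count-none (adj G v) (anyB-false (adj G v) q)
      alive : live v ≡ true → 5 ≤ deg v
      alive q = deg≥5 (proj₂ (anyB⇒ (adj G v) q))
      go : (live v ≡ true) ⊎ (live v ≡ false) → (deg v ≤ 6) ⊎ (7 ≤ deg v) → sumF (flow v) + 360 * one-if (live v) ≤ 60 * deg v + 60 * one-if (needy v)
      go (inj₂ q) (inj₁ s) = ≤-trans (≤-reflexive (cong₂ (λ x z → x + 360 * one-if z) (flow-small s) q)) z≤n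
      go (inj₂ q) (inj₂ s) = ⊥-elim (n≮0 {6} (≤-trans s (≤-reflexive (dead q))))
      go (inj₁ q) (inj₂ s) = ≤-trans (≤-trans (≤-reflexive (cong (λ z → sumF (flow v) + 360 * one-if z) q)) (flow-bound s)) (m≤m+n (60 * deg v) (60 * one-if (needy v)))
      go (inj₁ q) (inj₁ s) = ≤-trans (≤-reflexive (cong₂ (λ x z → x + 360 * one-if z) (flow-small s) q)) (by (toSum (deg v ≤? 5)))
        where
        by : (deg v ≤ 5) ⊎ ¬ (deg v ≤ 5) → 360 ≤ 60 * deg v + 60 * one-if (needy v)
        by (inj₁ f) = +-mono-≤ (*-monoʳ-≤ 60 (alive q)) (≤-reflexive (symm (cong (λ z → 60 * one-if z) (∧-intro q (⇒≤ᵇ f)))))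
        by (inj₂ f) = ≤-trans (*-monoʳ-≤ 60 (≰⇒> f)) (m≤m+n (60 * deg v) (60 * one-if (needy v)))
    fedAll : ∀ u → 60 * one-if (needy u) ≤ inflow u
    fedAll u = go (bool-cases (needy u))
      where
      go : (needy u ≡ true) ⊎ (needy u ≡ false) → 60 * one-if (needy u) ≤ inflow u
      go (inj₁ q) = ≤-trans (≤-reflexive (cong (λ z → 60 * one-if z) q)) (fed (proj₂ (anyB⇒ (adj G u) (proj₁ (∧-elim {live u} q)))) (≤ᵇ⇒ (proj₂ (∧-elim {live u} q))))
      go (inj₂ q) = ≤-trans (≤-reflexive (cong (λ z → 60 * one-if z) q)) z≤n
    ΣΣ = sumF (λ v → sumF (flow v))
    tally : ∀ c (q : Fin n → Bool) → sumF (λ u → c * one-if (q u)) ≡ c * count q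
    tally c q = trans (sumF-* c (λ u → one-if (q u))) (cong (c *_) (symm (count-sum q)))
    outs : ΣΣ + 360 * N ≤ 60 * numDarts G + 60 * M
    outs = ≤-trans (≤-reflexive (symm (trans (sumF-+ (λ v → sumF (flow v)) (λ v → 360 * one-if (live v))) (cong (ΣΣ +_) (tally 360 live)))))
      (≤-trans (sumF-mono {f = λ v → sumF (flow v) + 360 * one-if (live v)} {g = λ v → 60 * deg v + 60 * one-if (needy v)} vertex)
        (≤-reflexive (trans (sumF-+ (λ v → 60 * deg v) (λ v → 60 * one-if (needy v))) (cong₂ _+_ (sumF-* 60 deg) (tally 60 needy)))))
    ins : 60 * M ≤ ΣΣ
    ins = ≤-trans (≤-reflexive (symm (tally 60 needy))) (≤-trans (sumF-mono {f = λ u → 60 * one-if (needy u)} {g = inflow} fedAll)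
      (≤-reflexive (trans (symm (sumF-cong {f = λ u → sumF (λ v → flow v u)} {g = inflow} inflow-def)) (symm (sumF-swap flow)))))
    le : 60 * (6 * N) ≤ 60 * numDarts G
    le = +-cancelʳ-≤ (60 * M) (60 * (6 * N)) (60 * numDarts G) (begin
      60 * (6 * N) + 60 * M   ≡⟨ solve 2 (λ x y → con 60 :* (con 6 :* x) :+ y := y :+ con 360 :* x) refl N (60 * M) ⟩
      60 * M + 360 * N        ≤⟨ +-monoˡ-≤ (360 * N) ins ⟩
      ΣΣ + 360 * N            ≤⟨ outs ⟩
      60 * numDarts G + 60 * M ∎)
      where
      open ≤-Reasoning
      open +-*-Solver

-- Collecting greedily

module _ {n : ℕ} where
  open import Data.List.Membership.DecPropositional (F._≟_ {n}) using (_∈?_)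

  abstract
    mem : List (Fin n) → Fin n → Bool
    mem xs x = does (x ∈? xs)

    mem⇒ : ∀ {xs x} → mem xs x ≡ true → x ∈ xs
    mem⇒ {xs} {x} = does⇒ (x ∈? xs)

    mem⇐ : ∀ {xs x} → x ∈ xs → mem xs x ≡ true
    mem⇐ {xs} {x} = does⇐ (x ∈? xs)

    mem⇐¬ : ∀ {xs x} → x ∉ xs → mem xs x ≡ false
    mem⇐¬ {xs} {x} = does⇐¬ (x ∈? xs)

  ¬mem⇒ : ∀ {xs x} → not (mem xs x) ≡ true → x ∉ xs
  ¬mem⇒ q i = contra (mem⇐ i) (not-elim q)

count-split : ∀ {n} (p q : Fin n → Bool) → count p ≡ count (λ x → p x ∧ q x) + count (λ x → p x ∧ not (q x))
count-split {zero}  p q = refl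
count-split {suc n} p q = trans (cong ((if p F.zero then 1 else 0) +_) (count-split (λ i → p (F.suc i)) (λ i → q (F.suc i))))
    (go (p F.zero) (q F.zero) _ _)
  where
  go : ∀ a b x y → (if a then 1 else 0) + (x + y) ≡ ((if a ∧ b then 1 else 0) + x) + ((if a ∧ not b then 1 else 0) + y)
  go true  true  x y = refl
  go true  false x y = symm (+-suc x y)
  go false b     x y = refl

outside : ∀ {n} (xs : List (Fin n)) → length xs < n → ∃ λ x → x ∉ xs
outside {n} xs lt = go (search (λ x → not (mem xs x)))
  where
  go : (∃ λ x → not (mem xs x) ≡ true) ⊎ (∀ x → not (mem xs x) ≡ false) → ∃ λ x → x ∉ xs
  go (inj₁ (x , q)) = x , ¬mem⇒ q
  go (inj₂ none) = ⊥-elim (<⇒≱ lt (≤-trans (≤-reflexive total) (#-≤-cover (λ _ → true) xs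
      (λ x _ → mem⇒ (≢false λ q → contra (not-intro q) (none x))))))
    where
    total : n ≡ count {n} (λ _ → true)
    total = trans (symm (count-not {n} (λ _ → true))) (trans (cong (count {n} (λ _ → true) +_) (count-none {n} (λ _ → false) (λ _ → refl)))
      (+-identityʳ (count {n} (λ _ → true))))

some-or-all : ∀ {n} {A B : Fin n → Set} → (∀ v → A v ⊎ B v) → (∃ A) ⊎ (∀ v → B v)
some-or-all {zero} h = inj₂ λ ()
some-or-all {suc n} {A} {B} h = go (h F.zero) (some-or-all (λ i → h (F.suc i)))
  where
  go : A F.zero ⊎ B F.zero → (∃ λ i → A (F.suc i)) ⊎ (∀ i → B (F.suc i)) → (∃ A) ⊎ (∀ v → B v)
  go (inj₁ a) _              = inj₁ (F.zero , a)
  go (inj₂ b) (inj₁ (i , a)) = inj₁ (F.suc i , a)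
  go (inj₂ b) (inj₂ bs)      = inj₂ λ { F.zero → b ; (F.suc i) → bs i }

-- Used with two filters: everything is allowed when reducing the given graph to its core, while in
-- the triangulation the isolated vertices, collected already, are barred.
module Greedy {n} (G : Graph n) (allowed : Fin n → Bool) where

  Fits : (Fin n → Bool) → Fin n → Set
  Fits X w = count (adj G w) ≤ 4 + count (λ x → adj G w x ∧ X x)

  fits-mono : ∀ {X Y} → (∀ x → X x ≡ true → Y x ≡ true) → ∀ {w} → Fits X w → Fits Y w
  fits-mono {X} {Y} h {w} le = ≤-trans le (+-monoʳ-≤ 4 (#-mono (λ x → adj G w x ∧ X x) (λ x → adj G w x ∧ Y x)
    (λ x q → ∧-intro (proj₁ (∧-elim {adj G w x} q)) (h x (proj₂ (∧-elim {adj G w x} q))))))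

  fits⇒ : ∀ {X w} → Fits X w → count (λ x → adj G w x ∧ not (X x)) ≤ 4
  fits⇒ {X} {w} le = +-cancelʳ-≤ (count (λ x → adj G w x ∧ X x)) _ 4 (≤-trans (≤-reflexive
    (trans (+-comm (count (λ x → adj G w x ∧ not (X x))) (count (λ x → adj G w x ∧ X x))) (symm (count-split (adj G w) X)))) le)

  fits⇐ : ∀ {X w} → count (λ x → adj G w x ∧ not (X x)) ≤ 4 → Fits X w
  fits⇐ {X} {w} le = ≤-trans (≤-reflexive (trans (count-split (adj G w) X)
    (+-comm (count (λ x → adj G w x ∧ X x)) (count (λ x → adj G w x ∧ not (X x)))))) (+-monoˡ-≤ (count (λ x → adj G w x ∧ X x)) le)

  data Chain (base : List (Fin n)) : List (Fin n) → Set where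
    start : Chain base base
    next  : ∀ {w xs} → Chain base xs → allowed w ≡ true → w ∉ xs → Fits (mem xs) w → Chain base (w ∷ xs)

  Closed : (Fin n → Bool) → Set
  Closed X = ∀ w → allowed w ≡ true → Fits X w → X w ≡ true

  chain-⊆ : ∀ {base xs} → Chain base xs → ∀ {x} → x ∈ base → x ∈ xs
  chain-⊆ start          i = i
  chain-⊆ (next c _ _ _) i = there (chain-⊆ c i)

  chain-min : ∀ {base xs} X → (∀ {x} → x ∈ base → X x ≡ true) → Closed X → Chain base xs → ∀ {x} → x ∈ xs → X x ≡ true
  chain-min X h cl start i = h i
  chain-min X h cl (next {w} c a _ f) (here refl) = cl w a (fits-mono (λ x q → chain-min X h cl c (mem⇒ q)) f)
  chain-min X h cl (next c _ _ _) (there i) = chain-min X h cl c i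

  grow : ∀ {base} fuel {xs} → Chain base xs →
    (∃ λ ys → Chain base ys × Closed (mem ys) × (length ys < length xs + fuel)) ⊎ (∃ λ ys → Chain base ys × (length ys ≡ length xs + fuel))
  grow zero {xs} c = inj₂ (xs , c , symm (+-identityʳ (length xs)))
  grow {base} (suc fuel) {xs} c = go (search ready)
    where
    fits : Fin n → Bool
    fits w = count (adj G w) ≤ᵇ 4 + count (λ x → adj G w x ∧ mem xs x)
    ready : Fin n → Bool
    ready w = (allowed w ∧ fits w) ∧ not (mem xs w)
    Res : ℕ → Set
    Res m = (∃ λ ys → Chain base ys × Closed (mem ys) × (length ys < m)) ⊎ (∃ λ ys → Chain base ys × (length ys ≡ m))
    go : (∃ λ w → ready w ≡ true) ⊎ (∀ w → ready w ≡ false) → Res (length xs + suc fuel)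
    go (inj₁ (w , q)) = subst Res (symm (+-suc (length xs) fuel)) (grow fuel (next c (proj₁ af) (¬mem⇒ (proj₂ (∧-elim {allowed w ∧ fits w} q))) (≤ᵇ⇒ (proj₂ af))))
      where
      af : (allowed w ≡ true) × (fits w ≡ true)
      af = ∧-elim {allowed w} (proj₁ (∧-elim {allowed w ∧ fits w} q))
    go (inj₂ none) = inj₁ (xs , c , (λ w a f → ≢false λ m → contra (∧-intro (∧-intro a (⇒≤ᵇ f)) (not-intro m)) (none w)) ,
      ≤-trans (≤-reflexive (+-comm 1 (length xs))) (+-monoʳ-≤ (length xs) (s≤s z≤n)))

-- Collected vertices are listed from the last to the first.
data Collectable {n} (G : Graph n) (v : Fin n) : List (Fin n) → Set where
  []  : Collectable G v []
  add : ∀ {w xs} → w ≢ v → w ∉ xs → count (λ x → adj G w x ∧ not (mem (v ∷ xs) x)) ≤ 4 → Collectable G v xs → Collectable G v (w ∷ xs)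

Conclusion : ∀ {n} → Graph n → Set
Conclusion {n} G = Σ (Fin n) λ v → Σ (Fin 6 → Fin n) λ u →
  (∀ i j → u i ≡ u j → i ≡ j) × (∀ i → u i ≢ v) × (∀ i → degIn G (aliveAt v u i) (u i) ≤ 4)

collectable-unique : ∀ {n} {G : Graph n} {v xs} → Collectable G v xs → Unique xs
collectable-unique []             = []
collectable-unique {xs = w ∷ xs} (add _ w∉ _ c) = ¬Any⇒All¬ xs w∉ ∷ collectable-unique c

collectable-≢ : ∀ {n} {G : Graph n} {v xs} → Collectable G v xs → All (_≢ v) xs
collectable-≢ []             = []
collectable-≢ (add ne _ _ c) = ne ∷ collectable-≢ c

lookup-injective : ∀ {A : Set} {xs : List A} → Unique xs → ∀ i j → lookup xs i ≡ lookup xs j → i ≡ j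
lookup-injective (x∉ ∷ u) F.zero    F.zero    e = refl
lookup-injective (x∉ ∷ u) F.zero    (F.suc j) e = ⊥-elim (All.lookup x∉ (∈-lookup j) e)
lookup-injective (x∉ ∷ u) (F.suc i) F.zero    e = ⊥-elim (All.lookup x∉ (∈-lookup i) (symm e))
lookup-injective (x∉ ∷ u) (F.suc i) (F.suc j) e = cong F.suc (lookup-injective u i j e)

conclude : ∀ {n} {G : Graph n} {v xs} → Collectable G v xs → length xs ≡ 6 → Conclusion G
conclude {n} {G} {v} {w₅ ∷ w₄ ∷ w₃ ∷ w₂ ∷ w₁ ∷ w₀ ∷ []} c@(add _ _ d₅ (add _ _ d₄ (add _ _ d₃ (add _ _ d₂ (add _ _ d₁ (add _ _ d₀ [])))))) refl =
    v , u , inj-u , (λ i → All.lookup (collectable-≢ c) (∈-lookup (F.opposite i))) , low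
  where
  xs : List (Fin n)
  xs = w₅ ∷ w₄ ∷ w₃ ∷ w₂ ∷ w₁ ∷ w₀ ∷ []
  u : Fin 6 → Fin n
  -- The list begins with the vertex collected last, so the order is reversed.
  u i = lookup xs (F.opposite i)
  inj-u : ∀ i j → u i ≡ u j → i ≡ j
  inj-u i j e = trans (symm (FP.opposite-involutive i)) (trans (cong F.opposite
    (lookup-injective (collectable-unique c) (F.opposite i) (F.opposite j) e)) (FP.opposite-involutive j))
  at-most : ∀ i ys → (∀ x → x ≢ v → (∀ j → (toℕ j <ᵇ toℕ i) ≡ true → x ≢ u j) → All (x ≢_) ys) →
    count (λ x → adj G (u i) x ∧ not (mem (v ∷ ys) x)) ≤ 4 → degIn G (aliveAt v u i) (u i) ≤ 4
  at-most i ys h le = ≤-trans (#-mono (λ x → aliveAt v u i x ∧ adj G (u i) x) (λ x → adj G (u i) x ∧ not (mem (v ∷ ys) x)) step′) le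
    where
    step′ : ∀ x → aliveAt v u i x ∧ adj G (u i) x ≡ true → adj G (u i) x ∧ not (mem (v ∷ ys) x) ≡ true
    step′ x q = ∧-intro (proj₂ split) (not-intro (mem⇐¬ (All¬⇒¬Any (x≢v ∷ h x x≢v before))))
      where
      split : (aliveAt v u i x ≡ true) × (adj G (u i) x ≡ true)
      split = ∧-elim {aliveAt v u i x} q
      alive : (not (x == v) ≡ true) × (not (anyB (λ j → (toℕ j <ᵇ toℕ i) ∧ (u j == x))) ≡ true)
      alive = ∧-elim {not (x == v)} (proj₁ split)
      x≢v : x ≢ v
      x≢v e = contra (does⇐ (x F.≟ v) e) (not-elim (proj₁ alive))
      before : ∀ j → (toℕ j <ᵇ toℕ i) ≡ true → x ≢ u j
      before j lt e = contra (∧-intro lt (does⇐ (u j F.≟ x) (symm e))) (anyB-false (λ j → (toℕ j <ᵇ toℕ i) ∧ (u j == x)) (not-elim (proj₂ alive)) j)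
  low : ∀ i → degIn G (aliveAt v u i) (u i) ≤ 4
  low 0F = at-most 0F [] (λ x ne h → []) d₀
  low 1F = at-most 1F (w₀ ∷ []) (λ x ne h → h 0F refl ∷ []) d₁
  low 2F = at-most 2F (w₁ ∷ w₀ ∷ []) (λ x ne h → h 1F refl ∷ h 0F refl ∷ []) d₂
  low 3F = at-most 3F (w₂ ∷ w₁ ∷ w₀ ∷ []) (λ x ne h → h 2F refl ∷ h 1F refl ∷ h 0F refl ∷ []) d₃
  low 4F = at-most 4F (w₃ ∷ w₂ ∷ w₁ ∷ w₀ ∷ []) (λ x ne h → h 3F refl ∷ h 2F refl ∷ h 1F refl ∷ h 0F refl ∷ []) d₄
  low 5F = at-most 5F (w₄ ∷ w₃ ∷ w₂ ∷ w₁ ∷ w₀ ∷ []) (λ x ne h → h 4F refl ∷ h 3F refl ∷ h 2F refl ∷ h 1F refl ∷ h 0F refl ∷ []) d₅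

six-suffice : ∀ {n} {G : Graph n} {v xs} → Collectable G v xs → 6 ≤ length xs → Conclusion G
six-suffice {n} {G} {v} c le = go c (m≤n⇒m<n∨m≡n le)
  where
  go : ∀ {xs} → Collectable G v xs → (6 < length xs) ⊎ (6 ≡ length xs) → Conclusion G
  go c (inj₂ e) = conclude c (symm e)
  go (add _ _ _ c) (inj₁ (s≤s lt)) = six-suffice c lt

chain-collectable : ∀ {n} {G : Graph n} {v cs} → v ∉ cs → Greedy.Chain G (λ _ → true) [] cs → Collectable G v cs
chain-collectable v∉ Greedy.start = []
chain-collectable {G = G} {v} v∉ (Greedy.next {w} {xs} c _ w∉ f) = add (λ e → v∉ (here (symm e))) w∉
  (≤-trans (#-mono (λ x → adj G w x ∧ not (mem (v ∷ xs) x)) (λ x → adj G w x ∧ not (mem xs x))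
    (λ x q → ∧-intro (proj₁ (∧-elim {adj G w x} q)) (not-intro (mem⇐¬ (λ i → ¬mem⇒ (proj₂ (∧-elim {adj G w x} q)) (there i))))))
    (Greedy.fits⇒ G (λ _ → true) f)) (chain-collectable (λ i → v∉ (there i)) c)

-- The core, its triangulation, and the way back

module Core {n} (G : Graph n) (cs : List (Fin n)) (chain : Greedy.Chain G (λ _ → true) [] cs)
  (closed : Greedy.Closed G (λ _ → true) (mem cs)) (few : length cs < n) (pl : Planar G) where

  K : Fin n → Bool
  K x = not (mem cs x)

  Restricted : Set
  Restricted = Σ (Graph n) λ H → Σ (Rotation H) λ ρ → Euler ρ × (∀ u v → adj H u v ≡ adj G u v ∧ (K u ∧ K v))

  restricted : Restricted
  restricted = go (restrict K (numDarts G) (proj₁ pl) (Init.euler-init (proj₁ pl) (proj₂ pl)) ≤-refl)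
    where
    go : (Σ (Graph n) λ H → Σ (Rotation H) λ ρ → Euler ρ × (∀ u v → adj H u v ≡ adj G u v ∧ (K u ∧ K v))
      × (∀ u v → adj H v u ≡ true → adj H v (σ (proj₁ pl) v u) ≡ true → σ ρ v u ≡ σ (proj₁ pl) v u)) → Restricted
    go (H , ρ , ε , eq , _) = H , ρ , ε , eq

  module _ (H : Graph n) (eq : ∀ u v → adj H u v ≡ adj G u v ∧ (K u ∧ K v)) where
    up : ∀ {u v} → adj G u v ≡ true → K u ≡ true → K v ≡ true → adj H u v ≡ true
    up {u} {v} p q r = trans (eq u v) (∧-intro p (∧-intro q r))

    down : ∀ {u v} → adj H u v ≡ true → K u ≡ true
    down {u} {v} p = proj₁ (∧-elim {K u} (proj₂ (∧-elim {adj G u v} (trans (symm (eq u v)) p))))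

    core-deg : ∀ {u} → K u ≡ true → 5 ≤ count (adj H u)
    core-deg {u} ku = ≤-trans (≰⇒> λ le → contra (closed u refl (Greedy.fits⇐ G (λ _ → true) le)) (not-elim ku))
      (#-mono (λ x → adj G u x ∧ not (mem cs x)) (adj H u) (λ x q → up (proj₁ (∧-elim {adj G u x} q)) ku (proj₂ (∧-elim {adj G u x} q))))

    minDeg : MinDeg5 H
    minDeg u v p = core-deg (down p)

    module _ (Δ : Graph n) (ρ : Rotation Δ) (ε : Euler ρ) (sub : H ⊑ Δ) (tri : Triangular ρ) where
      md : MinDeg5 Δ
      md = minDeg-⊑ {G = H} {Δ} sub minDeg

      allowed : Fin n → Bool
      allowed w = 5 ≤ᵇ count (adj Δ w)

      open Greedy Δ allowed

      live : Fin n → Bool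
      live u = anyB (adj Δ u)

      nbr : ∀ {u} → 5 ≤ count (adj Δ u) → live u ≡ true
      nbr {u} le = go (#-elems 1 (adj Δ u) (≤-trans (s≤s z≤n) le))
        where
        go : (∃ λ xs → Unique xs × All (λ x → adj Δ u x ≡ true) xs × (length xs ≡ 1)) → live u ≡ true
        go (x ∷ _ , _ , p ∷ _ , _) = anyB⇐ (adj Δ u) x p

      live⇒K : ∀ {u} → live u ≡ true → K u ≡ true
      live⇒K {u} q = let v , p = anyB⇒ (adj Δ u) q ; w , r = proj₂ sub u v p in down r

      live-vertex : ∃ λ x → live x ≡ true
      live-vertex = let x , x∉ = outside cs few in
        x , nbr (≤-trans (core-deg (not-intro (mem⇐¬ x∉))) (#-mono (adj H x) (adj Δ x) (proj₁ sub x)))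

      dead-chain : ∀ {v xs} → live v ≡ false → Chain (v ∷ []) xs → length xs ≡ 1
      dead-chain dv start = refl
      dead-chain {v} dv (next {w} {xs} c a w∉ f) = ⊥-elim (1+n≰n {4} (≤-trans (≤ᵇ⇒ {5} {count (adj Δ w)} a) (≤-trans f (≤-reflexive (cong (4 +_) none)))))
        where
        only-v : ∀ {ys} → Chain (v ∷ []) ys → length ys ≡ 1 → ∀ {x} → x ∈ ys → x ≡ v
        only-v start _ (here e) = e
        only-v (next start _ _ _) ()
        only-v (next (next _ _ _ _) _ _ _) ()
        none : count (λ x → adj Δ w x ∧ mem xs x) ≡ 0
        none = count-none (λ x → adj Δ w x ∧ mem xs x) (λ x → ≢true λ q → contra (adj-flip {G = Δ}
          (subst (λ z → adj Δ w z ≡ true) (only-v c (dead-chain dv c) (mem⇒ (proj₂ (∧-elim {adj Δ w x} q)))) (proj₁ (∧-elim {adj Δ w x} q))))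
          (anyB-false (adj Δ v) dv w))

      -- In the given graph without `v`, the vertices `cs` are collected before the chain is
      -- replayed. Every edge between core vertices is present in `Δ`, so degrees are no larger than
      -- they were there.
      lift : ∀ {v ys} → live v ≡ true → Chain (v ∷ []) ys →
        ∃ λ zs → Collectable G v zs × (length ys ≤ suc (length zs)) × (∀ {x} → x ∈ ys → x ∈ v ∷ zs) × (∀ {x} → x ∈ cs → x ∈ zs)
          × (∀ {x} → x ∈ zs → (x ∈ ys) ⊎ (x ∈ cs))
      lift {v} lv start = cs , chain-collectable (¬mem⇒ (live⇒K lv)) chain , s≤s z≤n , (λ { (here e) → here e }) , (λ i → i) , inj₂
      lift {v} lv (next {w} {ys} c a w∉ f) = go (lift lv c)
        where
        kw : K w ≡ true
        kw = live⇒K (nbr (≤ᵇ⇒ {5} {count (adj Δ w)} a))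
        go : (∃ λ zs → Collectable G v zs × (length ys ≤ suc (length zs)) × (∀ {x} → x ∈ ys → x ∈ v ∷ zs) × (∀ {x} → x ∈ cs → x ∈ zs)
               × (∀ {x} → x ∈ zs → (x ∈ ys) ⊎ (x ∈ cs))) →
             ∃ λ zs → Collectable G v zs × (length (w ∷ ys) ≤ suc (length zs)) × (∀ {x} → x ∈ w ∷ ys → x ∈ v ∷ zs) × (∀ {x} → x ∈ cs → x ∈ zs)
               × (∀ {x} → x ∈ zs → (x ∈ w ∷ ys) ⊎ (x ∈ cs))
        go (zs , col , len , ys⊆ , cs⊆ , back) = w ∷ zs , add w≢v w∉zs low col , s≤s len , ys⊆′ , (λ i → there (cs⊆ i)) , back′
          where
          w≢v : w ≢ v
          w≢v e = w∉ (subst (_∈ ys) (symm e) (chain-⊆ c (here refl)))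
          w∉zs : w ∉ zs
          w∉zs i = at (back i)
            where
            at : (w ∈ ys) ⊎ (w ∈ cs) → ⊥
            at (inj₁ j) = w∉ j
            at (inj₂ j) = ¬mem⇒ kw j
          low : count (λ x → adj G w x ∧ not (mem (v ∷ zs) x)) ≤ 4
          low = ≤-trans (#-mono (λ x → adj G w x ∧ not (mem (v ∷ zs) x)) (λ x → adj Δ w x ∧ not (mem ys x)) (λ x q →
              ∧-intro (proj₁ sub w x (up (proj₁ (∧-elim {adj G w x} q)) kw (not-intro (mem⇐¬ (λ i → ¬mem⇒ (proj₂ (∧-elim {adj G w x} q)) (there (cs⊆ i)))))))
                (not-intro (mem⇐¬ (λ i → ¬mem⇒ (proj₂ (∧-elim {adj G w x} q)) (ys⊆ i)))))) (fits⇒ f)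
          ys⊆′ : ∀ {x} → x ∈ w ∷ ys → x ∈ v ∷ w ∷ zs
          ys⊆′ (here e) = there (here e)
          ys⊆′ (there i) = shift (ys⊆ i)
            where
            shift : ∀ {x} → x ∈ v ∷ zs → x ∈ v ∷ w ∷ zs
            shift (here e)  = here e
            shift (there j) = there (there j)
          back′ : ∀ {x} → x ∈ w ∷ zs → (x ∈ w ∷ ys) ⊎ (x ∈ cs)
          back′ (here e) = inj₁ (here e)
          back′ (there i) = at (back i)
            where
            at : ∀ {x} → (x ∈ ys) ⊎ (x ∈ cs) → (x ∈ w ∷ ys) ⊎ (x ∈ cs)
            at (inj₁ j) = inj₁ (there j)
            at (inj₂ j) = inj₂ j

      Small : Fin n → Set
      Small v = ∃ λ ys → Chain (v ∷ []) ys × Closed (mem ys) × (length ys < 7)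

      stuck : (∀ v → Small v) → ⊥
      stuck small = Absurd.absurd St (euler-bound ρ ε md (proj₁ live-vertex) (proj₂ live-vertex))
        where
        S : Fin n → Fin n → Bool
        S v = mem (proj₁ (small v))
        St : Setting
        St = record
          { n = n ; G = Δ ; ρ = ρ ; md = md ; tri = tri ; S = S
          ; S-self = λ v → mem⇐ (chain-⊆ (proj₁ (proj₂ (small v))) (here refl))
          ; S-size = λ v → ≤-trans (#-≤-cover (S v) (proj₁ (small v)) (λ x → mem⇒)) (≤-pred (proj₂ (proj₂ (proj₂ (small v)))))
          ; S-closed = λ v w d f → proj₁ (proj₂ (proj₂ (small v))) w (⇒≤ᵇ d) f
          ; S-min = λ v X xv cl w m → chain-min X (λ { (here refl) → xv }) (λ w a f → cl w (≤ᵇ⇒ {5} {count (adj Δ w)} a) f)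
              (proj₁ (proj₂ (small v))) (mem⇒ m) }

      found : Conclusion G
      found = decide (some-or-all attempt)
        where
        Large : Fin n → Set
        Large v = (live v ≡ true) × ∃ λ ys → Chain (v ∷ []) ys × (length ys ≡ 7)
        attempt : ∀ v → Large v ⊎ Small v
        attempt v = go (grow 6 start) (bool-cases (live v))
          where
          go : Small v ⊎ (∃ λ ys → Chain (v ∷ []) ys × (length ys ≡ 7)) → (live v ≡ true) ⊎ (live v ≡ false) → Large v ⊎ Small v
          go (inj₁ s) _ = inj₂ s
          go (inj₂ l) (inj₁ lv) = inj₁ (lv , l)
          go (inj₂ (ys , c , len)) (inj₂ dv) = ⊥-elim (1≢7 (trans (symm (dead-chain dv c)) len))
            where
            1≢7 : 1 ≢ 7
            1≢7 ()
        decide : (∃ Large) ⊎ (∀ v → Small v) → Conclusion G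
        decide (inj₂ small) = ⊥-elim (stuck small)
        decide (inj₁ (v , lv , ys , c , len)) = let zs , col , le , _ = lift lv c in
          six-suffice col (≤-pred (≤-trans (≤-reflexive (symm len)) le))

  core : Conclusion G
  core = go restricted
    where
    go : Restricted → Conclusion G
    go (H , ρ , ε , eq) = go′ (triangulate (suc (n * n)) ρ ε (minDeg H eq) (m≤n+m (suc (n * n)) (numDarts H)))
      where
      go′ : (Σ (Graph n) λ Δ → Σ (Rotation Δ) λ ρ′ → Euler ρ′ × (H ⊑ Δ) × Triangular ρ′) → Conclusion G
      go′ (Δ , ρ′ , ε′ , sub , tri) = found H eq Δ ρ′ ε′ sub tri

theorem2 : (n : ℕ) (G : Graph n) → 7 ≤ n → Planar G →
  Σ (Fin n) λ v → Σ (Fin 6 → Fin n) λ u →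
    (∀ i j → u i ≡ u j → i ≡ j) ×
    (∀ i → u i ≢ v) ×
    (∀ i → degIn G (aliveAt v u i) (u i) ≤ 4)
theorem2 n G n7 pl = go (Greedy.grow G (λ _ → true) 6 Greedy.start)
  where
  go : (∃ λ cs → Greedy.Chain G (λ _ → true) [] cs × Greedy.Closed G (λ _ → true) (mem cs) × (length cs < 6)) ⊎
       (∃ λ cs → Greedy.Chain G (λ _ → true) [] cs × (length cs ≡ 6)) → Conclusion G
  go (inj₁ (cs , c , cl , lt)) = Core.core G cs c cl (≤-trans lt (≤-trans (n≤1+n 6) n7)) pl
  -- Six vertices are collected before anything is deleted; any seventh vertex serves as `v`, since
  -- its removal only lowers degrees.
  go (inj₂ (cs , c , len)) = let v , v∉ = outside cs (≤-trans (s≤s (≤-reflexive len)) n7) in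
    conclude (chain-collectable v∉ c) len
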